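{- Let $n\ge1$, let $A=(a_{ij})_{1\le i<j\le 2n}$ be an upper-triangular array (representing a skew-symmetric $2n\times2n$ matrix) such that $a_{ij}=0$ if $1\le i<j\le n$ or $n+1\le i<j\le 2n$, and let $B=(b_{ij})$ be the $n\times n$ matrix with $b_{ij}=a_{i,j+n}$. Let $D\in\mathcal{T}^e_n$. Then $$\mathrm{Pfaf}_D(A)=\sum_{D'\in S(D)}\ \sum_{d\in\mathrm{TL}_n}\tilde g_{D'}(d)\,\mathrm{Imm}_d(B).$$
   Context: Matchings. $[2n]=\{1,\dots,2n\}$. $F_{2n}$ is the set of perfect matchings $\pi$ of $[2n]$, and $a_\pi=\prod_{(i<j)\in\pi}a_{ij}$. Symmetric TL-diagrams. Place points $1,\dots,2n$ on the left side and $1',\dots,(2n)'$ on the right side of a rectangle, numbered from top to bottom. A TL-diagram is a non-crossing perfect matching of these $4n$ points (drawn inside the rectangle); it is symmetric if invariant under the mirror reflection $i\leftrightarrow i'$. Then every edge is either horizontal, of the form $(i,i')$, or belongs to a mirror pair of vertical edges $\{(i,j),(i',j')\}$. The order $|D|$ is the number of edges with both ends on the left side. $\mathcal{T}_n$ is the set of symmetric TL-diagrams and $\mathcal{T}^e_n$ the subset of those with $|D|$ even. Diagram pfaffinants. For $\pi\in F_{2n}$ let $\nu(\pi)$ be the matching of $[2n]\cup[2n]'$ with edges $(i,j')$ and $(i',j)$ for each $(i,j)\in\pi$. Fix for each $\pi$ a nice embedding of $\nu(\pi)$: all edges lie in the rectangle, every pair of edges meets at most once, the picture is mirror symmetric,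 no two edges are tangent, no three edges pass through one point. An unpaired crossing is a crossing of an edge with its own mirror image; all other crossings come in mirror-symmetric pairs (paired crossings). Each edge joins the left side to the right side, so at a crossing of two edges there are two half-edges leading to left endpoints and two leading to right endpoints. The vertical uncrossing replaces the crossing by one strand joining the two left half-edges and one joining the two right half-edges (picture ")("); the horizontal uncrossing joins the left half-edge of each edge to the right half-edge of the other edge without crossing. $X(\pi)$ is the set of diagrams obtained by uncrossing every crossing of $\nu(\pi)$ in one of the two ways, the two members of a paired crossing being uncrossed in the same way. Each $x\in X(\pi)$ is mirror symmetric, and is topologically an element $D(x)\in\mathcal{T}_n$ together with some closed loops. Set $\mathrm{wt}(x)=2^{l(x)}(-1)^{\mathrm{uv}(x)+\mathrm{ph}(x)}$, where $l(x)$ is the number of closed loops (a pair of mirror-symmetric loops counted once), $\mathrm{uv}(x)$ the number of unpaired crossings uncrossed vertically, and $\mathrm{ph}(x)$ the number of pairs of paired crossings uncrossed horizontally. Put $f_D(\pi)=\sum_{x\in X(\pi),\,D(x)=D}\mathrm{wt}(x)$ and $\mathrm{Pfaf}'_D(A)=\sum_{\pi\in F_{2n}}f_D(\pi)\,a_\pi$ for $D\in\mathcal{T}_n$. TL-pfaffinants. A vertical left edge $(i,j)$ with $i<j$ is odd if $i$ is odd, even otherwise. For $D\in\mathcal{T}_n$, $S(D)$ is the set of all diagrams in $\mathcal{T}_n$ obtained from $D$ by erasing several (possibly zero) odd edges and their mirror images, and matching the resulting unmatched vertices by horizontal edges $(i,i')$. For $D\in\mathcal{T}^e_n$, $\mathrm{Pfaf}_D(A)=\sum_{D'\in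 S(D)}\mathrm{Pfaf}'_{D'}(A)$. TL-immanants. $\mathrm{TL}_n$ is the set of non-crossing perfect matchings of $2n$ points on the boundary of a rectangle, labeled $1,\dots,n$ from top to bottom on the left side and $n+1,\dots,2n$ from bottom to top on the right side. For $w\in S_n$ choose a wiring diagram of $w$: wires running from left to right, the wire starting at the $i$-th left point (from the top) ending at the $w(i)$-th right point (from the top). $X(w)$ is the set of ways to uncross every crossing vertically or horizontally, where at a crossing of two wires the vertical uncrossing replaces the crossing by one strand joining the two half-wires coming from the left and one strand joining the two half-wires going to the right (picture ")("), and the horizontal uncrossing joins the left half of each wire to the right half of the other wire without crossing; for $x\in X(w)$, $D(x)\in\mathrm{TL}_n$ is the diagram topologically equivalent to $x$ with loops removed, $h(x)$ is the number of horizontal uncrossings, $l(x)$ the number of loops, and $\mathrm{wt}(x)=2^{l(x)}(-1)^{h(x)}$. For $d\in\mathrm{TL}_n$ put $f_d(w)=\sum_{x\in X(w),\,D(x)=d}\mathrm{wt}(x)$ and $\mathrm{Imm}_d(B)=\sum_{w\in S_n}f_d(w)\,b_{1,w(1)}\cdots b_{n,w(n)}$. The coefficients $\tilde g_D(d)$. For $d\in\mathrm{TL}_n$ define a mirror-symmetric matching $\nu(d)$ of $[2n]\cup[2n]'$: regard the left points of $d$ (labeled $1,\dots,n$) as the vertices $1,\dots,n$, and the right points of $d$ (from top to bottom, originally labeled $2n,2n-1,\dots,n+1$) as the vertices $(n+1)',\dots,(2n)'$; take all edges of $d$ so relabeled together with all their mirror images under $i\leftrightarrow i'$. Choose a mirror-symmetric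 embedding of $\nu(d)$ in the rectangle in which no pair of edges meets more than once or is tangent and no three edges pass through one point. (Crossings then occur only between edges joining the left and right sides.) $X(d)$ is the set of all ways to uncross all crossings of $\nu(d)$, each vertically or horizontally, mirror-symmetric crossings being uncrossed in the same manner. For $x\in X(d)$, the diagram $D(x)\in\mathcal{T}_n$ is the symmetric TL-diagram topologically equivalent to $x$ with closed loops removed, and the weight is $\mathrm{wt}(x)=2^{l(x)}(-1)^{\mathrm{uv}(x)+\mathrm{ph}(x)}$, where $l(x)$ is the number of closed loops of $x$ (a pair of mirror-symmetric loops counted once), $\mathrm{uv}(x)$ is the number of unpaired crossings of $\nu(d)$ (crossings of an edge with its own mirror image) uncrossed vertically, and $\mathrm{ph}(x)$ is the number of pairs of paired (mirror-symmetric) crossings of $\nu(d)$ uncrossed horizontally. For $D\in\mathcal{T}_n$ put $g_D(d)=\sum_{x\in X(d),\,D(x)=D}\mathrm{wt}(x)$, let $z(d)$ be the number of edges of $d$ with both ends in $[n]$, and set $\tilde g_D(d)=(-1)^{z(d)\cdot n}g_D(d)$. -}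

module Defs where

open import Algebra.Bundles using (CommutativeRing)
open import Data.Bool.Base using (Bool; true; false; not; if_then_else_)
open import Data.Fin.Base using (Fin; toℕ; _↑ˡ_; _↑ʳ_; splitAt; opposite; _<_)
open import Data.Fin.Permutation.Components using (transpose)
open import Data.Fin.Properties using (all?; any?) renaming (_≟_ to _≟ᶠ_; _<?_ to _<ᶠ?_)
open import Data.List.Base
  using (List; []; _∷_; _++_; map; foldr; filter; filterᵇ; length; mapMaybe;
         reverse; zip; drop; allFin; cartesianProduct; cartesianProductWith)
open import Data.List.Membership.Propositional using (_∈_)
open import Data.List.Relation.Unary.All using (All)
open import Data.Maybe.Base as Maybe using (Maybe)
open import Data.Nat.Base as ℕ using (ℕ; zero; suc; _⊔_)
open import Data.Nat.Divisibility using (_∣_; _∣?_)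
open import Data.Product.Base using (Σ; ∃; ∃-syntax; _×_; _,_; proj₁; proj₂)
open import Data.Sum.Base using (_⊎_; inj₁; inj₂; [_,_]; swap)
open import Data.Sum.Properties using (≡-dec)
open import Data.Vec.Functional as VF using ()
open import Function.Base using (_∘_)
open import Relation.Binary.Definitions using (DecidableEquality)
open import Relation.Binary.PropositionalEquality.Core using (_≡_; _≢_; _≗_)
open import Relation.Nullary.Decidable
  using (Dec; does; map′; dec⇒maybe; ¬?; _×-dec_; _⊎-dec_; _→-dec_)
open import Relation.Nullary.Negation using (¬_)
open import Relation.Unary using (Decidable)

------------------------------------------------------------------------
-- Boundary points of the rectangle

-- inj₁ i and inj₂ i are the i-th points from the top (counting from 0) of
-- the left and of the right side.
Point : ℕ → Set
Point m = Fin m ⊎ Fin m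

infix 4 _≟_
_≟_ : ∀ {m} → DecidableEquality (Point m)
_≟_ = ≡-dec _≟ᶠ_ _≟ᶠ_

mirror : ∀ {m} → Point m → Point m
mirror = swap

-- Position along the boundary: down the left side, then up the right side.
position : ∀ {m} → Point m → Fin (m ℕ.+ m)
position {m} (inj₁ i) = i ↑ˡ m
position {m} (inj₂ i) = m ↑ʳ opposite i

allPoints? : ∀ {m} {Q : Point m → Set} → Decidable Q → Dec (∀ p → Q p)
allPoints? Q? =
  map′ (λ { (l , r) (inj₁ i) → l i ; (l , r) (inj₂ i) → r i })
       (λ q → (q ∘ inj₁) , (q ∘ inj₂))
       (all? (Q? ∘ inj₁) ×-dec all? (Q? ∘ inj₂))

_≗?_ : ∀ {m} (f g : Point m → Point m) → Dec (f ≗ g)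
f ≗? g = allPoints? λ p → f p ≟ g p

------------------------------------------------------------------------
-- Matchings, diagrams and permutations

-- A perfect matching is given by the map sending each vertex to its partner.
IsMatching : {A : Set} → (A → A) → Set
IsMatching f = (∀ x → f (f x) ≡ x) × (∀ x → f x ≢ x)

Matching : ℕ → Set
Matching k = ∃ λ (f : Fin k → Fin k) → IsMatching f

NonCrossing : ∀ {m} → (Point m → Point m) → Set
NonCrossing f = ∀ p q →
  ¬ (position p < position q × position q < position (f p) ×
     position (f p) < position (f q))

IsTL : ∀ {m} → (Point m → Point m) → Set
IsTL f = IsMatching f × NonCrossing f

TL : ℕ → Set
TL n = ∃ λ (f : Point n → Point n) → IsTL f

IsSymmetricTL : ∀ {m} → (Point m → Point m) → Set
IsSymmetricTL f = IsTL f × (∀ p → f (mirror p) ≡ mirror (f p))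

T : ℕ → Set
T n = ∃ λ (f : Point (n ℕ.+ n) → Point (n ℕ.+ n)) → IsSymmetricTL f

IsPermutation : ∀ {n} → (Fin n → Fin n) → Set
IsPermutation w = ∀ i j → w i ≡ w j → i ≡ j

Perm : ℕ → Set
Perm n = ∃ λ (w : Fin n → Fin n) → IsPermutation w

isMatching? : ∀ {k} → Decidable (IsMatching {Fin k})
isMatching? f = all? (λ x → f (f x) ≟ᶠ x) ×-dec all? (λ x → ¬? (f x ≟ᶠ x))

isTL? : ∀ {m} → Decidable (IsTL {m})
isTL? f =
  (allPoints? (λ x → f (f x) ≟ x) ×-dec allPoints? (λ x → ¬? (f x ≟ x))) ×-dec
  allPoints? λ p → allPoints? λ q →
    ¬? ((position p <ᶠ? position q) ×-dec (position q <ᶠ? position (f p)) ×-dec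
        (position (f p) <ᶠ? position (f q)))

isSymmetricTL? : ∀ {m} → Decidable (IsSymmetricTL {m})
isSymmetricTL? f = isTL? f ×-dec allPoints? λ p → f (mirror p) ≟ mirror (f p)

isPermutation? : ∀ {n} → Decidable (IsPermutation {n})
isPermutation? w = all? λ i → all? λ j → (w i ≟ᶠ w j) →-dec (i ≟ᶠ j)

------------------------------------------------------------------------
-- Enumerations: every object occurs exactly once, up to pointwise equality

functions : {B : Set} → List B → ∀ k → List (Fin k → B)
functions bs zero    = (λ ()) ∷ []
functions bs (suc k) = cartesianProductWith VF._∷_ bs (functions bs k)

endofunctions : ∀ k → List (Fin k → Fin k)
endofunctions k = functions (allFin k) k

pointMaps : ∀ m → List (Point m → Point m)
pointMaps m = cartesianProductWith [_,_] sides sides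
  where
  sides : List (Fin m → Point m)
  sides = functions (map inj₁ (allFin m) ++ map inj₂ (allFin m)) m

collect : {A : Set} {Q : A → Set} → Decidable Q → List A → List (∃ Q)
collect Q? = mapMaybe λ x → Maybe.map (x ,_) (dec⇒maybe (Q? x))

allMatchings : ∀ k → List (Matching k)
allMatchings k = collect isMatching? (endofunctions k)

allPerms : ∀ n → List (Perm n)
allPerms n = collect isPermutation? (endofunctions n)

allTL : ∀ n → List (TL n)
allTL n = collect isTL? (pointMaps n)

allT : ∀ n → List (T n)
allT n = collect isSymmetricTL? (pointMaps (n ℕ.+ n))

------------------------------------------------------------------------
-- Order of a diagram and the set S(D)

-- i is the smaller end of an edge with both ends on the left.
LeftEdge : ∀ {m} → (Point m → Point m) → Fin m → Fin m → Set
LeftEdge f i j = i < j × f (inj₁ i) ≡ inj₁ j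

leftEdge? : ∀ {m} (f : Point m → Point m) i j → Dec (LeftEdge f i j)
leftEdge? f i j = (i <ᶠ? j) ×-dec (f (inj₁ i) ≟ inj₁ j)

order : ∀ {m} → (Point m → Point m) → ℕ
order {m} f =
  length (filter (λ (i , j) → leftEdge? f i j)
                 (cartesianProduct (allFin m) (allFin m)))

-- Vertices are numbered from 1 in the definition of an odd edge, so its
-- smaller end has an even index here.
OddEdge : ∀ {m} → (Point m → Point m) → Fin m → Fin m → Set
OddEdge f i j = LeftEdge f i j × 2 ∣ toℕ i

oddEdge? : ∀ {m} (f : Point m → Point m) i j → Dec (OddEdge f i j)
oddEdge? f i j = leftEdge? f i j ×-dec (2 ∣? toℕ i)

-- E arises from D by erasing odd edges: each left vertex keeps its edge, or
-- lies on an odd edge of D and is now matched horizontally.  Since E is a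
-- matching, both ends of an edge of D are treated alike; since D and E are
-- symmetric, the right side follows the left.
Erasure : ∀ {n} → T n → T n → Set
Erasure (D , _) (E , _) = ∀ i →
  (E (inj₁ i) ≡ D (inj₁ i)) ⊎
  ((∃[ j ] (OddEdge D i j ⊎ OddEdge D j i)) × E (inj₁ i) ≡ inj₂ i)

erasure? : ∀ {n} (D E : T n) → Dec (Erasure {n} D E)
erasure? (D , _) (E , _) = all? λ i →
  (E (inj₁ i) ≟ D (inj₁ i)) ⊎-dec
  (any? (λ j → oddEdge? D i j ⊎-dec oddEdge? D j i) ×-dec (E (inj₁ i) ≟ inj₂ i))

S : ∀ {n} → T n → List (T n)
S {n} D = filter (erasure? {n} D) (allT n)

------------------------------------------------------------------------
-- Drawings

-- Wires run from left to right through slots, which stand for heights and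
-- are named by the boundary points at that height.  The crossing (a , b)
-- exchanges the wires in the vertically consecutive slots a and b.
Crossing : ℕ → Set
Crossing m = Fin m × Fin m

consecutive : {A : Set} → List A → List (A × A)
consecutive xs = zip xs (drop 1 xs)

endOf : ∀ {m} → List (Crossing m) → Fin m → Fin m
endOf []             i = i
endOf ((a , b) ∷ cs) i = endOf cs (transpose a b i)

-- The number of crossings between the wires that start in slots i and j.
meetings : ∀ {m} → List (Crossing m) → Fin m → Fin m → ℕ
meetings []             i j = 0
meetings ((a , b) ∷ cs) i j =
  (if does (((i ≟ᶠ a) ×-dec (j ≟ᶠ b)) ⊎-dec ((i ≟ᶠ b) ×-dec (j ≟ᶠ a)))
   then 1 else 0)
  ℕ.+ meetings cs (transpose a b i) (transpose a b j)

record Wiring {n} (w : Fin n → Fin n) : Set where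
  field
    crossings : List (Crossing n)
    adjacent  : All (_∈ consecutive (allFin n)) crossings
    ends      : ∀ i → endOf crossings i ≡ w i

isRight : ∀ {m} → Point m → Bool
isRight (inj₁ _) = false
isRight (inj₂ _) = true

-- The left vertices joined by ν to the right side, from top to bottom.
through : ∀ {m} → (Point m → Point m) → List (Fin m)
through {m} ν = filterᵇ (λ i → isRight (ν (inj₁ i))) (allFin m)

pairUp : {A : Set} → List A → List (A × A)
pairUp (a ∷ b ∷ xs) = (a , b) ∷ pairUp xs
pairUp _            = []

-- A mirror-symmetric embedding, up to isotopy, of a mirror-symmetric matching
-- ν whose left-left and right-right edges do not cross anything and in which
-- no edge is its own mirror image.  The former are drawn close to the sides.
--
-- A point of the mirror axis on an edge e lies on the mirror image of e too,
-- so e and its image cross there, and, meeting only once, nowhere else.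
-- Hence the edges reach the axis in pairs occupying slots 1 and 2, 3 and 4,
-- and so on, each pair forming an unpaired crossing on the axis; all other
-- crossings lie off the axis and are paired.  The embedding is given by its
-- crossings in the left half, listed from the left side to the axis.
record SymmetricDrawing {m} (ν : Point m → Point m) : Set where
  field
    paired : List (Crossing m)

  unpaired : List (Crossing m)
  unpaired = pairUp (through ν)

  whole : List (Crossing m)
  whole = paired ++ unpaired ++ reverse paired

  field
    adjacent : All (_∈ consecutive (through ν)) paired
    ends     : ∀ i j → ν (inj₁ i) ≡ inj₂ j → endOf whole i ≡ j
    nice     : ∀ i j → i ≢ j → meetings whole i j ℕ.≤ 1

νMatching : ∀ {k} → (Fin k → Fin k) → Point k → Point k
νMatching π (inj₁ i) = inj₂ (π i)
νMatching π (inj₂ i) = inj₁ (π i)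

-- The left points of d become the vertices 1, …, n and its right points the
-- vertices (n+1)', …, (2n)', both from top to bottom.
place : ∀ {n} → Point n → Point (n ℕ.+ n)
place {n} (inj₁ i) = inj₁ (i ↑ˡ n)
place {n} (inj₂ i) = inj₂ (n ↑ʳ i)

νTLˡ : ∀ {n} → (Point n → Point n) → Fin (n ℕ.+ n) → Point (n ℕ.+ n)
νTLˡ {n} d k with splitAt n k
... | inj₁ i = place (d (inj₁ i))
... | inj₂ i = mirror (place (d (inj₂ i)))

νTL : ∀ {n} → (Point n → Point n) → Point (n ℕ.+ n) → Point (n ℕ.+ n)
νTL d (inj₁ k) = νTLˡ d k
νTL d (inj₂ k) = mirror (νTLˡ d k)

------------------------------------------------------------------------
-- Uncrossings

data Uncrossing : Set where
  vertical horizontal : Uncrossing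

isVertical : Uncrossing → Bool
isVertical vertical   = true
isVertical horizontal = false

Uncrossed : ℕ → Set
Uncrossed m = List (Crossing m × Uncrossing)

uncrossings : ∀ {m} → List (Crossing m) → List (Uncrossed m)
uncrossings []       = [] ∷ []
uncrossings (c ∷ cs) =
  cartesianProductWith _∷_ ((c , vertical) ∷ (c , horizontal) ∷ [])
                           (uncrossings cs)

verticals horizontals : ∀ {m} → Uncrossed m → ℕ
verticals   x = length (filterᵇ (isVertical ∘ proj₂) x)
horizontals x = length (filterᵇ (not ∘ isVertical ∘ proj₂) x)

-- A partial picture: which of its ends are joined, and its number of loops.
Picture : ℕ → Set
Picture m = (Point m → Point m) × ℕ

-- Gluing the piece ")(" onto the ends p and q: the new ends p and q are
-- joined to each other, and so are the former partners of p and q.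
reconnect : ∀ {m} → Point m → Point m →
            (Point m → Point m) → Point m → Point m
reconnect p q f r =
  if does (r ≟ p)   then q   else
  if does (r ≟ q)   then p   else
  if does (f r ≟ p) then f q else
  if does (f r ≟ q) then f p else
  f r

-- If p and q were already joined, this gluing closes a loop.
loop : ∀ {m} → Point m → Point m → (Point m → Point m) → ℕ
loop p q f = if does (f p ≟ q) then 1 else 0

glue : ∀ {m} → Crossing m × Uncrossing → Picture m → Picture m
glue (_       , horizontal) pic     = pic
glue ((a , b) , vertical)   (f , l) =
  reconnect (inj₁ a) (inj₁ b) f , loop (inj₁ a) (inj₁ b) f ℕ.+ l

-- Gluing a piece on the left and its mirror image on the right.  This closes
-- no loop, a symmetric loop, or a mirror pair of loops, which counts once.
glueBoth : ∀ {m} → Crossing m × Uncrossing → Picture m → Picture m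
glueBoth (_       , horizontal) pic     = pic
glueBoth ((a , b) , vertical)   (f , l) =
  reconnect (inj₂ a) (inj₂ b) f₁ ,
  (loop (inj₁ a) (inj₁ b) f ⊔ loop (inj₂ a) (inj₂ b) f₁) ℕ.+ l
  where
  f₁ = reconnect (inj₁ a) (inj₁ b) f

-- Crossings are listed from left to right, so foldr builds the picture from
-- right to left (and a symmetric one from the axis outwards).
pictureTL : ∀ {n} → Uncrossed n → Picture n
pictureTL = foldr glue (mirror , 0)

-- The innermost part of a symmetric drawing: the left-left and right-right
-- edges of ν, and horizontal strands in all other slots.
core : ∀ {m} → (Point m → Point m) → Point m → Point m
core ν (inj₁ i) = if isRight (ν (inj₁ i)) then inj₂ i else ν (inj₁ i)
core ν (inj₂ i) = if isRight (ν (inj₂ i)) then ν (inj₂ i) else inj₁ i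

pictureSym : ∀ {m} → (Point m → Point m) →
             Uncrossed m × Uncrossed m → Picture m
pictureSym ν (x , y) = foldr glueBoth (foldr glue (core ν , 0) y) x

------------------------------------------------------------------------
-- Pfaffinants and immanants

MatchingDrawings PermWirings TLDrawings : ℕ → Set
MatchingDrawings n = (π : Matching (n ℕ.+ n)) → SymmetricDrawing (νMatching (proj₁ π))
PermWirings      n = (w : Perm n) → Wiring (proj₁ w)
TLDrawings       n = (d : TL n) → SymmetricDrawing (νTL (proj₁ d))

module Pfaffinants {c ℓ} (R : CommutativeRing c ℓ) where

  open CommutativeRing R
  open import Algebra.Properties.Semiring.Exp semiring using (_^_)

  ∑ ∏ : {A : Set} → List A → (A → Carrier) → Carrier
  ∑ xs f = foldr (λ x s → f x + s) 0# xs
  ∏ xs f = foldr (λ x s → f x * s) 1# xs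

  weight : ℕ → ℕ → Carrier
  weight l k = (1# + 1#) ^ l * (- 1#) ^ k

  -- The sum of wt(x) over the uncrossings x of a symmetric drawing with
  -- D(x) = D.
  symmetricCoefficient : ∀ {m} {ν : Point m → Point m} → SymmetricDrawing ν →
                         (Point m → Point m) → Carrier
  symmetricCoefficient {ν = ν} E D =
    ∑ (filter (λ x → proj₁ (pictureSym ν x) ≗? D)
              (cartesianProduct (uncrossings paired) (uncrossings unpaired)))
      λ (x , y) → weight (proj₂ (pictureSym ν (x , y)))
                         (verticals y ℕ.+ horizontals x)
    where open SymmetricDrawing E

  -- Only the entries a i j with i < j are used.
  Array : ℕ → Set c
  Array k = Fin k → Fin k → Carrier

  monomial : ∀ {k} → Array k → Matching k → Carrier
  monomial {k} a (π , _) = ∏ (filter (λ i → i <ᶠ? π i) (allFin k)) λ i → a i (π i)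

  Pfaf′ : ∀ {n} → MatchingDrawings n → T n → Array (n ℕ.+ n) → Carrier
  Pfaf′ {n} E (D , _) a =
    ∑ (allMatchings (n ℕ.+ n)) λ π →
      symmetricCoefficient (E π) D * monomial a π

  Pfaf : ∀ {n} → MatchingDrawings n → T n → Array (n ℕ.+ n) → Carrier
  Pfaf {n} E D a = ∑ (S {n} D) λ D′ → Pfaf′ {n} E D′ a

  immanantCoefficient : ∀ {n} {w : Fin n → Fin n} → Wiring w →
                        (Point n → Point n) → Carrier
  immanantCoefficient W d =
    ∑ (filter (λ x → proj₁ (pictureTL x) ≗? d) (uncrossings (Wiring.crossings W)))
      λ x → weight (proj₂ (pictureTL x)) (horizontals x)

  Imm : ∀ {n} → PermWirings n → TL n → (Fin n → Fin n → Carrier) → Carrier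
  Imm {n} W (d , _) b =
    ∑ (allPerms n) λ w →
      immanantCoefficient (W w) d * ∏ (allFin n) λ i → b i (proj₁ w i)

  g̃ : ∀ {n} → TLDrawings n → T n → TL n → Carrier
  g̃ {n} G (D , _) d =
    (- 1#) ^ (order (proj₁ d) ℕ.* n) * symmetricCoefficient (G d) D

{-# OPTIONS --safe #-}
module Submission where

-- A picture without crossings is represented by the indicator function of the
-- two-colourings of its ends that are constant on its edges; for a symmetric
-- picture the right ends are coloured false, and the function is scaled by two
-- to the power of half the number of horizontal edges.  A crossing, as vertical
-- minus horizontal uncrossing, then acts up to explicit signs by exchanging two
-- tensor factors, so the sum over all uncrossings of a drawing of ν is a sign
-- times the indicator of the colourings in which (after a shift by the parity
-- of the slots) the edges crossing the rectangle have ends of opposite colours.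
-- The sign involves the drawing only through the parity of its number of
-- crossings, and niceness makes that number a count of inversions of ν.
--
-- A monomial a_π that does not vanish belongs to a permutation w of n.  With
-- these formulas the vector of ν(π) is the vector of the wiring of w, and up to
-- a sign that the factor (-1)^(z(d) n) makes independent of d, the vector of ν(d)
-- is the indicator of the colourings constant on d.  Since planar symmetric
-- diagrams have linearly independent vectors over ℤ, the coefficients agree
-- over ℤ, and hence over every commutative ring.

open import Defs
open import Algebra.Bundles using (CommutativeRing; CommutativeMonoid)
import Algebra.Properties.CommutativeMonoid.Sum as MonoidSum
import Algebra.Properties.Semiring.Exp as Exp
open import Data.Bool.Base using (Bool; true; false; not; if_then_else_; _∧_; _∨_; _xor_)
open import Data.Bool.Properties as 𝔹
  using (xor-same; xor-comm; xor-assoc; xor-∧-commutativeRing; not-involutive; xor-identityʳ)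
open import Data.Bool.Solver using (module xor-∧-Solver)
open import Data.Empty using (⊥; ⊥-elim)
open import Data.Fin.Base as F using (Fin; zero; suc; toℕ; _<_; _↑ˡ_; _↑ʳ_; splitAt; join; opposite)
open import Data.Fin.Permutation as Perm using (Permutation′; permutation; _⟨$⟩ʳ_)
open import Data.Fin.Permutation.Components using (transpose)
import Data.Fin.Properties as F
open import Data.Integer.Base as ℤ using (ℤ; +_; -[1+_]; 0ℤ; 1ℤ; -1ℤ)
import Data.Integer.Properties as ℤ
open import Data.Integer.Tactic.RingSolver using (solve-∀)
open import Data.List.Base as List
  using (List; []; _∷_; _++_; map; foldr; filter; filterᵇ; length; reverse; drop;
         allFin; cartesianProduct; cartesianProductWith; _∷ʳ_)
import Data.List.Properties as List
open import Data.List.Membership.Propositional using (_∈_)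
open import Data.List.Membership.Propositional.Properties using (∈-allFin; ∈-filter⁺)
open import Data.List.Relation.Unary.All as All using (All; []; _∷_)
import Data.List.Relation.Unary.All.Properties as All
open import Data.List.Relation.Unary.AllPairs as AllPairs using (AllPairs; []; _∷_)
import Data.List.Relation.Unary.AllPairs.Properties as AllPairs
open import Data.List.Relation.Unary.Any using (here; there)
import Data.List.Relation.Unary.Any.Properties as Any
open import Data.Nat.Base as ℕ using (ℕ; zero; suc; _⊔_; s≤s; z≤n; ⌊_/2⌋)
open import Data.Nat.Divisibility using (_∣_)
import Data.Nat.Properties as ℕ
open import Data.Product.Base using (∃-syntax; _×_; _,_; proj₁; proj₂)
open import Data.Sum.Base using (_⊎_; inj₁; inj₂; [_,_])
open import Data.Sum.Properties using (inj₁-injective; inj₂-injective)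
open import Data.Vec.Base as Vec using (Vec; []; _∷_)
import Data.Vec.Functional as VF
import Data.Vec.Properties as Vec
open import Function.Base using (_∘_; id; flip; const; case_of_)
open import Relation.Binary.Definitions using (tri<; tri≈; tri>)
open import Relation.Binary.PropositionalEquality
  using (_≡_; _≢_; _≗_; refl; sym; trans; cong; cong₂; subst; subst₂; module ≡-Reasoning)
open import Relation.Nullary using (¬_; Dec; yes; no; does)
open import Relation.Nullary.Decidable using (dec-true; dec-false; _→-dec_; _×-dec_)
open import Relation.Nullary.Negation using (contradiction)

-- A closed loop weighs 2, so the piece ")(" acts on colourings as an operator `U` with `U U = 2 U`,
-- built from the symmetric form "equal colours". Neighbouring through slots have opposite parity.
-- Complementing the colours of odd slots, with a sign for each, makes this form alternating, and
-- then `U` is 1 minus an exchange; this is why vertical minus horizontal is minus an exchange. An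
-- unpaired crossing carries the opposite sign and glues one piece only: up to scale, its two
-- uncrossings combine to a number that depends on the two colours alone and vanishes when they
-- differ, which in the new colours demands that they be opposite. The scale is forced by gluing a
-- mirror pair of pieces to two horizontal edges, which uses up these edges and closes one loop. The
-- 2n slots of ν(π) and ν(d) are compared with a wiring diagram of size n by reading the upper n
-- slots as its left ends and the lower n slots as its right ends. Powers of 2 have to be cancelled
-- on the way, which ℤ permits and a general ring does not; hence the detour over ℤ.

private
  variable
    m n : ℕ

-- Parity and positions

par : ℕ → Bool
par zero    = false
par (suc k) = not (par k)

-- Sums modulo 2. Signs are carried as exponents in this ring, where the `xor`-`∧` solver can
-- compare two of them.
module ⊕ = MonoidSum (CommutativeRing.+-commutativeMonoid xor-∧-commutativeRing)

pos : Point m → ℕ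
pos p = toℕ (position p)

lt : Point m → Point m → Bool
lt x z = pos x ℕ.<ᵇ pos z

<⇒lt : ∀ {a b} → a ℕ.< b → (a ℕ.<ᵇ b) ≡ true
<⇒lt {a} {b} a<b = dec-true (a ℕ.<? b) a<b

≮⇒lt : ∀ {a b} → ¬ a ℕ.< b → (a ℕ.<ᵇ b) ≡ false
≮⇒lt {a} {b} a≮b = dec-false (a ℕ.<? b) a≮b

lt⇒< : ∀ {a b} → (a ℕ.<ᵇ b) ≡ true → a ℕ.< b
lt⇒< {a} {b} e with a ℕ.<? b
... | yes a<b = a<b
... | no  a≮b = contradiction (trans (sym (≮⇒lt a≮b)) e) λ ()

lt⇒≮ : ∀ {a b} → (a ℕ.<ᵇ b) ≡ false → ¬ a ℕ.< b
lt⇒≮ e a<b = contradiction (trans (sym e) (<⇒lt a<b)) λ ()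

<ᵇ-flip : ∀ {a b} → a ≢ b → (a ℕ.<ᵇ b) ≡ not (b ℕ.<ᵇ a)
<ᵇ-flip {a} {b} a≢b with ℕ.<-cmp a b
... | tri< a<b _ b≮a rewrite <⇒lt a<b | ≮⇒lt b≮a = refl
... | tri≈ _ a≡b _ = contradiction a≡b a≢b
... | tri> a≮b _ b<a rewrite ≮⇒lt a≮b | <⇒lt b<a = refl

point : Fin (m ℕ.+ m) → Point m
point {m} k with splitAt m k
... | inj₁ i = inj₁ i
... | inj₂ i = inj₂ (opposite i)

point-position : (p : Point m) → point (position p) ≡ p
point-position {m} (inj₁ i) rewrite F.splitAt-↑ˡ m i m = refl
point-position {m} (inj₂ i) rewrite F.splitAt-↑ʳ m m (opposite i) = cong inj₂ (F.opposite-involutive i)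

position-point : (k : Fin (m ℕ.+ m)) → position (point {m} k) ≡ k
position-point {m} k with splitAt m k in eq
... | inj₁ i = F.splitAt⁻¹-↑ˡ eq
... | inj₂ i = trans (cong (m ↑ʳ_) (F.opposite-involutive i)) (F.splitAt⁻¹-↑ʳ {m} eq)

pos-injective : {p q : Point m} → pos p ≡ pos q → p ≡ q
pos-injective {p = p} {q} e =
  trans (sym (point-position p)) (trans (cong point (F.toℕ-injective e)) (point-position q))

pos-left : (i : Fin m) → pos (inj₁ i) ≡ toℕ i
pos-left i = F.toℕ-↑ˡ i _

pos-right : (i : Fin m) → pos (inj₂ i) ≡ m ℕ.+ toℕ (opposite i)
pos-right {m} i = F.toℕ-↑ʳ m (opposite i)

lt-flip : {x z : Point m} → x ≢ z → lt x z ≡ not (lt z x)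
lt-flip x≢z = <ᵇ-flip (x≢z ∘ pos-injective)

-- Gluing one piece to a matching

data Reconnected (p q : Point m) (f : Point m → Point m) (r : Point m) : Point m → Set where
  at-p  : r ≡ p → Reconnected p q f r q
  at-q  : r ≢ p → r ≡ q → Reconnected p q f r p
  to-p  : r ≢ p → r ≢ q → f r ≡ p → Reconnected p q f r (f q)
  to-q  : r ≢ p → r ≢ q → f r ≢ p → f r ≡ q → Reconnected p q f r (f p)
  other : r ≢ p → r ≢ q → f r ≢ p → f r ≢ q → Reconnected p q f r (f r)

-- A view of the nested tests of `reconnect`: matching on it yields the value together with the
-- tests that failed before it, so two gluings can be compared case by case.
reconnected : ∀ (p q : Point m) f r → Reconnected p q f r (reconnect p q f r)
reconnected p q f r with r ≟ p
... | yes e = at-p e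
... | no r≢p with r ≟ q
...   | yes e = at-q r≢p e
...   | no r≢q with f r ≟ p
...     | yes e = to-p r≢p r≢q e
...     | no fr≢p with f r ≟ q
...       | yes e = to-q r≢p r≢q fr≢p e
...       | no fr≢q = other r≢p r≢q fr≢p fr≢q

module _ (p q : Point m) (f : Point m → Point m) where

  reconnect-p : reconnect p q f p ≡ q
  reconnect-p rewrite dec-true (p ≟ p) refl = refl

  reconnect-q : q ≢ p → reconnect p q f q ≡ p
  reconnect-q q≢p rewrite dec-false (q ≟ p) q≢p | dec-true (q ≟ q) refl = refl

  reconnect-to-p : ∀ {r} → r ≢ p → r ≢ q → f r ≡ p → reconnect p q f r ≡ f q
  reconnect-to-p {r} r≢p r≢q e
    rewrite dec-false (r ≟ p) r≢p | dec-false (r ≟ q) r≢q | dec-true (f r ≟ p) e = refl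

  reconnect-to-q : ∀ {r} → r ≢ p → r ≢ q → f r ≢ p → f r ≡ q → reconnect p q f r ≡ f p
  reconnect-to-q {r} r≢p r≢q fr≢p e
    rewrite dec-false (r ≟ p) r≢p | dec-false (r ≟ q) r≢q | dec-false (f r ≟ p) fr≢p
          | dec-true (f r ≟ q) e = refl

  reconnect-other : ∀ {r} → r ≢ p → r ≢ q → f r ≢ p → f r ≢ q → reconnect p q f r ≡ f r
  reconnect-other {r} r≢p r≢q fr≢p fr≢q
    rewrite dec-false (r ≟ p) r≢p | dec-false (r ≟ q) r≢q | dec-false (f r ≟ p) fr≢p
          | dec-false (f r ≟ q) fr≢q = refl

reconnect-cong : ∀ {p q : Point m} {f g : Point m → Point m} → f ≗ g → reconnect p q f ≗ reconnect p q g
reconnect-cong {p = p} {q} f≗g r rewrite f≗g r | f≗g p | f≗g q = refl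

matching-injective : {A : Set} {f : A → A} → IsMatching f → ∀ {x y} → f x ≡ f y → x ≡ y
matching-injective {f = f} (inv , _) {x} {y} e = trans (sym (inv x)) (trans (cong f e) (inv y))

-- The edge between `p` and `q` disappears into a loop, and the outer strand of the piece puts back
-- an edge between the same two ends; only the loop count sees the gluing.
reconnect-loop : ∀ {p q : Point m} {f} → IsMatching f → f p ≡ q → reconnect p q f ≗ f
reconnect-loop {p = p} {q} {f} (inv , _) fp≡q r with reconnect p q f r | reconnected p q f r
... | _ | at-p refl = sym fp≡q
... | _ | at-q _ refl = trans (sym (inv p)) (cong f fp≡q)
... | _ | to-p _ r≢q e = contradiction (trans (sym (inv r)) (trans (cong f e) fp≡q)) r≢q
... | _ | to-q r≢p _ _ e = contradiction (trans (sym (inv r)) (trans (cong f (trans e (sym fp≡q))) (inv p))) r≢p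
... | _ | other _ _ _ _ = refl

reconnect-comm : ∀ {p q : Point m} {f} → p ≢ q → IsMatching f → reconnect p q f ≗ reconnect q p f
reconnect-comm {p = p} {q} {f} p≢q M r
  with reconnect p q f r | reconnected p q f r | reconnect q p f r | reconnected q p f r
... | _ | at-p e | _ | at-p e′ = contradiction (trans (sym e) e′) p≢q
... | _ | at-p e | _ | at-q _ _ = refl
... | _ | at-p e | _ | to-p _ r≢p _ = contradiction e r≢p
... | _ | at-p e | _ | to-q _ r≢p _ _ = contradiction e r≢p
... | _ | at-p e | _ | other _ r≢p _ _ = contradiction e r≢p
... | _ | at-q _ _ | _ | at-p _ = refl
... | _ | at-q r≢p e | _ | at-q _ e′ = contradiction e′ r≢p
... | _ | at-q _ e | _ | to-p r≢q _ _ = contradiction e r≢q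
... | _ | at-q _ e | _ | to-q r≢q _ _ _ = contradiction e r≢q
... | _ | at-q _ e | _ | other r≢q _ _ _ = contradiction e r≢q
... | _ | to-p _ r≢q _ | _ | at-p e = contradiction e r≢q
... | _ | to-p r≢p _ _ | _ | at-q _ e = contradiction e r≢p
... | _ | to-p _ _ e | _ | to-p _ _ e′ = contradiction (trans (sym e) e′) p≢q
... | _ | to-p _ _ _ | _ | to-q _ _ _ _ = refl
... | _ | to-p _ _ e | _ | other _ _ _ fr≢p = contradiction e fr≢p
... | _ | to-q _ r≢q _ _ | _ | at-p e = contradiction e r≢q
... | _ | to-q r≢p _ _ _ | _ | at-q _ e = contradiction e r≢p
... | _ | to-q _ _ _ _ | _ | to-p _ _ _ = refl
... | _ | to-q _ _ fr≢p _ | _ | to-q _ _ _ e = contradiction e fr≢p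
... | _ | to-q _ _ _ e | _ | other _ _ fr≢q _ = contradiction e fr≢q
... | _ | other _ r≢q _ _ | _ | at-p e = contradiction e r≢q
... | _ | other r≢p _ _ _ | _ | at-q _ e = contradiction e r≢p
... | _ | other _ _ _ fr≢q | _ | to-p _ _ e = contradiction e fr≢q
... | _ | other _ _ fr≢p _ | _ | to-q _ _ _ e = contradiction e fr≢p
... | _ | other _ _ _ _ | _ | other _ _ _ _ = refl

reconnect-matching : ∀ {p q : Point m} {f} → p ≢ q → IsMatching f → IsMatching (reconnect p q f)
reconnect-matching {p = p} {q} {f} p≢q M@(inv , nofix) = involutive , noFix
  where
  involutive : ∀ r → reconnect p q f (reconnect p q f r) ≡ r
  involutive r with reconnect p q f r | reconnected p q f r
  ... | _ | at-p refl = reconnect-q p q f (p≢q ∘ sym)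
  ... | _ | at-q _ refl = reconnect-p p q f
  ... | _ | to-p r≢p r≢q e = trans (reconnect-to-q p q f fq≢p (nofix q) (λ e′ → p≢q (trans (sym e′) (inv q))) (inv q))
                                   (trans (cong f (sym e)) (inv r))
    where fq≢p : f q ≢ p
          fq≢p e′ = r≢q (matching-injective M (trans e (sym e′)))
  ... | _ | to-q r≢p r≢q _ e = trans (reconnect-to-p p q f (nofix p) fp≢q (inv p)) (trans (cong f (sym e)) (inv r))
    where fp≢q : f p ≢ q
          fp≢q e′ = r≢p (matching-injective M (trans e (sym e′)))
  ... | _ | other r≢p r≢q fr≢p fr≢q =
    trans (reconnect-other p q f fr≢p fr≢q (r≢p ∘ trans (sym (inv r))) (r≢q ∘ trans (sym (inv r)))) (inv r)

  noFix : ∀ r → reconnect p q f r ≢ r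
  noFix r e with reconnect p q f r | reconnected p q f r
  ... | _ | at-p e′ = p≢q (sym (trans e e′))
  ... | _ | at-q _ e′ = p≢q (trans e e′)
  ... | _ | to-p _ _ e′ = p≢q (trans (sym e′) (trans (cong f (sym e)) (inv q)))
  ... | _ | to-q _ _ _ e′ = p≢q (trans (sym (inv p)) (trans (cong f e) e′))
  ... | _ | other _ _ _ _ = nofix r e

-- Planarity

-- z and w lie on the same side of the chord xy.
Disjoint : (x y z w : Point m) → Set
Disjoint x y z w = lt x z xor lt y z ≡ lt x w xor lt y w

-- `NonCrossing` forbids one linear order of four ends. This form is an equation of parities,
-- symmetric in the ends of each chord, so that instances can be chained by transitivity.
Planar : (Point m → Point m) → Set
Planar f = ∀ x z → z ≢ x → z ≢ f x → Disjoint x (f x) z (f z)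

xor-swap : ∀ a b c d → a xor b ≡ c xor d → a xor c ≡ b xor d
xor-swap false false false false _ = refl
xor-swap false false true  true  _ = refl
xor-swap false true  false true  _ = refl
xor-swap false true  true  false _ = refl
xor-swap true  false false true  _ = refl
xor-swap true  false true  false _ = refl
xor-swap true  true  false false _ = refl
xor-swap true  true  true  true  _ = refl

disjoint-swap₁ : {x y z w : Point m} → Disjoint x y z w → Disjoint y x z w
disjoint-swap₁ {x = x} {y} {z} {w} e =
  trans (xor-comm (lt y z) (lt x z)) (trans e (xor-comm (lt x w) (lt y w)))

-- Both equations involve the same four comparisons, read in opposite directions. Reversing a
-- comparison negates it, and the four negations cancel in pairs.
disjoint-transpose : {x y z w : Point m} → z ≢ x → z ≢ y → w ≢ x → w ≢ y →
                     Disjoint x y z w → Disjoint z w x y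
disjoint-transpose {x = x} {y} {z} {w} zx zy wx wy e
  rewrite lt-flip zx | lt-flip zy | lt-flip wx | lt-flip wy =
  trans (𝔹.xor-annihilates-not (lt x z) (lt x w))
        (trans (xor-swap (lt x z) (lt y z) (lt x w) (lt y w) e)
               (sym (𝔹.xor-annihilates-not (lt y z) (lt y w))))

-- p and q can be joined without crossing the chords of f.
Accessible : (p q : Point m) → (Point m → Point m) → Set
Accessible p q f = ∀ z → z ≢ p → z ≢ q →
  (f z ≢ p → f z ≢ q → Disjoint p q z (f z)) ×
  (f z ≡ p ⊎ f z ≡ q → lt p z xor lt q z ≡ false)

-- The new chord from `f p` to `f q` can be drawn along the old edge of `p`, the chord from `p` to
-- `q`, and the old edge of `q`. A third chord that separates the ends of none of these has `f p`
-- and `f q` on one side.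
reconnect-planar : {p q : Point m} {f : Point m → Point m} → p ≢ q → IsMatching f →
                   Accessible p q f → Planar f → Planar (reconnect p q f)
reconnect-planar {p = p} {q} {f} p≢q M@(inv , nofix) acc planar with f p ≟ q
... | yes fp≡q = λ x z z≢x z≢gx →
  subst (λ y → Disjoint x y z (reconnect p q f z)) (sym (reconnect-loop M fp≡q x))
    (subst (Disjoint x (f x) z) (sym (reconnect-loop M fp≡q z))
      (planar x z z≢x (z≢gx ∘ flip trans (sym (reconnect-loop M fp≡q x)))))
... | no fp≢q = main
  where
  inj : ∀ {x y} → f x ≡ f y → x ≡ y
  inj = matching-injective M

  fq≢p : f q ≢ p
  fq≢p e = fp≢q (trans (cong f (sym e)) (inv q))

  inner : Disjoint p q (f p) (f q)
  inner = trans (proj₂ (acc (f p) (nofix p) fp≢q) (inj₁ (inv p)))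
                (sym (proj₂ (acc (f q) fq≢p (nofix q)) (inj₂ (inv q))))

  innerᵀ : Disjoint (f p) (f q) p q
  innerᵀ = disjoint-transpose (nofix p) fp≢q fq≢p (nofix q) inner

  module _ {z} (z≢p : z ≢ p) (z≢q : z ≢ q) (fz≢p : f z ≢ p) (fz≢q : f z ≢ q) where

    z≢fp : z ≢ f p
    z≢fp e = fz≢p (trans (cong f e) (inv p))

    z≢fq : z ≢ f q
    z≢fq e = fz≢q (trans (cong f e) (inv q))

    short : Disjoint p q z (f z)
    short = proj₁ (acc z z≢p z≢q) fz≢p fz≢q

    shortᵀ : Disjoint z (f z) p q
    shortᵀ = disjoint-transpose z≢p z≢q fz≢p fz≢q short

    longᵀ : Disjoint z (f z) (f p) (f q)
    longᵀ = trans (sym (planar z p (z≢p ∘ sym) (fz≢p ∘ sym)))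
                  (trans shortᵀ (planar z q (z≢q ∘ sym) (fz≢q ∘ sym)))

    long : Disjoint (f p) (f q) z (f z)
    long = disjoint-transpose (z≢fp ∘ sym) (λ e → z≢p (sym (inj e))) (z≢fq ∘ sym)
                              (λ e → z≢q (sym (inj e))) longᵀ

  main : Planar (reconnect p q f)
  main x z z≢x z≢gx with reconnect p q f x | reconnected p q f x | reconnect p q f z | reconnected p q f z
  ... | _ | at-p refl | _ | at-p e = contradiction e z≢x
  ... | _ | at-p refl | _ | at-q _ e = contradiction e z≢gx
  ... | _ | at-p refl | _ | to-p _ _ e rewrite sym (trans (cong f (sym e)) (inv z)) = inner
  ... | _ | at-p refl | _ | to-q _ _ _ e rewrite sym (trans (cong f (sym e)) (inv z)) = sym inner
  ... | _ | at-p refl | _ | other a b c d = short a b c d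
  ... | _ | at-q _ refl | _ | at-p e = contradiction e z≢gx
  ... | _ | at-q _ refl | _ | at-q _ e = contradiction e z≢x
  ... | _ | at-q _ refl | _ | to-p _ _ e rewrite sym (trans (cong f (sym e)) (inv z)) = disjoint-swap₁ {x = p} {q} {f p} {f q} inner
  ... | _ | at-q _ refl | _ | to-q _ _ _ e rewrite sym (trans (cong f (sym e)) (inv z)) =
    disjoint-swap₁ {x = p} {q} {f q} {f p} (sym inner)
  ... | _ | at-q _ refl | _ | other a b c d = disjoint-swap₁ {x = p} {q} {z} {f z} (short a b c d)
  ... | _ | to-p _ _ e′ | _ | at-p refl rewrite sym (trans (cong f (sym e′)) (inv x)) = innerᵀ
  ... | _ | to-p _ _ e′ | _ | at-q _ refl rewrite sym (trans (cong f (sym e′)) (inv x)) = sym innerᵀ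
  ... | _ | to-p _ _ e′ | _ | to-p _ _ e = contradiction (inj (trans e (sym e′))) z≢x
  ... | _ | to-p _ _ e′ | _ | to-q _ _ _ e = contradiction (inj (trans e (sym (inv q)))) z≢gx
  ... | _ | to-p _ _ e′ | _ | other a b c d rewrite sym (trans (cong f (sym e′)) (inv x)) = long a b c d
  ... | _ | to-q _ _ _ e′ | _ | at-p refl rewrite sym (trans (cong f (sym e′)) (inv x)) =
    disjoint-swap₁ {x = f p} {f q} {p} {q} innerᵀ
  ... | _ | to-q _ _ _ e′ | _ | at-q _ refl rewrite sym (trans (cong f (sym e′)) (inv x)) =
    disjoint-swap₁ {x = f p} {f q} {q} {p} (sym innerᵀ)
  ... | _ | to-q _ _ _ e′ | _ | to-p _ _ e = contradiction (inj (trans e (sym (inv p)))) z≢gx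
  ... | _ | to-q _ _ _ e′ | _ | to-q _ _ _ e = contradiction (inj (trans e (sym e′))) z≢x
  ... | _ | to-q _ _ _ e′ | _ | other a b c d rewrite sym (trans (cong f (sym e′)) (inv x)) =
    disjoint-swap₁ {x = f p} {f q} {z} {f z} (long a b c d)
  ... | _ | other a b c d | _ | at-p refl = shortᵀ a b c d
  ... | _ | other a b c d | _ | at-q _ refl = sym (shortᵀ a b c d)
  ... | _ | other a b c d | _ | to-p _ _ e rewrite sym (trans (cong f (sym e)) (inv z)) = longᵀ a b c d
  ... | _ | other a b c d | _ | to-q _ _ _ e rewrite sym (trans (cong f (sym e)) (inv z)) = sym (longᵀ a b c d)
  ... | _ | other _ _ _ _ | _ | other _ _ _ _ = planar x z z≢x z≢gx

planar-cong : {f g : Point m → Point m} → f ≗ g → Planar f → Planar g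
planar-cong e P x z z≢x z≢gx rewrite sym (e x) | sym (e z) = P x z z≢x z≢gx

planar⇒nonCrossing : {f : Point m → Point m} → Planar f → NonCrossing f
planar⇒nonCrossing {f = f} P p q (p<q , q<fp , fp<fq) = contradiction (trans (sym lhs) (trans (P p q q≢p q≢fp) rhs)) λ ()
  where
  q≢p : q ≢ p
  q≢p refl = ℕ.<-irrefl refl p<q
  q≢fp : q ≢ f p
  q≢fp e = ℕ.<-irrefl (cong pos e) q<fp
  lhs : lt p q xor lt (f p) q ≡ true
  lhs rewrite <⇒lt p<q | ≮⇒lt (ℕ.<-asym q<fp) = refl
  rhs : lt p (f q) xor lt (f p) (f q) ≡ false
  rhs rewrite <⇒lt fp<fq | <⇒lt (ℕ.<-trans p<q (ℕ.<-trans q<fp fp<fq)) = refl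

-- Of the sixteen patterns of comparisons, the eight with an odd number of `true` are the eight
-- linear orders in which the two chords interlace; each contradicts `NonCrossing` read from the end
-- that comes first.
nonCrossing⇒planar : {f : Point m → Point m} → IsMatching f → NonCrossing f → Planar f
nonCrossing⇒planar {f = f} M@(inv , nofix) N x z z≢x z≢fx = main
  where
  inj : ∀ {x y} → f x ≡ f y → x ≡ y
  inj = matching-injective M
  fz≢x : f z ≢ x
  fz≢x e = z≢fx (trans (sym (inv z)) (cong f e))
  fz≢fx : f z ≢ f x
  fz≢fx e = z≢x (inj e)
  cross : ∀ u v → lt u v ≡ true → lt v (f u) ≡ true → lt (f u) (f v) ≡ true → ⊥
  cross u v a b c = N u v (lt⇒< a , lt⇒< b , lt⇒< c)
  flip₁ : {u v : Point _} → u ≢ v → lt u v ≡ false → lt v u ≡ true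
  flip₁ u≢v e = trans (lt-flip (u≢v ∘ sym)) (cong not e)
  main : Disjoint x (f x) z (f z)
  main with lt x z in a | lt (f x) z in b | lt x (f z) in c | lt (f x) (f z) in d
  ... | false | false | false | false = refl
  ... | false | false | true  | true  = refl
  ... | true  | true  | false | false = refl
  ... | true  | true  | true  | true  = refl
  ... | false | true  | false | true  = refl
  ... | false | true  | true  | false = refl
  ... | true  | false | false | true  = refl
  ... | true  | false | true  | false = refl
  ... | false | false | true  | false = ⊥-elim (cross z x (flip₁ (z≢x ∘ sym) a) c (flip₁ (fz≢fx ∘ sym) d))
  ... | false | false | false | true  = ⊥-elim (cross z (f x) (flip₁ (z≢fx ∘ sym) b) d
                                         (subst (λ y → lt (f z) y ≡ true) (sym (inv x)) (flip₁ (fz≢x ∘ sym) c)))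
  ... | true  | true  | false | true  = ⊥-elim (cross (f x) (f z) d
                                         (subst (λ y → lt (f z) y ≡ true) (sym (inv x)) (flip₁ (fz≢x ∘ sym) c))
                                         (subst (λ y → lt (f (f x)) y ≡ true) (sym (inv z)) (subst (λ y → lt y z ≡ true) (sym (inv x)) a)))
  ... | true  | true  | true  | false = ⊥-elim (cross x (f z) c (flip₁ (fz≢fx ∘ sym) d)
                                         (subst (λ y → lt (f x) y ≡ true) (sym (inv z)) b))
  ... | true  | false | true  | true  = ⊥-elim (cross x z a (flip₁ (z≢fx ∘ sym) b) d)
  ... | true  | false | false | false = ⊥-elim (cross (f z) x (flip₁ (fz≢x ∘ sym) c)
                                         (subst (λ y → lt x y ≡ true) (sym (inv z)) a)
                                         (subst (λ y → lt y (f x) ≡ true) (sym (inv z)) (flip₁ (z≢fx ∘ sym) b)))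
  ... | false | true  | true  | true  = ⊥-elim (cross (f x) z b
                                         (subst (λ y → lt z y ≡ true) (sym (inv x)) (flip₁ (z≢x ∘ sym) a))
                                         (subst (λ y → lt y (f z) ≡ true) (sym (inv x)) c))
  ... | false | true  | false | false = ⊥-elim (cross (f z) (f x) (flip₁ (fz≢fx ∘ sym) d)
                                         (subst (λ y → lt (f x) y ≡ true) (sym (inv z)) b)
                                         (subst (λ y → lt (f (f z)) y ≡ true) (sym (inv x)) (subst (λ y → lt y x ≡ true) (sym (inv z)) (flip₁ (z≢x ∘ sym) a))))

-- Parity of the ends of an edge

involution-permutation : (g : Fin n → Fin n) → (∀ k → g (g k) ≡ k) → Permutation′ n
involution-permutation g inv = permutation g g inv inv

⊕-involution : (g : Fin n → Fin n) → (∀ k → g (g k) ≡ k) → (h : Fin n → Bool) →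
               ⊕.sum h ≡ ⊕.sum (h ∘ g)
⊕-involution g inv h = ⊕.sum-permute h (involution-permutation g inv)

⊕-zero : {h : Fin n → Bool} → (∀ k → h k ≡ false) → ⊕.sum h ≡ false
⊕-zero {n} e = trans (⊕.sum-cong-≗ e) (⊕.sum-replicate-zero n)

∧-xor-not : ∀ s b → s ≡ (s ∧ b) xor (s ∧ not b)
∧-xor-not false b     = refl
∧-xor-not true  false = refl
∧-xor-not true  true  = refl

-- The members of `U` come in pairs `k`, `g k`. Marking the smaller member of each pair writes the
-- sum as that of `h` plus that of its image under the involution `g`, and these cancel modulo 2.
even-invariant-set : (g : Fin n → Fin n) → IsMatching g → (U : Fin n → Bool) → (∀ k → U (g k) ≡ U k) →
                     ⊕.sum U ≡ false
even-invariant-set g (inv , nofix) U closed = begin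
  ⊕.sum U                                ≡⟨ ⊕.sum-cong-≗ split ⟩
  ⊕.sum (λ k → h k xor h (g k))          ≡⟨ ⊕.∑-distrib-+ h (h ∘ g) ⟩
  ⊕.sum h xor ⊕.sum (h ∘ g)              ≡⟨ cong (⊕.sum h xor_) (⊕-involution g inv h) ⟨
  ⊕.sum h xor ⊕.sum h                    ≡⟨ xor-same (⊕.sum h) ⟩
  false                                  ∎
  where
  open ≡-Reasoning
  h : Fin _ → Bool
  h k = U k ∧ (toℕ k ℕ.<ᵇ toℕ (g k))
  split : ∀ k → U k ≡ h k xor h (g k)
  split k rewrite inv k | closed k | <ᵇ-flip (nofix k ∘ F.toℕ-injective) = ∧-xor-not (U k) _

⊕-below : ∀ y → y ℕ.≤ n → ⊕.sum {n} (λ k → toℕ k ℕ.<ᵇ y) ≡ par y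
⊕-below {n} zero _ = ⊕-zero {n} {λ k → toℕ k ℕ.<ᵇ zero} λ k → refl
⊕-below {suc n} (suc y) (s≤s y≤n) = cong not (⊕-below y y≤n)

-- The initial segments with bounds `x` and `y` differ in a set that `f` preserves, hence in an even
-- number of positions. Taking the `xor` avoids deciding which bound is larger.
invariant-interval : {f : Point m → Point m} → IsMatching f → ∀ x y → x ℕ.≤ m ℕ.+ m → y ℕ.≤ m ℕ.+ m →
                     (∀ p → (pos (f p) ℕ.<ᵇ y) xor (pos (f p) ℕ.<ᵇ x) ≡ (pos p ℕ.<ᵇ y) xor (pos p ℕ.<ᵇ x)) →
                     par x ≡ par y
invariant-interval {m} {f} (inv , nofix) x y x≤ y≤ closed = xor-cancel {par y} {par x} (begin
  par y xor par x                                                      ≡⟨ cong₂ _xor_ (⊕-below {m ℕ.+ m} y y≤) (⊕-below {m ℕ.+ m} x x≤) ⟨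
  ⊕.sum {m ℕ.+ m} (λ k → toℕ k ℕ.<ᵇ y) xor ⊕.sum {m ℕ.+ m} (λ k → toℕ k ℕ.<ᵇ x)  ≡⟨ ⊕.∑-distrib-+ {m ℕ.+ m} (λ k → toℕ k ℕ.<ᵇ y) (λ k → toℕ k ℕ.<ᵇ x) ⟨
  ⊕.sum U                                                              ≡⟨ even-invariant-set g (g-inv , g-nofix) U U-closed ⟩
  false                                                                ∎)
  where
  open ≡-Reasoning
  xor-cancel : ∀ {a b} → a xor b ≡ false → b ≡ a
  xor-cancel {false} e = e
  xor-cancel {true} {true} e = refl
  g : Fin (m ℕ.+ m) → Fin (m ℕ.+ m)
  g k = position (f (point k))
  U : Fin (m ℕ.+ m) → Bool
  U k = (toℕ k ℕ.<ᵇ y) xor (toℕ k ℕ.<ᵇ x)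
  g-inv : ∀ k → g (g k) ≡ k
  g-inv k rewrite point-position (f (point k)) | inv (point k) = position-point {m} k
  g-nofix : ∀ k → g k ≢ k
  g-nofix k e = nofix (point k) (trans (sym (point-position _)) (cong point e))
  U-closed : ∀ k → U (g k) ≡ U k
  U-closed k = trans (closed (point k)) (cong (λ j → (toℕ j ℕ.<ᵇ y) xor (toℕ j ℕ.<ᵇ x)) (position-point {m} k))

<ᵇ-suc : ∀ {a b} → a ≢ b → (a ℕ.<ᵇ suc b) ≡ (a ℕ.<ᵇ b)
<ᵇ-suc {a} {b} a≢b with a ℕ.<? b
... | yes a<b = trans (<⇒lt {a} {suc b} (ℕ.m<n⇒m<1+n a<b)) (sym (<⇒lt a<b))
... | no a≮b = trans (≮⇒lt {a} {suc b} λ { (s≤s a≤b) → a≮b (ℕ.≤∧≢⇒< a≤b a≢b) }) (sym (≮⇒lt a≮b))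

pos< : (p : Point m) → pos p ℕ.< m ℕ.+ m
pos< p = F.toℕ<n (position p)

-- In a planar matching no edge leaves the interval spanned by another edge, so the positions
-- between the two ends are matched among themselves and their number is even.
edge-parity : {f : Point m → Point m} → IsMatching f → Planar f → ∀ p → par (pos (f p)) ≡ not (par (pos p))
edge-parity {m} {f} M@(inv , nofix) planar p =
  -- When `f p` comes after `p`, these bounds cut out the positions strictly between the ends; when
  -- it comes before, both ends are included. The set is invariant either way.
  sym (invariant-interval M (suc (pos p)) (pos (f p)) (pos< p) (ℕ.<⇒≤ (pos< (f p))) closed)
  where
  ends : lt (f p) (f p) xor (pos (f p) ℕ.<ᵇ suc (pos p)) ≡ lt p (f p) xor (pos p ℕ.<ᵇ suc (pos p))
  ends rewrite ≮⇒lt (ℕ.<-irrefl {pos (f p)} refl) | <⇒lt (ℕ.n<1+n (pos p))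
             | <ᵇ-suc {pos (f p)} {pos p} (nofix p ∘ pos-injective)
             | lt-flip (nofix p ∘ sym) | xor-comm (not (lt (f p) p)) true = sym (not-involutive _)
  closed : ∀ z → (pos (f z) ℕ.<ᵇ pos (f p)) xor (pos (f z) ℕ.<ᵇ suc (pos p)) ≡
                 (pos z ℕ.<ᵇ pos (f p)) xor (pos z ℕ.<ᵇ suc (pos p))
  closed z with z ≟ p
  ... | yes refl = ends
  ... | no z≢p with z ≟ f p
  ...   | yes refl rewrite inv p = sym ends
  ...   | no z≢fp
    rewrite <ᵇ-suc {pos z} {pos p} (z≢p ∘ pos-injective)
          | <ᵇ-suc {pos (f z)} {pos p} (λ e → z≢fp (trans (sym (inv z)) (cong f (pos-injective e))))
          = trans (xor-comm (lt (f z) (f p)) (lt (f z) p))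
              (trans (sym (xor-swap (lt z p) (lt (f z) p) (lt z (f p)) (lt (f z) (f p))
                       (planar z p (z≢p ∘ sym) λ e → z≢fp (trans (sym (inv z)) (cong f (sym e))))))
                (xor-comm (lt z p) (lt z (f p))))

lt-left-left : (i j : Fin m) → lt (inj₁ i) (inj₁ j) ≡ (toℕ i ℕ.<ᵇ toℕ j)
lt-left-left i j = cong₂ ℕ._<ᵇ_ (pos-left i) (pos-left j)

pos-left<right : (i j : Fin m) → pos (inj₁ i) ℕ.< pos (inj₂ j)
pos-left<right {m} i j rewrite pos-left i | pos-right j = ℕ.<-≤-trans (F.toℕ<n i) (ℕ.m≤m+n m _)

lt-left-right : (i j : Fin m) → lt (inj₁ i) (inj₂ j) ≡ true
lt-left-right i j = <⇒lt (pos-left<right i j)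

lt-right-left : (i j : Fin m) → lt (inj₂ i) (inj₁ j) ≡ false
lt-right-left i j = ≮⇒lt (ℕ.<-asym (pos-left<right j i))

lt-right-right : (i j : Fin m) → lt (inj₂ i) (inj₂ j) ≡ (toℕ j ℕ.<ᵇ toℕ i)
lt-right-right {m} i j with toℕ j ℕ.<? toℕ i
... | yes j<i = trans (<⇒lt lem) (sym (<⇒lt j<i))
  where
  lem : pos (inj₂ i) ℕ.< pos (inj₂ j)
  lem rewrite pos-right i | pos-right j | F.opposite-prop i | F.opposite-prop j =
    ℕ.+-monoʳ-< m (ℕ.∸-monoʳ-< (s≤s j<i) (F.toℕ<n i))
... | no j≮i = trans (≮⇒lt lem) (sym (≮⇒lt j≮i))
  where
  lem : ¬ pos (inj₂ i) ℕ.< pos (inj₂ j)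
  lem rewrite pos-right i | pos-right j | F.opposite-prop i | F.opposite-prop j =
    ℕ.≤⇒≯ (ℕ.+-monoʳ-≤ m (ℕ.∸-monoʳ-≤ m (s≤s (ℕ.≮⇒≥ j≮i))))

-- Gluing a symmetric pair of pieces

Symmetric : (Point m → Point m) → Set
Symmetric f = ∀ p → f (mirror p) ≡ mirror (f p)

mirror-mirror : (p : Point m) → mirror (mirror p) ≡ p
mirror-mirror (inj₁ _) = refl
mirror-mirror (inj₂ _) = refl

mirror-move : {p q : Point m} → mirror p ≡ q → p ≡ mirror q
mirror-move {p = p} e = trans (sym (mirror-mirror p)) (cong mirror e)

inj₁≢inj₂ : {i j : Fin m} → _≢_ {A = Point m} (inj₁ i) (inj₂ j)
inj₁≢inj₂ ()

inj₂≢inj₁ : {i j : Fin m} → _≢_ {A = Point m} (inj₂ i) (inj₁ j)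
inj₂≢inj₁ ()

-- By symmetry `f` also joins the left point `j` to the right point `i`. For `i ≢ j` this edge would
-- cross the one from the left point `i` to the right point `j`.
symmetric-horizontal : {f : Point m → Point m} → IsMatching f → Planar f → Symmetric f →
                       ∀ {i j} → f (inj₁ i) ≡ inj₂ j → i ≡ j
symmetric-horizontal {f = f} (inv , _) planar symm {i} {j} e with i F.≟ j
... | yes i≡j = i≡j
... | no i≢j = contradiction crossing (absurd (toℕ i ℕ.<ᵇ toℕ j))
  where
  fj : f (inj₁ j) ≡ inj₂ i
  fj = trans (symm (inj₂ j)) (cong mirror (trans (cong f (sym e)) (inv (inj₁ i))))
  crossing : (toℕ i ℕ.<ᵇ toℕ j) xor false ≡ true xor (toℕ i ℕ.<ᵇ toℕ j)
  crossing with planar (inj₁ i) (inj₁ j) (i≢j ∘ sym ∘ inj₁-injective) (λ e′ → inj₁≢inj₂ (trans e′ e))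
  ... | d rewrite e | fj | lt-left-left i j | lt-right-left j j | lt-left-right i i | lt-right-right j i = d
  absurd : ∀ b → b xor false ≢ true xor b
  absurd false ()
  absurd true ()

reconnectBoth : (a b : Fin m) → (Point m → Point m) → Point m → Point m
reconnectBoth a b f = reconnect (inj₂ a) (inj₂ b) (reconnect (inj₁ a) (inj₁ b) f)

reconnectBoth-comm : ∀ {a b : Fin m} {f} → a ≢ b → IsMatching f → reconnectBoth a b f ≗ reconnectBoth b a f
reconnectBoth-comm a≢b M r =
  trans (reconnect-comm (a≢b ∘ inj₂-injective) (reconnect-matching (a≢b ∘ inj₁-injective) M) r)
        (reconnect-cong (reconnect-comm (a≢b ∘ inj₁-injective) M) r)

Apart : (a b : Fin m) → Point m → Set
Apart a b r = (r ≢ inj₁ a × r ≢ inj₁ b) × (r ≢ inj₂ a × r ≢ inj₂ b)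

apart-mirror : ∀ {a b : Fin m} {r} → Apart a b r → Apart a b (mirror r)
apart-mirror ((x , y) , z , w) = (z ∘ mirror-move , w ∘ mirror-move) , (x ∘ mirror-move , y ∘ mirror-move)

apart-comm : ∀ {a b : Fin m} {r} → Apart a b r → Apart b a r
apart-comm ((x , y) , z , w) = (y , x) , (w , z)

record SymmetricState (f : Point m → Point m) : Set where
  constructor state
  field
    matching  : IsMatching f
    planar    : Planar f
    symmetric : Symmetric f

  level : ∀ {i j} → f (inj₁ i) ≡ inj₂ j → i ≡ j
  level = symmetric-horizontal matching planar symmetric

  involutive : ∀ p → f (f p) ≡ p
  involutive = proj₁ matching

  noFix : ∀ p → f p ≢ p
  noFix = proj₂ matching

module Both {f : Point m → Point m} (F : SymmetricState f) {a b : Fin m} (a≢b : a ≢ b) where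

  open SymmetricState F

  f₁ f₂ : Point m → Point m
  f₁ = reconnect (inj₁ a) (inj₁ b) f
  f₂ = reconnectBoth a b f

  a≢b₁ : _≢_ {A = Point m} (inj₁ a) (inj₁ b)
  a≢b₁ = a≢b ∘ inj₁-injective

  a≢b₂ : _≢_ {A = Point m} (inj₂ a) (inj₂ b)
  a≢b₂ = a≢b ∘ inj₂-injective

  matching₁ : IsMatching f₁
  matching₁ = reconnect-matching a≢b₁ matching

  matching₂ : IsMatching f₂
  matching₂ = reconnect-matching a≢b₂ matching₁

  f₁a : f₁ (inj₁ a) ≡ inj₁ b
  f₁a = reconnect-p (inj₁ a) (inj₁ b) f

  f₁b : f₁ (inj₁ b) ≡ inj₁ a
  f₁b = reconnect-q (inj₁ a) (inj₁ b) f (a≢b₁ ∘ sym)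

  f₂a : f₂ (inj₁ a) ≡ inj₁ b
  f₂a = trans (reconnect-other (inj₂ a) (inj₂ b) f₁ {inj₁ a} inj₁≢inj₂ inj₁≢inj₂ (inj₁≢inj₂ ∘ trans (sym f₁a)) (inj₁≢inj₂ ∘ trans (sym f₁a))) f₁a

  f₂b : f₂ (inj₁ b) ≡ inj₁ a
  f₂b = trans (cong f₂ (sym f₂a)) (proj₁ matching₂ (inj₁ a))

  f₂a′ : f₂ (inj₂ a) ≡ inj₂ b
  f₂a′ = reconnect-p (inj₂ a) (inj₂ b) f₁

  f₂b′ : f₂ (inj₂ b) ≡ inj₂ a
  f₂b′ = reconnect-q (inj₂ a) (inj₂ b) f₁ (a≢b₂ ∘ sym)

  f₁-other : ∀ {r} → r ≢ inj₁ a → r ≢ inj₁ b → f r ≢ inj₁ a → f r ≢ inj₁ b → f₁ r ≡ f r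
  f₁-other {r} = reconnect-other (inj₁ a) (inj₁ b) f {r}

  f₂-other : ∀ {r} → r ≢ inj₂ a → r ≢ inj₂ b → f₁ r ≢ inj₂ a → f₁ r ≢ inj₂ b → f₂ r ≡ f₁ r
  f₂-other {r} = reconnect-other (inj₂ a) (inj₂ b) f₁ {r}

  untouched : ∀ {r} → Apart a b r → Apart a b (f r) → f₂ r ≡ f r
  untouched {r} ((x , y) , z , w) ((x′ , y′) , z′ , w′) =
    trans (f₂-other {r} z w (z′ ∘ trans (sym e)) (w′ ∘ trans (sym e))) e
    where e = f₁-other {r} x y x′ y′

  module _ {r} (r# : Apart a b r) (fr≡a : f r ≡ inj₁ a) where

    private
      x = proj₁ (proj₁ r#)
      y = proj₂ (proj₁ r#)
      z = proj₁ (proj₂ r#)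
      w = proj₂ (proj₂ r#)
      r̄# = apart-mirror {a = a} {b} r#
      x̄ = proj₁ (proj₁ r̄#)
      ȳ = proj₂ (proj₁ r̄#)
      z̄ = proj₁ (proj₂ r̄#)
      w̄ = proj₂ (proj₂ r̄#)

      f₁r : f₁ r ≡ f (inj₁ b)
      f₁r = reconnect-to-p (inj₁ a) (inj₁ b) f {r} x y fr≡a

      fa : f (inj₁ a) ≡ r
      fa = trans (cong f (sym fr≡a)) (involutive r)

      fa′ : f (inj₂ a) ≡ mirror r
      fa′ = trans (symmetric (inj₁ a)) (cong mirror fa)

      f₁a′ : f₁ (inj₂ a) ≡ mirror r
      f₁a′ = trans (f₁-other {inj₂ a} inj₂≢inj₁ inj₂≢inj₁ (x̄ ∘ trans (sym fa′)) (ȳ ∘ trans (sym fa′))) fa′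

      fr̄ : f (mirror r) ≡ inj₂ a
      fr̄ = trans (symmetric r) (cong mirror fr≡a)

      f₁r̄ : f₁ (mirror r) ≡ inj₂ a
      f₁r̄ = trans (f₁-other {mirror r} x̄ ȳ (inj₂≢inj₁ ∘ trans (sym fr̄)) (inj₂≢inj₁ ∘ trans (sym fr̄))) fr̄

      f₂r̄ : f₂ (mirror r) ≡ f₁ (inj₂ b)
      f₂r̄ = reconnect-to-p (inj₂ a) (inj₂ b) f₁ {mirror r} z̄ w̄ f₁r̄

    -- After the left piece, `r` is joined to the right point `b`; the right piece then connects it
    -- with the partner of the right point `a`, which is `mirror r`. The edge that ended at `a`
    -- turns horizontal.
    to-a-horizontal : f (inj₁ b) ≡ inj₂ b → f₂ r ≡ mirror r × f₂ (mirror r) ≡ r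
    to-a-horizontal fb =
      trans (reconnect-to-q (inj₂ a) (inj₂ b) f₁ {r} z w (λ e → a≢b₂ (trans (sym e) (trans f₁r fb))) (trans f₁r fb)) f₁a′ ,
      trans f₂r̄ (trans (reconnect-to-q (inj₁ a) (inj₁ b) f {inj₂ b} inj₂≢inj₁ inj₂≢inj₁ (λ e → a≢b₁ (trans (sym e) fb′)) fb′) fa)
      where
      fb′ : f (inj₂ b) ≡ inj₁ b
      fb′ = trans (symmetric (inj₁ b)) (cong mirror fb)

    -- Here the edges at `a` and `b` both stay on the left side, so the two pieces do not interact.
    to-a-vertical : f (inj₁ b) ≢ inj₂ b → f₂ r ≡ f (inj₁ b) × f₂ (mirror r) ≡ mirror (f (inj₁ b))
    to-a-vertical fb≢b′ =
      trans (f₂-other {r} z w (fb≢a′ ∘ trans (sym f₁r)) (fb≢b′ ∘ trans (sym f₁r))) f₁r ,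
      trans f₂r̄ (trans (f₁-other {inj₂ b} inj₂≢inj₁ inj₂≢inj₁
        (λ e → fb≢a′ (mirror-move (trans (sym (symmetric (inj₁ b))) e)))
        (λ e → fb≢b′ (mirror-move (trans (sym (symmetric (inj₁ b))) e)))) (symmetric (inj₁ b)))
      where
      fb≢a′ : f (inj₁ b) ≢ inj₂ a
      fb≢a′ e = a≢b (sym (level e))

    to-a-symmetric : f₂ (mirror r) ≡ mirror (f₂ r)
    to-a-symmetric with f (inj₁ b) ≟ inj₂ b
    ... | yes e = trans (proj₂ (to-a-horizontal e)) (sym (trans (cong mirror (proj₁ (to-a-horizontal e))) (mirror-mirror r)))
    ... | no ne = trans (proj₂ (to-a-vertical ne)) (cong mirror (sym (proj₁ (to-a-vertical ne))))

module _ {f : Point m → Point m} (F : SymmetricState f) {a b : Fin m} (a≢b : a ≢ b) where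

  open SymmetricState F
  open Both F a≢b
  private module Swapped = Both F (a≢b ∘ sym)

  -- The intermediate matching `f₁` is in general not symmetric, so symmetry is checked on the
  -- result. A point whose edge ended at one of the four glued ends is reduced to the case of the
  -- left end `a` by exchanging `a` with `b` (`swapped`) and by reflection (`turn`).
  reconnectBoth-symmetric : Symmetric (reconnectBoth a b f)
  reconnectBoth-symmetric r = special (r ≟ inj₁ a) (r ≟ inj₁ b) (r ≟ inj₂ a) (r ≟ inj₂ b)
    where
    comm = reconnectBoth-comm a≢b matching
    turn : f₂ (mirror (mirror r)) ≡ mirror (f₂ (mirror r)) → f₂ (mirror r) ≡ mirror (f₂ r)
    turn e = mirror-move (sym (trans (cong f₂ (sym (mirror-mirror r))) e))
    swapped : ∀ s → Swapped.f₂ (mirror s) ≡ mirror (Swapped.f₂ s) → f₂ (mirror s) ≡ mirror (f₂ s)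
    swapped s e = trans (comm (mirror s)) (trans e (cong mirror (sym (comm s))))
    general : Apart a b r → Dec (f r ≡ inj₁ a) → Dec (f r ≡ inj₁ b) → Dec (f r ≡ inj₂ a) → Dec (f r ≡ inj₂ b) →
              f₂ (mirror r) ≡ mirror (f₂ r)
    general r# (yes e) _ _ _ = to-a-symmetric r# e
    general r# _ (yes e) _ _ = swapped r (Swapped.to-a-symmetric (apart-comm {a = a} {b} r#) e)
    general r# _ _ (yes e) _ = turn (to-a-symmetric (apart-mirror {a = a} {b} r#) (trans (symmetric r) (cong mirror e)))
    general r# _ _ _ (yes e) =
      turn (swapped (mirror r) (Swapped.to-a-symmetric (apart-comm {a = a} {b} (apart-mirror {a = a} {b} r#))
                                                       (trans (symmetric r) (cong mirror e))))
    general r# (no x) (no y) (no z) (no w) =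
      trans (untouched (apart-mirror {a = a} {b} r#) (subst (Apart a b) (sym (symmetric r)) (apart-mirror {a = a} {b} fr#)))
            (trans (symmetric r) (cong mirror (sym (untouched r# fr#))))
      where
      fr# : Apart a b (f r)
      fr# = (x , y) , (z , w)
    special : Dec (r ≡ inj₁ a) → Dec (r ≡ inj₁ b) → Dec (r ≡ inj₂ a) → Dec (r ≡ inj₂ b) →
              f₂ (mirror r) ≡ mirror (f₂ r)
    special (yes e) _ _ _ = trans (cong (f₂ ∘ mirror) e) (trans f₂a′ (cong mirror (sym (trans (cong f₂ e) f₂a))))
    special _ (yes e) _ _ = trans (cong (f₂ ∘ mirror) e) (trans f₂b′ (cong mirror (sym (trans (cong f₂ e) f₂b))))
    special _ _ (yes e) _ = trans (cong (f₂ ∘ mirror) e) (trans f₂a (cong mirror (sym (trans (cong f₂ e) f₂a′))))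
    special _ _ _ (yes e) = trans (cong (f₂ ∘ mirror) e) (trans f₂b (cong mirror (sym (trans (cong f₂ e) f₂b′))))
    special (no x) (no y) (no z) (no w) =
      general ((x , y) , (z , w)) (f r ≟ inj₁ a) (f r ≟ inj₁ b) (f r ≟ inj₂ a) (f r ≟ inj₂ b)

-- Symmetric drawings

sorted-allFin : ∀ m → AllPairs F._<_ (allFin m)
sorted-allFin m = AllPairs.tabulate⁺-< id

all-filterᵇ : {A : Set} (P : A → Bool) (xs : List A) → All (λ x → P x ≡ true) (filterᵇ P xs)
all-filterᵇ P [] = []
all-filterᵇ P (x ∷ xs) with P x in eq
... | true  = eq ∷ all-filterᵇ P xs
... | false = all-filterᵇ P xs

filterᵇ⁺ : {A : Set} {Q : A → Set} (P : A → Bool) {xs : List A} → All Q xs → All Q (filterᵇ P xs)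
filterᵇ⁺ P [] = []
filterᵇ⁺ P {x ∷ _} (q ∷ qs) with P x
... | true  = q ∷ filterᵇ⁺ P qs
... | false = filterᵇ⁺ P qs

filterᵇ-pairs : {A : Set} {_~_ : A → A → Set} (P : A → Bool) {xs : List A} →
                AllPairs _~_ xs → AllPairs _~_ (filterᵇ P xs)
filterᵇ-pairs P [] = []
filterᵇ-pairs P {x ∷ _} (q ∷ qs) with P x
... | true  = filterᵇ⁺ P q ∷ filterᵇ-pairs P qs
... | false = filterᵇ-pairs P qs

-- With `P` selecting the through slots this is adjacency among the wires: slots strictly between
-- `a` and `b` may carry arcs, which stay close to the sides of the rectangle.
Neighbours : (Fin m → Bool) → Fin m → Fin m → Set
Neighbours P a b = (a F.< b) × (P a ≡ true) × (P b ≡ true) × (∀ c → a F.< c → c F.< b → P c ≡ false)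

filterᵇ-head : ∀ (P : Fin m → Bool) {xs y ys} → AllPairs F._<_ xs → filterᵇ P xs ≡ y ∷ ys →
               ∀ {c} → c ∈ xs → c F.< y → P c ≡ false
filterᵇ-head P {x ∷ xs} (x< ∷ sorted) eq c∈ c<y with P x in Px
filterᵇ-head P {x ∷ xs} (x< ∷ sorted) refl (here refl) c<y | true  = contradiction c<y (ℕ.<-irrefl refl)
filterᵇ-head P {x ∷ xs} (x< ∷ sorted) refl (there c∈) c<y  | true  = contradiction c<y (ℕ.<-asym (All.lookup x< c∈))
filterᵇ-head P {x ∷ xs} (x< ∷ sorted) eq (here refl) c<y   | false = Px
filterᵇ-head P {x ∷ xs} (x< ∷ sorted) eq (there c∈) c<y    | false = filterᵇ-head P sorted eq c∈ c<y

∈-consecutive : ∀ {A : Set} {xs : List A} {a b} → (a , b) ∈ consecutive xs → a ∈ xs × b ∈ xs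
∈-consecutive {xs = x ∷ y ∷ xs} (here refl) = here refl , there (here refl)
∈-consecutive {xs = x ∷ y ∷ xs} (there i) with ∈-consecutive {xs = y ∷ xs} i
... | u , v = there u , there v

neighbours : ∀ (P : Fin m → Bool) {xs} → AllPairs F._<_ xs → ∀ {a b} → (a , b) ∈ consecutive (filterᵇ P xs) →
             a F.< b × P a ≡ true × P b ≡ true × (∀ {c} → c ∈ xs → a F.< c → c F.< b → P c ≡ false)
neighbours P {x ∷ xs} (x< ∷ sorted) i with P x in Px
neighbours P {x ∷ xs} (x< ∷ sorted) i | false with neighbours P sorted i
... | a<b , Pa , Pb , gap = a<b , Pa , Pb , λ { (here refl) _ _ → Px ; (there c∈) → gap c∈ }
neighbours P {x ∷ xs} (x< ∷ sorted) i | true with filterᵇ P xs in eq | filterᵇ⁺ P x< | all-filterᵇ P xs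
neighbours P {x ∷ xs} (x< ∷ sorted) (here refl) | true | y ∷ ys | x<y ∷ _ | Py ∷ _ =
  x<y , Px , Py , λ { (here refl) x<x _ → contradiction x<x (ℕ.<-irrefl refl)
                    ; (there c∈) _ c<y → filterᵇ-head P sorted eq c∈ c<y }
neighbours P {x ∷ xs} (x< ∷ sorted) (there i) | true | y ∷ ys | x<ys | _
  with neighbours P sorted (subst (λ zs → _ ∈ consecutive zs) (sym eq) i)
... | a<b , Pa , Pb , gap =
  a<b , Pa , Pb , λ { (here refl) a<x _ → contradiction a<x (ℕ.<-asym (All.lookup x<ys (proj₁ (∈-consecutive i))))
                    ; (there c∈) → gap c∈ }

∈-pairUp : ∀ {A : Set} {xs : List A} {p} → p ∈ pairUp xs → p ∈ consecutive xs
∈-pairUp {xs = x ∷ y ∷ xs} (here refl) = here refl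
∈-pairUp {xs = x ∷ y ∷ z ∷ xs} (there i) = there (there (∈-pairUp {xs = z ∷ xs} i))

slot : Point m → Fin m
slot = [ id , id ]

odd : Fin m → Bool
odd i = par (toℕ i)

module Layout {m} (ν : Point m → Point m) (C : SymmetricState (core ν)) where

  private module C = SymmetricState C

  th : Fin m → Bool
  th i = isRight (ν (inj₁ i))

  core-through : ∀ {i} → th i ≡ true → core ν (inj₁ i) ≡ inj₂ i
  core-through e rewrite e = refl

  core-arc : ∀ {i} → th i ≡ false → ∃[ j ] core ν (inj₁ i) ≡ inj₁ j × ν (inj₁ i) ≡ inj₁ j
  core-arc {i} e with ν (inj₁ i)
  ... | inj₁ j = j , refl , refl

  core-arc′ : ∀ {i} → th i ≡ false → ∃[ j ] core ν (inj₂ i) ≡ inj₂ j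
  core-arc′ {i} e with core-arc e
  ... | j , e′ , _ = j , trans (C.symmetric (inj₁ i)) (cong mirror e′)

  core-closed : ∀ p → th (slot p) ≡ false → th (slot (core ν p)) ≡ false
  core-closed p e with th (slot (core ν p)) in e′
  ... | false = refl
  ... | true with core ν p in eq
  ...   | inj₁ j = contradiction (trans (sym e) (trans (cong (th ∘ slot) (trans (sym (C.involutive p)) (trans (cong (core ν) eq) (core-through e′)))) e′)) λ ()
  ...   | inj₂ j = contradiction (trans (sym e) (trans (cong (th ∘ slot) (trans (sym (C.involutive p)) (trans (cong (core ν) eq) (trans (C.symmetric (inj₁ j)) (cong mirror (core-through e′)))))) e′)) λ ()

  -- Pieces are glued to through slots only, so every picture contains the arcs of `core ν`;
  -- planarity of each further gluing relies on it.
  KeepsArcs : (Point m → Point m) → Set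
  KeepsArcs f = ∀ p → th (slot p) ≡ false → f p ≡ core ν p

  through-closed : ∀ {f} → IsMatching f → KeepsArcs f → ∀ p → th (slot p) ≡ true → th (slot (f p)) ≡ true
  through-closed {f} (inv , _) arcs p e with th (slot (f p)) in e′
  ... | true = refl
  ... | false = contradiction (trans (sym e) (subst (λ q → th (slot q) ≡ false) (trans (sym (arcs (f p) e′)) (inv p)) (core-closed (f p) e′))) λ ()

  arc≢through : ∀ {p q} → th (slot p) ≡ false → th (slot q) ≡ true → p ≢ q
  arc≢through e e′ refl = contradiction (trans (sym e) e′) λ ()

  -- Slot `a` holds a horizontal strand of `core ν`, and by planarity an arc has both ends on the
  -- same side of it.
  left-arc-side : ∀ {a} z → th a ≡ true → th (slot z) ≡ false → lt (inj₁ a) z ≡ lt (inj₁ a) (core ν z)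
  left-arc-side {a} (inj₂ c) e e′ with core-arc′ e′
  ... | d , e″ rewrite e″ = trans (lt-left-right a c) (sym (lt-left-right a d))
  left-arc-side {a} (inj₁ c) e e′ with core-arc e′ | C.planar (inj₁ a) (inj₁ c) (arc≢through e′ e) (λ q → arc≢through e′ e (trans q (core-through e)))
  ... | d , e″ , _ | D rewrite core-through e | e″ | lt-right-left a c | lt-right-left a d
    | xor-identityʳ (lt (inj₁ a) (inj₁ c)) | xor-identityʳ (lt (inj₁ a) (inj₁ d)) = D

  right-arc-side : ∀ {a} z → th a ≡ true → th (slot z) ≡ false → lt (inj₂ a) z ≡ lt (inj₂ a) (core ν z)
  right-arc-side {a} (inj₁ c) e e′ with core-arc e′
  ... | d , e″ , _ rewrite e″ = trans (lt-right-left a c) (sym (lt-right-left a d))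
  right-arc-side {a} (inj₂ c) e e′ with core-arc′ e′ | C.planar (inj₁ a) (inj₂ c) (arc≢through e′ e) (λ q → arc≢through e′ e (trans q (core-through e)))
  ... | d , e″ | D rewrite core-through e | e″ | lt-left-right a c | lt-left-right a d = 𝔹.not-injective D

  left-through-side : ∀ {a b} z → Neighbours th a b → th (slot z) ≡ true → z ≢ inj₁ a → z ≢ inj₁ b →
                      lt (inj₁ a) z xor lt (inj₁ b) z ≡ false
  left-through-side {a} {b} (inj₂ c) _ _ _ _ rewrite lt-left-right a c | lt-left-right b c = refl
  left-through-side {a} {b} (inj₁ c) (a<b , _ , _ , gap) e c≢a c≢b
    rewrite lt-left-left a c | lt-left-left b c with ℕ.<-cmp (toℕ a) (toℕ c) | ℕ.<-cmp (toℕ b) (toℕ c)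
  ... | tri≈ _ e′ _ | _ = contradiction (cong inj₁ (sym (F.toℕ-injective e′))) c≢a
  ... | _ | tri≈ _ e′ _ = contradiction (cong inj₁ (sym (F.toℕ-injective e′))) c≢b
  ... | tri< a<c _ _ | tri< b<c _ _ rewrite <⇒lt a<c | <⇒lt b<c = refl
  ... | tri< a<c _ _ | tri> _ _ c<b = contradiction (trans (sym e) (gap c a<c c<b)) λ ()
  ... | tri> a≮c _ c<a | tri< b<c _ _ = contradiction (ℕ.<-trans (ℕ.<-trans a<b b<c) c<a) (ℕ.<-irrefl refl)
  ... | tri> a≮c _ _ | tri> b≮c _ _ rewrite ≮⇒lt a≮c | ≮⇒lt b≮c = refl

  right-through-side : ∀ {a b} z → Neighbours th a b → th (slot z) ≡ true → z ≢ inj₂ a → z ≢ inj₂ b →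
                       lt (inj₂ a) z xor lt (inj₂ b) z ≡ false
  right-through-side {a} {b} (inj₁ c) _ _ _ _ rewrite lt-right-left a c | lt-right-left b c = refl
  right-through-side {a} {b} (inj₂ c) (a<b , _ , _ , gap) e c≢a c≢b
    rewrite lt-right-right a c | lt-right-right b c with ℕ.<-cmp (toℕ a) (toℕ c) | ℕ.<-cmp (toℕ b) (toℕ c)
  ... | tri≈ _ e′ _ | _ = contradiction (cong inj₂ (sym (F.toℕ-injective e′))) c≢a
  ... | _ | tri≈ _ e′ _ = contradiction (cong inj₂ (sym (F.toℕ-injective e′))) c≢b
  ... | tri< _ _ c≮a | tri< _ _ c≮b rewrite ≮⇒lt c≮a | ≮⇒lt c≮b = refl
  ... | tri< a<c _ _ | tri> _ _ c<b = contradiction (trans (sym e) (gap c a<c c<b)) λ ()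
  ... | tri> a≮c _ c<a | tri< b<c _ _ = contradiction (ℕ.<-trans (ℕ.<-trans a<b b<c) c<a) (ℕ.<-irrefl refl)
  ... | tri> _ _ c<a | tri> _ _ c<b rewrite <⇒lt c<a | <⇒lt c<b = refl

  module _ (side : Fin m → Point m) (slot-side : ∀ i → slot (side i) ≡ i) {a b : Fin m} (ta : th a ≡ true) (tb : th b ≡ true)
           (arc-side : ∀ {a} z → th a ≡ true → th (slot z) ≡ false → lt (side a) z ≡ lt (side a) (core ν z))
           (through-side : ∀ z → th (slot z) ≡ true → z ≢ side a → z ≢ side b → lt (side a) z xor lt (side b) z ≡ false) where

    private
      through-a : th (slot (side a)) ≡ true
      through-a = trans (cong th (slot-side a)) ta
      through-b : th (slot (side b)) ≡ true
      through-b = trans (cong th (slot-side b)) tb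

    accessible : ∀ {f} → IsMatching f → KeepsArcs f → Accessible (side a) (side b) f
    accessible {f} M arcs z z≢a z≢b with th (slot z) in e
    ... | true = (λ fz≢a fz≢b → trans (through-side z e z≢a z≢b)
                   (sym (through-side (f z) (through-closed M arcs z e) fz≢a fz≢b))) , λ _ → through-side z e z≢a z≢b
    ... | false = (λ _ _ → short) , [ (λ e′ → contradiction e′ (arc≢through fz through-a)) , (λ e′ → contradiction e′ (arc≢through fz through-b)) ]
      where
      fz : th (slot (f z)) ≡ false
      fz = subst (λ q → th (slot q) ≡ false) (sym (arcs z e)) (core-closed z e)
      short : Disjoint (side a) (side b) z (f z)
      short rewrite arcs z e = cong₂ _xor_ (arc-side z ta e) (arc-side z tb e)

    reconnect-keepsArcs : ∀ {f} → KeepsArcs f → KeepsArcs (reconnect (side a) (side b) f)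
    reconnect-keepsArcs {f} arcs p e = trans
      (reconnect-other (side a) (side b) f (arc≢through e through-a) (arc≢through e through-b)
        (arc≢through fp through-a) (arc≢through fp through-b)) (arcs p e)
      where
      fp : th (slot (f p)) ≡ false
      fp = subst (λ q → th (slot q) ≡ false) (sym (arcs p e)) (core-closed p e)

  record State (f : Point m → Point m) : Set where
    constructor _,_
    field
      symmetricState : SymmetricState f
      keepsArcs      : KeepsArcs f
    open SymmetricState symmetricState public

  core-state : State (core ν)
  core-state = C , λ _ _ → refl

  neighbours-≢ : ∀ {a b} → Neighbours th a b → a ≢ b
  neighbours-≢ (a<b , _) refl = ℕ.<-irrefl refl a<b

  glue-planar : ∀ {a b f} → Neighbours th a b → IsMatching f → KeepsArcs f → Planar f →
                Planar (reconnect (inj₁ a) (inj₁ b) f)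
  glue-planar N@(_ , ta , tb , _) M arcs = reconnect-planar (neighbours-≢ N ∘ inj₁-injective) M
    (accessible inj₁ (λ _ → refl) ta tb left-arc-side (λ z → left-through-side z N) M arcs)

  glue-keepsArcs : ∀ {a b f} → Neighbours th a b → KeepsArcs f → KeepsArcs (reconnect (inj₁ a) (inj₁ b) f)
  glue-keepsArcs N@(_ , ta , tb , _) = reconnect-keepsArcs inj₁ (λ _ → refl) ta tb left-arc-side (λ z → left-through-side z N)

  -- Gluing ")(" to `core ν` at `a` and `b` keeps it planar and creates an edge between them, so
  -- `edge-parity` applies. Geometrically, the slots between two neighbouring wires are filled with
  -- complete arcs.
  neighbours-parity : ∀ {a b} → Neighbours th a b → odd b ≡ not (odd a)
  neighbours-parity {a} {b} N = begin
    par (toℕ b)                  ≡⟨ cong par (pos-left b) ⟨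
    par (pos (inj₁ b))           ≡⟨ cong (par ∘ pos) (reconnect-p (inj₁ a) (inj₁ b) (core ν)) ⟨
    par (pos (reconnect (inj₁ a) (inj₁ b) (core ν) (inj₁ a)))
      ≡⟨ edge-parity (reconnect-matching (neighbours-≢ N ∘ inj₁-injective) C.matching)
                     (glue-planar N C.matching (λ _ _ → refl) C.planar) (inj₁ a) ⟩
    not (par (pos (inj₁ a)))     ≡⟨ cong (not ∘ par) (pos-left a) ⟩
    not (par (toℕ a))            ∎
    where open ≡-Reasoning

  module _ {a b} (N : Neighbours th a b) {f} (St : State f) where

    private
      module St = State St
      a≢b = neighbours-≢ N
      ta = proj₁ (proj₂ N)
      tb = proj₁ (proj₂ (proj₂ N))
      module B = Both St.symmetricState a≢b
      planar₁ = glue-planar N St.matching St.keepsArcs St.planar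
      keepsArcs₁ = glue-keepsArcs {f = f} N St.keepsArcs

    glueBoth-state : State (reconnectBoth a b f)
    glueBoth-state = state B.matching₂
      (reconnect-planar B.a≢b₂ B.matching₁
        (accessible inj₂ (λ _ → refl) ta tb right-arc-side (λ z → right-through-side z N) B.matching₁ keepsArcs₁) planar₁)
      (reconnectBoth-symmetric St.symmetricState a≢b) ,
      reconnect-keepsArcs inj₂ (λ _ → refl) ta tb right-arc-side (λ z → right-through-side z N) keepsArcs₁

    module _ (fa : f (inj₁ a) ≡ inj₂ a) (fb : f (inj₁ b) ≡ inj₂ b) where

      glue-axis : B.f₁ (inj₂ a) ≡ inj₂ b
      glue-axis = trans (reconnect-to-p (inj₁ a) (inj₁ b) f {inj₂ a} inj₂≢inj₁ inj₂≢inj₁ (trans (St.symmetric (inj₁ a)) (cong mirror fa))) fb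

      -- On the axis a single piece is glued, whereas `reconnectBoth-symmetric` speaks of mirror
      -- pairs. As both strands are horizontal, the left piece already joins the two right ends, and
      -- a right piece would only close a loop.
      reconnectBoth-axis : reconnectBoth a b f ≗ B.f₁
      reconnectBoth-axis = reconnect-loop B.matching₁ glue-axis

      glue-axis-state : State B.f₁
      glue-axis-state = state B.matching₁ planar₁
        (λ p → trans (sym (reconnectBoth-axis (mirror p)))
                     (trans (reconnectBoth-symmetric St.symmetricState a≢b p) (cong mirror (reconnectBoth-axis p)))) ,
        keepsArcs₁

-- Colourings

decide : {A B : Set} → (A → B) → (B → A) → (a? : Dec A) (b? : Dec B) → does a? ≡ does b?
decide to from (yes a) b? = sym (dec-true b? (to a))
decide to from (no ¬a) b? = sym (dec-false b? (¬a ∘ from))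

Constant : (Point m → Point m) → (Point m → Bool) → Set
Constant f ε = ∀ p → ε (f p) ≡ ε p

constant? : (f : Point m → Point m) (ε : Point m → Bool) → Dec (Constant f ε)
constant? f ε = allPoints? λ p → ε (f p) 𝔹.≟ ε p

constant : (Point m → Point m) → (Point m → Bool) → Bool
constant f ε = does (constant? f ε)

constant-cong : ∀ {f g : Point m → Point m} {ε ζ} → f ≗ g → ε ≗ ζ → constant f ε ≡ constant g ζ
constant-cong {f = f} {g} {ε} {ζ} f≗g ε≗ζ = decide
  (λ c p → trans (sym (trans (cong ε (f≗g p)) (ε≗ζ (g p)))) (trans (c p) (ε≗ζ p)))
  (λ c p → trans (trans (cong ε (f≗g p)) (ε≗ζ (g p))) (trans (c p) (sym (ε≗ζ p))))
  (constant? f ε) (constant? g ζ)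

nonconstant : ∀ {f : Point m → Point m} {ε} p → ε (f p) ≢ ε p → constant f ε ≡ false
nonconstant {f = f} {ε} p ne = dec-false (constant? f ε) λ c → ne (c p)

⟦_⟧ : Bool → ℤ
⟦ true  ⟧ = 1ℤ
⟦ false ⟧ = 0ℤ

pow2 : ℕ → ℤ
pow2 zero    = 1ℤ
pow2 (suc k) = + 2 ℤ.* pow2 k

toggle : (p q : Point m) → (Point m → Bool) → Point m → Bool
toggle p q ε r = ε r xor (does (r ≟ p) ∨ does (r ≟ q))

toggle-p : ∀ (p q : Point m) ε → toggle p q ε p ≡ not (ε p)
toggle-p p q ε rewrite dec-true (p ≟ p) refl = xor-comm (ε p) true

toggle-q : ∀ (p q : Point m) ε → toggle p q ε q ≡ not (ε q)
toggle-q p q ε rewrite dec-true (q ≟ q) refl | 𝔹.∨-zeroʳ (does (q ≟ p)) = xor-comm (ε q) true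

toggle-other : ∀ (p q : Point m) ε {r} → r ≢ p → r ≢ q → toggle p q ε r ≡ ε r
toggle-other p q ε {r} r≢p r≢q rewrite dec-false (r ≟ p) r≢p | dec-false (r ≟ q) r≢q = xor-identityʳ (ε r)

toggle-edge : ∀ {f : Point m → Point m} {p q} ε → IsMatching f → f p ≡ q → constant f (toggle p q ε) ≡ constant f ε
toggle-edge {f = f} {p} {q} ε M@(inv , _) fp≡q = decide to from (constant? f (toggle p q ε)) (constant? f ε)
  where
  fq≡p : f q ≡ p
  fq≡p = trans (cong f (sym fp≡q)) (inv p)
  same : ∀ r → (does (f r ≟ p) ∨ does (f r ≟ q)) ≡ (does (r ≟ p) ∨ does (r ≟ q))
  same r = trans (𝔹.∨-comm (does (f r ≟ p)) _) (cong₂ _∨_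
    (decide (λ e → matching-injective M (trans e (sym fp≡q))) (λ e → trans (cong f e) fp≡q) (f r ≟ q) (r ≟ p))
    (decide (λ e → matching-injective M (trans e (sym fq≡p))) (λ e → trans (cong f e) fq≡p) (f r ≟ p) (r ≟ q)))
  xor-cancelʳ : ∀ a b c → a xor c ≡ b xor c → a ≡ b
  xor-cancelʳ a b false e = trans (sym (xor-identityʳ a)) (trans e (xor-identityʳ b))
  xor-cancelʳ true true true _ = refl
  xor-cancelʳ false false true _ = refl
  to : Constant f (toggle p q ε) → Constant f ε
  to c r = xor-cancelʳ _ _ _ (trans (cong (ε (f r) xor_) (sym (same r))) (c r))
  from : Constant f ε → Constant f (toggle p q ε)
  from c r = cong₂ _xor_ (c r) (same r)

reconnect-constant : ∀ {f : Point m → Point m} {p q} ε → IsMatching f → ε p ≡ ε q → ε (f p) ≡ ε p → ε (f q) ≡ ε q →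
                     constant f ε ≡ constant (reconnect p q f) ε
reconnect-constant {f = f} {p} {q} ε (inv , _) εp≡εq εfp εfq = decide to from (constant? f ε) (constant? (reconnect p q f) ε)
  where
  back : ∀ {r s} → f r ≡ s → r ≡ f s
  back e = trans (sym (inv _)) (cong f e)
  to : Constant f ε → Constant (reconnect p q f) ε
  to c r with reconnect p q f r | reconnected p q f r
  ... | _ | at-p refl = sym εp≡εq
  ... | _ | at-q _ refl = εp≡εq
  ... | _ | to-p _ _ e = trans εfq (trans (sym εp≡εq) (trans (sym εfp) (cong ε (sym (back e)))))
  ... | _ | to-q _ _ _ e = trans εfp (trans εp≡εq (trans (sym εfq) (cong ε (sym (back e)))))
  ... | _ | other _ _ _ _ = c r
  from : Constant (reconnect p q f) ε → Constant f ε
  from c r with reconnect p q f r | reconnected p q f r | c r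
  ... | _ | at-p refl | _ = εfp
  ... | _ | at-q _ refl | _ = εfq
  ... | _ | to-p _ _ e | _ = trans (cong ε e) (trans (sym εfp) (cong ε (sym (back e))))
  ... | _ | to-q _ _ _ e | _ = trans (cong ε e) (trans (sym εfq) (cong ε (sym (back e))))
  ... | _ | other _ _ _ _ | cr = cr

-- Gluing sums over the common colour of the two glued ends, and `ε` and `toggle p q ε` offer the
-- two choices. If a loop is closed both choices count equally, whence the factor 2; otherwise only
-- the colour of `f p` can occur, and only if it is also that of `f q`.
reconnect-colour : ∀ {f : Point m → Point m} {p q} ε → IsMatching f → p ≢ q → ε p ≡ ε q →
                   ⟦ constant f ε ⟧ ℤ.+ ⟦ constant f (toggle p q ε) ⟧ ≡ pow2 (loop p q f) ℤ.* ⟦ constant (reconnect p q f) ε ⟧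
reconnect-colour {f = f} {p} {q} ε M@(inv , nofix) p≢q εp≡εq with f p ≟ q
... | yes fp≡q = trans (cong (λ x → ⟦ constant f ε ⟧ ℤ.+ ⟦ x ⟧) (toggle-edge ε M fp≡q))
  (trans (double ⟦ constant f ε ⟧)
    (cong (λ x → (+ 2 ℤ.* 1ℤ) ℤ.* ⟦ x ⟧) (sym (constant-cong {ε = ε} (reconnect-loop M fp≡q) (λ _ → refl)))))
  where
  double : ∀ x → x ℤ.+ x ≡ (+ 2 ℤ.* 1ℤ) ℤ.* x
  double = solve-∀
... | no fp≢q = trans (cases (ε (f p) 𝔹.≟ ε p) (ε (f q) 𝔹.≟ ε q)) (sym (ℤ.*-identityˡ _))
  where
  fq≢p : f q ≢ p
  fq≢p e = fp≢q (trans (cong f (sym e)) (inv q))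
  ε′ = toggle p q ε
  ε′fp : ε′ (f p) ≡ ε (f p)
  ε′fp = toggle-other p q ε (nofix p) fp≢q
  ε′fq : ε′ (f q) ≡ ε (f q)
  ε′fq = toggle-other p q ε fq≢p (nofix q)
  g = reconnect p q f
  gp≡q : g p ≡ q
  gp≡q = reconnect-p p q f
  gfp : g (f p) ≡ f q
  gfp = reconnect-to-p p q f (nofix p) fp≢q (inv p)
  M′ : IsMatching g
  M′ = reconnect-matching p≢q M
  cases : Dec (ε (f p) ≡ ε p) → Dec (ε (f q) ≡ ε q) → ⟦ constant f ε ⟧ ℤ.+ ⟦ constant f ε′ ⟧ ≡ ⟦ constant g ε ⟧
  add : ∀ {x y x′ y′ z} → x ≡ x′ → y ≡ y′ → ⟦ x′ ⟧ ℤ.+ ⟦ y′ ⟧ ≡ z → ⟦ x ⟧ ℤ.+ ⟦ y ⟧ ≡ z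
  add refl refl e = e
  toggled-p : ε (f p) ≡ ε p → constant f ε′ ≡ false
  toggled-p e = nonconstant {f = f} {ε′} p λ e″ → 𝔹.not-¬ {ε p} refl (trans (sym e) (trans (sym ε′fp) (trans e″ (toggle-p p q ε))))
  toggled-q : ε (f q) ≡ ε q → constant f ε′ ≡ false
  toggled-q e = nonconstant {f = f} {ε′} q λ e″ → 𝔹.not-¬ {ε q} refl (trans (sym e) (trans (sym ε′fq) (trans e″ (toggle-q p q ε))))
  cases (yes e) (yes e′) = add (reconnect-constant ε M εp≡εq e e′) (toggled-p e) (ℤ.+-identityʳ _)
  cases (no e) (no e′) = add (nonconstant {f = f} {ε} p e)
    (trans (reconnect-constant {f = f} {p} {q} ε′ M
              (trans (toggle-p p q ε) (trans (cong not εp≡εq) (sym (toggle-q p q ε))))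
              (trans ε′fp (trans (𝔹.¬-not e) (sym (toggle-p p q ε))))
              (trans ε′fq (trans (𝔹.¬-not e′) (sym (toggle-q p q ε)))))
           (toggle-edge ε M′ gp≡q))
    (ℤ.+-identityˡ _)
  cases (yes e) (no e′) = add (nonconstant {f = f} {ε} q e′) (toggled-p e)
    (cong ⟦_⟧ (sym (nonconstant {f = g} {ε} (f p) (λ e″ → e′ (trans (cong ε (sym gfp)) (trans e″ (trans e εp≡εq)))))))
  cases (no e) (yes e′) = add (nonconstant {f = f} {ε} p e) (toggled-q e′)
    (cong ⟦_⟧ (sym (nonconstant {f = g} {ε} (f p) (λ e″ → e (trans (sym e″) (trans (cong ε gfp) (trans e′ (sym εp≡εq))))))))

reconnect-unbalanced : ∀ {f : Point m → Point m} {p q} ε → ε p ≢ ε q → constant (reconnect p q f) ε ≡ false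
reconnect-unbalanced {f = f} {p} {q} ε ne =
  nonconstant {f = reconnect p q f} {ε} p λ e → ne (trans (sym e) (cong ε (reconnect-p p q f)))

toggleᶠ : (a b : Fin m) → (Fin m → Bool) → Fin m → Bool
toggleᶠ a b ε i = ε i xor (does (i F.≟ a) ∨ does (i F.≟ b))

toggle-left : ∀ (a b : Fin m) (ε ρ : Fin m → Bool) → toggle (inj₁ a) (inj₁ b) [ ε , ρ ] ≗ [ toggleᶠ a b ε , ρ ]
toggle-left a b ε ρ (inj₁ i) = refl
toggle-left a b ε ρ (inj₂ i) = xor-identityʳ (ρ i)

-- The operator of the piece ")(" at a and b on functions of colourings.
cupcap : (a b : Fin m) → ((Fin m → Bool) → ℤ) → (Fin m → Bool) → ℤ
cupcap a b φ ε = if does (ε a 𝔹.≟ ε b) then φ ε ℤ.+ φ (toggleᶠ a b ε) else 0ℤ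

glue-colour : ∀ {f : Point m → Point m} {a b} (ρ : Fin m → Bool) ε → IsMatching f → a ≢ b →
              pow2 (loop (inj₁ a) (inj₁ b) f) ℤ.* ⟦ constant (reconnect (inj₁ a) (inj₁ b) f) [ ε , ρ ] ⟧ ≡
              cupcap a b (λ ζ → ⟦ constant f [ ζ , ρ ] ⟧) ε
glue-colour {f = f} {a} {b} ρ ε M a≢b with ε a 𝔹.≟ ε b
... | yes e = trans (sym (reconnect-colour [ ε , ρ ] M (a≢b ∘ inj₁-injective) e))
                    (cong (λ x → ⟦ constant f [ ε , ρ ] ⟧ ℤ.+ ⟦ x ⟧) (constant-cong {f = f} (λ _ → refl) (toggle-left a b ε ρ)))
... | no ne = trans (cong (λ x → pow2 (loop (inj₁ a) (inj₁ b) f) ℤ.* ⟦ x ⟧) (reconnect-unbalanced {f = f} {inj₁ a} {inj₁ b} [ ε , ρ ] ne))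
                    (ℤ.*-zeroʳ (pow2 (loop (inj₁ a) (inj₁ b) f)))

-- Horizontal edges and the scale of a symmetric picture

module ℕ∑ = MonoidSum ℕ.+-0-commutativeMonoid

bit : Bool → ℕ
bit b = if b then 1 else 0

horizontalAt : (Point m → Point m) → Fin m → ℕ
horizontalAt f i = bit (isRight (f (inj₁ i)))

horizontalEdges : (Point m → Point m) → ℕ
horizontalEdges f = ℕ∑.sum (horizontalAt f)

-- Two horizontal edges can be joined by a vertical piece at the price of a
-- loop, so that in the scale 2 ^ (half their number) this piece acts on
-- colourings like any other.
scale : (Point m → Point m) → ℤ
scale f = pow2 ⌊ horizontalEdges f /2⌋

scale-cong : {f g : Point m → Point m} → f ≗ g → scale f ≡ scale g
scale-cong f≗g = cong (λ k → pow2 ⌊ k /2⌋) (ℕ∑.sum-cong-≗ λ i → cong (bit ∘ isRight) (f≗g (inj₁ i)))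

ℕ∑-single : (a : Fin n) (v : ℕ) → ℕ∑.sum (λ i → if does (i F.≟ a) then v else 0) ≡ v
ℕ∑-single {suc n} zero v = trans (cong (v ℕ.+_) (ℕ∑.sum-replicate-zero n)) (ℕ.+-identityʳ v)
ℕ∑-single (suc a) v = ℕ∑-single a v

⊕-single : (a : Fin n) (v : Bool) → ⊕.sum (λ i → if does (i F.≟ a) then v else false) ≡ v
⊕-single {suc n} zero v = trans (cong (v xor_) (⊕.sum-replicate-zero n)) (xor-identityʳ v)
⊕-single (suc a) v = ⊕-single a v

transpose-a : (a b : Fin n) → transpose a b a ≡ b
transpose-a a b rewrite dec-true (a F.≟ a) refl = refl

transpose-b : (a b : Fin n) → transpose a b b ≡ a
transpose-b a b with b F.≟ a
... | yes b≡a = b≡a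
... | no _ rewrite dec-true (b F.≟ b) refl = refl

transpose-other : (a b : Fin n) {i : Fin n} → i ≢ a → i ≢ b → transpose a b i ≡ i
transpose-other a b {i} i≢a i≢b rewrite dec-false (i F.≟ a) i≢a | dec-false (i F.≟ b) i≢b = refl

transpose-involutive : (a b : Fin n) → ∀ i → transpose a b (transpose a b i) ≡ i
transpose-involutive a b i with i F.≟ a
... | yes refl = transpose-b i b
... | no i≢a with i F.≟ b
...   | yes refl = transpose-a a i
...   | no i≢b = transpose-other a b i≢a i≢b

module _ {f : Point m → Point m} (F : SymmetricState f) {a b : Fin m} (a≢b : a ≢ b) where

  open SymmetricState F
  open Both F a≢b
  private module Swapped = Both F (a≢b ∘ sym)

  horizontalEdges-axis : f (inj₁ a) ≡ inj₂ a → f (inj₁ b) ≡ inj₂ b → horizontalEdges f ≡ 2 ℕ.+ horizontalEdges f₁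
  horizontalEdges-axis fa fb = begin
    ℕ∑.sum (horizontalAt f)                                   ≡⟨ ℕ∑.sum-cong-≗ (λ i → pointwise i (i F.≟ a) (i F.≟ b)) ⟩
    ℕ∑.sum (λ i → δ a i ℕ.+ (δ b i ℕ.+ horizontalAt f₁ i))    ≡⟨ ℕ∑.∑-distrib-+ (δ a) _ ⟩
    ℕ∑.sum (δ a) ℕ.+ ℕ∑.sum (λ i → δ b i ℕ.+ horizontalAt f₁ i) ≡⟨ cong₂ ℕ._+_ (ℕ∑-single a 1) (ℕ∑.∑-distrib-+ (δ b) _) ⟩
    1 ℕ.+ (ℕ∑.sum (δ b) ℕ.+ horizontalEdges f₁)               ≡⟨ cong (λ k → 1 ℕ.+ (k ℕ.+ horizontalEdges f₁)) (ℕ∑-single b 1) ⟩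
    2 ℕ.+ horizontalEdges f₁                                  ∎
    where
    open ≡-Reasoning
    δ : Fin m → Fin m → ℕ
    δ c i = if does (i F.≟ c) then 1 else 0
    δ-at : ∀ {c i} → i ≡ c → δ c i ≡ 1
    δ-at {c} {i} e = cong bit (dec-true (i F.≟ c) e)
    δ-off : ∀ {c i} → i ≢ c → δ c i ≡ 0
    δ-off {c} {i} e = cong bit (dec-false (i F.≟ c) e)
    right : ∀ {p c} → p ≡ inj₂ {A = Fin m} c → bit (isRight p) ≡ 1
    right refl = refl
    left : ∀ {p c} → p ≡ inj₁ {B = Fin m} c → bit (isRight p) ≡ 0
    left refl = refl
    pointwise : ∀ i → Dec (i ≡ a) → Dec (i ≡ b) → horizontalAt f i ≡ δ a i ℕ.+ (δ b i ℕ.+ horizontalAt f₁ i)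
    pointwise i (yes e) _ =
      trans (right (trans (cong (f ∘ inj₁) e) fa))
            (sym (cong₂ ℕ._+_ (δ-at e) (cong₂ ℕ._+_ (δ-off (a≢b ∘ trans (sym e))) (left (trans (cong (f₁ ∘ inj₁) e) f₁a)))))
    pointwise i (no ne) (yes e) =
      trans (right (trans (cong (f ∘ inj₁) e) fb))
            (sym (cong₂ ℕ._+_ (δ-off ne) (cong₂ ℕ._+_ (δ-at e) (left (trans (cong (f₁ ∘ inj₁) e) f₁b)))))
    pointwise i (no ne) (no ne′) =
      sym (cong₂ ℕ._+_ (δ-off ne) (cong₂ ℕ._+_ (δ-off ne′) (cong (bit ∘ isRight)
        (f₁-other {inj₁ i} (ne ∘ inj₁-injective) (ne′ ∘ inj₁-injective)
          (λ e → inj₁≢inj₂ (trans (trans (sym (involutive (inj₁ i))) (cong f e)) fa))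
          (λ e → inj₁≢inj₂ (trans (trans (sym (involutive (inj₁ i))) (cong f e)) fb))))))

  -- Gluing gives `a` the arc to `b` and passes the former edge of `a` on to `c`, so `c` becomes
  -- horizontal exactly if `a` was. The count is then reindexed by the transposition of `a` and `c`.
  horizontalEdges-vertical : ∀ {c} → f (inj₁ b) ≡ inj₁ c → c ≢ a → horizontalEdges f₂ ≡ horizontalEdges f
  horizontalEdges-vertical {c} fb c≢a =
    trans (ℕ∑.sum-cong-≗ λ i → cong bit (pointwise i (i F.≟ a) (i F.≟ b) (i F.≟ c)))
          (sym (ℕ∑.sum-permute (horizontalAt f) (Perm.transpose a c)))
    where
    h h₂ : Fin m → Bool
    h i = isRight (f (inj₁ i))
    h₂ i = isRight (f₂ (inj₁ i))
    fc : f (inj₁ c) ≡ inj₁ b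
    fc = trans (cong f (sym fb)) (involutive (inj₁ b))
    c≢b : c ≢ b
    c≢b e = noFix (inj₁ b) (trans fb (cong inj₁ e))
    apart : ∀ {i} → i ≢ a → i ≢ b → Apart a b (inj₁ i)
    apart x y = (x ∘ inj₁-injective , y ∘ inj₁-injective) , (inj₁≢inj₂ , inj₁≢inj₂)
    left : ∀ {p c} → p ≡ inj₁ {B = Fin m} c → isRight p ≡ false
    left refl = refl
    right : ∀ {p c} → p ≡ inj₂ {A = Fin m} c → isRight p ≡ true
    right refl = refl
    at-c : Dec (f (inj₁ a) ≡ inj₂ a) → h₂ c ≡ h a
    at-c (yes e) = trans (right (trans (reconnectBoth-comm a≢b matching (inj₁ c))
      (proj₁ (Swapped.to-a-horizontal (apart-comm {a = a} {b} {inj₁ c} (apart c≢a c≢b)) fc e)))) (sym (right e))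
    at-c (no ne) = cong isRight (trans (reconnectBoth-comm a≢b matching (inj₁ c))
      (proj₁ (Swapped.to-a-vertical (apart-comm {a = a} {b} {inj₁ c} (apart c≢a c≢b)) fc ne)))
    elsewhere : ∀ {i} → i ≢ a → i ≢ b → i ≢ c → Dec (f (inj₁ i) ≡ inj₁ a) → h₂ i ≡ h i
    elsewhere {i} x y z (yes e) = trans (left (trans (proj₁ (to-a-vertical (apart x y) e (inj₁≢inj₂ ∘ trans (sym fb)))) fb)) (sym (left e))
    elsewhere {i} x y z (no ne) = cong isRight (untouched (apart x y)
      ((ne , λ e → z (inj₁-injective (trans (sym (involutive (inj₁ i))) (trans (cong f e) fb))))
      , (x ∘ level , y ∘ level)))
    pointwise : ∀ i → Dec (i ≡ a) → Dec (i ≡ b) → Dec (i ≡ c) → h₂ i ≡ h (transpose a c i)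
    pointwise i (yes refl) _ _ = trans (left f₂a) (sym (trans (cong h (transpose-a i c)) (left fc)))
    pointwise i _ (yes refl) _ = trans (left f₂b) (sym (trans (cong h (transpose-other a c (a≢b ∘ sym) (c≢b ∘ sym))) (left fb)))
    pointwise i _ _ (yes refl) = trans (at-c (f (inj₁ a) ≟ inj₂ a)) (cong h (sym (transpose-b a i)))
    pointwise i (no x) (no y) (no z) = trans (elsewhere x y z (f (inj₁ i) ≟ inj₁ a)) (cong h (sym (transpose-other a c x z)))

-- Sums over lists

module Sums {c ℓ} (R : CommutativeRing c ℓ) where

  open CommutativeRing R
    renaming (refl to ≈-refl; sym to ≈-sym; trans to ≈-trans)
  open Pfaffinants R
  open import Relation.Binary.Reasoning.Setoid setoid
  open import Algebra.Properties.CommutativeSemigroup +-commutativeSemigroup using (interchange)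

  private
    variable
      A B D : Set

  ∑-cong-All : {xs : List A} {f g : A → Carrier} → All (λ x → f x ≈ g x) xs → ∑ xs f ≈ ∑ xs g
  ∑-cong-All []       = ≈-refl
  ∑-cong-All (e ∷ es) = +-cong e (∑-cong-All es)

  ∑-cong : (xs : List A) {f g : A → Carrier} → (∀ x → f x ≈ g x) → ∑ xs f ≈ ∑ xs g
  ∑-cong xs e = ∑-cong-All (All.universal e xs)

  ∑-zero : (xs : List A) → ∑ xs (λ _ → 0#) ≈ 0#
  ∑-zero []       = ≈-refl
  ∑-zero (x ∷ xs) = ≈-trans (+-identityˡ _) (∑-zero xs)

  ∑-++ : (xs ys : List A) {f : A → Carrier} → ∑ (xs ++ ys) f ≈ ∑ xs f + ∑ ys f
  ∑-++ []       ys = ≈-sym (+-identityˡ _)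
  ∑-++ (x ∷ xs) ys = ≈-trans (+-congˡ (∑-++ xs ys)) (≈-sym (+-assoc _ _ _))

  ∑-map : (h : A → B) (xs : List A) {f : B → Carrier} → ∑ (map h xs) f ≈ ∑ xs (f ∘ h)
  ∑-map h []       = ≈-refl
  ∑-map h (x ∷ xs) = +-congˡ (∑-map h xs)

  ∑-+ : (xs : List A) {f g : A → Carrier} → ∑ xs (λ x → f x + g x) ≈ ∑ xs f + ∑ xs g
  ∑-+ []       = ≈-sym (+-identityˡ _)
  ∑-+ (x ∷ xs) = ≈-trans (+-congˡ (∑-+ xs)) (interchange _ _ _ _)

  ∑-*ˡ : (k : Carrier) (xs : List A) {f : A → Carrier} → k * ∑ xs f ≈ ∑ xs (λ x → k * f x)
  ∑-*ˡ k []       = zeroʳ k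
  ∑-*ˡ k (x ∷ xs) = ≈-trans (distribˡ _ _ _) (+-congˡ (∑-*ˡ k xs))

  ∑-*ʳ : (k : Carrier) (xs : List A) {f : A → Carrier} → ∑ xs f * k ≈ ∑ xs (λ x → f x * k)
  ∑-*ʳ k xs = ≈-trans (*-comm _ _) (≈-trans (∑-*ˡ k xs) (∑-cong xs λ _ → *-comm _ _))

  ∑-swap : (xs : List A) (ys : List B) {f : A → B → Carrier} →
           ∑ xs (λ x → ∑ ys (f x)) ≈ ∑ ys (λ y → ∑ xs (λ x → f x y))
  ∑-swap []       ys = ≈-sym (∑-zero ys)
  ∑-swap (x ∷ xs) ys = ≈-trans (+-congˡ (∑-swap xs ys)) (≈-sym (∑-+ ys))

  ∑-filter : {Q : A → Set} (Q? : ∀ x → Dec (Q x)) (xs : List A) {f : A → Carrier} →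
             ∑ (filter Q? xs) f ≈ ∑ xs (λ x → if does (Q? x) then f x else 0#)
  ∑-filter Q? [] = ≈-refl
  ∑-filter Q? (x ∷ xs) with does (Q? x)
  ... | true  = +-congˡ (∑-filter Q? xs)
  ... | false = ≈-trans (∑-filter Q? xs) (≈-sym (+-identityˡ _))

  ∑-cartesianProductWith : (h : A → B → D) (xs : List A) (ys : List B) {f : D → Carrier} →
                           ∑ (cartesianProductWith h xs ys) f ≈ ∑ xs (λ x → ∑ ys (λ y → f (h x y)))
  ∑-cartesianProductWith h []       ys = ≈-refl
  ∑-cartesianProductWith h (x ∷ xs) ys =
    ≈-trans (∑-++ (map (h x) ys) _) (+-cong (∑-map (h x) ys) (∑-cartesianProductWith h xs ys))

  ∑-uncrossings : ∀ (c : Crossing m) cs {f : Uncrossed m → Carrier} →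
                  ∑ (uncrossings (c ∷ cs)) f ≈
                  ∑ (uncrossings cs) (λ x → f ((c , vertical) ∷ x) + f ((c , horizontal) ∷ x))
  ∑-uncrossings c cs =
    ≈-trans (∑-cartesianProductWith _∷_ ((c , vertical) ∷ (c , horizontal) ∷ []) (uncrossings cs))
            (≈-trans (+-congˡ (+-identityʳ _)) (≈-sym (∑-+ (uncrossings cs))))

module ℤS = Sums ℤ.+-*-commutativeRing
module ℤP = Pfaffinants ℤ.+-*-commutativeRing

uncrossings-crossings : (cs : List (Crossing m)) → All (λ x → map proj₁ x ≡ cs) (uncrossings cs)
uncrossings-crossings []       = refl ∷ []
uncrossings-crossings (c ∷ cs) = All.++⁺ (step vertical) (All.++⁺ (step horizontal) [])
  where
  step : ∀ u → All (λ x → map proj₁ x ≡ c ∷ cs) (map ((c , u) ∷_) (uncrossings cs))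
  step u = All.map⁺ (All.map (cong (c ∷_)) (uncrossings-crossings cs))

-- Signs, weights and the vector of a symmetric picture

sg : Bool → ℤ
sg true  = -1ℤ
sg false = 1ℤ

sg-not : ∀ b → sg (not b) ≡ ℤ.- sg b
sg-not false = refl
sg-not true  = refl

sg-xor : ∀ a b → sg (a xor b) ≡ sg a ℤ.* sg b
sg-xor false b     = sym (ℤ.*-identityˡ (sg b))
sg-xor true  false = refl
sg-xor true  true  = refl

weightℤ : ∀ l k → ℤP.weight l k ≡ pow2 l ℤ.* sg (par k)
weightℤ l k = cong₂ ℤ._*_ (two l) (minus k)
  where
  open import Algebra.Properties.Semiring.Exp (CommutativeRing.semiring ℤ.+-*-commutativeRing) using () renaming (_^_ to _↑_)
  two : ∀ l → (1ℤ ℤ.+ 1ℤ) ↑ l ≡ pow2 l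
  two zero    = refl
  two (suc l) = cong (+ 2 ℤ.*_) (two l)
  minus : ∀ k → (ℤ.- 1ℤ) ↑ k ≡ sg (par k)
  minus zero    = refl
  minus (suc k) = trans (cong (-1ℤ ℤ.*_) (minus k)) (trans (ℤ.-1*i≡-i _) (sym (sg-not (par k))))

pow2-+ : ∀ k l → pow2 (k ℕ.+ l) ≡ pow2 k ℤ.* pow2 l
pow2-+ zero    l = sym (ℤ.*-identityˡ _)
pow2-+ (suc k) l = trans (cong (+ 2 ℤ.*_) (pow2-+ k l)) (sym (ℤ.*-assoc (+ 2) (pow2 k) (pow2 l)))

colour : (Point m → Point m) → (Fin m → Bool) → ℤ
colour f ε = scale f ℤ.* ⟦ constant f [ ε , const false ] ⟧

loop-yes : ∀ (p q : Point m) f → f p ≡ q → loop p q f ≡ 1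
loop-yes p q f e = cong (λ b → if b then 1 else 0) (dec-true (f p ≟ q) e)

loop-no : ∀ (p q : Point m) f → f p ≢ q → loop p q f ≡ 0
loop-no p q f e = cong (λ b → if b then 1 else 0) (dec-false (f p ≟ q) e)

cupcap-* : ∀ k (a b : Fin m) φ ε → k ℤ.* cupcap a b φ ε ≡ cupcap a b (λ ζ → k ℤ.* φ ζ) ε
cupcap-* k a b φ ε with does (ε a 𝔹.≟ ε b)
... | true  = ℤ.*-distribˡ-+ k _ _
... | false = ℤ.*-zeroʳ k

module _ {f : Point m → Point m} (F : SymmetricState f) {a b : Fin m} (a≢b : a ≢ b) where

  open SymmetricState F
  open Both F a≢b

  private
    loops : ℕ
    loops = loop (inj₁ a) (inj₁ b) f ⊔ loop (inj₂ a) (inj₂ b) f₁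

    ind : (Point m → Point m) → (Fin m → Bool) → ℤ
    ind g ε = ⟦ constant g [ ε , const false ] ⟧

    ind-cong : ∀ {g h} → g ≗ h → ∀ ε → ind g ε ≡ ind h ε
    ind-cong g≗h ε = cong ⟦_⟧ (constant-cong {ε = [ ε , const false ]} g≗h (λ _ → refl))

    left : ∀ {ε k} → loop (inj₁ a) (inj₁ b) f ≡ k → pow2 k ℤ.* ind f₁ ε ≡ cupcap a b (ind f) ε
    left {ε} refl = glue-colour (const false) ε matching a≢b

    finish : ∀ {ε k l s} → loops ≡ k → loop (inj₁ a) (inj₁ b) f ≡ l → ind f₂ ε ≡ ind f₁ ε →
             pow2 k ℤ.* scale f₂ ≡ s ℤ.* pow2 l → s ≡ scale f → pow2 loops ℤ.* colour f₂ ε ≡ cupcap a b (colour f) ε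
    finish {ε} {k} {l} refl el e e′ refl = begin
      pow2 k ℤ.* (scale f₂ ℤ.* ind f₂ ε)   ≡⟨ ℤ.*-assoc (pow2 k) _ _ ⟨
      pow2 k ℤ.* scale f₂ ℤ.* ind f₂ ε     ≡⟨ cong₂ ℤ._*_ e′ e ⟩
      scale f ℤ.* pow2 l ℤ.* ind f₁ ε      ≡⟨ ℤ.*-assoc (scale f) (pow2 l) _ ⟩
      scale f ℤ.* (pow2 l ℤ.* ind f₁ ε)    ≡⟨ cong (scale f ℤ.*_) (left el) ⟩
      scale f ℤ.* cupcap a b (ind f) ε     ≡⟨ cupcap-* (scale f) a b (ind f) ε ⟩
      cupcap a b (colour f) ε              ∎
      where open ≡-Reasoning

    -- The right-hand ends a and b are coloured alike, and the other colour is
    -- ruled out by the edge at one of them.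
    unlooped : ∀ {ε} p {c} → f (inj₁ a) ≢ inj₁ b → p ≡ a ⊎ p ≡ b → f₁ (inj₂ p) ≡ inj₂ c → c ≢ a → c ≢ b →
               horizontalEdges f₂ ≡ horizontalEdges f → pow2 loops ℤ.* colour f₂ ε ≡ cupcap a b (colour f) ε
    unlooped {ε} p {c} fa≢b p∈ f₁p c≢a c≢b edges =
      finish {ε} {0} {0} (cong₂ _⊔_ (loop-no (inj₁ a) (inj₁ b) f fa≢b) noLoop)
        (loop-no (inj₁ a) (inj₁ b) f fa≢b) same (trans (ℤ.*-identityˡ _) (trans (cong (λ k → pow2 ⌊ k /2⌋) edges) (sym (ℤ.*-identityʳ _)))) refl
      where
      ε⁺ : Point m → Bool
      ε⁺ = [ ε , const false ]
      f₁a≢b : f₁ (inj₂ a) ≢ inj₂ b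
      f₁a≢b e = [ (λ { refl → c≢b (inj₂-injective (trans (sym f₁p) e)) })
                , (λ { refl → c≢a (sym (inj₂-injective (trans (sym (proj₁ matching₁ (inj₂ a))) (trans (cong f₁ e) f₁p)))) }) ] p∈
      noLoop : loop (inj₂ a) (inj₂ b) f₁ ≡ 0
      noLoop = loop-no (inj₂ a) (inj₂ b) f₁ f₁a≢b
      other-colour : constant f₁ (toggle (inj₂ a) (inj₂ b) ε⁺) ≡ false
      other-colour = nonconstant {f = f₁} {toggle (inj₂ a) (inj₂ b) ε⁺} (inj₂ p) λ e → contradiction
        (trans (sym (trans (cong (toggle (inj₂ a) (inj₂ b) ε⁺) f₁p)
                           (toggle-other (inj₂ a) (inj₂ b) ε⁺ (c≢a ∘ inj₂-injective) (c≢b ∘ inj₂-injective))))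
               (trans e (flipped p∈))) λ ()
        where
        flipped : p ≡ a ⊎ p ≡ b → toggle (inj₂ a) (inj₂ b) ε⁺ (inj₂ p) ≡ true
        flipped (inj₁ refl) = toggle-p (inj₂ a) (inj₂ b) ε⁺
        flipped (inj₂ refl) = toggle-q (inj₂ a) (inj₂ b) ε⁺
      same : ind f₂ ε ≡ ind f₁ ε
      same = begin
        ind f₂ ε                                                              ≡⟨ ℤ.*-identityˡ _ ⟨
        pow2 0 ℤ.* ind f₂ ε                                                   ≡⟨ cong (λ k → pow2 k ℤ.* ind f₂ ε) noLoop ⟨
        pow2 (loop (inj₂ a) (inj₂ b) f₁) ℤ.* ind f₂ ε                         ≡⟨ reconnect-colour {f = f₁} {inj₂ a} {inj₂ b} ε⁺ matching₁ a≢b₂ refl ⟨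
        ind f₁ ε ℤ.+ ⟦ constant f₁ (toggle (inj₂ a) (inj₂ b) ε⁺) ⟧             ≡⟨ cong (λ x → ind f₁ ε ℤ.+ ⟦ x ⟧) other-colour ⟩
        ind f₁ ε ℤ.+ 0ℤ                                                       ≡⟨ ℤ.+-identityʳ _ ⟩
        ind f₁ ε                                                              ∎
        where open ≡-Reasoning

    f₁-right : ∀ p {c} → f (inj₁ p) ≡ inj₁ c → f₁ (inj₂ p) ≡ inj₂ c
    f₁-right p e = trans (f₁-other {inj₂ p} inj₂≢inj₁ inj₂≢inj₁ (inj₂≢inj₁ ∘ trans (sym e′)) (inj₂≢inj₁ ∘ trans (sym e′))) e′
      where e′ = trans (symmetric (inj₁ p)) (cong mirror e)

    shape : ∀ p → f (inj₁ p) ≡ inj₂ p ⊎ ∃[ c ] f (inj₁ p) ≡ inj₁ c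
    shape p with f (inj₁ p) in e
    ... | inj₁ c = inj₂ (c , refl)
    ... | inj₂ c = inj₁ (cong inj₂ (sym (level e)))

  -- The left piece is handled by `glue-colour`; the question is what the right piece adds. If it
  -- closes a loop, then either the left piece closed the mirror image of that loop, and `⊔` counts
  -- the pair once, or both strands were horizontal, and the loop makes up for the halved scale. If
  -- it closes none, the right ends, fixed to `false`, leave a single possible colour at the glued
  -- ends and nothing changes.
  glueBoth-colour : ∀ ε → pow2 loops ℤ.* colour f₂ ε ≡ cupcap a b (colour f) ε
  glueBoth-colour ε = cases (f (inj₁ a) ≟ inj₁ b) (shape a) (shape b)
    where
    cases : Dec (f (inj₁ a) ≡ inj₁ b) → f (inj₁ a) ≡ inj₂ a ⊎ ∃[ c ] f (inj₁ a) ≡ inj₁ c →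
            f (inj₁ b) ≡ inj₂ b ⊎ ∃[ c ] f (inj₁ b) ≡ inj₁ c →
            pow2 loops ℤ.* colour f₂ ε ≡ cupcap a b (colour f) ε
    cases (yes e) _ _ = finish {ε} {1} {1} (cong₂ _⊔_ (loop-yes (inj₁ a) (inj₁ b) f e) (loop-yes (inj₂ a) (inj₂ b) f₁ f₁a′)) (loop-yes (inj₁ a) (inj₁ b) f e)
      (ind-cong (reconnect-loop {p = inj₂ a} {inj₂ b} {f₁} matching₁ f₁a′) ε)
      (trans (ℤ.*-comm (pow2 1) _) (cong (ℤ._* pow2 1)
        (scale-cong λ p → trans (reconnect-loop {p = inj₂ a} {inj₂ b} {f₁} matching₁ f₁a′ p) (reconnect-loop {p = inj₁ a} {inj₁ b} {f} matching e p)))) refl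
      where
      f₁a′ : f₁ (inj₂ a) ≡ inj₂ b
      f₁a′ = f₁-right a e
    cases (no e) (inj₁ fa) (inj₁ fb) = finish {ε} {1} {0} (cong₂ _⊔_ (loop-no (inj₁ a) (inj₁ b) f e) (loop-yes (inj₂ a) (inj₂ b) f₁ f₁a′)) (loop-no (inj₁ a) (inj₁ b) f e)
      (ind-cong axis ε)
      (trans (cong (pow2 1 ℤ.*_) (scale-cong axis))
             (trans (sym (cong (λ k → pow2 ⌊ k /2⌋) (horizontalEdges-axis F a≢b fa fb))) (sym (ℤ.*-identityʳ (scale f)))))
      refl
      where
      f₁a′ : f₁ (inj₂ a) ≡ inj₂ b
      f₁a′ = trans (reconnect-to-p (inj₁ a) (inj₁ b) f {inj₂ a} inj₂≢inj₁ inj₂≢inj₁ (trans (symmetric (inj₁ a)) (cong mirror fa))) fb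
      axis : f₂ ≗ f₁
      axis = reconnect-loop {p = inj₂ a} {inj₂ b} {f₁} matching₁ f₁a′
    cases (no e) _ (inj₂ (c , fb)) = unlooped b e (inj₂ refl) (f₁-right b fb) c≢a (noFix (inj₁ b) ∘ trans fb ∘ cong inj₁)
      (horizontalEdges-vertical F a≢b fb c≢a)
      where
      c≢a : c ≢ a
      c≢a refl = e (trans (cong f (sym fb)) (involutive (inj₁ b)))
    cases (no e) (inj₂ (c , fa)) (inj₁ fb) = unlooped a e (inj₁ refl) (f₁-right a fa) (noFix (inj₁ a) ∘ trans fa ∘ cong inj₁) c≢b
      (trans (ℕ∑.sum-cong-≗ λ i → cong (bit ∘ isRight) (reconnectBoth-comm a≢b matching (inj₁ i)))
             (horizontalEdges-vertical F (a≢b ∘ sym) fa c≢b))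
      where
      c≢b : c ≢ b
      c≢b refl = e fa

-- In wirings and at paired crossings the sign sits on the horizontal uncrossing, which acts as the
-- identity. At unpaired crossings it sits on the vertical one; those are treated in `axis-colour`.
crossing : (a b : Fin m) → ((Fin m → Bool) → ℤ) → (Fin m → Bool) → ℤ
crossing a b φ ε = cupcap a b φ ε ℤ.- φ ε

-- In the coordinates η = ε xor odd, and up to the sign twist below, a crossing
-- becomes minus the exchange of two tensor factors.
shade : (Fin m → Bool) → Fin m → Bool
shade η i = η i xor odd i

oddShades : (Fin m → Bool) → Bool
oddShades η = ⊕.sum λ i → η i ∧ odd i

twisted : ((Fin m → Bool) → ℤ) → (Fin m → Bool) → ℤ
twisted φ η = sg (oddShades η) ℤ.* φ (shade η)

Extensional : ((Fin m → Bool) → ℤ) → Set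
Extensional φ = ∀ {ε ζ} → ε ≗ ζ → φ ε ≡ φ ζ

sg-cong-not : ∀ {a b} → a ≡ not b → sg a ≡ ℤ.- sg b
sg-cong-not {b = b} refl = sg-not b

-- For `η a ≡ η b` the shaded colours differ, so `cupcap` vanishes and minus the identity is left;
-- the exchange is trivial there. Otherwise `cupcap` adds the toggled colouring, which is the
-- exchanged one, its first term cancels the identity, and the twist changes sign because exactly
-- one of the two slots is odd.
twisted-crossing : ∀ {a b : Fin m} {φ} → Extensional φ → a ≢ b → odd b ≡ not (odd a) → ∀ η →
                   twisted (crossing a b φ) η ≡ ℤ.- twisted φ (η ∘ transpose a b)
twisted-crossing {a = a} {b} {φ} ext a≢b odd-b η with η a 𝔹.≟ η b
... | yes e = begin
  sg (oddShades η) ℤ.* (cupcap a b φ (shade η) ℤ.- φ (shade η))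
    ≡⟨ cong (λ x → sg (oddShades η) ℤ.* ((if x then φ (shade η) ℤ.+ φ (toggleᶠ a b (shade η)) else 0ℤ) ℤ.- φ (shade η))) (dec-false (shade η a 𝔹.≟ shade η b) differ) ⟩
  sg (oddShades η) ℤ.* (0ℤ ℤ.- φ (shade η))
    ≡⟨ negate (sg (oddShades η)) (φ (shade η)) ⟩
  ℤ.- (sg (oddShades η) ℤ.* φ (shade η))
    ≡⟨ cong ℤ.-_ (cong₂ (λ x y → sg x ℤ.* y) (⊕.sum-cong-≗ λ i → cong (_∧ odd i) (sym (same i))) (ext λ i → cong (_xor odd i) (sym (same i)))) ⟩
  ℤ.- twisted φ (η ∘ transpose a b) ∎
  where
  open ≡-Reasoning
  negate : ∀ x y → x ℤ.* (0ℤ ℤ.- y) ≡ ℤ.- (x ℤ.* y)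
  negate = solve-∀
  differ : shade η a ≢ shade η b
  differ e′ = absurd (η b) (odd a) (trans (cong (_xor odd a) (sym e)) (trans e′ (cong (η b xor_) odd-b)))
    where
    absurd : ∀ x y → x xor y ≢ x xor not y
    absurd false false ()
    absurd false true ()
    absurd true false ()
    absurd true true ()
  same : ∀ i → η (transpose a b i) ≡ η i
  same i with i F.≟ a
  ... | yes refl = sym e
  ... | no _ with i F.≟ b
  ...   | yes refl = e
  ...   | no _ = refl
... | no ne = begin
  sg (oddShades η) ℤ.* (cupcap a b φ (shade η) ℤ.- φ (shade η))
    ≡⟨ cong (λ x → sg (oddShades η) ℤ.* ((if x then φ (shade η) ℤ.+ φ (toggleᶠ a b (shade η)) else 0ℤ) ℤ.- φ (shade η)))
            (dec-true (shade η a 𝔹.≟ shade η b) agree) ⟩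
  sg (oddShades η) ℤ.* (φ (shade η) ℤ.+ φ (toggleᶠ a b (shade η)) ℤ.- φ (shade η))
    ≡⟨ cong₂ (λ x y → x ℤ.* (φ (shade η) ℤ.+ y ℤ.- φ (shade η))) (sg-cong-not oddShades-η) (ext toggled) ⟩
  (ℤ.- sg (oddShades η′)) ℤ.* (φ (shade η) ℤ.+ φ (shade η′) ℤ.- φ (shade η))
    ≡⟨ cancel (sg (oddShades η′)) (φ (shade η)) (φ (shade η′)) ⟩
  ℤ.- (sg (oddShades η′) ℤ.* φ (shade η′)) ∎
  where
  open ≡-Reasoning
  η′ : Fin _ → Bool
  η′ = η ∘ transpose a b
  cancel : ∀ x y z → (ℤ.- x) ℤ.* (y ℤ.+ z ℤ.- y) ≡ ℤ.- (x ℤ.* z)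
  cancel = solve-∀
  ηb : η b ≡ not (η a)
  ηb = 𝔹.¬-not (ne ∘ sym)
  agree : shade η a ≡ shade η b
  agree = sym (trans (cong₂ _xor_ ηb odd-b) (𝔹.xor-annihilates-not (η a) (odd a)))
  δ : Fin _ → Bool
  δ i = does (i F.≟ a) ∨ does (i F.≟ b)
  swapped : ∀ i → η′ i ≡ η i xor δ i
  swapped i with i F.≟ a
  ... | yes refl = trans ηb (xor-comm true (η i))
  ... | no _ with i F.≟ b
  ...   | yes refl = trans (𝔹.¬-not ne) (xor-comm true (η i))
  ...   | no _ = sym (xor-identityʳ (η i))
  toggled : toggleᶠ a b (shade η) ≗ shade η′
  toggled i = trans (xor-assoc (η i) (odd i) (δ i)) (trans (cong (η i xor_) (xor-comm (odd i) (δ i)))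
    (trans (sym (xor-assoc (η i) (δ i) (odd i))) (cong (_xor odd i) (sym (swapped i)))))
  δ-odd : ∀ i → δ i ∧ odd i ≡ (if does (i F.≟ a) then odd a else false) xor (if does (i F.≟ b) then odd b else false)
  δ-odd i with i F.≟ a | i F.≟ b
  ... | yes refl | yes e = contradiction e a≢b
  ... | yes refl | no _ = sym (xor-identityʳ (odd i))
  ... | no _ | yes refl = refl
  ... | no _ | no _ = refl
  δ-sum : ⊕.sum (λ i → δ i ∧ odd i) ≡ true
  δ-sum = begin
    ⊕.sum (λ i → δ i ∧ odd i)  ≡⟨ ⊕.sum-cong-≗ δ-odd ⟩
    ⊕.sum (λ i → (if does (i F.≟ a) then odd a else false) xor (if does (i F.≟ b) then odd b else false))
      ≡⟨ ⊕.∑-distrib-+ (λ i → if does (i F.≟ a) then odd a else false) (λ i → if does (i F.≟ b) then odd b else false) ⟩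
    ⊕.sum (λ i → if does (i F.≟ a) then odd a else false) xor ⊕.sum (λ i → if does (i F.≟ b) then odd b else false)
      ≡⟨ cong₂ _xor_ (⊕-single a (odd a)) (trans (⊕-single b (odd b)) odd-b) ⟩
    odd a xor not (odd a)      ≡⟨ 𝔹.not-distribʳ-xor (odd a) (odd a) ⟨
    not (odd a xor odd a)      ≡⟨ cong not (xor-same (odd a)) ⟩
    true                       ∎
  oddShades-η : oddShades η ≡ not (oddShades η′)
  oddShades-η = sym (begin
    not (oddShades η′)                                       ≡⟨ cong not (⊕.sum-cong-≗ λ i → trans (cong (_∧ odd i) (swapped i)) (𝔹.∧-distribʳ-xor (odd i) (η i) (δ i))) ⟩
    not (⊕.sum λ i → (η i ∧ odd i) xor (δ i ∧ odd i))        ≡⟨ cong not (⊕.∑-distrib-+ (λ i → η i ∧ odd i) (λ i → δ i ∧ odd i)) ⟩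
    not (oddShades η xor ⊕.sum (λ i → δ i ∧ odd i))          ≡⟨ cong (λ x → not (oddShades η xor x)) δ-sum ⟩
    not (oddShades η xor true)                               ≡⟨ cong not (xor-comm (oddShades η) true) ⟩
    not (not (oddShades η))                                  ≡⟨ not-involutive _ ⟩
    oddShades η                                              ∎)

endOf-++ : ∀ (cs ds : List (Crossing m)) i → endOf (cs ++ ds) i ≡ endOf ds (endOf cs i)
endOf-++ []             ds i = refl
endOf-++ ((a , b) ∷ cs) ds i = endOf-++ cs ds (transpose a b i)

-- Crossings on the axis

pairSign : Bool → Bool → ℤ
pairSign x y = if does (x 𝔹.≟ y) then sg x else 0ℤ

-- The indicator is reduced to the one with `false` at both slots of an evaluated axis crossing,
-- since a horizontal strand is constant only if its left end has the colour `false` of its right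
-- end.
clear : (a b : Fin m) → (Fin m → Bool) → Fin m → Bool
clear a b ε i = if does (i F.≟ a) ∨ does (i F.≟ b) then false else ε i

clears : List (Crossing m) → (Fin m → Bool) → Fin m → Bool
clears []             ε = ε
clears ((a , b) ∷ ps) ε = clears ps (clear a b ε)

pairSigns : List (Crossing m) → (Fin m → Bool) → ℤ
pairSigns []             ε = 1ℤ
pairSigns ((a , b) ∷ ps) ε = pairSign (ε a) (ε b) ℤ.* pairSigns ps ε

-- Excludes a last slot left over, which `pairUp` would silently drop.
halves : List (Fin m) → Set
halves zs = length zs ≡ length (pairUp zs) ℕ.+ length (pairUp zs)

halves-tail : ∀ {a b : Fin m} {zs} → halves (a ∷ b ∷ zs) → halves zs
halves-tail {zs = zs} e = ℕ.suc-injective (trans (ℕ.suc-injective e) (ℕ.+-suc (length (pairUp zs)) (length (pairUp zs))))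

pairSigns-cong : ∀ (zs : List (Fin m)) {ε ζ} → All (λ i → ε i ≡ ζ i) zs → pairSigns (pairUp zs) ε ≡ pairSigns (pairUp zs) ζ
pairSigns-cong [] _ = refl
pairSigns-cong (_ ∷ []) _ = refl
pairSigns-cong (a ∷ b ∷ zs) (e ∷ e′ ∷ es) = cong₂ ℤ._*_ (cong₂ pairSign e e′) (pairSigns-cong zs es)

clear-a : ∀ (a b : Fin m) ε → clear a b ε a ≡ false
clear-a a b ε rewrite dec-true (a F.≟ a) refl = refl

clear-b : ∀ (a b : Fin m) ε → clear a b ε b ≡ false
clear-b a b ε rewrite dec-true (b F.≟ b) refl | 𝔹.∨-zeroʳ (does (b F.≟ a)) = refl

clear-other : ∀ (a b : Fin m) ε {i} → i ≢ a → i ≢ b → clear a b ε i ≡ ε i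
clear-other a b ε {i} x y rewrite dec-false (i F.≟ a) x | dec-false (i F.≟ b) y = refl

module _ {f : Point m → Point m} (F : SymmetricState f) {a b : Fin m} (a≢b : a ≢ b)
         (fa : f (inj₁ a) ≡ inj₂ a) (fb : f (inj₁ b) ≡ inj₂ b) where

  open SymmetricState F
  open Both F a≢b

  private
    ind : (Fin m → Bool) → ℤ
    ind ε = ⟦ constant f [ ε , const false ] ⟧

    defect : ∀ {ε i} → f (inj₁ i) ≡ inj₂ i → ε i ≡ true → ind ε ≡ 0ℤ
    defect {ε} {i} fi εi = cong ⟦_⟧ (nonconstant {f = f} {[ ε , const false ]} (inj₁ i)
      λ e → contradiction (trans (sym (cong [ ε , const false ] fi)) (trans e εi)) λ ())

    ind-cong : ∀ {ε ζ} → ε ≗ ζ → ind ε ≡ ind ζ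
    ind-cong {ε} {ζ} e = cong ⟦_⟧ (constant-cong {f = f} {f} {[ ε , const false ]} {[ ζ , const false ]} (λ _ → refl) λ { (inj₁ i) → e i ; (inj₂ _) → refl })

    ind₁ : ∀ ε → ⟦ constant f₁ [ ε , const false ] ⟧ ≡ cupcap a b ind ε
    ind₁ ε = trans (sym (ℤ.*-identityˡ _)) (trans
      (cong (λ k → pow2 k ℤ.* ⟦ constant f₁ [ ε , const false ] ⟧) (sym (loop-no (inj₁ a) (inj₁ b) f (λ e → inj₂≢inj₁ (trans (sym fa) e)))))
      (glue-colour (const false) ε matching a≢b))

    core-identity : ∀ ε → + 2 ℤ.* ind ε ℤ.- cupcap a b ind ε ≡ pairSign (ε a) (ε b) ℤ.* ind (clear a b ε)
    core-identity ε with ε a in εa | ε b in εb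
    ... | false | false = trans (cong (λ x → + 2 ℤ.* ind ε ℤ.- (ind ε ℤ.+ x)) (defect {toggleᶠ a b ε} {a} fa (trans (cong (_xor (does (a F.≟ a) ∨ does (a F.≟ b))) εa) (cong (_∨ does (a F.≟ b)) (dec-true (a F.≟ a) refl)))))
      (trans (lemma (ind ε)) (cong (1ℤ ℤ.*_) (ind-cong cleared)))
      where
      lemma : ∀ x → + 2 ℤ.* x ℤ.- (x ℤ.+ 0ℤ) ≡ 1ℤ ℤ.* x
      lemma = solve-∀
      cleared : ε ≗ clear a b ε
      cleared i with i F.≟ a | i F.≟ b
      ... | yes refl | _ = εa
      ... | no _ | yes refl = εb
      ... | no _ | no _ = refl
    ... | true | true = trans (cong (λ x → + 2 ℤ.* x ℤ.- (x ℤ.+ ind (toggleᶠ a b ε))) (defect {ε} {a} fa εa))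
      (trans (lemma (ind (toggleᶠ a b ε))) (cong (-1ℤ ℤ.*_) (ind-cong cleared)))
      where
      lemma : ∀ x → 0ℤ ℤ.- (0ℤ ℤ.+ x) ≡ -1ℤ ℤ.* x
      lemma = solve-∀
      cleared : toggleᶠ a b ε ≗ clear a b ε
      cleared i with i F.≟ a | i F.≟ b
      ... | yes refl | _ = cong (_xor true) εa
      ... | no _ | yes refl = cong (_xor true) εb
      ... | no _ | no _ = xor-identityʳ (ε i)
    ... | false | true = cong (λ x → + 2 ℤ.* x ℤ.- 0ℤ) (defect {ε} {b} fb εb)
    ... | true | false = cong (λ x → + 2 ℤ.* x ℤ.- 0ℤ) (defect {ε} {a} fa εa)

  -- Horizontal minus vertical, where the vertical uncrossing loses two horizontal edges and so has
  -- half the scale. In units of `scale f₁`, and up to the indicator of the other edges, two `false`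
  -- ends give 2 - 1, two `true` ends 0 - 1, and unequal ends 0. The factor 2 in front restores
  -- `scale f` on the right.
  axis-colour : ∀ ε → + 2 ℤ.* (colour f ε ℤ.- colour f₁ ε) ≡ pairSign (ε a) (ε b) ℤ.* colour f (clear a b ε)
  axis-colour ε = begin
    + 2 ℤ.* (scale f ℤ.* ind ε ℤ.- scale f₁ ℤ.* ⟦ constant f₁ [ ε , const false ] ⟧)
      ≡⟨ cong₂ (λ s x → + 2 ℤ.* (s ℤ.* ind ε ℤ.- scale f₁ ℤ.* x)) scale-f (ind₁ ε) ⟩
    + 2 ℤ.* (+ 2 ℤ.* scale f₁ ℤ.* ind ε ℤ.- scale f₁ ℤ.* cupcap a b ind ε)
      ≡⟨ lemma (scale f₁) (ind ε) (cupcap a b ind ε) ⟩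
    + 2 ℤ.* scale f₁ ℤ.* (+ 2 ℤ.* ind ε ℤ.- cupcap a b ind ε)
      ≡⟨ cong₂ ℤ._*_ (sym scale-f) (core-identity ε) ⟩
    scale f ℤ.* (pairSign (ε a) (ε b) ℤ.* ind (clear a b ε))
      ≡⟨ exchange (scale f) (pairSign (ε a) (ε b)) (ind (clear a b ε)) ⟩
    pairSign (ε a) (ε b) ℤ.* (scale f ℤ.* ind (clear a b ε)) ∎
    where
    open ≡-Reasoning
    scale-f : scale f ≡ + 2 ℤ.* scale f₁
    scale-f = cong (λ k → pow2 ⌊ k /2⌋) (horizontalEdges-axis F a≢b fa fb)
    lemma : ∀ s x y → + 2 ℤ.* (+ 2 ℤ.* s ℤ.* x ℤ.- s ℤ.* y) ≡ + 2 ℤ.* s ℤ.* (+ 2 ℤ.* x ℤ.- y)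
    lemma = solve-∀
    exchange : ∀ x y z → x ℤ.* (y ℤ.* z) ≡ y ℤ.* (x ℤ.* z)
    exchange = solve-∀

weight-suc : ∀ l k → ℤP.weight l (suc k) ≡ ℤ.- ℤP.weight l k
weight-suc l k = begin
  ℤP.weight l (suc k)           ≡⟨ weightℤ l (suc k) ⟩
  pow2 l ℤ.* sg (not (par k))   ≡⟨ cong (pow2 l ℤ.*_) (sg-not (par k)) ⟩
  pow2 l ℤ.* (ℤ.- sg (par k))   ≡⟨ ℤ.neg-distribʳ-* (pow2 l) (sg (par k)) ⟨
  ℤ.- (pow2 l ℤ.* sg (par k))   ≡⟨ cong ℤ.-_ (weightℤ l k) ⟨
  ℤ.- ℤP.weight l k             ∎
  where open ≡-Reasoning

weight-+ : ∀ j l k → ℤP.weight (j ℕ.+ l) k ≡ pow2 j ℤ.* ℤP.weight l k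
weight-+ j l k = begin
  ℤP.weight (j ℕ.+ l) k               ≡⟨ weightℤ (j ℕ.+ l) k ⟩
  pow2 (j ℕ.+ l) ℤ.* sg (par k)       ≡⟨ cong (ℤ._* sg (par k)) (pow2-+ j l) ⟩
  pow2 j ℤ.* pow2 l ℤ.* sg (par k)    ≡⟨ ℤ.*-assoc (pow2 j) (pow2 l) (sg (par k)) ⟩
  pow2 j ℤ.* (pow2 l ℤ.* sg (par k))  ≡⟨ cong (pow2 j ℤ.*_) (weightℤ l k) ⟨
  pow2 j ℤ.* ℤP.weight l k            ∎
  where open ≡-Reasoning

module Axis {m} (ν : Point m → Point m) (C : SymmetricState (core ν)) where

  open Layout ν C public

  axisPicture : Uncrossed m → Picture m
  axisPicture = foldr glue (core ν , 0)

  Ready : List (Fin m) → Set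
  Ready zs = AllPairs F._<_ zs × All (λ z → th z ≡ true) zs × All (λ (a , b) → Neighbours th a b) (pairUp zs)

  -- The second component keeps the through slots outside `zs` horizontal, so that the next axis
  -- crossing meets two horizontal strands, as `axis-colour` requires.
  AxisState : List (Fin m) → (Point m → Point m) → Set
  AxisState zs f = State f × (∀ i → th i ≡ true → All (i ≢_) zs → f (inj₁ i) ≡ inj₂ i)

  ready-tail : ∀ {a b zs} → Ready (a ∷ b ∷ zs) → Ready zs
  ready-tail (_ ∷ _ ∷ s , _ ∷ _ ∷ t , _ ∷ ns) = s , t , ns

  ready-fresh : ∀ {a b zs} → Ready (a ∷ b ∷ zs) → All (a ≢_) zs × All (b ≢_) zs
  ready-fresh ((_ ∷ a<) ∷ b< ∷ _ , _) = All.map F.<⇒≢ a< , All.map F.<⇒≢ b<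

  axisPicture-state : ∀ zs y → Ready zs → map proj₁ y ≡ pairUp zs → AxisState zs (proj₁ (axisPicture y))
  axisPicture-state [] [] _ _ = core-state , λ i ti _ → core-through ti
  axisPicture-state (_ ∷ []) [] _ _ = core-state , λ i ti _ → core-through ti
  axisPicture-state (a ∷ b ∷ zs) ((_ , u) ∷ y) r e
    with List.∷-injective e | axisPicture-state zs y (ready-tail r) (proj₂ (List.∷-injective e)) | r | u
  ... | refl , _ | St , flat | _ , _ , N ∷ _ | horizontal = St , λ { i ti (_ ∷ _ ∷ i∉) → flat i ti i∉ }
  ... | refl , _ | St , flat | _ , ta ∷ tb ∷ _ , N ∷ _ | vertical =
    glue-axis-state N St fa fb , λ { i ti (i≢a ∷ i≢b ∷ i∉) →
      trans (B.f₁-other {inj₁ i} (i≢a ∘ inj₁-injective) (i≢b ∘ inj₁-injective)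
              (inj₂≢inj₁ ∘ trans (sym (flat i ti i∉))) (inj₂≢inj₁ ∘ trans (sym (flat i ti i∉)))) (flat i ti i∉) }
    where
    module B = Both (State.symmetricState St) (neighbours-≢ N)
    fa = flat a ta (proj₁ (ready-fresh r))
    fb = flat b tb (proj₂ (ready-fresh r))

  axisTerm : (Fin m → Bool) → Uncrossed m → ℤ
  axisTerm ε y = ℤP.weight (proj₂ (axisPicture y)) (verticals y) ℤ.* colour (proj₁ (axisPicture y)) ε

  axisSum : List (Crossing m) → (Fin m → Bool) → ℤ
  axisSum ps ε = ℤP.∑ (uncrossings ps) (axisTerm ε)

  axisSum-step : ∀ {a b zs} → Ready (a ∷ b ∷ zs) → ∀ ε →
                 + 2 ℤ.* axisSum ((a , b) ∷ pairUp zs) ε ≡ pairSign (ε a) (ε b) ℤ.* axisSum (pairUp zs) (clear a b ε)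
  axisSum-step {a} {b} {zs} r@(_ , ta ∷ tb ∷ _ , N ∷ _) ε = begin
    + 2 ℤ.* axisSum ((a , b) ∷ pairUp zs) ε
      ≡⟨ cong (+ 2 ℤ.*_) (ℤS.∑-uncrossings (a , b) (pairUp zs) {axisTerm ε}) ⟩
    + 2 ℤ.* ℤP.∑ (uncrossings (pairUp zs)) (λ y → axisTerm ε (((a , b) , vertical) ∷ y) ℤ.+ axisTerm ε (((a , b) , horizontal) ∷ y))
      ≡⟨ ℤS.∑-*ˡ (+ 2) (uncrossings (pairUp zs)) {λ y → axisTerm ε (((a , b) , vertical) ∷ y) ℤ.+ axisTerm ε (((a , b) , horizontal) ∷ y)} ⟩
    ℤP.∑ (uncrossings (pairUp zs)) (λ y → + 2 ℤ.* (axisTerm ε (((a , b) , vertical) ∷ y) ℤ.+ axisTerm ε (((a , b) , horizontal) ∷ y)))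
      ≡⟨ ℤS.∑-cong-All (All.map (λ {y} e → term y (axisPicture-state zs y (ready-tail r) e)) (uncrossings-crossings (pairUp zs))) ⟩
    ℤP.∑ (uncrossings (pairUp zs)) (λ y → pairSign (ε a) (ε b) ℤ.* axisTerm (clear a b ε) y)
      ≡⟨ ℤS.∑-*ˡ (pairSign (ε a) (ε b)) (uncrossings (pairUp zs)) {axisTerm (clear a b ε)} ⟨
    pairSign (ε a) (ε b) ℤ.* axisSum (pairUp zs) (clear a b ε) ∎
    where
    open ≡-Reasoning
    term : ∀ y → AxisState zs (proj₁ (axisPicture y)) →
           + 2 ℤ.* (axisTerm ε (((a , b) , vertical) ∷ y) ℤ.+ axisTerm ε (((a , b) , horizontal) ∷ y)) ≡
           pairSign (ε a) (ε b) ℤ.* axisTerm (clear a b ε) y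
    term y (St , flat) = begin
      + 2 ℤ.* (ℤP.weight (loop (inj₁ a) (inj₁ b) f ℕ.+ l) (suc v) ℤ.* colour f₁ ε ℤ.+ ℤP.weight l v ℤ.* colour f ε)
        ≡⟨ cong (λ k → + 2 ℤ.* (k ℤ.* colour f₁ ε ℤ.+ ℤP.weight l v ℤ.* colour f ε))
             (trans (cong (λ k → ℤP.weight (k ℕ.+ l) (suc v)) (loop-no (inj₁ a) (inj₁ b) f (λ e → inj₂≢inj₁ (trans (sym fa) e)))) (weight-suc l v)) ⟩
      + 2 ℤ.* ((ℤ.- ℤP.weight l v) ℤ.* colour f₁ ε ℤ.+ ℤP.weight l v ℤ.* colour f ε)
        ≡⟨ collect₂ (ℤP.weight l v) (colour f₁ ε) (colour f ε) ⟩
      ℤP.weight l v ℤ.* (+ 2 ℤ.* (colour f ε ℤ.- colour f₁ ε))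
        ≡⟨ cong (ℤP.weight l v ℤ.*_) (axis-colour (State.symmetricState St) (neighbours-≢ N) fa fb ε) ⟩
      ℤP.weight l v ℤ.* (pairSign (ε a) (ε b) ℤ.* colour f (clear a b ε))
        ≡⟨ exchange (ℤP.weight l v) (pairSign (ε a) (ε b)) (colour f (clear a b ε)) ⟩
      pairSign (ε a) (ε b) ℤ.* (ℤP.weight l v ℤ.* colour f (clear a b ε)) ∎
      where
      f = proj₁ (axisPicture y)
      f₁ = reconnect (inj₁ a) (inj₁ b) f
      l = proj₂ (axisPicture y)
      v = verticals y
      fa = flat a ta (proj₁ (ready-fresh r))
      fb = flat b tb (proj₂ (ready-fresh r))
      collect₂ : ∀ w x y → + 2 ℤ.* ((ℤ.- w) ℤ.* x ℤ.+ w ℤ.* y) ≡ w ℤ.* (+ 2 ℤ.* (y ℤ.- x))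
      collect₂ = solve-∀
      exchange : ∀ x y z → x ℤ.* (y ℤ.* z) ≡ y ℤ.* (x ℤ.* z)
      exchange = solve-∀

  -- One factor 2 accumulates for each axis crossing. Their product equals `scale (core ν)`, so
  -- `axisSum-closed` can cancel them.
  axisSum-pairs : ∀ zs → Ready zs → ∀ ε →
    pow2 (length (pairUp zs)) ℤ.* axisSum (pairUp zs) ε ≡ pairSigns (pairUp zs) ε ℤ.* colour (core ν) (clears (pairUp zs) ε)
  axisSum-pairs [] _ ε = cong (1ℤ ℤ.*_) (trans (ℤ.+-identityʳ _) (ℤ.*-identityˡ _))
  axisSum-pairs (_ ∷ []) _ ε = cong (1ℤ ℤ.*_) (trans (ℤ.+-identityʳ _) (ℤ.*-identityˡ _))
  axisSum-pairs (a ∷ b ∷ zs) r ε = begin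
    + 2 ℤ.* k ℤ.* axisSum ((a , b) ∷ pairUp zs) ε                  ≡⟨ shuffle k (axisSum ((a , b) ∷ pairUp zs) ε) ⟩
    k ℤ.* (+ 2 ℤ.* axisSum ((a , b) ∷ pairUp zs) ε)                ≡⟨ cong (k ℤ.*_) (axisSum-step r ε) ⟩
    k ℤ.* (s ℤ.* axisSum (pairUp zs) (clear a b ε))                ≡⟨ exchange k s _ ⟩
    s ℤ.* (k ℤ.* axisSum (pairUp zs) (clear a b ε))                ≡⟨ cong (s ℤ.*_) (axisSum-pairs zs (ready-tail r) (clear a b ε)) ⟩
    s ℤ.* (pairSigns (pairUp zs) (clear a b ε) ℤ.* c)              ≡⟨ cong (λ x → s ℤ.* (x ℤ.* c)) (pairSigns-cong zs unaffected) ⟩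
    s ℤ.* (pairSigns (pairUp zs) ε ℤ.* c)                          ≡⟨ ℤ.*-assoc s _ c ⟨
    s ℤ.* pairSigns (pairUp zs) ε ℤ.* c                            ∎
    where
    open ≡-Reasoning
    k = pow2 (length (pairUp zs))
    s = pairSign (ε a) (ε b)
    c = colour (core ν) (clears (pairUp zs) (clear a b ε))
    shuffle : ∀ x y → + 2 ℤ.* x ℤ.* y ≡ x ℤ.* (+ 2 ℤ.* y)
    shuffle = solve-∀
    exchange : ∀ x y z → x ℤ.* (y ℤ.* z) ≡ y ℤ.* (x ℤ.* z)
    exchange = solve-∀
    unaffected : All (λ i → clear a b ε i ≡ ε i) zs
    unaffected = All.zipWith (λ (x , y) → clear-other a b ε (x ∘ sym) (y ∘ sym)) (ready-fresh r)

-- The state vector of a symmetric drawing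

pow2-nonZero : ∀ k → ℤ.NonZero (pow2 k)
pow2-nonZero zero    = _
pow2-nonZero (suc k) = ℤ.i*j≢0 (+ 2) (pow2 k) {{_}} {{pow2-nonZero k}}

⟦⟧-∧ : ∀ a b → ⟦ a ∧ b ⟧ ≡ ⟦ a ⟧ ℤ.* ⟦ b ⟧
⟦⟧-∧ true  b = sym (ℤ.*-identityˡ ⟦ b ⟧)
⟦⟧-∧ false b = refl

sg-square : ∀ b → sg b ℤ.* sg b ≡ 1ℤ
sg-square true  = refl
sg-square false = refl

does-true : ∀ b → does (b 𝔹.≟ true) ≡ b
does-true true  = refl
does-true false = refl

∑-neg : {A : Set} (xs : List A) {f : A → ℤ} → ℤP.∑ xs (λ x → ℤ.- f x) ≡ ℤ.- ℤP.∑ xs f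
∑-neg []           = refl
∑-neg (x ∷ xs) {f} = trans (cong (λ y → ℤ.- f x ℤ.+ y) (∑-neg xs {f})) (sym (ℤ.neg-distrib-+ (f x) _))

cupcap-∑ : {A : Set} (xs : List A) (a b : Fin m) (g : (Fin m → Bool) → A → ℤ) (ε : Fin m → Bool) →
           ℤP.∑ xs (λ x → cupcap a b (λ ζ → g ζ x) ε) ≡ cupcap a b (λ ζ → ℤP.∑ xs (g ζ)) ε
cupcap-∑ xs a b g ε with does (ε a 𝔹.≟ ε b)
... | true  = ℤS.∑-+ xs {g ε} {g (toggleᶠ a b ε)}
... | false = ℤS.∑-zero xs

∈-filterᵇ⁺ : {A : Set} (P : A → Bool) {xs : List A} {x : A} → x ∈ xs → P x ≡ true → x ∈ filterᵇ P xs
∈-filterᵇ⁺ P {y ∷ _} i e with P y in eq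
∈-filterᵇ⁺ P (here refl) e | true  = here refl
∈-filterᵇ⁺ P (there i)   e | true  = there (∈-filterᵇ⁺ P i e)
∈-filterᵇ⁺ P (here refl) e | false = contradiction (trans (sym e) eq) λ ()
∈-filterᵇ⁺ P (there i)   e | false = ∈-filterᵇ⁺ P i e

length-filterᵇ : (P : Fin m → Bool) (g : Fin n → Fin m) →
                 length (filterᵇ P (List.tabulate g)) ≡ ℕ∑.sum (bit ∘ P ∘ g)
length-filterᵇ {n = zero} P g = refl
length-filterᵇ {n = suc n} P g with P (g zero)
... | true  = cong suc (length-filterᵇ P (g ∘ suc))
... | false = length-filterᵇ P (g ∘ suc)

⊕-list : List (Fin m) → (Fin m → Bool) → Bool
⊕-list zs h = foldr (λ i s → h i xor s) false zs

⊕-filterᵇ : (P h : Fin m → Bool) (g : Fin n → Fin m) →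
            ⊕-list (filterᵇ P (List.tabulate g)) h ≡ ⊕.sum (λ k → P (g k) ∧ h (g k))
⊕-filterᵇ {n = zero} P h g = refl
⊕-filterᵇ {n = suc n} P h g with P (g zero)
... | true  = cong (h (g zero) xor_) (⊕-filterᵇ P h (g ∘ suc))
... | false = ⊕-filterᵇ P h (g ∘ suc)

opposed : List (Crossing m) → (Fin m → Bool) → Bool
opposed []             η = true
opposed ((a , b) ∷ ps) η = (η a xor η b) ∧ opposed ps η

-- The two slots of an axis crossing have opposite parity, so equal colours become unequal ones in
-- shaded coordinates. The sign splits into the twist at the two slots and one `-1` for the
-- crossing.
pairSign-shade : ∀ x y o → pairSign (x xor o) (y xor not o) ≡ sg ((x ∧ o) xor (y ∧ not o)) ℤ.* (-1ℤ ℤ.* ⟦ x xor y ⟧)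
pairSign-shade false false false = refl
pairSign-shade false false true  = refl
pairSign-shade false true  false = refl
pairSign-shade false true  true  = refl
pairSign-shade true  false false = refl
pairSign-shade true  false true  = refl
pairSign-shade true  true  false = refl
pairSign-shade true  true  true  = refl

pairSigns-shade : ∀ (zs : List (Fin m)) η → halves zs → All (λ (a , b) → odd b ≡ not (odd a)) (pairUp zs) →
  pairSigns (pairUp zs) (shade η) ≡
  sg (⊕-list zs (λ i → η i ∧ odd i)) ℤ.* (sg (par (length (pairUp zs))) ℤ.* ⟦ opposed (pairUp zs) η ⟧)
pairSigns-shade [] η _ _ = refl
pairSigns-shade (_ ∷ []) η () _
pairSigns-shade (a ∷ b ∷ zs) η half (e ∷ es)
  rewrite e | pairSign-shade (η a) (η b) (odd a) | pairSigns-shade zs η (halves-tail {a = a} {b} {zs} half) es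
        | sym (xor-assoc (η a ∧ odd a) (η b ∧ not (odd a)) (⊕-list zs (λ i → η i ∧ odd i)))
        | sg-xor ((η a ∧ odd a) xor (η b ∧ not (odd a))) (⊕-list zs (λ i → η i ∧ odd i))
        | ⟦⟧-∧ (η a xor η b) (opposed (pairUp zs) η)
        | sg-not (par (length (pairUp zs)))
  = shuffle (sg ((η a ∧ odd a) xor (η b ∧ not (odd a)))) ⟦ η a xor η b ⟧ (sg (⊕-list zs (λ i → η i ∧ odd i)))
            (sg (par (length (pairUp zs)))) ⟦ opposed (pairUp zs) η ⟧
  where
  shuffle : ∀ x u y s v → x ℤ.* (-1ℤ ℤ.* u) ℤ.* (y ℤ.* (s ℤ.* v)) ≡ x ℤ.* y ℤ.* ((ℤ.- s) ℤ.* (u ℤ.* v))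
  shuffle = solve-∀

clears-false : ∀ ps (ε : Fin m → Bool) {i} → ε i ≡ false → clears ps ε i ≡ false
clears-false [] ε e = e
clears-false ((a , b) ∷ ps) ε {i} e = clears-false ps (clear a b ε) (lemma (does (i F.≟ a) ∨ does (i F.≟ b)))
  where
  lemma : ∀ c → (if c then false else ε i) ≡ false
  lemma true  = refl
  lemma false = e

clears-∈ : ∀ (zs : List (Fin m)) ε {i} → halves zs → i ∈ zs → clears (pairUp zs) ε i ≡ false
clears-∈ (_ ∷ []) ε () _
clears-∈ (a ∷ b ∷ zs) ε half (here refl)         = clears-false (pairUp zs) _ (clear-a a b ε)
clears-∈ (a ∷ b ∷ zs) ε half (there (here refl)) = clears-false (pairUp zs) _ (clear-b a b ε)
clears-∈ (a ∷ b ∷ zs) ε half (there (there i))   = clears-∈ zs _ (halves-tail {a = a} {b} {zs} half) i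

clears-∉ : ∀ (zs : List (Fin m)) ε {i} → All (i ≢_) zs → clears (pairUp zs) ε i ≡ ε i
clears-∉ [] ε _ = refl
clears-∉ (_ ∷ []) ε _ = refl
clears-∉ (a ∷ b ∷ zs) ε (x ∷ y ∷ i∉) = trans (clears-∉ zs _ i∉) (clear-other a b ε x y)

endOf-∉ : ∀ (zs : List (Fin m)) {i} → All (i ≢_) zs → endOf (pairUp zs) i ≡ i
endOf-∉ [] _ = refl
endOf-∉ (_ ∷ []) _ = refl
endOf-∉ (a ∷ b ∷ zs) {i} (x ∷ y ∷ i∉) = trans (cong (endOf (pairUp zs)) (transpose-other a b x y)) (endOf-∉ zs i∉)

opposed⇒ : ∀ (zs : List (Fin m)) η → halves zs → AllPairs F._<_ zs → opposed (pairUp zs) η ≡ true →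
           All (λ i → η (endOf (pairUp zs) i) ≡ not (η i)) zs
opposed⇒ [] η _ _ _ = []
opposed⇒ (_ ∷ []) η () _ _
opposed⇒ (a ∷ b ∷ zs) η half ((a<b ∷ a<) ∷ b< ∷ sorted) e with η a xor η b in e₁ | e
... | true | e₂ =
  trans (cong η (trans (cong (endOf (pairUp zs)) (transpose-a a b)) (endOf-∉ zs (All.map F.<⇒≢ b<)))) (sym (lemma (η a) (η b) e₁)) ∷
  trans (cong η (trans (cong (endOf (pairUp zs)) (transpose-b a b)) (endOf-∉ zs (All.map F.<⇒≢ a<)))) (sym (lemma (η b) (η a) (trans (xor-comm (η b) (η a)) e₁))) ∷
  All.zipWith (λ { ((a<i , b<i) , e₃) → trans (cong (η ∘ endOf (pairUp zs)) (transpose-other a b (F.<⇒≢ a<i ∘ sym) (F.<⇒≢ b<i ∘ sym))) e₃ })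
    (All.zip (a< , b<) , opposed⇒ zs η (halves-tail {a = a} {b} {zs} half) sorted e₂)
  where
  lemma : ∀ x y → x xor y ≡ true → not x ≡ y
  lemma false true _ = refl
  lemma true false _ = refl

⇒opposed : ∀ (zs : List (Fin m)) η → halves zs → AllPairs F._<_ zs →
           All (λ i → η (endOf (pairUp zs) i) ≡ not (η i)) zs → opposed (pairUp zs) η ≡ true
⇒opposed [] η _ _ _ = refl
⇒opposed (_ ∷ []) η () _ _
⇒opposed (a ∷ b ∷ zs) η half ((a<b ∷ a<) ∷ b< ∷ sorted) (e ∷ _ ∷ es) = cong₂ _∧_
  (trans (cong (η a xor_) (trans (cong η (sym (trans (cong (endOf (pairUp zs)) (transpose-a a b)) (endOf-∉ zs (All.map F.<⇒≢ b<))))) e)) (lemma (η a)))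
  (⇒opposed zs η (halves-tail {a = a} {b} {zs} half) sorted
    (All.zipWith (λ { ((a<i , b<i) , e₃) → trans (cong (η ∘ endOf (pairUp zs)) (sym (transpose-other a b (F.<⇒≢ a<i ∘ sym) (F.<⇒≢ b<i ∘ sym)))) e₃ })
      (All.zip (a< , b<) , es)))
  where
  lemma : ∀ x → x xor not x ≡ true
  lemma false = refl
  lemma true  = refl

module StateVector {m} (ν : Point m → Point m) (C : SymmetricState (core ν)) where

  open Axis ν C public

  consecutive-neighbours : ∀ {a b} → (a , b) ∈ consecutive (through ν) → Neighbours th a b
  consecutive-neighbours i with neighbours th (sorted-allFin m) i
  ... | a<b , ta , tb , gap = a<b , ta , tb , λ c → gap (∈-allFin c)

  through-sorted : AllPairs F._<_ (through ν)
  through-sorted = filterᵇ-pairs th (sorted-allFin m)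

  through-ready : Ready (through ν)
  through-ready = through-sorted , all-filterᵇ th (allFin m) , All.tabulate (consecutive-neighbours ∘ ∈-pairUp)

  pairs : ℕ
  pairs = length (pairUp (through ν))

  throughShades arcShades : (Fin m → Bool) → Bool
  throughShades η = ⊕.sum λ i → th i ∧ (η i ∧ odd i)
  arcShades     η = ⊕.sum λ i → not (th i) ∧ (η i ∧ odd i)

  oddShades-split : ∀ η → oddShades η ≡ throughShades η xor arcShades η
  oddShades-split η = trans (⊕.sum-cong-≗ λ i → lemma (th i) (η i ∧ odd i))
    (⊕.∑-distrib-+ (λ i → th i ∧ (η i ∧ odd i)) (λ i → not (th i) ∧ (η i ∧ odd i)))
    where
    lemma : ∀ t x → x ≡ (t ∧ x) xor (not t ∧ x)
    lemma true  x = sym (xor-identityʳ x)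
    lemma false x = refl

  -- The value `false` makes the horizontal strands of `core ν` constant, so that only its arcs are
  -- tested.
  mask : (Fin m → Bool) → Fin m → Bool
  mask ε i = if th i then false else ε i

  arcsConstant : (Fin m → Bool) → Bool
  arcsConstant ε = constant (core ν) [ mask ε , const false ]

  arcsConstant-cong : ∀ {ε ζ} → (∀ i → th i ≡ false → ε i ≡ ζ i) → arcsConstant ε ≡ arcsConstant ζ
  arcsConstant-cong {ε} {ζ} e = constant-cong {f = core ν} {core ν} {[ mask ε , const false ]} {[ mask ζ , const false ]} (λ _ → refl)
    λ { (inj₁ i) → agree i (th i) refl ; (inj₂ _) → refl }
    where
    agree : ∀ i b → th i ≡ b → (if b then false else ε i) ≡ (if b then false else ζ i)
    agree i true  _  = refl
    agree i false eq = e i eq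

  Opposed : (Fin m → Fin m) → (Fin m → Bool) → Set
  Opposed ρ η = ∀ i → th i ≡ true → η (ρ i) ≡ not (η i)

  opposed? : ∀ ρ η → Dec (Opposed ρ η)
  opposed? ρ η = F.all? λ i → (th i 𝔹.≟ true) →-dec (η (ρ i) 𝔹.≟ not (η i))

  opposed-through : ∀ η → halves (through ν) → opposed (pairUp (through ν)) η ≡ does (opposed? (endOf (pairUp (through ν))) η)
  opposed-through η half = trans (sym (does-true _)) (decide
    (λ e i ti → All.lookup (opposed⇒ (through ν) η half through-sorted e) (∈-filterᵇ⁺ th (∈-allFin i) ti))
    (λ e → ⇒opposed (through ν) η half through-sorted (All.map (e _) (all-filterᵇ th (allFin m))))
    (opposed (pairUp (through ν)) η 𝔹.≟ true) (opposed? (endOf (pairUp (through ν))) η))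

  core-scale : halves (through ν) → scale (core ν) ≡ pow2 pairs
  core-scale half = cong pow2 (begin
    ⌊ horizontalEdges (core ν) /2⌋  ≡⟨ cong ⌊_/2⌋ (ℕ∑.sum-cong-≗ λ i → cong bit (right i (th i) refl)) ⟩
    ⌊ ℕ∑.sum (bit ∘ th) /2⌋         ≡⟨ cong ⌊_/2⌋ (length-filterᵇ th id) ⟨
    ⌊ length (through ν) /2⌋        ≡⟨ cong ⌊_/2⌋ half ⟩
    ⌊ pairs ℕ.+ pairs /2⌋           ≡⟨ ℕ.n≡⌊n+n/2⌋ pairs ⟨
    pairs                           ∎)
    where
    open ≡-Reasoning
    right : ∀ i b → th i ≡ b → isRight (core ν (inj₁ i)) ≡ th i
    right i true  e = trans (cong isRight (core-through e)) (sym e)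
    right i false e = trans (cong isRight (proj₁ (proj₂ (core-arc e)))) (sym e)

  axisSum-closed : halves (through ν) → ∀ η → axisSum (pairUp (through ν)) (shade η) ≡
    sg (throughShades η) ℤ.* (sg (par pairs) ℤ.* (⟦ arcsConstant (shade η) ⟧ ℤ.* ⟦ does (opposed? (endOf (pairUp (through ν))) η) ⟧))
  axisSum-closed half η = ℤ.*-cancelˡ-≡ (pow2 pairs) _ _ {{pow2-nonZero pairs}} (begin
    pow2 pairs ℤ.* axisSum (pairUp (through ν)) (shade η)
      ≡⟨ axisSum-pairs (through ν) through-ready (shade η) ⟩
    pairSigns (pairUp (through ν)) (shade η) ℤ.* (scale (core ν) ℤ.* ⟦ constant (core ν) [ clears (pairUp (through ν)) (shade η) , const false ] ⟧)
      ≡⟨ cong₂ (λ x y → pairSigns (pairUp (through ν)) (shade η) ℤ.* (x ℤ.* ⟦ y ⟧)) (core-scale half)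
           (constant-cong {f = core ν} {core ν} {[ clears (pairUp (through ν)) (shade η) , const false ]} {[ mask (shade η) , const false ]} (λ _ → refl)
             λ { (inj₁ i) → masked i (th i) refl ; (inj₂ _) → refl }) ⟩
    pairSigns (pairUp (through ν)) (shade η) ℤ.* (pow2 pairs ℤ.* A)
      ≡⟨ cong (ℤ._* (pow2 pairs ℤ.* A)) (pairSigns-shade (through ν) η half (All.map neighbours-parity (proj₂ (proj₂ through-ready)))) ⟩
    sg (⊕-list (through ν) (λ i → η i ∧ odd i)) ℤ.* (sg (par pairs) ℤ.* ⟦ opposed (pairUp (through ν)) η ⟧) ℤ.* (pow2 pairs ℤ.* A)
      ≡⟨ cong₂ (λ x y → sg x ℤ.* (sg (par pairs) ℤ.* ⟦ y ⟧) ℤ.* (pow2 pairs ℤ.* A)) (⊕-filterᵇ th (λ i → η i ∧ odd i) id) (opposed-through η half) ⟩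
    sg (throughShades η) ℤ.* (sg (par pairs) ℤ.* O) ℤ.* (pow2 pairs ℤ.* A)
      ≡⟨ shuffle (sg (throughShades η)) (sg (par pairs)) O (pow2 pairs) A ⟩
    pow2 pairs ℤ.* (sg (throughShades η) ℤ.* (sg (par pairs) ℤ.* (A ℤ.* O))) ∎)
    where
    open ≡-Reasoning
    A = ⟦ arcsConstant (shade η) ⟧
    O = ⟦ does (opposed? (endOf (pairUp (through ν))) η) ⟧
    shuffle : ∀ x s o k y → x ℤ.* (s ℤ.* o) ℤ.* (k ℤ.* y) ≡ k ℤ.* (x ℤ.* (s ℤ.* (y ℤ.* o)))
    shuffle = solve-∀
    masked : ∀ i b → th i ≡ b → clears (pairUp (through ν)) (shade η) i ≡ (if b then false else shade η i)
    masked i true  e = clears-∈ (through ν) (shade η) half (∈-filterᵇ⁺ th (∈-allFin i) e)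
    masked i false e = clears-∉ (through ν) (shade η) (All.map (λ { tz refl → contradiction (trans (sym e) tz) λ () }) (all-filterᵇ th (allFin m)))

  module _ {us : List (Crossing m)} (axis : ∀ y → map proj₁ y ≡ us → State (proj₁ (axisPicture y))) where

    pictureSym-state : ∀ cs x y → All (λ (a , b) → Neighbours th a b) cs → map proj₁ x ≡ cs → map proj₁ y ≡ us →
                       State (proj₁ (pictureSym ν (x , y)))
    pictureSym-state [] [] y _ _ ey = axis y ey
    pictureSym-state (_ ∷ cs) ((_ , u) ∷ x) y (N ∷ Ns) ex ey
      with List.∷-injective ex | pictureSym-state cs x y Ns (proj₂ (List.∷-injective ex)) ey | u
    ... | _    , _ | St | horizontal = St
    ... | refl , _ | St | vertical   = glueBoth-state N St

    term : (Fin m → Bool) → Uncrossed m → Uncrossed m → ℤ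
    term ε x y = ℤP.weight (proj₂ (pictureSym ν (x , y))) (verticals y ℕ.+ horizontals x) ℤ.* colour (proj₁ (pictureSym ν (x , y))) ε

    drawingSum : List (Crossing m) → (Fin m → Bool) → ℤ
    drawingSum cs ε = ℤP.∑ (uncrossings cs) λ x → ℤP.∑ (uncrossings us) λ y → term ε x y

    -- Both members of a paired crossing follow one choice, so the vertical uncrossing is a
    -- `glueBoth`, whose effect on colours is that of a single piece. The sum over the axis
    -- crossings stays inside and is acted on linearly.
    drawingSum-crossing : ∀ a b cs → Neighbours th a b → All (λ (a , b) → Neighbours th a b) cs → ∀ ε →
                          drawingSum ((a , b) ∷ cs) ε ≡ crossing a b (drawingSum cs) ε
    drawingSum-crossing a b cs N Ns ε = begin
      drawingSum ((a , b) ∷ cs) ε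
        ≡⟨ ℤS.∑-uncrossings (a , b) cs {λ x → ℤP.∑ (uncrossings us) (term ε x)} ⟩
      ℤP.∑ (uncrossings cs) (λ x → ℤP.∑ (uncrossings us) (term ε (((a , b) , vertical) ∷ x)) ℤ.+ ℤP.∑ (uncrossings us) (term ε (((a , b) , horizontal) ∷ x)))
        ≡⟨ ℤS.∑-cong-All (All.map (λ {x} ex → cong₂ ℤ._+_
             (trans (ℤS.∑-cong-All (All.map (λ {y} ey → vertically x y (pictureSym-state cs x y Ns ex ey)) (uncrossings-crossings us)))
                    (cupcap-∑ (uncrossings us) a b (λ ζ → term ζ x) ε))
             (trans (ℤS.∑-cong (uncrossings us) (horizontally x)) (∑-neg (uncrossings us) {term ε x}))) (uncrossings-crossings cs)) ⟩
      ℤP.∑ (uncrossings cs) (λ x → cupcap a b (λ ζ → inner ζ x) ε ℤ.+ ℤ.- inner ε x)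
        ≡⟨ ℤS.∑-+ (uncrossings cs) {λ x → cupcap a b (λ ζ → inner ζ x) ε} {λ x → ℤ.- inner ε x} ⟩
      ℤP.∑ (uncrossings cs) (λ x → cupcap a b (λ ζ → inner ζ x) ε) ℤ.+ ℤP.∑ (uncrossings cs) (λ x → ℤ.- inner ε x)
        ≡⟨ cong₂ ℤ._+_ (cupcap-∑ (uncrossings cs) a b inner ε) (∑-neg (uncrossings cs) {inner ε}) ⟩
      crossing a b (drawingSum cs) ε ∎
      where
      open ≡-Reasoning
      inner : (Fin m → Bool) → Uncrossed m → ℤ
      inner ζ x = ℤP.∑ (uncrossings us) (term ζ x)
      horizontally : ∀ x y → term ε (((a , b) , horizontal) ∷ x) y ≡ ℤ.- term ε x y
      horizontally x y = trans
        (cong (ℤ._* colour f ε) (trans (cong (ℤP.weight l) (ℕ.+-suc (verticals y) (horizontals x))) (weight-suc l (verticals y ℕ.+ horizontals x))))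
        (sym (ℤ.neg-distribˡ-* (ℤP.weight l (verticals y ℕ.+ horizontals x)) (colour f ε)))
        where
        f = proj₁ (pictureSym ν (x , y))
        l = proj₂ (pictureSym ν (x , y))
      vertically : ∀ x y → State (proj₁ (pictureSym ν (x , y))) →
                   term ε (((a , b) , vertical) ∷ x) y ≡ cupcap a b (λ ζ → term ζ x y) ε
      vertically x y St = begin
        ℤP.weight (λ′ ℕ.+ l) k ℤ.* colour f₂ ε            ≡⟨ cong (ℤ._* colour f₂ ε) (trans (weight-+ λ′ l k) (ℤ.*-comm (pow2 λ′) _)) ⟩
        ℤP.weight l k ℤ.* pow2 λ′ ℤ.* colour f₂ ε         ≡⟨ ℤ.*-assoc (ℤP.weight l k) (pow2 λ′) _ ⟩
        ℤP.weight l k ℤ.* (pow2 λ′ ℤ.* colour f₂ ε)       ≡⟨ cong (ℤP.weight l k ℤ.*_) (glueBoth-colour (State.symmetricState St) (neighbours-≢ N) ε) ⟩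
        ℤP.weight l k ℤ.* cupcap a b (colour f) ε         ≡⟨ cupcap-* (ℤP.weight l k) a b (colour f) ε ⟩
        cupcap a b (λ ζ → term ζ x y) ε                   ∎
        where
        f = proj₁ (pictureSym ν (x , y))
        f₂ = reconnectBoth a b f
        λ′ = loop (inj₁ a) (inj₁ b) f ⊔ loop (inj₂ a) (inj₂ b) (reconnect (inj₁ a) (inj₁ b) f)
        l = proj₂ (pictureSym ν (x , y))
        k = verticals y ℕ.+ horizontals x

colour-cong : {f : Point m → Point m} → Extensional (colour f)
colour-cong {f = f} {ε} {ζ} e = cong (λ x → scale f ℤ.* ⟦ x ⟧)
  (constant-cong {f = f} {f} {[ ε , const false ]} {[ ζ , const false ]} (λ _ → refl) λ { (inj₁ i) → e i ; (inj₂ _) → refl })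

transpose-invariant : ∀ {A : Set} (h : Fin m → A) {a b} → h a ≡ h b → ∀ i → h (transpose a b i) ≡ h i
transpose-invariant h {a} {b} e i with i F.≟ a
... | yes refl = sym e
... | no _ with i F.≟ b
...   | yes refl = e
...   | no _ = refl

module DrawingVector {m} (ν : Point m → Point m) (C : SymmetricState (core ν)) (half : halves (through ν)) where

  open StateVector ν C public

  axisCrossings : List (Crossing m)
  axisCrossings = pairUp (through ν)

  axis : ∀ y → map proj₁ y ≡ axisCrossings → State (proj₁ (axisPicture y))
  axis y e = proj₁ (axisPicture-state (through ν) y through-ready e)

  vector : List (Crossing m) → (Fin m → Bool) → ℤ
  vector = drawingSum axis

  vector-cong : ∀ cs → Extensional (vector cs)
  vector-cong cs {ε} {ζ} e = ℤS.∑-cong (uncrossings cs) λ x → ℤS.∑-cong (uncrossings axisCrossings) λ y →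
    cong (ℤP.weight (proj₂ (pictureSym ν (x , y))) (verticals y ℕ.+ horizontals x) ℤ.*_) (colour-cong {f = proj₁ (pictureSym ν (x , y))} {ε} {ζ} e)

  -- The complete drawing with an arbitrary list as its left half, so that an induction can add one
  -- paired crossing at a time.
  whole : List (Crossing m) → List (Crossing m)
  whole cs = cs ++ axisCrossings ++ reverse cs

  -- The new first crossing reappears, reflected, as the last one, so the end permutation is
  -- conjugated by the transposition.
  whole-∷ : ∀ a b cs i → endOf (whole ((a , b) ∷ cs)) i ≡ transpose a b (endOf (whole cs) (transpose a b i))
  whole-∷ a b cs i = begin
    endOf (cs ++ axisCrossings ++ reverse ((a , b) ∷ cs)) j          ≡⟨ cong (λ ds → endOf (cs ++ axisCrossings ++ ds) j) (List.unfold-reverse (a , b) cs) ⟩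
    endOf (cs ++ axisCrossings ++ (reverse cs ∷ʳ (a , b))) j          ≡⟨ cong (λ ds → endOf (cs ++ ds) j) (List.++-assoc axisCrossings (reverse cs) _) ⟨
    endOf (cs ++ (axisCrossings ++ reverse cs) ∷ʳ (a , b)) j          ≡⟨ cong (λ ds → endOf ds j) (List.++-assoc cs (axisCrossings ++ reverse cs) _) ⟨
    endOf (whole cs ∷ʳ (a , b)) j                                     ≡⟨ endOf-++ (whole cs) ((a , b) ∷ []) j ⟩
    transpose a b (endOf (whole cs) j)                                ∎
    where
    open ≡-Reasoning
    j = transpose a b i

  -- The twist extends over all slots, but exchanges move only through slots. The twist of the arc
  -- slots is therefore constant throughout the induction and is kept as a factor here.
  kernel : (Fin m → Fin m) → (Fin m → Bool) → ℤ
  kernel ρ η = sg (arcShades η) ℤ.* (⟦ arcsConstant (shade η) ⟧ ℤ.* ⟦ does (opposed? ρ η) ⟧)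

  -- Exchanging two through slots leaves the arcs alone and conjugates the permutation in the
  -- condition of opposite colours.
  kernel-transpose : ∀ {a b} → th a ≡ true → th b ≡ true → ∀ {ρ ρ′} → (∀ i → ρ′ i ≡ transpose a b (ρ (transpose a b i))) →
                     ∀ η → kernel ρ (η ∘ transpose a b) ≡ kernel ρ′ η
  kernel-transpose {a} {b} ta tb {ρ} {ρ′} eq η = cong₂ ℤ._*_ (cong sg (⊕.sum-cong-≗ λ i → arcs i (th i) refl))
    (cong₂ (λ x y → ⟦ x ⟧ ℤ.* ⟦ y ⟧) (arcsConstant-cong λ i e → cong (_xor odd i) (cong η (fixed i e)))
      (decide to from (opposed? ρ (η ∘ τ)) (opposed? ρ′ η)))
    where
    τ = transpose a b
    fixed : ∀ i → th i ≡ false → τ i ≡ i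
    fixed i e = transpose-other a b (λ { refl → contradiction (trans (sym e) ta) λ () }) (λ { refl → contradiction (trans (sym e) tb) λ () })
    arcs : ∀ i t → th i ≡ t → not t ∧ (η (τ i) ∧ odd i) ≡ not t ∧ (η i ∧ odd i)
    arcs i true  _ = refl
    arcs i false e = cong (λ j → η j ∧ odd i) (fixed i e)
    th-τ : ∀ i → th i ≡ true → th (τ i) ≡ true
    th-τ i = trans (transpose-invariant th (trans ta (sym tb)) i)
    to : Opposed ρ (η ∘ τ) → Opposed ρ′ η
    to o i ti = trans (cong η (eq i)) (trans (o (τ i) (th-τ i ti)) (cong (not ∘ η) (transpose-involutive a b i)))
    from : Opposed ρ′ η → Opposed ρ (η ∘ τ)
    from o i ti = trans (cong η (sym (trans (eq (τ i)) (cong (τ ∘ ρ) (transpose-involutive a b i))))) (o (τ i) (th-τ i ti))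

  -- On the axis the twist of the through slots cancels against the sign in `axisSum-closed`. Every
  -- paired crossing then exchanges two factors, which conjugates the end permutation, and
  -- contributes `-1`.
  twisted-vector : ∀ cs → All (λ (a , b) → Neighbours th a b) cs → ∀ η →
                   twisted (vector cs) η ≡ sg (par (length cs) xor par pairs) ℤ.* kernel (endOf (whole cs)) η
  twisted-vector [] [] η = begin
    sg (oddShades η) ℤ.* (axisVector ℤ.+ 0ℤ)
      ≡⟨ cong₂ (λ x y → sg x ℤ.* y) (oddShades-split η) (trans (ℤ.+-identityʳ _) (trans
           (ℤS.∑-cong (uncrossings axisCrossings) λ y → cong (λ k → ℤP.weight (proj₂ (axisPicture y)) k ℤ.* colour (proj₁ (axisPicture y)) (shade η)) (ℕ.+-identityʳ (verticals y)))
           (axisSum-closed half η))) ⟩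
    sg (throughShades η xor arcShades η) ℤ.* (sg (throughShades η) ℤ.* (sg (par pairs) ℤ.* D))
      ≡⟨ cong (ℤ._* (sg (throughShades η) ℤ.* (sg (par pairs) ℤ.* D))) (sg-xor (throughShades η) (arcShades η)) ⟩
    sg (throughShades η) ℤ.* sg (arcShades η) ℤ.* (sg (throughShades η) ℤ.* (sg (par pairs) ℤ.* D))
      ≡⟨ shuffle (sg (throughShades η)) (sg (arcShades η)) (sg (par pairs)) D ⟩
    sg (throughShades η) ℤ.* sg (throughShades η) ℤ.* (sg (par pairs) ℤ.* (sg (arcShades η) ℤ.* D))
      ≡⟨ trans (cong (ℤ._* (sg (par pairs) ℤ.* (sg (arcShades η) ℤ.* D))) (sg-square (throughShades η))) (ℤ.*-identityˡ _) ⟩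
    sg (par pairs) ℤ.* (sg (arcShades η) ℤ.* D)
      ≡⟨ cong (λ ds → sg (par pairs) ℤ.* (sg (arcShades η) ℤ.* (⟦ arcsConstant (shade η) ⟧ ℤ.* ⟦ does (opposed? (endOf ds) η) ⟧))) (List.++-identityʳ axisCrossings) ⟨
    sg (par pairs) ℤ.* kernel (endOf (whole [])) η ∎
    where
    open ≡-Reasoning
    axisVector = ℤP.∑ (uncrossings axisCrossings) λ y → term axis (shade η) [] y
    D = ⟦ arcsConstant (shade η) ⟧ ℤ.* ⟦ does (opposed? (endOf axisCrossings) η) ⟧
    shuffle : ∀ t a p d → t ℤ.* a ℤ.* (t ℤ.* (p ℤ.* d)) ≡ t ℤ.* t ℤ.* (p ℤ.* (a ℤ.* d))
    shuffle = solve-∀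
  twisted-vector ((a , b) ∷ cs) (N@(_ , ta , tb , _) ∷ Ns) η = begin
    sg (oddShades η) ℤ.* vector ((a , b) ∷ cs) (shade η)
      ≡⟨ cong (sg (oddShades η) ℤ.*_) (drawingSum-crossing axis a b cs N Ns (shade η)) ⟩
    twisted (crossing a b (vector cs)) η
      ≡⟨ twisted-crossing (vector-cong cs) (neighbours-≢ N) (neighbours-parity N) η ⟩
    ℤ.- twisted (vector cs) (η ∘ transpose a b)
      ≡⟨ cong ℤ.-_ (twisted-vector cs Ns (η ∘ transpose a b)) ⟩
    ℤ.- (sg s ℤ.* kernel (endOf (whole cs)) (η ∘ transpose a b))
      ≡⟨ ℤ.neg-distribˡ-* (sg s) _ ⟩
    (ℤ.- sg s) ℤ.* kernel (endOf (whole cs)) (η ∘ transpose a b)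
      ≡⟨ cong₂ ℤ._*_ (trans (sym (sg-not s)) (cong sg (𝔹.not-distribˡ-xor (par (length cs)) (par pairs)))) (kernel-transpose ta tb {endOf (whole cs)} {endOf (whole ((a , b) ∷ cs))} (whole-∷ a b cs) η) ⟩
    sg (par (suc (length cs)) xor par pairs) ℤ.* kernel (endOf (whole ((a , b) ∷ cs))) η ∎
    where
    open ≡-Reasoning
    s = par (length cs) xor par pairs

  module _ (E : SymmetricDrawing ν) where

    open SymmetricDrawing E using (paired; adjacent)

    -- Multiplying by the twist once more removes it from the left-hand side; its arc part squares
    -- away with that of `kernel` and its through part remains.
    vector-closed : ∀ η → vector paired (shade η) ≡
      sg (throughShades η xor (par (length paired) xor par pairs)) ℤ.*
      (⟦ arcsConstant (shade η) ⟧ ℤ.* ⟦ does (opposed? (endOf (SymmetricDrawing.whole E)) η) ⟧)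
    vector-closed η = begin
      V
        ≡⟨ sym (trans (cong (ℤ._* V) (sg-square (oddShades η))) (ℤ.*-identityˡ V)) ⟩
      sg (oddShades η) ℤ.* sg (oddShades η) ℤ.* V
        ≡⟨ ℤ.*-assoc (sg (oddShades η)) (sg (oddShades η)) V ⟩
      sg (oddShades η) ℤ.* twisted (vector paired) η
        ≡⟨ cong₂ (λ x y → sg x ℤ.* y) (oddShades-split η) (twisted-vector paired (All.map consecutive-neighbours adjacent) η) ⟩
      sg (throughShades η xor arcShades η) ℤ.* (sg s ℤ.* (sg (arcShades η) ℤ.* D))
        ≡⟨ cong (ℤ._* (sg s ℤ.* (sg (arcShades η) ℤ.* D))) (sg-xor (throughShades η) (arcShades η)) ⟩
      sg (throughShades η) ℤ.* sg (arcShades η) ℤ.* (sg s ℤ.* (sg (arcShades η) ℤ.* D))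
        ≡⟨ shuffle (sg (throughShades η)) (sg (arcShades η)) (sg s) D ⟩
      sg (arcShades η) ℤ.* sg (arcShades η) ℤ.* (sg (throughShades η) ℤ.* sg s ℤ.* D)
        ≡⟨ trans (cong (ℤ._* (sg (throughShades η) ℤ.* sg s ℤ.* D)) (sg-square (arcShades η))) (ℤ.*-identityˡ _) ⟩
      sg (throughShades η) ℤ.* sg s ℤ.* D
        ≡⟨ cong (ℤ._* D) (sg-xor (throughShades η) s) ⟨
      sg (throughShades η xor s) ℤ.* D ∎
      where
      open ≡-Reasoning
      V = vector paired (shade η)
      s = par (length paired) xor par pairs
      D = ⟦ arcsConstant (shade η) ⟧ ℤ.* ⟦ does (opposed? (endOf (SymmetricDrawing.whole E)) η) ⟧
      shuffle : ∀ t a p d → t ℤ.* a ℤ.* (p ℤ.* (a ℤ.* d)) ≡ a ℤ.* a ℤ.* (t ℤ.* p ℤ.* d)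
      shuffle = solve-∀

symmetricState-cong : {f g : Point m → Point m} → f ≗ g → SymmetricState f → SymmetricState g
symmetricState-cong {f = f} {g} e (state (inv , nofix) planar symm) = state
  ((λ p → trans (sym (trans (cong f (e p)) (e (g p)))) (inv p)) , λ p → nofix p ∘ trans (e p))
  (planar-cong e planar)
  (λ p → trans (sym (e (mirror p))) (trans (symm p) (cong mirror (e p))))

mirror-state : SymmetricState (mirror {m})
mirror-state {m} = state (mirror-mirror , noFix) planar λ _ → refl
  where
  noFix : ∀ p → mirror {m} p ≢ p
  noFix (inj₁ _) ()
  noFix (inj₂ _) ()
  flipped : ∀ {i j : Fin m} → i ≢ j → (toℕ i ℕ.<ᵇ toℕ j) ≡ not (toℕ j ℕ.<ᵇ toℕ i)
  flipped i≢j = <ᵇ-flip (i≢j ∘ F.toℕ-injective)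
  planar : Planar (mirror {m})
  planar (inj₁ i) (inj₁ j) z≢x z≢x̄
    rewrite lt-left-left i j | lt-right-left i j | lt-left-right i j | lt-right-right i j | flipped {i} {j} (z≢x ∘ sym ∘ cong inj₁)
    = xor-identityʳ _
  planar (inj₁ i) (inj₂ j) z≢x z≢x̄
    rewrite lt-left-left i j | lt-right-left i j | lt-left-right i j | lt-right-right i j | flipped {i} {j} (z≢x̄ ∘ sym ∘ cong inj₂)
    = sym (xor-identityʳ _)
  planar (inj₂ i) (inj₁ j) z≢x z≢x̄
    rewrite lt-left-left i j | lt-right-left i j | lt-left-right i j | lt-right-right i j | flipped {i} {j} (z≢x̄ ∘ sym ∘ cong inj₁)
    = sym (xor-comm (toℕ j ℕ.<ᵇ toℕ i) true)
  planar (inj₂ i) (inj₂ j) z≢x z≢x̄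
    rewrite lt-left-left i j | lt-right-left i j | lt-left-right i j | lt-right-right i j | flipped {i} {j} (z≢x ∘ sym ∘ cong inj₂)
    = xor-comm (toℕ j ℕ.<ᵇ toℕ i) true

core-mirror : (ν : Point m → Point m) → (∀ i → isRight (ν (inj₁ i)) ≡ true) → (∀ i → isRight (ν (inj₂ i)) ≡ false) →
              mirror ≗ core ν
core-mirror ν e e′ (inj₁ i) rewrite e i = refl
core-mirror ν e e′ (inj₂ i) rewrite e′ i = refl

-- The state vector of a wiring

-- In a wiring diagram all slots are through slots and there are no arcs, so planarity of gluings
-- and parity of neighbours come from the layout of `mirror`.
module Mirror n = Layout (mirror {n}) (symmetricState-cong (core-mirror mirror (λ _ → refl) λ _ → refl) mirror-state)

filterᵇ-all : {A : Set} {P : A → Bool} (xs : List A) → (∀ x → P x ≡ true) → filterᵇ P xs ≡ xs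
filterᵇ-all [] e = refl
filterᵇ-all {P = P} (x ∷ xs) e rewrite e x = cong (x ∷_) (filterᵇ-all xs e)

wire-neighbours : ∀ {a b : Fin n} → (a , b) ∈ consecutive (allFin n) → Neighbours (const true) a b
wire-neighbours {n} i with neighbours (const true) (sorted-allFin n) (subst (λ xs → _ ∈ consecutive xs) (sym (filterᵇ-all (allFin n) λ _ → refl)) i)
... | a<b , _ , _ , gap = a<b , refl , refl , λ c → gap (∈-allFin c)

pictureTL-planar : ∀ {cs : List (Crossing n)} x → All (_∈ consecutive (allFin n)) cs → map proj₁ x ≡ cs →
                   IsMatching (proj₁ (pictureTL x)) × Planar (proj₁ (pictureTL x))
pictureTL-planar [] _ _ = SymmetricState.matching mirror-state , SymmetricState.planar mirror-state
pictureTL-planar {n} ((_ , u) ∷ x) (c ∷ cs) refl with pictureTL-planar x cs refl | u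
... | M , planar | horizontal = M , planar
... | M , planar | vertical =
  reconnect-matching (Mirror.neighbours-≢ n (wire-neighbours c) ∘ inj₁-injective) M ,
  Mirror.glue-planar n (wire-neighbours c) M (λ { (inj₁ _) () ; (inj₂ _) () }) planar

-- The right ends keep a fixed colouring `ρ`, so the vector is a function of the left colours on
-- which crossings act as before.
module WiringVector {n} (ρ : Fin n → Bool) where

  wireTerm : (Fin n → Bool) → Uncrossed n → ℤ
  wireTerm ε x = ℤP.weight (proj₂ (pictureTL x)) (horizontals x) ℤ.* ⟦ constant (proj₁ (pictureTL x)) [ ε , ρ ] ⟧

  wireVector : List (Crossing n) → (Fin n → Bool) → ℤ
  wireVector cs ε = ℤP.∑ (uncrossings cs) (wireTerm ε)

  wireVector-cong : ∀ cs → Extensional (wireVector cs)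
  wireVector-cong cs {ε} {ζ} e = ℤS.∑-cong (uncrossings cs) λ x →
    cong (λ y → ℤP.weight (proj₂ (pictureTL x)) (horizontals x) ℤ.* ⟦ y ⟧)
      (constant-cong {f = proj₁ (pictureTL x)} {_} {[ ε , ρ ]} {[ ζ , ρ ]} (λ _ → refl) λ { (inj₁ i) → e i ; (inj₂ _) → refl })

  wireVector-crossing : ∀ a b cs → (a , b) ∈ consecutive (allFin n) → All (_∈ consecutive (allFin n)) cs → ∀ ε →
                        wireVector ((a , b) ∷ cs) ε ≡ crossing a b (wireVector cs) ε
  wireVector-crossing a b cs c Ns ε = begin
    wireVector ((a , b) ∷ cs) ε
      ≡⟨ ℤS.∑-uncrossings (a , b) cs {wireTerm ε} ⟩
    ℤP.∑ (uncrossings cs) (λ x → wireTerm ε (((a , b) , vertical) ∷ x) ℤ.+ wireTerm ε (((a , b) , horizontal) ∷ x))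
      ≡⟨ ℤS.∑-cong-All (All.map (λ {x} ex → cong₂ ℤ._+_ (vertically x (proj₁ (pictureTL-planar x Ns ex))) (horizontally x)) (uncrossings-crossings cs)) ⟩
    ℤP.∑ (uncrossings cs) (λ x → cupcap a b (λ ζ → wireTerm ζ x) ε ℤ.+ ℤ.- wireTerm ε x)
      ≡⟨ ℤS.∑-+ (uncrossings cs) {λ x → cupcap a b (λ ζ → wireTerm ζ x) ε} {λ x → ℤ.- wireTerm ε x} ⟩
    ℤP.∑ (uncrossings cs) (λ x → cupcap a b (λ ζ → wireTerm ζ x) ε) ℤ.+ ℤP.∑ (uncrossings cs) (λ x → ℤ.- wireTerm ε x)
      ≡⟨ cong₂ ℤ._+_ (cupcap-∑ (uncrossings cs) a b wireTerm ε) (∑-neg (uncrossings cs) {wireTerm ε}) ⟩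
    crossing a b (wireVector cs) ε ∎
    where
    open ≡-Reasoning
    horizontally : ∀ x → wireTerm ε (((a , b) , horizontal) ∷ x) ≡ ℤ.- wireTerm ε x
    horizontally x = trans (cong (ℤ._* v) (weight-suc (proj₂ (pictureTL x)) (horizontals x)))
                           (sym (ℤ.neg-distribˡ-* (ℤP.weight (proj₂ (pictureTL x)) (horizontals x)) v))
      where v = ⟦ constant (proj₁ (pictureTL x)) [ ε , ρ ] ⟧
    vertically : ∀ x → IsMatching (proj₁ (pictureTL x)) → wireTerm ε (((a , b) , vertical) ∷ x) ≡ cupcap a b (λ ζ → wireTerm ζ x) ε
    vertically x M = begin
      ℤP.weight (j ℕ.+ l) k ℤ.* v        ≡⟨ cong (ℤ._* v) (trans (weight-+ j l k) (ℤ.*-comm (pow2 j) _)) ⟩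
      ℤP.weight l k ℤ.* pow2 j ℤ.* v     ≡⟨ ℤ.*-assoc (ℤP.weight l k) (pow2 j) v ⟩
      ℤP.weight l k ℤ.* (pow2 j ℤ.* v)   ≡⟨ cong (ℤP.weight l k ℤ.*_) (glue-colour ρ ε M (Mirror.neighbours-≢ n (wire-neighbours c))) ⟩
      ℤP.weight l k ℤ.* cupcap a b (λ ζ → ⟦ constant f [ ζ , ρ ] ⟧) ε ≡⟨ cupcap-* (ℤP.weight l k) a b (λ ζ → ⟦ constant f [ ζ , ρ ] ⟧) ε ⟩
      cupcap a b (λ ζ → wireTerm ζ x) ε  ∎
      where
      f = proj₁ (pictureTL x)
      l = proj₂ (pictureTL x)
      k = horizontals x
      j = loop (inj₁ a) (inj₁ b) f
      v = ⟦ constant (reconnect (inj₁ a) (inj₁ b) f) [ ε , ρ ] ⟧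

  Joined : (Fin n → Fin n) → (Fin n → Bool) → Set
  Joined w η = ∀ i → η i ≡ ρ (w i) xor odd (w i)

  joined? : ∀ w η → Dec (Joined w η)
  joined? w η = F.all? λ i → η i 𝔹.≟ (ρ (w i) xor odd (w i))

  -- The twist, with parities taken at the slots where the wires end instead of those where they
  -- start.
  carriedShades : (Fin n → Fin n) → (Fin n → Bool) → Bool
  carriedShades w η = ⊕.sum λ i → η i ∧ odd (w i)

  -- Without crossings the vector is the indicator of `ρ` and the twist refers to the slots
  -- themselves. Each exchange carries both back along the wires, which is how the end slots enter,
  -- and contributes `-1`.
  twisted-wireVector : ∀ cs → All (_∈ consecutive (allFin n)) cs → ∀ η →
    twisted (wireVector cs) η ≡ sg (par (length cs) xor carriedShades (endOf cs) η) ℤ.* ⟦ does (joined? (endOf cs) η) ⟧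
  twisted-wireVector [] _ η = cong (sg (oddShades η) ℤ.*_) (trans (ℤ.+-identityʳ _) (trans (ℤ.*-identityˡ _)
    (cong ⟦_⟧ (decide to from (constant? mirror [ shade η , ρ ]) (joined? id η)))))
    where
    xor-move : ∀ {x y o} → y ≡ x xor o → x ≡ y xor o
    xor-move {x} {y} {o} refl = sym (trans (xor-assoc x o o) (trans (cong (x xor_) (xor-same o)) (xor-identityʳ x)))
    to : Constant mirror [ shade η , ρ ] → Joined id η
    to c i = xor-move (c (inj₁ i))
    from : Joined id η → Constant mirror [ shade η , ρ ]
    from j (inj₁ i) = xor-move (j i)
    from j (inj₂ i) = sym (xor-move (j i))
  twisted-wireVector ((a , b) ∷ cs) (c ∷ Ns) η = begin
    twisted (wireVector ((a , b) ∷ cs)) η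
      ≡⟨ cong (sg (oddShades η) ℤ.*_) (wireVector-crossing a b cs c Ns (shade η)) ⟩
    twisted (crossing a b (wireVector cs)) η
      ≡⟨ twisted-crossing (wireVector-cong cs) (Mirror.neighbours-≢ n (wire-neighbours c)) (Mirror.neighbours-parity n (wire-neighbours c)) η ⟩
    ℤ.- twisted (wireVector cs) (η ∘ τ)
      ≡⟨ cong ℤ.-_ (twisted-wireVector cs Ns (η ∘ τ)) ⟩
    ℤ.- (sg (p xor carriedShades (endOf cs) (η ∘ τ)) ℤ.* ⟦ does (joined? (endOf cs) (η ∘ τ)) ⟧)
      ≡⟨ ℤ.neg-distribˡ-* (sg (p xor carriedShades (endOf cs) (η ∘ τ))) _ ⟩
    (ℤ.- sg (p xor carriedShades (endOf cs) (η ∘ τ))) ℤ.* ⟦ does (joined? (endOf cs) (η ∘ τ)) ⟧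
      ≡⟨ cong₂ (λ x y → x ℤ.* ⟦ y ⟧) (trans (sym (sg-not _)) (cong sg (trans (𝔹.not-distribˡ-xor p _) (cong (not p xor_) carried))))
           (decide to from (joined? (endOf cs) (η ∘ τ)) (joined? (endOf cs ∘ τ) η)) ⟩
    sg (not p xor carriedShades (endOf cs ∘ τ) η) ℤ.* ⟦ does (joined? (endOf cs ∘ τ) η) ⟧ ∎
    where
    open ≡-Reasoning
    τ = transpose a b
    p = par (length cs)
    carried : carriedShades (endOf cs) (η ∘ τ) ≡ carriedShades (endOf cs ∘ τ) η
    carried = trans (⊕-involution τ (transpose-involutive a b) (λ i → η (τ i) ∧ odd (endOf cs i)))
      (⊕.sum-cong-≗ λ i → cong (λ j → η j ∧ odd (endOf cs (τ i))) (transpose-involutive a b i))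
    to : Joined (endOf cs) (η ∘ τ) → Joined (endOf cs ∘ τ) η
    to j i = trans (cong η (sym (transpose-involutive a b i))) (j (τ i))
    from : Joined (endOf cs ∘ τ) η → Joined (endOf cs) (η ∘ τ)
    from j i = trans (j (τ i)) (cong (λ k → ρ (endOf cs k) xor odd (endOf cs k)) (transpose-involutive a b i))

-- Counting crossings

ℕ∑-involution : (g : Fin n → Fin n) → (∀ k → g (g k) ≡ k) → (h : Fin n → ℕ) → ℕ∑.sum h ≡ ℕ∑.sum (h ∘ g)
ℕ∑-involution g inv h = ℕ∑.sum-permute h (involution-permutation g inv)

ℕ∑-zero : {h : Fin n → ℕ} → (∀ k → h k ≡ 0) → ℕ∑.sum h ≡ 0
ℕ∑-zero {n} e = trans (ℕ∑.sum-cong-≗ e) (ℕ∑.sum-replicate-zero n)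

par-+ : ∀ k l → par (k ℕ.+ l) ≡ par k xor par l
par-+ zero    l = refl
par-+ (suc k) l = trans (cong not (par-+ k l)) (𝔹.not-distribˡ-xor (par k) (par l))

par-bit : ∀ b → par (bit b) ≡ b
par-bit true  = refl
par-bit false = refl

par-∑ : (h : Fin n → ℕ) → par (ℕ∑.sum h) ≡ ⊕.sum (par ∘ h)
par-∑ {zero}  h = refl
par-∑ {suc n} h = trans (par-+ (h zero) _) (cong (par (h zero) xor_) (par-∑ (h ∘ suc)))

∑∑ : (Fin n → Fin n → ℕ) → ℕ
∑∑ M = ℕ∑.sum λ i → ℕ∑.sum λ j → M i j

∑∑-cong : {M N : Fin n → Fin n → ℕ} → (∀ i j → M i j ≡ N i j) → ∑∑ M ≡ ∑∑ N
∑∑-cong e = ℕ∑.sum-cong-≗ λ i → ℕ∑.sum-cong-≗ (e i)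

∑∑-+ : (M N : Fin n → Fin n → ℕ) → ∑∑ (λ i j → M i j ℕ.+ N i j) ≡ ∑∑ M ℕ.+ ∑∑ N
∑∑-+ M N = trans (ℕ∑.sum-cong-≗ λ i → ℕ∑.∑-distrib-+ (M i) (N i)) (ℕ∑.∑-distrib-+ (λ i → ℕ∑.sum (M i)) (λ i → ℕ∑.sum (N i)))

∑∑-involution : (g : Fin n → Fin n) → (∀ k → g (g k) ≡ k) → (M : Fin n → Fin n → ℕ) → ∑∑ M ≡ ∑∑ (λ i j → M (g i) (g j))
∑∑-involution g inv M = trans (ℕ∑.sum-cong-≗ λ i → ℕ∑-involution g inv (M i)) (ℕ∑-involution g inv (λ i → ℕ∑.sum (M i ∘ g)))

δ : Fin n → Fin n → ℕ
δ a i = if does (i F.≟ a) then 1 else 0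

∑∑-δ : (a b : Fin n) → ∑∑ (λ i j → δ a i ℕ.* δ b j) ≡ 1
∑∑-δ {n} a b = trans (ℕ∑.sum-cong-≗ row) (ℕ∑-single a 1)
  where
  row : ∀ i → ℕ∑.sum (λ j → δ a i ℕ.* δ b j) ≡ δ a i
  row i with does (i F.≟ a)
  ... | true  = trans (ℕ∑.sum-cong-≗ λ j → ℕ.+-identityʳ (δ b j)) (ℕ∑-single b 1)
  ... | false = ℕ∑.sum-replicate-zero n

hits : (a b i j : Fin n) → ℕ
hits a b i j = if (does (i F.≟ a) ∧ does (j F.≟ b)) ∨ (does (i F.≟ b) ∧ does (j F.≟ a)) then 1 else 0

∑∑-hits : {a b : Fin n} → a ≢ b → ∑∑ (hits a b) ≡ 2
∑∑-hits {a = a} {b} a≢b = trans (∑∑-cong split) (trans (∑∑-+ (λ i j → δ a i ℕ.* δ b j) (λ i j → δ b i ℕ.* δ a j))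
  (cong₂ ℕ._+_ (∑∑-δ a b) (∑∑-δ b a)))
  where
  split : ∀ i j → hits a b i j ≡ δ a i ℕ.* δ b j ℕ.+ δ b i ℕ.* δ a j
  split i j with i F.≟ a | i F.≟ b
  ... | yes refl | yes e = contradiction e a≢b
  ... | yes refl | no _ with does (j F.≟ b)
  ...   | true  = refl
  ...   | false = refl
  split i j | no _ | yes refl with does (j F.≟ a)
  ...   | true  = refl
  ...   | false = refl
  split i j | no _ | no _ = refl

-- Each crossing is the meeting of one unordered pair of wires, hence of two ordered ones. The sum
-- over the later crossings is unaffected by the relabelling with `τ`.
∑∑-meetings : ∀ (cs : List (Crossing m)) → All (λ (a , b) → a ≢ b) cs → ∑∑ (meetings cs) ≡ length cs ℕ.+ length cs
∑∑-meetings {m} [] [] = ℕ∑-zero {m} λ i → ℕ∑-zero {m} λ j → refl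
∑∑-meetings ((a , b) ∷ cs) (a≢b ∷ ne) = begin
  ∑∑ (meetings ((a , b) ∷ cs))                                          ≡⟨ ∑∑-+ (hits a b) (λ i j → meetings cs (τ i) (τ j)) ⟩
  ∑∑ (hits a b) ℕ.+ ∑∑ (λ i j → meetings cs (τ i) (τ j))                ≡⟨ cong₂ ℕ._+_ (∑∑-hits a≢b) (sym (∑∑-involution τ (transpose-involutive a b) (meetings cs))) ⟩
  2 ℕ.+ ∑∑ (meetings cs)                                                ≡⟨ cong (2 ℕ.+_) (∑∑-meetings cs ne) ⟩
  2 ℕ.+ (length cs ℕ.+ length cs)                                       ≡⟨ cong suc (ℕ.+-suc (length cs) (length cs)) ⟨
  suc (length cs) ℕ.+ suc (length cs)                                   ∎
  where
  open ≡-Reasoning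
  τ = transpose a b

meetings-same : ∀ (cs : List (Crossing m)) → All (λ (a , b) → a ≢ b) cs → ∀ i → meetings cs i i ≡ 0
meetings-same [] _ i = refl
meetings-same ((a , b) ∷ cs) (a≢b ∷ ne) i = cong₂ ℕ._+_ none (meetings-same cs ne (transpose a b i))
  where
  none : hits a b i i ≡ 0
  none with i F.≟ a | i F.≟ b
  ... | yes refl | yes e = contradiction e a≢b
  ... | yes _ | no _ = refl
  ... | no _ | yes _ = refl
  ... | no _ | no _ = refl

meetings-comm : ∀ (cs : List (Crossing m)) i j → meetings cs i j ≡ meetings cs j i
meetings-comm [] i j = refl
meetings-comm ((a , b) ∷ cs) i j = cong₂ ℕ._+_
  (cong bit (trans (𝔹.∨-comm (does (i F.≟ a) ∧ does (j F.≟ b)) _) (cong₂ _∨_ (𝔹.∧-comm (does (i F.≟ b)) _) (𝔹.∧-comm (does (i F.≟ a)) _))))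
  (meetings-comm cs (transpose a b i) (transpose a b j))

_⋖_ : Fin n → Fin n → Bool
i ⋖ j = toℕ i ℕ.<ᵇ toℕ j

module _ (P : Fin m → Bool) where

  neighbours-⋖ : ∀ {a b} → Neighbours P a b → ∀ {y} → P y ≡ true → y ≢ a → y ≢ b → (a ⋖ y) ≡ (b ⋖ y)
  neighbours-⋖ {a} {b} (a<b , _ , _ , gap) {y} Py y≢a y≢b with ℕ.<-cmp (toℕ a) (toℕ y) | ℕ.<-cmp (toℕ b) (toℕ y)
  ... | tri≈ _ e _ | _ = contradiction (sym (F.toℕ-injective e)) y≢a
  ... | _ | tri≈ _ e _ = contradiction (sym (F.toℕ-injective e)) y≢b
  ... | tri< a<y _ _ | tri< b<y _ _ = trans (<⇒lt a<y) (sym (<⇒lt b<y))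
  ... | tri< a<y _ _ | tri> _ _ y<b = contradiction (trans (sym Py) (gap y a<y y<b)) λ ()
  ... | tri> a≮y _ y<a | tri< b<y _ _ = contradiction (ℕ.<-trans (ℕ.<-trans a<b b<y) y<a) (ℕ.<-irrefl refl)
  ... | tri> a≮y _ _ | tri> b≮y _ _ = trans (≮⇒lt a≮y) (sym (≮⇒lt b≮y))

  ⋖-flip : ∀ {x y : Fin m} → x ≢ y → (x ⋖ y) ≡ not (y ⋖ x)
  ⋖-flip x≢y = <ᵇ-flip (x≢y ∘ F.toℕ-injective)

  neighbours-⋗ : ∀ {a b} → Neighbours P a b → ∀ {y} → P y ≡ true → y ≢ a → y ≢ b → (y ⋖ a) ≡ (y ⋖ b)
  neighbours-⋗ N Py y≢a y≢b = trans (⋖-flip y≢a) (trans (cong not (neighbours-⋖ N Py y≢a y≢b)) (sym (⋖-flip y≢b)))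

  -- Since no wire runs between neighbours, a crossing reverses the order of its own two wires and
  -- of no other pair.
  crossing-⋖ : ∀ {a b} → Neighbours P a b → ∀ {x y} → P x ≡ true → P y ≡ true → x ≢ y →
               par (hits a b x y) ≡ (x ⋖ y) xor (transpose a b x ⋖ transpose a b y)
  crossing-⋖ {a} {b} N@(a<b , _) {x} {y} Px Py x≢y = cases (x F.≟ a) (x F.≟ b) (y F.≟ a) (y F.≟ b)
    where
    τ = transpose a b
    finish : ∀ {p q r s u v} → does (x F.≟ a) ≡ p → does (x F.≟ b) ≡ q → does (y F.≟ a) ≡ r → does (y F.≟ b) ≡ s →
             τ x ≡ u → τ y ≡ v → (p ∧ s) ∨ (q ∧ r) ≡ (x ⋖ y) xor (u ⋖ v) →
             par (hits a b x y) ≡ (x ⋖ y) xor (τ x ⋖ τ y)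
    finish refl refl refl refl refl refl e = trans (par-bit _) e
    off : ∀ {c d : Fin m} → c ≢ d → does (c F.≟ d) ≡ false
    off {c} {d} = dec-false (c F.≟ d)
    on : ∀ (c : Fin m) → does (c F.≟ c) ≡ true
    on c = dec-true (c F.≟ c) refl
    unchanged : ∀ {p} → x ⋖ y ≡ p → false ≡ (x ⋖ y) xor p
    unchanged e = sym (trans (cong ((x ⋖ y) xor_) (sym e)) (xor-same (x ⋖ y)))
    a≢b : a ≢ b
    a≢b refl = ℕ.<-irrefl refl a<b
    cases : Dec (x ≡ a) → Dec (x ≡ b) → Dec (y ≡ a) → Dec (y ≡ b) → par (hits a b x y) ≡ (x ⋖ y) xor (τ x ⋖ τ y)
    cases (yes refl) (yes e) _ _ = contradiction e a≢b
    cases _ _ (yes refl) (yes e) = contradiction e a≢b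
    cases (yes refl) _ (yes refl) _ = contradiction refl x≢y
    cases _ (yes refl) _ (yes refl) = contradiction refl x≢y
    cases (yes refl) (no x≢b) (no y≢a) (yes refl) = finish (on a) (off x≢b) (off y≢a) (on b) (transpose-a a b) (transpose-b a b)
      (sym (cong₂ _xor_ (<⇒lt a<b) (≮⇒lt (ℕ.<-asym a<b))))
    cases (no x≢a) (yes refl) (yes refl) (no y≢b) = finish (off x≢a) (on b) (on a) (off y≢b) (transpose-b a b) (transpose-a a b)
      (sym (cong₂ _xor_ (≮⇒lt (ℕ.<-asym a<b)) (<⇒lt a<b)))
    cases (yes refl) (no x≢b) (no y≢a) (no y≢b) = finish (on a) (off x≢b) (off y≢a) (off y≢b) (transpose-a a b) (transpose-other a b y≢a y≢b)
      (unchanged (neighbours-⋖ N Py y≢a y≢b))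
    cases (no x≢a) (yes refl) (no y≢a) (no y≢b) = finish (off x≢a) (on b) (off y≢a) (off y≢b) (transpose-b a b) (transpose-other a b y≢a y≢b)
      (unchanged (sym (neighbours-⋖ N Py y≢a y≢b)))
    cases (no x≢a) (no x≢b) (yes refl) (no y≢b) = finish (off x≢a) (off x≢b) (on a) (off y≢b) (transpose-other a b x≢a x≢b) (transpose-a a b)
      (unchanged (neighbours-⋗ N Px x≢a x≢b))
    cases (no x≢a) (no x≢b) (no y≢a) (yes refl) = finish (off x≢a) (off x≢b) (off y≢a) (on b) (transpose-other a b x≢a x≢b) (transpose-b a b)
      (unchanged (sym (neighbours-⋗ N Px x≢a x≢b)))
    cases (no x≢a) (no x≢b) (no y≢a) (no y≢b) = finish (off x≢a) (off x≢b) (off y≢a) (off y≢b) (transpose-other a b x≢a x≢b) (transpose-other a b y≢a y≢b)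
      (unchanged refl)

  transpose-injective : ∀ (a b : Fin m) {x y} → transpose a b x ≡ transpose a b y → x ≡ y
  transpose-injective a b e = trans (sym (transpose-involutive a b _)) (trans (cong (transpose a b) e) (transpose-involutive a b _))

  neighbours-transpose : ∀ {a b} → Neighbours P a b → ∀ {x t} → P x ≡ t → P (transpose a b x) ≡ t
  neighbours-transpose (_ , Pa , Pb , _) e = trans (transpose-invariant P (trans Pa (sym Pb)) _) e

  par-meetings : ∀ {cs} → All (λ (a , b) → Neighbours P a b) cs → ∀ {x y} → P x ≡ true → P y ≡ true → x ≢ y →
                 par (meetings cs x y) ≡ (x ⋖ y) xor (endOf cs x ⋖ endOf cs y)
  par-meetings [] {x} {y} _ _ _ = sym (xor-same (x ⋖ y))
  par-meetings {(a , b) ∷ cs} (N ∷ Ns) {x} {y} Px Py x≢y = begin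
    par (hits a b x y ℕ.+ meetings cs (τ x) (τ y))               ≡⟨ par-+ (hits a b x y) _ ⟩
    par (hits a b x y) xor par (meetings cs (τ x) (τ y))
      ≡⟨ cong₂ _xor_ (crossing-⋖ N Px Py x≢y) (par-meetings Ns (neighbours-transpose N Px) (neighbours-transpose N Py) (x≢y ∘ transpose-injective a b)) ⟩
    ((x ⋖ y) xor (τ x ⋖ τ y)) xor ((τ x ⋖ τ y) xor e)            ≡⟨ telescope (x ⋖ y) (τ x ⋖ τ y) e ⟩
    (x ⋖ y) xor e                                                ∎
    where
    open ≡-Reasoning
    τ = transpose a b
    e = endOf cs (τ x) ⋖ endOf cs (τ y)
    telescope : ∀ p q r → (p xor q) xor (q xor r) ≡ p xor r
    telescope p q r = trans (xor-assoc p q (q xor r)) (cong (p xor_) (trans (sym (xor-assoc q q r)) (cong (_xor r) (xor-same q))))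

  meetings-outside : ∀ {cs} → All (λ (a , b) → Neighbours P a b) cs → ∀ x y → P x ≡ false → meetings cs x y ≡ 0
  meetings-outside [] x y _ = refl
  meetings-outside {(a , b) ∷ cs} (N@(_ , Pa , Pb , _) ∷ Ns) x y e = cong₂ ℕ._+_ none
    (meetings-outside Ns (transpose a b x) (transpose a b y) (neighbours-transpose N e))
    where
    none : hits a b x y ≡ 0
    none rewrite dec-false (x F.≟ a) (λ { refl → contradiction (trans (sym e) Pa) λ () })
               | dec-false (x F.≟ b) (λ { refl → contradiction (trans (sym e) Pb) λ () }) = refl

  inverted : (Fin m → Fin m) → Fin m → Fin m → Bool
  inverted ρ x y = P x ∧ (P y ∧ ((x ⋖ y) xor (ρ x ⋖ ρ y)))

  -- A number that is at most 1 equals its parity, and the parity tells whether the two wires end in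
  -- the reversed order. This is how niceness turns crossings into inversions.
  nice-meetings : ∀ {cs} → All (λ (a , b) → Neighbours P a b) cs → (∀ x y → x ≢ y → meetings cs x y ℕ.≤ 1) →
                  ∀ x y → meetings cs x y ≡ bit (inverted (endOf cs) x y)
  nice-meetings {cs} Ns nice x y with P x in Px | P y in Py
  ... | false | _     = meetings-outside Ns x y Px
  ... | true  | false = trans (meetings-comm cs x y) (meetings-outside Ns y x Py)
  ... | true  | true with x F.≟ y
  ...   | yes refl = trans (meetings-same cs (All.map (λ { (a<b , _) refl → ℕ.<-irrefl refl a<b }) Ns) x)
                           (sym (cong bit (cong₂ _xor_ (≮⇒lt (ℕ.<-irrefl {toℕ x} refl)) (≮⇒lt (ℕ.<-irrefl {toℕ (endOf cs x)} refl)))))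
  ...   | no x≢y = trans (small (nice x y x≢y)) (cong bit (par-meetings Ns Px Py x≢y))
    where
    small : ∀ {k} → k ℕ.≤ 1 → k ≡ bit (par k)
    small z≤n       = refl
    small (s≤s z≤n) = refl

module _ (ν : Point m → Point m) (C : SymmetricState (core ν)) where

  open StateVector ν C using (th; consecutive-neighbours; pairs; through-ready)

  -- Each paired crossing occurs twice in `whole`, and each crossing is met by two ordered pairs. As
  -- the left-hand side depends only on where the wires end, the length of `paired` is the same for
  -- all nice drawings.
  nice-count : (E : SymmetricDrawing ν) → let open SymmetricDrawing E in
    ∑∑ (λ x y → bit (inverted th (endOf whole) x y)) ≡
    2 ℕ.* (2 ℕ.* length paired ℕ.+ pairs)
  nice-count E = begin
    ∑∑ (λ x y → bit (inverted th (endOf whole) x y))  ≡⟨ ∑∑-cong (nice-meetings th Ns nice) ⟨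
    ∑∑ (meetings whole)                               ≡⟨ ∑∑-meetings whole (All.map (λ { (a<b , _) refl → ℕ.<-irrefl refl a<b }) Ns) ⟩
    length whole ℕ.+ length whole                     ≡⟨ cong (length whole ℕ.+_) (ℕ.+-identityʳ (length whole)) ⟨
    2 ℕ.* length whole                                ≡⟨ cong (2 ℕ.*_) total ⟩
    2 ℕ.* (2 ℕ.* length paired ℕ.+ pairs)             ∎
    where
    open ≡-Reasoning
    open SymmetricDrawing E
    paired-neighbours = All.map consecutive-neighbours adjacent
    Ns : All (λ (a , b) → Neighbours th a b) whole
    Ns = All.++⁺ paired-neighbours (All.++⁺ (proj₂ (proj₂ through-ready)) (All.tabulate (All.lookup paired-neighbours ∘ Any.reverse⁻)))
    total : length whole ≡ 2 ℕ.* length paired ℕ.+ pairs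
    total = begin
      length whole
        ≡⟨ trans (List.length-++ paired) (cong (length paired ℕ.+_) (List.length-++ unpaired)) ⟩
      length paired ℕ.+ (pairs ℕ.+ length (reverse paired))
        ≡⟨ cong (λ k → length paired ℕ.+ (pairs ℕ.+ k)) (List.length-reverse paired) ⟩
      length paired ℕ.+ (pairs ℕ.+ length paired)
        ≡⟨ cong (length paired ℕ.+_) (ℕ.+-comm pairs (length paired)) ⟩
      length paired ℕ.+ (length paired ℕ.+ pairs)
        ≡⟨ ℕ.+-assoc (length paired) (length paired) pairs ⟨
      length paired ℕ.+ length paired ℕ.+ pairs
        ≡⟨ cong (λ k → length paired ℕ.+ k ℕ.+ pairs) (ℕ.+-identityʳ (length paired)) ⟨
      2 ℕ.* length paired ℕ.+ pairs ∎

module Split {c ℓ} (M : CommutativeMonoid c ℓ) where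

  open CommutativeMonoid M renaming (refl to ≈-refl; sym to ≈-sym; trans to ≈-trans)
  open MonoidSum M using (sum; sum-cong-≋; sum-permute)

  sum-split : ∀ k {l} (h : Fin (k ℕ.+ l) → Carrier) → sum h ≈ sum (h ∘ (_↑ˡ l)) ∙ sum (h ∘ (k ↑ʳ_))
  sum-split zero    h = ≈-sym (identityˡ _)
  sum-split (suc k) h = ≈-trans (∙-congˡ (sum-split k (h ∘ suc))) (≈-sym (assoc _ _ _))

  sum-slots : (h : Point n → Carrier) → sum {n ℕ.+ n} (h ∘ splitAt n) ≈ sum (h ∘ inj₁) ∙ sum (h ∘ inj₂)
  sum-slots {n} h = ≈-trans (sum-split n (h ∘ splitAt n)) (∙-cong
    (sum-cong-≋ λ i → reflexive (cong h (F.splitAt-↑ˡ n i n)))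
    (sum-cong-≋ λ i → reflexive (cong h (F.splitAt-↑ʳ n n i))))

  sum-points : (d : Point n → Point n) → (∀ q → d (d q) ≡ q) → (h : Point n → Carrier) →
               sum (h ∘ inj₁) ∙ sum (h ∘ inj₂) ≈ sum (h ∘ d ∘ inj₁) ∙ sum (h ∘ d ∘ inj₂)
  sum-points {n} d inv h = ≈-trans (≈-sym (sum-slots h)) (≈-trans (sum-permute _ (involution-permutation g g-inv))
    (≈-trans (sum-cong-≋ λ k → reflexive (cong h (F.splitAt-join n n (d (splitAt n k))))) (sum-slots (h ∘ d))))
    where
    g : Fin (n ℕ.+ n) → Fin (n ℕ.+ n)
    g k = join n n (d (splitAt n k))
    g-inv : ∀ k → g (g k) ≡ k
    g-inv k = trans (cong (join n n ∘ d) (F.splitAt-join n n (d (splitAt n k))))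
                    (trans (cong (join n n) (inv (splitAt n k))) (F.join-splitAt n n k))

module ⊕S = Split (CommutativeRing.+-commutativeMonoid xor-∧-commutativeRing)
module ℕS = Split ℕ.+-0-commutativeMonoid

-- The symmetric matching of a Temperley-Lieb diagram

-- A slot of the symmetric matching ν(d) is a point of d.
jn : Point n → Fin (n ℕ.+ n)
jn {n} = join n n

jn-injective : {q r : Point n} → jn q ≡ jn r → q ≡ r
jn-injective {n} {q} {r} e = trans (sym (F.splitAt-join n n q)) (trans (cong (splitAt n) e) (F.splitAt-join n n r))

jn-split : (k : Fin (n ℕ.+ n)) → ∃[ q ] k ≡ jn {n} q
jn-split {n} k = splitAt n k , sym (F.join-splitAt n n k)

top-⋖ : (i j : Fin n) → (jn (inj₁ i) ⋖ jn (inj₁ j)) ≡ (i ⋖ j)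
top-⋖ {n} i j = cong₂ ℕ._<ᵇ_ (F.toℕ-↑ˡ i n) (F.toℕ-↑ˡ j n)

<ᵇ-+ : ∀ k a b → (k ℕ.+ a ℕ.<ᵇ k ℕ.+ b) ≡ (a ℕ.<ᵇ b)
<ᵇ-+ zero    a b = refl
<ᵇ-+ (suc k) a b = <ᵇ-+ k a b

bottom-⋖ : (i j : Fin n) → (jn (inj₂ i) ⋖ jn (inj₂ j)) ≡ (i ⋖ j)
bottom-⋖ {n} i j = trans (cong₂ ℕ._<ᵇ_ (F.toℕ-↑ʳ n i) (F.toℕ-↑ʳ n j)) (<ᵇ-+ n (toℕ i) (toℕ j))

top-bottom : (i j : Fin n) → toℕ (jn (inj₁ i)) ℕ.< toℕ (jn {n} (inj₂ j))
top-bottom {n} i j rewrite F.toℕ-↑ˡ i n | F.toℕ-↑ʳ n j = ℕ.<-≤-trans (F.toℕ<n i) (ℕ.m≤m+n n (toℕ j))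

top-bottom-⋖ : (i j : Fin n) → (jn (inj₁ i) ⋖ jn {n} (inj₂ j)) ≡ true
top-bottom-⋖ i j = <⇒lt (top-bottom i j)

bottom-top-⋖ : (i j : Fin n) → (jn {n} (inj₂ i) ⋖ jn (inj₁ j)) ≡ false
bottom-top-⋖ i j = ≮⇒lt (ℕ.<-asym (top-bottom j i))

⋖-not : {i j : Fin n} → i ≢ j → (i ⋖ j) ≡ not (j ⋖ i)
⋖-not i≢j = <ᵇ-flip (i≢j ∘ F.toℕ-injective)

lt-mirror : (p q : Point m) → lt (mirror p) (mirror q) ≡ lt q p
lt-mirror (inj₁ i) (inj₁ j) = trans (lt-right-right i j) (sym (lt-left-left j i))
lt-mirror (inj₁ i) (inj₂ j) = trans (lt-right-left i j) (sym (lt-right-left j i))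
lt-mirror (inj₂ i) (inj₁ j) = trans (lt-left-right i j) (sym (lt-left-right j i))
lt-mirror (inj₂ i) (inj₂ j) = trans (lt-left-left i j) (sym (lt-right-right j i))

-- Reflecting all four points reverses their order.
disjoint-mirror : {x y z w : Point m} → z ≢ x → z ≢ y → w ≢ x → w ≢ y →
                  Disjoint x y z w → Disjoint (mirror x) (mirror y) (mirror z) (mirror w)
disjoint-mirror {x = x} {y} {z} {w} zx zy wx wy D
  rewrite lt-mirror x z | lt-mirror y z | lt-mirror x w | lt-mirror y w =
  xor-swap (lt z x) (lt w x) (lt z y) (lt w y) (disjoint-transpose zx zy wx wy D)

xor≡false : ∀ x y → x xor y ≡ false → x ≡ y
xor≡false false false _ = refl
xor≡false true  true  _ = refl

module TLMatching {n} (d : Point n → Point n) (M : IsMatching d) (planar : Planar d) where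

  private
    inv = proj₁ M
    noFix = proj₂ M

  -- The edges of `d` between its two sides are those that cross the rectangle in `νTL d`. An edge
  -- of `d` on the right appears, reflected, as an arc in the lower half of the left side.
  cross : Point n → Bool
  cross q = isRight q xor isRight (d q)

  cross-d : ∀ q → cross (d q) ≡ cross q
  cross-d q rewrite inv q = xor-comm (isRight (d q)) (isRight q)

  same-side : ∀ {q} → cross q ≡ false → isRight (d q) ≡ isRight q
  same-side {q} e with isRight q | isRight (d q)
  ... | false | false = refl
  ... | true  | true  = refl

  other-side : ∀ {q} → cross q ≡ true → isRight (d q) ≡ not (isRight q)
  other-side {q} e with isRight q | isRight (d q)
  ... | false | true  = refl
  ... | true  | false = refl

  put : Bool → Fin (n ℕ.+ n) → Point (n ℕ.+ n)
  put b k = if b then inj₂ k else inj₁ k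

  ν-left : ∀ q → νTL d (inj₁ (jn q)) ≡ put (cross q) (jn (d q))
  ν-left q rewrite F.splitAt-join n n q with q
  ... | inj₁ i with d (inj₁ i)
  ...   | inj₁ _ = refl
  ...   | inj₂ _ = refl
  ν-left q | inj₂ i with d (inj₂ i)
  ...   | inj₁ _ = refl
  ...   | inj₂ _ = refl

  core-left : ∀ q → core (νTL d) (inj₁ (jn q)) ≡ (if cross q then inj₂ (jn q) else inj₁ (jn (d q)))
  core-left q rewrite ν-left q with cross q
  ... | true  = refl
  ... | false = refl

  core-symmetric : Symmetric (core (νTL d))
  core-symmetric (inj₁ k) with νTL d (inj₁ k)
  ... | inj₁ _ = refl
  ... | inj₂ _ = refl
  core-symmetric (inj₂ k) with νTL d (inj₁ k)
  ... | inj₁ _ = refl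
  ... | inj₂ _ = refl

  core-right : ∀ q → core (νTL d) (inj₂ (jn q)) ≡ (if cross q then inj₁ (jn q) else inj₂ (jn (d q)))
  core-right q = trans (core-symmetric (inj₁ (jn q))) (trans (cong mirror (core-left q)) (lemma (cross q)))
    where
    lemma : ∀ b → mirror (if b then inj₂ (jn q) else inj₁ (jn (d q))) ≡ (if b then inj₁ (jn q) else inj₂ (jn (d q)))
    lemma true  = refl
    lemma false = refl

  core-matching : IsMatching (core (νTL d))
  core-matching = core-inv , core-noFix
    where
    left-inv : ∀ q → core (νTL d) (core (νTL d) (inj₁ (jn q))) ≡ inj₁ (jn q)
    left-inv q rewrite core-left q with cross q in e
    ... | true  rewrite core-right q | e = refl
    ... | false rewrite core-left (d q) | cross-d q | e = cong (inj₁ ∘ jn) (inv q)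
    left-noFix : ∀ q → core (νTL d) (inj₁ (jn q)) ≢ inj₁ (jn q)
    left-noFix q e rewrite core-left q with cross q
    ... | false = noFix q (jn-injective (inj₁-injective e))
    core-inv : ∀ p → core (νTL d) (core (νTL d) p) ≡ p
    core-inv (inj₁ k) with jn-split {n} k
    ... | q , refl = left-inv q
    core-inv (inj₂ k) with jn-split {n} k
    ... | q , refl = trans (cong (core (νTL d)) (core-symmetric (inj₁ (jn q)))) (trans (core-symmetric (core (νTL d) (inj₁ (jn q)))) (cong mirror (left-inv q)))
    core-noFix : ∀ p → core (νTL d) p ≢ p
    core-noFix (inj₁ k) with jn-split {n} k
    ... | q , refl = left-noFix q
    core-noFix (inj₂ k) with jn-split {n} k
    ... | q , refl = λ e → left-noFix q (trans (sym (mirror-mirror _)) (cong mirror (trans (sym (core-symmetric (inj₁ (jn q)))) e)))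

  _◃_ : Point n → Point n → Bool
  q ◃ r = jn q ⋖ jn r

  -- Reversing the order of the right points does not affect sides of arcs.
  arc-side : ∀ {q r s} → isRight q ≡ isRight r → s ≢ q → s ≢ r → lt q s xor lt r s ≡ (q ◃ s) xor (r ◃ s)
  arc-side {inj₁ i} {inj₁ j} {inj₁ k} _ _ _ = cong₂ _xor_
    (trans (lt-left-left i k) (sym (top-⋖ i k))) (trans (lt-left-left j k) (sym (top-⋖ j k)))
  arc-side {inj₁ i} {inj₁ j} {inj₂ k} _ _ _ = cong₂ _xor_
    (trans (lt-left-right i k) (sym (top-bottom-⋖ i k))) (trans (lt-left-right j k) (sym (top-bottom-⋖ j k)))
  arc-side {inj₂ i} {inj₂ j} {inj₁ k} _ _ _ = cong₂ _xor_
    (trans (lt-right-left i k) (sym (bottom-top-⋖ i k))) (trans (lt-right-left j k) (sym (bottom-top-⋖ j k)))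
  arc-side {inj₂ i} {inj₂ j} {inj₂ k} _ s≢q s≢r = begin
    lt (inj₂ i) (inj₂ k) xor lt (inj₂ j) (inj₂ k)  ≡⟨ cong₂ _xor_ (lt-right-right i k) (lt-right-right j k) ⟩
    (k ⋖ i) xor (k ⋖ j)                            ≡⟨ cong₂ _xor_ (⋖-not (s≢q ∘ cong inj₂)) (⋖-not (s≢r ∘ cong inj₂)) ⟩
    not (i ⋖ k) xor not (j ⋖ k)                    ≡⟨ 𝔹.xor-annihilates-not (i ⋖ k) (j ⋖ k) ⟩
    (i ⋖ k) xor (j ⋖ k)                            ≡⟨ cong₂ _xor_ (bottom-⋖ i k) (bottom-⋖ j k) ⟨
    (inj₂ i ◃ inj₂ k) xor (inj₂ j ◃ inj₂ k)        ∎
    where open ≡-Reasoning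

  far-side : ∀ {q r s} → isRight q ≡ isRight r → isRight s ≡ not (isRight q) → (q ◃ s) xor (r ◃ s) ≡ false
  far-side {inj₁ i} {inj₁ j} {inj₂ k} _ _ = cong₂ _xor_ (top-bottom-⋖ i k) (top-bottom-⋖ j k)
  far-side {inj₂ i} {inj₂ j} {inj₁ k} _ _ = cong₂ _xor_ (bottom-top-⋖ i k) (bottom-top-⋖ j k)

  module _ {q r} (arc : cross q ≡ false) (r≢q : r ≢ q) (r≢dq : r ≢ d q) where

    private
      dr≢q : d r ≢ q
      dr≢q e = r≢dq (trans (sym (inv r)) (cong d e))
      dr≢dq : d r ≢ d q
      dr≢dq = r≢q ∘ matching-injective M
      moved : (q ◃ r) xor (d q ◃ r) ≡ (q ◃ d r) xor (d q ◃ d r)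
      moved = trans (sym (arc-side (sym (same-side arc)) r≢q r≢dq))
        (trans (planar q r r≢q r≢dq) (arc-side (sym (same-side arc)) dr≢q dr≢dq))

    arc-arc : (q ◃ r) xor (d q ◃ r) ≡ (q ◃ d r) xor (d q ◃ d r)
    arc-arc = moved

    -- A point on the opposite side of `d` lies above or below both ends of the arc. For a through
    -- point on the same side its partner is such a point, and by planarity the arc does not
    -- separate the two.
    arc-through : cross r ≡ true → (q ◃ r) xor (d q ◃ r) ≡ false
    arc-through e with isRight r 𝔹.≟ isRight q
    ... | no ne = far-side (sym (same-side arc)) (𝔹.¬-not ne)
    ... | yes e′ = trans moved (far-side (sym (same-side arc)) (trans (other-side e) (cong not e′)))

  PlanarAt : (x z : Point (n ℕ.+ n)) → Set
  PlanarAt x z = z ≢ x → z ≢ core (νTL d) x → Disjoint x (core (νTL d) x) z (core (νTL d) z)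

  planar-left-left : ∀ q r → PlanarAt (inj₁ (jn q)) (inj₁ (jn r))
  planar-left-left q r z≢x z≢x̄ rewrite core-left q | core-left r with cross q in eq | cross r in er
  ... | false | false
    rewrite lt-left-left (jn q) (jn r) | lt-left-left (jn (d q)) (jn r) | lt-left-left (jn q) (jn (d r)) | lt-left-left (jn (d q)) (jn (d r))
    = arc-arc {q} {r} eq (z≢x ∘ cong (inj₁ ∘ jn)) (z≢x̄ ∘ cong (inj₁ ∘ jn))
  ... | false | true
    rewrite lt-left-left (jn q) (jn r) | lt-left-left (jn (d q)) (jn r) | lt-left-right (jn q) (jn r) | lt-left-right (jn (d q)) (jn r)
    = arc-through {q} {r} eq (z≢x ∘ cong (inj₁ ∘ jn)) (z≢x̄ ∘ cong (inj₁ ∘ jn)) er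
  ... | true  | false
    rewrite lt-left-left (jn q) (jn r) | lt-right-left (jn q) (jn r) | lt-left-left (jn q) (jn (d r)) | lt-right-left (jn q) (jn (d r))
          | ⋖-not {i = jn q} {jn r} (z≢x ∘ cong inj₁ ∘ sym) | ⋖-not {i = jn q} {jn (d r)} (λ e → contradiction (trans (sym eq) (trans (cong cross (jn-injective {q = q} {d r} e)) (trans (cross-d r) er))) λ ())
    = cong (λ b → not b xor false) (xor≡false (r ◃ q) (d r ◃ q) (arc-through {r} {q} er (z≢x ∘ cong (inj₁ ∘ jn) ∘ sym) q≢dr eq))
    where
    q≢dr : q ≢ d r
    q≢dr e = contradiction (trans (sym eq) (trans (cong cross e) (trans (cross-d r) er))) λ ()
  ... | true  | true
    rewrite lt-left-left (jn q) (jn r) | lt-right-left (jn q) (jn r) | lt-left-right (jn q) (jn r) | lt-right-right (jn q) (jn r)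
          | ⋖-not {i = jn q} {jn r} (z≢x ∘ cong inj₁ ∘ sym)
    = xor-identityʳ _

  planar-left-right : ∀ q r → PlanarAt (inj₁ (jn q)) (inj₂ (jn r))
  planar-left-right q r z≢x z≢x̄ rewrite core-left q | core-right r with cross q in eq | cross r in er
  ... | false | false
    rewrite lt-left-right (jn q) (jn r) | lt-left-right (jn (d q)) (jn r) | lt-left-right (jn q) (jn (d r)) | lt-left-right (jn (d q)) (jn (d r))
    = refl
  ... | false | true
    rewrite lt-left-right (jn q) (jn r) | lt-left-right (jn (d q)) (jn r) | lt-left-left (jn q) (jn r) | lt-left-left (jn (d q)) (jn r)
    = sym (arc-through {q} {r} eq r≢q r≢dq er)
    where
    r≢q : r ≢ q
    r≢q refl = contradiction (trans (sym eq) er) λ ()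
    r≢dq : r ≢ d q
    r≢dq refl = contradiction (trans (sym eq) (trans (sym (cross-d q)) er)) λ ()
  ... | true  | false
    rewrite lt-left-right (jn q) (jn r) | lt-right-right (jn q) (jn r) | lt-left-right (jn q) (jn (d r)) | lt-right-right (jn q) (jn (d r))
    = cong not (xor≡false (r ◃ q) (d r ◃ q) (arc-through {r} {q} er q≢r q≢dr eq))
    where
    q≢r : q ≢ r
    q≢r refl = contradiction (trans (sym eq) er) λ ()
    q≢dr : q ≢ d r
    q≢dr e = contradiction (trans (sym eq) (trans (cong cross e) (trans (cross-d r) er))) λ ()
  ... | true  | true
    rewrite lt-left-right (jn q) (jn r) | lt-right-right (jn q) (jn r) | lt-left-left (jn q) (jn r) | lt-right-left (jn q) (jn r)
          | ⋖-not {i = jn q} {jn r} (z≢x̄ ∘ cong inj₂ ∘ sym)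
    = sym (xor-identityʳ _)

  core-planar-left : ∀ q z → PlanarAt (inj₁ (jn q)) z
  core-planar-left q (inj₁ k) with jn-split {n} k
  ... | r , refl = planar-left-left q r
  core-planar-left q (inj₂ k) with jn-split {n} k
  ... | r , refl = planar-left-right q r

  -- A chord that starts on the right is reflected to the left: `core (νTL d)` is symmetric, and
  -- reflection preserves disjointness.
  core-planar : Planar (core (νTL d))
  core-planar (inj₁ k) z z≢x z≢x̄ with jn-split {n} k
  ... | q , refl = core-planar-left q z z≢x z≢x̄
  core-planar (inj₂ k) z z≢x z≢x̄ with jn-split {n} k
  ... | q , refl = subst₃ (core-symmetric x) (mirror-mirror z) (core-symmetric (mirror z))
    (disjoint-mirror {x = x} {core (νTL d) x} {mirror z} {core (νTL d) (mirror z)}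
      (λ e → z≢x (mirror-move e)) z̄≢ (λ e → z̄≢ (trans (sym (core-inv (mirror z))) (cong (core (νTL d)) e)))
      (λ e → z≢x (mirror-move (matching-injective core-matching e)))
      (core-planar-left q (mirror z) (λ e → z≢x (mirror-move e)) z̄≢))
    where
    x = inj₁ (jn q)
    core-inv = proj₁ core-matching
    z̄≢ : mirror z ≢ core (νTL d) x
    z̄≢ e = z≢x̄ (trans (mirror-move e) (sym (core-symmetric x)))
    subst₃ : core (νTL d) (mirror x) ≡ mirror (core (νTL d) x) → mirror (mirror z) ≡ z →
             core (νTL d) (mirror (mirror z)) ≡ mirror (core (νTL d) (mirror z)) →
             Disjoint (mirror x) (mirror (core (νTL d) x)) (mirror (mirror z)) (mirror (core (νTL d) (mirror z))) →
             Disjoint (mirror x) (core (νTL d) (mirror x)) z (core (νTL d) z)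
    subst₃ e₁ e₂ e₃ D rewrite e₁ | sym e₃ | e₂ = D

  core-TL : SymmetricState (core (νTL d))
  core-TL = state core-matching core-planar core-symmetric

-- Matchings of the top half with the bottom half

halves-double : ∀ (zs : List (Fin m)) k → length zs ≡ k ℕ.+ k → length (pairUp zs) ≡ k
halves-double []           zero    e = refl
halves-double (_ ∷ [])     (suc k) e = contradiction (ℕ.suc-injective e) λ e′ → ℕ.0≢1+n (trans e′ (ℕ.+-suc k k))
halves-double (_ ∷ _ ∷ zs) (suc k) e =
  cong suc (halves-double zs k (ℕ.suc-injective (trans (ℕ.suc-injective e) (ℕ.+-suc k k))))

-- The binomial coefficient of `k` over 2. It counts pairs of wires, and it is the sum of the
-- numbers below `k`, which links it to the number of odd slots in `⊕-odd`.
triangle : ℕ → ℕ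
triangle zero    = 0
triangle (suc k) = triangle k ℕ.+ k

n*n≡n+2triangle : ∀ k → k ℕ.* k ≡ k ℕ.+ (triangle k ℕ.+ triangle k)
n*n≡n+2triangle zero    = refl
n*n≡n+2triangle (suc k) = cong suc (begin
  k ℕ.+ k ℕ.* suc k                        ≡⟨ cong (k ℕ.+_) (ℕ.*-suc k k) ⟩
  k ℕ.+ (k ℕ.+ k ℕ.* k)                    ≡⟨ cong (λ x → k ℕ.+ (k ℕ.+ x)) (n*n≡n+2triangle k) ⟩
  k ℕ.+ (k ℕ.+ (k ℕ.+ (t ℕ.+ t)))          ≡⟨ shuffle k t ⟩
  k ℕ.+ (t ℕ.+ k ℕ.+ (t ℕ.+ k))            ∎)
  where
  open ≡-Reasoning
  open import Data.Nat.Tactic.RingSolver using () renaming (solve-∀ to ℕ-solve)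
  t = triangle k
  shuffle : ∀ k t → k ℕ.+ (k ℕ.+ (k ℕ.+ (t ℕ.+ t))) ≡ k ℕ.+ (t ℕ.+ k ℕ.+ (t ℕ.+ k))
  shuffle = ℕ-solve

⊕-const : ∀ k b → ⊕.sum {k} (λ _ → b) ≡ par k ∧ b
⊕-const zero    b = refl
⊕-const (suc k) b = trans (cong (b xor_) (⊕-const k b)) (lemma (par k) b)
  where
  lemma : ∀ p b → b xor (p ∧ b) ≡ not p ∧ b
  lemma true  b = xor-same b
  lemma false b = xor-identityʳ b

⊕-∧ : ∀ b (h : Fin n → Bool) → ⊕.sum (λ i → b ∧ h i) ≡ b ∧ ⊕.sum h
⊕-∧ {zero}  b h = sym (𝔹.∧-zeroʳ b)
⊕-∧ {suc n} b h = trans (cong ((b ∧ h zero) xor_) (⊕-∧ b (h ∘ suc))) (sym (𝔹.∧-distribˡ-xor b (h zero) _))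

⊕-odd : ∀ k → ⊕.sum {k} odd ≡ par (triangle k)
⊕-odd zero    = refl
⊕-odd (suc k) = begin
  ⊕.sum {k} (λ i → true xor odd i)              ≡⟨ ⊕.∑-distrib-+ {k} (λ _ → true) odd ⟩
  ⊕.sum {k} (λ _ → true) xor ⊕.sum {k} odd      ≡⟨ cong₂ _xor_ (⊕-const k true) (⊕-odd k) ⟩
  (par k ∧ true) xor par (triangle k)           ≡⟨ cong (_xor par (triangle k)) (𝔹.∧-identityʳ (par k)) ⟩
  par k xor par (triangle k)                    ≡⟨ xor-comm (par k) _ ⟩
  par (triangle k) xor par k                    ≡⟨ par-+ (triangle k) k ⟨
  par (triangle k ℕ.+ k)                        ∎
  where open ≡-Reasoning

odd-top : ∀ (i : Fin n) → odd (jn (inj₁ i)) ≡ odd i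
odd-top {n} i = cong par (F.toℕ-↑ˡ i n)

odd-bottom : ∀ (j : Fin n) → odd (jn {n} (inj₂ j)) ≡ par n xor odd j
odd-bottom {n} j = trans (cong par (F.toℕ-↑ʳ n j)) (par-+ n (toℕ j))

ℕ∑-const : ∀ k c → ℕ∑.sum {k} (λ _ → c) ≡ k ℕ.* c
ℕ∑-const zero    c = refl
ℕ∑-const (suc k) c = cong (c ℕ.+_) (ℕ∑-const k c)

∑∑-permute : (π : Permutation′ n) (M : Fin n → Fin n → ℕ) → ∑∑ M ≡ ∑∑ (λ i j → M (π ⟨$⟩ʳ i) (π ⟨$⟩ʳ j))
∑∑-permute π M = trans (ℕ∑.sum-cong-≗ λ i → ℕ∑.sum-permute (M i) π)
  (ℕ∑.sum-permute (λ i → ℕ∑.sum λ j → M i (π ⟨$⟩ʳ j)) π)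

∑∑-split : (M : Fin (n ℕ.+ n) → Fin (n ℕ.+ n) → ℕ) → ∑∑ M ≡
  (∑∑ {n} (λ i j → M (jn (inj₁ i)) (jn (inj₁ j))) ℕ.+ ∑∑ {n} (λ i j → M (jn (inj₁ i)) (jn {n} (inj₂ j)))) ℕ.+
  (∑∑ {n} (λ i j → M (jn {n} (inj₂ i)) (jn (inj₁ j))) ℕ.+ ∑∑ {n} (λ i j → M (jn {n} (inj₂ i)) (jn {n} (inj₂ j))))
∑∑-split {n} M = trans (ℕS.sum-split n (λ k → ℕ∑.sum (M k))) (cong₂ ℕ._+_ (row inj₁) (row inj₂))
  where
  row : (side : Fin n → Point n) → ℕ∑.sum {n} (λ i → ℕ∑.sum (M (jn (side i)))) ≡
        ∑∑ {n} (λ i j → M (jn (side i)) (jn (inj₁ j))) ℕ.+ ∑∑ {n} (λ i j → M (jn (side i)) (jn {n} (inj₂ j)))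
  row side = trans (ℕ∑.sum-cong-≗ λ i → ℕS.sum-split n (M (jn (side i))))
    (ℕ∑.∑-distrib-+ (λ i → ℕ∑.sum {n} λ j → M (jn (side i)) (jn (inj₁ j))) (λ i → ℕ∑.sum {n} λ j → M (jn (side i)) (jn {n} (inj₂ j))))

upper : (Fin n → Fin n → ℕ) → Fin n → Fin n → ℕ
upper M i j = if i ⋖ j then M i j else 0

∑∑-upper : (M : Fin n → Fin n → ℕ) → (∀ i j → M i j ≡ M j i) → (∀ i → M i i ≡ 0) → ∑∑ M ≡ ∑∑ (upper M) ℕ.+ ∑∑ (upper M)
∑∑-upper M symm diag = begin
  ∑∑ M                                          ≡⟨ ∑∑-cong split ⟩
  ∑∑ (λ i j → upper M i j ℕ.+ upper M j i)      ≡⟨ ∑∑-+ (upper M) (flip (upper M)) ⟩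
  ∑∑ (upper M) ℕ.+ ∑∑ (flip (upper M))          ≡⟨ cong (∑∑ (upper M) ℕ.+_) (ℕ∑.∑-comm (flip (upper M))) ⟩
  ∑∑ (upper M) ℕ.+ ∑∑ (upper M)                 ∎
  where
  open ≡-Reasoning
  split : ∀ i j → M i j ≡ upper M i j ℕ.+ upper M j i
  split i j with i F.≟ j
  ... | yes refl = trans (diag i) (sym (cong₂ ℕ._+_ off off))
    where
    off : upper M i i ≡ 0
    off = cong (λ b → if b then M i i else 0) (≮⇒lt (ℕ.<-irrefl {toℕ i} refl))
  ... | no i≢j with i ⋖ j | j ⋖ i | ⋖-not i≢j
  ...   | true  | false | _ = sym (ℕ.+-identityʳ _)
  ...   | false | true  | _ = symm i j

par-∑∑ : (M : Fin n → Fin n → ℕ) → par (∑∑ M) ≡ ⊕.sum (λ i → ⊕.sum λ j → par (M i j))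
par-∑∑ M = trans (par-∑ (λ i → ℕ∑.sum (M i))) (⊕.sum-cong-≗ λ i → par-∑ (M i))

double-injective : ∀ {a b} → a ℕ.+ a ≡ b ℕ.+ b → a ≡ b
double-injective {a} {b} e = trans (ℕ.n≡⌊n+n/2⌋ a) (trans (cong ⌊_/2⌋ e) (sym (ℕ.n≡⌊n+n/2⌋ b)))

inversions : (Fin n → Fin n) → ℕ
inversions w = ∑∑ (upper λ i j → bit ((i ⋖ j) xor (w i ⋖ w j)))

∑∑-inversions : (w : Fin n → Fin n) → (∀ {i j} → w i ≡ w j → i ≡ j) →
                ∑∑ (λ i j → bit ((i ⋖ j) xor (w i ⋖ w j))) ≡ inversions w ℕ.+ inversions w
∑∑-inversions w inj = ∑∑-upper (λ i j → bit ((i ⋖ j) xor (w i ⋖ w j))) symm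
  λ i → cong bit (cong₂ _xor_ (≮⇒lt (ℕ.<-irrefl {toℕ i} refl)) (≮⇒lt (ℕ.<-irrefl {toℕ (w i)} refl)))
  where
  symm : ∀ i j → bit ((i ⋖ j) xor (w i ⋖ w j)) ≡ bit ((j ⋖ i) xor (w j ⋖ w i))
  symm i j with i F.≟ j
  ... | yes refl = refl
  ... | no i≢j = cong bit (trans (cong₂ _xor_ (⋖-not i≢j) (⋖-not (i≢j ∘ inj))) (𝔹.xor-annihilates-not (j ⋖ i) (w j ⋖ w i)))

-- Wires may meet repeatedly in a wiring diagram, so inversions determine only the parity of the
-- number of meetings of each pair.
wiring-parity : {w : Fin n → Fin n} (W : Wiring w) → par (length (Wiring.crossings W)) ≡ par (inversions w)
wiring-parity {n} {w} W = begin
  par (length cs)                                       ≡⟨ cong par (double-injective {length cs} {∑∑ (upper (meetings cs))} (trans (sym (∑∑-meetings cs ne)) (∑∑-upper (meetings cs) (meetings-comm cs) (meetings-same cs ne)))) ⟩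
  par (∑∑ (upper (meetings cs)))                        ≡⟨ par-∑∑ (upper (meetings cs)) ⟩
  ⊕.sum (λ i → ⊕.sum λ j → par (upper (meetings cs) i j))
    ≡⟨ ⊕.sum-cong-≗ (λ i → ⊕.sum-cong-≗ λ j → same i j) ⟩
  ⊕.sum (λ i → ⊕.sum λ j → par (upper (λ i j → bit ((i ⋖ j) xor (w i ⋖ w j))) i j))
    ≡⟨ par-∑∑ (upper λ i j → bit ((i ⋖ j) xor (w i ⋖ w j))) ⟨
  par (inversions w)                                    ∎
  where
  open ≡-Reasoning
  cs = Wiring.crossings W
  Ns : All (λ (a , b) → Neighbours (const true) a b) cs
  Ns = All.map wire-neighbours (Wiring.adjacent W)
  ne : All (λ (a , b) → a ≢ b) cs
  ne = All.map (λ { (a<b , _) refl → ℕ.<-irrefl refl a<b }) Ns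
  same : ∀ i j → par (upper (meetings cs) i j) ≡ par (upper (λ i j → bit ((i ⋖ j) xor (w i ⋖ w j))) i j)
  same i j with i ⋖ j in e
  ... | false = refl
  ... | true = trans (par-meetings (const true) Ns refl refl λ { refl → ℕ.<-irrefl refl (lt⇒< {toℕ i} e) })
    (trans (cong₂ _xor_ e (cong₂ _⋖_ (Wiring.ends W i) (Wiring.ends W j))) (sym (par-bit _)))

matching-core : (π : Fin m → Fin m) → SymmetricState (core (νMatching π))
matching-core π = symmetricState-cong (core-mirror (νMatching π) (λ _ → refl) (λ _ → refl)) mirror-state

matching-length : (π : Fin (n ℕ.+ n) → Fin (n ℕ.+ n)) → length (through (νMatching π)) ≡ n ℕ.+ n
matching-length {n} π = trans (cong length (filterᵇ-all (allFin (n ℕ.+ n)) λ _ → refl)) (List.length-tabulate id)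

matching-pairs : (π : Fin (n ℕ.+ n) → Fin (n ℕ.+ n)) → length (pairUp (through (νMatching π))) ≡ n
matching-pairs {n} π = halves-double (through (νMatching π)) n (matching-length {n} π)

matching-halves : (π : Fin (n ℕ.+ n) → Fin (n ℕ.+ n)) → halves (through (νMatching π))
matching-halves {n} π = trans (matching-length {n} π) (sym (cong₂ ℕ._+_ (matching-pairs {n} π) (matching-pairs {n} π)))

module _ {n} {w w⁻¹ : Fin n → Fin n} (w-w⁻¹ : ∀ k → w (w⁻¹ k) ≡ k) (w⁻¹-w : ∀ k → w⁻¹ (w k) ≡ k)
         {π : Fin (n ℕ.+ n) → Fin (n ℕ.+ n)} (Mπ : IsMatching π) (π-top : ∀ i → π (jn (inj₁ i)) ≡ jn {n} (inj₂ (w i)))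
         (E : SymmetricDrawing (νMatching π)) (W : Wiring w) where

  private
    ν : Point (n ℕ.+ n) → Point (n ℕ.+ n)
    ν = νMatching π
    C : SymmetricState (core ν)
    C = matching-core π
    pairs≡n : length (pairUp (through ν)) ≡ n
    pairs≡n = matching-pairs {n} π
    open DrawingVector ν C (matching-halves {n} π)
    perm : Permutation′ n
    perm = permutation w w⁻¹ w-w⁻¹ w⁻¹-w
    w-injective : ∀ {i j} → w i ≡ w j → i ≡ j
    w-injective {i} {j} e = trans (sym (w⁻¹-w i)) (trans (cong w⁻¹ e) (w⁻¹-w j))
    π-bottom : ∀ i → π (jn {n} (inj₂ (w i))) ≡ jn (inj₁ i)
    π-bottom i = trans (cong π (sym (π-top i))) (proj₁ Mπ _)
    open SymmetricDrawing E using (paired; ends) renaming (whole to wholeE)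
    end : ∀ k → endOf wholeE k ≡ π k
    end k = ends k (π k) refl
    end-top : ∀ i → endOf wholeE (jn (inj₁ i)) ≡ jn {n} (inj₂ (w i))
    end-top i = trans (end _) (π-top i)
    end-bottom : ∀ i → endOf wholeE (jn {n} (inj₂ (w i))) ≡ jn (inj₁ i)
    end-bottom i = trans (end _) (π-bottom i)

    -- `π` sends top slots to bottom slots by `w`, and bottom slots back. Two top wires or two
    -- bottom wires cross at the inversions of `w`, a top and a bottom wire always cross. With
    -- `V = 2 I` ordered inversions this gives `2 V + 2 n n = 2 (2 p + n)`.
    paired-count : length paired ≡ inversions w ℕ.+ triangle n
    paired-count = double-injective (ℕ.+-cancelʳ-≡ n _ _ (begin
      p ℕ.+ p ℕ.+ n                     ≡⟨ cong (λ x → p ℕ.+ x ℕ.+ n) (ℕ.+-identityʳ p) ⟨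
      2 ℕ.* p ℕ.+ n                     ≡⟨ double-injective total ⟨
      V ℕ.+ n ℕ.* n                     ≡⟨ cong₂ ℕ._+_ (∑∑-inversions w w-injective) (n*n≡n+2triangle n) ⟩
      I ℕ.+ I ℕ.+ (n ℕ.+ (t ℕ.+ t))     ≡⟨ shuffle I n t ⟩
      I ℕ.+ t ℕ.+ (I ℕ.+ t) ℕ.+ n       ∎))
      where
      open ≡-Reasoning
      open import Data.Nat.Tactic.RingSolver using () renaming (solve-∀ to ℕ-solve)
      p = length paired
      I = inversions w
      t = triangle n
      V = ∑∑ λ i j → bit ((i ⋖ j) xor (w i ⋖ w j))
      shuffle : ∀ I n t → I ℕ.+ I ℕ.+ (n ℕ.+ (t ℕ.+ t)) ≡ I ℕ.+ t ℕ.+ (I ℕ.+ t) ℕ.+ n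
      shuffle = ℕ-solve
      regroup : ∀ V s → V ℕ.+ s ℕ.+ (s ℕ.+ V) ≡ V ℕ.+ s ℕ.+ (V ℕ.+ s)
      regroup = ℕ-solve
      M : Fin (n ℕ.+ n) → Fin (n ℕ.+ n) → ℕ
      M x y = bit ((x ⋖ y) xor (endOf wholeE x ⋖ endOf wholeE y))
      ones : (N : Fin n → Fin n → ℕ) → (∀ i j → N i j ≡ 1) → ∑∑ N ≡ n ℕ.* n
      ones N e = trans (ℕ∑.sum-cong-≗ {n} {λ i → ℕ∑.sum (N i)} {λ _ → n} λ i →
        trans (ℕ∑.sum-cong-≗ {n} {N i} {λ _ → 1} (e i)) (trans (ℕ∑-const n 1) (ℕ.*-identityʳ n))) (ℕ∑-const n n)
      TT TB BT BB : Fin n → Fin n → ℕ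
      TT i j = M (jn (inj₁ i)) (jn (inj₁ j))
      TB i j = M (jn (inj₁ i)) (jn {n} (inj₂ j))
      BT i j = M (jn {n} (inj₂ i)) (jn (inj₁ j))
      BB i j = M (jn {n} (inj₂ i)) (jn {n} (inj₂ j))
      tt-block : ∀ i j → M (jn (inj₁ i)) (jn (inj₁ j)) ≡ bit ((i ⋖ j) xor (w i ⋖ w j))
      tt-block i j = cong bit (cong₂ _xor_ (top-⋖ i j) (trans (cong₂ _⋖_ (end-top i) (end-top j)) (bottom-⋖ (w i) (w j))))
      tb-block : ∀ i j → M (jn (inj₁ i)) (jn {n} (inj₂ (w j))) ≡ 1
      tb-block i j = cong bit (cong₂ _xor_ (top-bottom-⋖ i (w j)) (trans (cong₂ _⋖_ (end-top i) (end-bottom j)) (bottom-top-⋖ (w i) j)))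
      bt-block : ∀ i j → M (jn {n} (inj₂ (w i))) (jn (inj₁ j)) ≡ 1
      bt-block i j = cong bit (cong₂ _xor_ (bottom-top-⋖ (w i) j) (trans (cong₂ _⋖_ (end-bottom i) (end-top j)) (top-bottom-⋖ i (w j))))
      bb-block : ∀ i j → M (jn {n} (inj₂ (w i))) (jn {n} (inj₂ (w j))) ≡ bit ((i ⋖ j) xor (w i ⋖ w j))
      bb-block i j = cong bit (trans (cong₂ _xor_ (bottom-⋖ (w i) (w j)) (trans (cong₂ _⋖_ (end-bottom i) (end-bottom j)) (top-⋖ i j))) (xor-comm (w i ⋖ w j) (i ⋖ j)))
      via-w : (k : Fin n) → ∃[ i ] k ≡ w i
      via-w k = w⁻¹ k , sym (w-w⁻¹ k)
      tb : ∀ i k → M (jn (inj₁ i)) (jn {n} (inj₂ k)) ≡ 1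
      tb i k with via-w k
      ... | j , refl = tb-block i j
      bt : ∀ k j → M (jn {n} (inj₂ k)) (jn (inj₁ j)) ≡ 1
      bt k j with via-w k
      ... | i , refl = bt-block i j
      total : V ℕ.+ n ℕ.* n ℕ.+ (V ℕ.+ n ℕ.* n) ≡ 2 ℕ.* p ℕ.+ n ℕ.+ (2 ℕ.* p ℕ.+ n)
      total = begin
        V ℕ.+ n ℕ.* n ℕ.+ (V ℕ.+ n ℕ.* n)
          ≡⟨ regroup V (n ℕ.* n) ⟨
        V ℕ.+ n ℕ.* n ℕ.+ (n ℕ.* n ℕ.+ V)
          ≡⟨ cong₂ ℕ._+_ (cong₂ ℕ._+_ (∑∑-cong tt-block) (ones TB tb))
               (cong₂ ℕ._+_ (ones BT bt) (trans (∑∑-permute perm BB) (∑∑-cong bb-block))) ⟨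
        (∑∑ TT ℕ.+ ∑∑ TB) ℕ.+ (∑∑ BT ℕ.+ ∑∑ BB)
          ≡⟨ ∑∑-split {n} M ⟨
        ∑∑ M ≡⟨ nice-count ν C E ⟩
        2 ℕ.* (2 ℕ.* p ℕ.+ pairs) ≡⟨ cong (λ k → 2 ℕ.* (2 ℕ.* p ℕ.+ k)) pairs≡n ⟩
        2 ℕ.* (2 ℕ.* p ℕ.+ n) ≡⟨ cong (2 ℕ.* p ℕ.+ n ℕ.+_) (ℕ.+-identityʳ _) ⟩
        2 ℕ.* p ℕ.+ n ℕ.+ (2 ℕ.* p ℕ.+ n) ∎

    module _ (η : Fin (n ℕ.+ n) → Bool) where

      ηᵗ : Fin n → Bool
      ηᵗ i = η (jn (inj₁ i))

      -- The bottom slot `j` has parity `par n xor odd j`, so adding `par n` replaces its shading by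
      -- that of slot `j` of the wiring, and the `not` turns opposite colours at the two ends of an
      -- edge into equal ones.
      ρ : Fin n → Bool
      ρ j = shade η (jn {n} (inj₂ j)) xor not (par n)

      open WiringVector ρ

      joined⇔ : ∀ i → (ρ (w i) xor odd (w i)) ≡ not (η (jn {n} (inj₂ (w i))))
      joined⇔ i = trans (cong (λ o → ((η (jn {n} (inj₂ (w i))) xor o) xor not (par n)) xor odd (w i)) (odd-bottom (w i)))
        (lemma (η (jn {n} (inj₂ (w i)))) (par n) (odd (w i)))
        where
        open xor-∧-Solver
        lemma : ∀ b N o → ((b xor (N xor o)) xor (true xor N)) xor o ≡ true xor b
        lemma = solve 3 (λ b N o → ((b :+ (N :+ o)) :+ (con true :+ N)) :+ o := con true :+ b) refl

      opposed⇔joined : does (opposed? (endOf wholeE) η) ≡ does (joined? w ηᵗ)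
      opposed⇔joined = decide to from (opposed? (endOf wholeE) η) (joined? w ηᵗ)
        where
        to : Opposed (endOf wholeE) η → Joined w ηᵗ
        to o i = trans (sym (trans (cong not (trans (cong η (sym (end-top i))) (o (jn (inj₁ i)) refl))) (not-involutive _))) (sym (joined⇔ i))
        from-top : Joined w ηᵗ → ∀ i → η (jn {n} (inj₂ (w i))) ≡ not (ηᵗ i)
        from-top j i = sym (trans (cong not (trans (j i) (joined⇔ i))) (not-involutive _))
        from : Joined w ηᵗ → Opposed (endOf wholeE) η
        from j k _ with jn-split {n} k
        ... | inj₁ i , refl = trans (cong η (end-top i)) (from-top j i)
        ... | inj₂ k′ , refl = subst (λ l → η (endOf wholeE (jn {n} (inj₂ l))) ≡ not (η (jn {n} (inj₂ l)))) (w-w⁻¹ k′)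
          (trans (cong η (end-bottom (w⁻¹ k′))) (sym (trans (cong not (from-top j (w⁻¹ k′))) (not-involutive _))))

      -- On the support of the indicator the bottom colours are the complements of the top ones.
      -- Expanding the twist of the bottom slots then produces the parities alone, which sum to a
      -- triangular number, and the mixed term `carriedShades`.
      shades : Joined w ηᵗ → throughShades η ≡
        oddShades ηᵗ xor (((par n xor par (triangle n)) xor (par n ∧ ⊕.sum ηᵗ)) xor carriedShades w ηᵗ)
      shades j = trans (⊕S.sum-split n (λ k → η k ∧ odd k)) (cong₂ _xor_
        (⊕.sum-cong-≗ λ i → cong (ηᵗ i ∧_) (odd-top i)) (begin
          ⊕.sum (λ k → η (jn {n} (inj₂ k)) ∧ odd (jn {n} (inj₂ k)))
            ≡⟨ ⊕.sum-permute _ perm ⟩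
          ⊕.sum (λ i → η (jn {n} (inj₂ (w i))) ∧ odd (jn {n} (inj₂ (w i))))
            ≡⟨ ⊕.sum-cong-≗ (λ i → trans (cong₂ _∧_ (sym (trans (cong not (trans (j i) (joined⇔ i))) (not-involutive _))) (odd-bottom (w i)))
                                         (lemma (ηᵗ i) (par n) (odd (w i)))) ⟩
          ⊕.sum (λ i → ((par n xor odd (w i)) xor (par n ∧ ηᵗ i)) xor (ηᵗ i ∧ odd (w i)))
            ≡⟨ ⊕.∑-distrib-+ (λ i → (par n xor odd (w i)) xor (par n ∧ ηᵗ i)) (λ i → ηᵗ i ∧ odd (w i)) ⟩
          ⊕.sum (λ i → (par n xor odd (w i)) xor (par n ∧ ηᵗ i)) xor carriedShades w ηᵗ
            ≡⟨ cong (_xor carriedShades w ηᵗ) (⊕.∑-distrib-+ (λ i → par n xor odd (w i)) (λ i → par n ∧ ηᵗ i)) ⟩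
          (⊕.sum (λ i → par n xor odd (w i)) xor ⊕.sum (λ i → par n ∧ ηᵗ i)) xor carriedShades w ηᵗ
            ≡⟨ cong₂ (λ x y → (x xor y) xor carriedShades w ηᵗ)
                 (trans (⊕.∑-distrib-+ (λ _ → par n) (odd ∘ w)) (cong₂ _xor_ (trans (⊕-const n (par n)) (𝔹.∧-idem (par n)))
                    (trans (sym (⊕.sum-permute odd perm)) (⊕-odd n))))
                 (⊕-∧ (par n) ηᵗ) ⟩
          ((par n xor par (triangle n)) xor (par n ∧ ⊕.sum ηᵗ)) xor carriedShades w ηᵗ ∎))
        where
        open ≡-Reasoning
        open xor-∧-Solver
        lemma : ∀ a N o → (true xor a) ∧ (N xor o) ≡ ((N xor o) xor (N ∧ a)) xor (a ∧ o)
        lemma = solve 3 (λ a N o → (con true :+ a) :* (N :+ o) := ((N :+ o) :+ (N :* a)) :+ (a :* o)) refl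

      -- The parity of the paired crossings cancels the triangular term and leaves the sign of the
      -- wiring. The extra term `par n ∧ ⊕.sum ηᵗ` depends on the colouring but not on `w`, and
      -- `tlVector` has the same one.
      sign : Joined w ηᵗ → throughShades η xor (par (length paired) xor par pairs) ≡
        (par n ∧ ⊕.sum ηᵗ) xor (oddShades ηᵗ xor (par (length (Wiring.crossings W)) xor carriedShades w ηᵗ))
      sign j = trans (cong₂ _xor_ (shades j) (cong₂ _xor_
          (trans (cong par paired-count) (trans (par-+ (inversions w) (triangle n)) (cong (_xor par (triangle n)) (sym (wiring-parity W)))))
          (cong par pairs≡n)))
        (lemma (oddShades ηᵗ) (par n) (par (triangle n)) (par n ∧ ⊕.sum ηᵗ) (carriedShades w ηᵗ) (par (length (Wiring.crossings W))))
        where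
        open xor-∧-Solver
        lemma : ∀ X N T A c W → (X xor (((N xor T) xor A) xor c)) xor ((W xor T) xor N) ≡ A xor (X xor (W xor c))
        lemma = solve 6 (λ X N T A c W → (X :+ (((N :+ T) :+ A) :+ c)) :+ ((W :+ T) :+ N) := A :+ (X :+ (W :+ c))) refl

      arcsConstant-true : arcsConstant (shade η) ≡ true
      arcsConstant-true = dec-true (constant? (core ν) [ mask (shade η) , const false ]) λ p → trans (black (core ν p)) (sym (black p))
        where
        black : ∀ p → [ mask (shade η) , const false ] p ≡ false
        black (inj₁ _) = refl
        black (inj₂ _) = refl

      matchingVectorη : vector paired (shade η) ≡ sg (par n ∧ ⊕.sum ηᵗ) ℤ.* wireVector (Wiring.crossings W) (shade ηᵗ)
      matchingVectorη = begin
        vector paired (shade η)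
          ≡⟨ vector-closed E η ⟩
        sg s ℤ.* (⟦ arcsConstant (shade η) ⟧ ℤ.* ⟦ does (opposed? (endOf wholeE) η) ⟧)
          ≡⟨ cong₂ (λ x y → sg s ℤ.* (⟦ x ⟧ ℤ.* ⟦ y ⟧)) arcsConstant-true opposed⇔joined ⟩
        sg s ℤ.* (1ℤ ℤ.* J)
          ≡⟨ cong (sg s ℤ.*_) (ℤ.*-identityˡ J) ⟩
        sg s ℤ.* J
          ≡⟨ agree (joined? w ηᵗ) ⟩
        sg (A xor (X xor (Wp xor c))) ℤ.* J
          ≡⟨ cong (ℤ._* J) (trans (sg-xor A _) (cong (sg A ℤ.*_) (sg-xor X (Wp xor c)))) ⟩
        sg A ℤ.* (sg X ℤ.* sg (Wp xor c)) ℤ.* J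
          ≡⟨ reassoc (sg A) (sg X) (sg (Wp xor c)) J ⟩
        sg A ℤ.* (sg X ℤ.* (sg (Wp xor c) ℤ.* J))
          ≡⟨ cong (λ x → sg A ℤ.* (sg X ℤ.* x)) wires ⟨
        sg A ℤ.* (sg X ℤ.* (sg X ℤ.* V))
          ≡⟨ cong (sg A ℤ.*_) (trans (sym (ℤ.*-assoc (sg X) (sg X) V)) (trans (cong (ℤ._* V) (sg-square X)) (ℤ.*-identityˡ V))) ⟩
        sg A ℤ.* V ∎
        where
        open ≡-Reasoning
        s = throughShades η xor (par (length paired) xor par pairs)
        J = ⟦ does (joined? w ηᵗ) ⟧
        A = par n ∧ ⊕.sum ηᵗ
        X = oddShades ηᵗ
        Wp = par (length (Wiring.crossings W))
        c = carriedShades w ηᵗ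
        V = wireVector (Wiring.crossings W) (shade ηᵗ)
        reassoc : ∀ a x y z → a ℤ.* (x ℤ.* y) ℤ.* z ≡ a ℤ.* (x ℤ.* (y ℤ.* z))
        reassoc = solve-∀
        -- The two signs have to coincide only where the indicator is 1.
        agree : (j? : Dec (Joined w ηᵗ)) → sg s ℤ.* ⟦ does j? ⟧ ≡ sg (A xor (X xor (Wp xor c))) ℤ.* ⟦ does j? ⟧
        agree (yes j) = cong (λ x → sg x ℤ.* 1ℤ) (sign j)
        agree (no _)  = trans (ℤ.*-zeroʳ (sg s)) (sym (ℤ.*-zeroʳ (sg (A xor (X xor (Wp xor c))))))
        wires : sg X ℤ.* V ≡ sg (Wp xor c) ℤ.* J
        wires = trans (twisted-wireVector (Wiring.crossings W) (Wiring.adjacent W) ηᵗ)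
          (cong₂ (λ x y → sg (Wp xor x) ℤ.* ⟦ y ⟧)
            (⊕.sum-cong-≗ λ i → cong (λ k → ηᵗ i ∧ odd k) (Wiring.ends W i))
            (decide (λ j i → trans (j i) (cong (λ k → ρ k xor odd k) (Wiring.ends W i)))
                    (λ j i → trans (j i) (cong (λ k → ρ k xor odd k) (sym (Wiring.ends W i))))
                    (joined? (endOf (Wiring.crossings W)) ηᵗ) (joined? w ηᵗ)))

  matchingVector : ∀ η → vector paired (shade η) ≡ sg (par n ∧ ⊕.sum {n} (λ i → η (jn (inj₁ i)))) ℤ.*
    WiringVector.wireVector (λ j → shade η (jn {n} (inj₂ j)) xor not (par n)) (Wiring.crossings W) (shade (λ i → η (jn (inj₁ i))))
  matchingVector = matchingVectorη

-- The state vector of ν(d) for a Temperley-Lieb diagram d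

par-* : ∀ k l → par (k ℕ.* l) ≡ par k ∧ par l
par-* zero    l = refl
par-* (suc k) l = trans (par-+ l (k ℕ.* l)) (trans (cong (par l xor_) (par-* k l)) (lemma (par k) (par l)))
  where
  lemma : ∀ p b → b xor (p ∧ b) ≡ not p ∧ b
  lemma true  b = xor-same b
  lemma false b = xor-identityʳ b

-- Passing from `k` to `k + 2` adds the odd number `k + (k + 1)` to `triangle k`.
par-triangle : ∀ q z → par (triangle (q ℕ.+ (z ℕ.+ z))) ≡ par (triangle q) xor par z
par-triangle q zero = trans (cong (par ∘ triangle) (ℕ.+-identityʳ q)) (sym (xor-identityʳ _))
par-triangle q (suc z) = begin
  par (triangle (q ℕ.+ (suc z ℕ.+ suc z)))          ≡⟨ cong (par ∘ triangle) (trans (cong (λ x → q ℕ.+ suc x) (ℕ.+-suc z z)) (trans (ℕ.+-suc q _) (cong suc (ℕ.+-suc q _)))) ⟩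
  par (triangle k ℕ.+ k ℕ.+ suc k)                  ≡⟨ trans (par-+ (triangle k ℕ.+ k) (suc k)) (cong (_xor not (par k)) (par-+ (triangle k) k)) ⟩
  (par (triangle k) xor par k) xor not (par k)      ≡⟨ lemma (par (triangle k)) (par k) ⟩
  not (par (triangle k))                            ≡⟨ cong not (par-triangle q z) ⟩
  not (par (triangle q) xor par z)                  ≡⟨ 𝔹.not-distribʳ-xor (par (triangle q)) (par z) ⟩
  par (triangle q) xor not (par z)                  ∎
  where
  open ≡-Reasoning
  k = q ℕ.+ (z ℕ.+ z)
  lemma : ∀ t p → (t xor p) xor not p ≡ not t
  lemma false false = refl
  lemma false true  = refl
  lemma true  false = refl
  lemma true  true  = refl

∑∑-* : (f g : Fin n → ℕ) → ∑∑ (λ i j → f i ℕ.* g j) ≡ ℕ∑.sum f ℕ.* ℕ∑.sum g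
∑∑-* {n} f g = trans (ℕ∑.sum-cong-≗ λ i → pull (f i) g) (trans (ℕ∑.sum-cong-≗ λ i → ℕ.*-comm (f i) _) (trans (pull (ℕ∑.sum g) f) (ℕ.*-comm (ℕ∑.sum g) _)))
  where
  pull : ∀ {k} c (h : Fin k → ℕ) → ℕ∑.sum (λ j → c ℕ.* h j) ≡ c ℕ.* ℕ∑.sum h
  pull {zero}  c h = sym (ℕ.*-zeroʳ c)
  pull {suc k} c h = trans (cong (c ℕ.* h zero ℕ.+_) (pull c (h ∘ suc))) (sym (ℕ.*-distribˡ-+ c (h zero) _))

length-filter-tabulate : {A : Set} {Q : A → Set} (Q? : ∀ x → Dec (Q x)) (g : Fin n → A) →
                         length (filter Q? (List.tabulate g)) ≡ ℕ∑.sum (λ i → bit (does (Q? (g i))))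
length-filter-tabulate {n = zero} Q? g = refl
length-filter-tabulate {n = suc n} Q? g with does (Q? (g zero))
... | true  = cong suc (length-filter-tabulate Q? (g ∘ suc))
... | false = length-filter-tabulate Q? (g ∘ suc)

length-filter-product : {A B : Set} {Q : A × B → Set} (Q? : ∀ x → Dec (Q x)) (g : Fin n → A) (ys : List B) →
  length (filter Q? (cartesianProduct (List.tabulate g) ys)) ≡ ℕ∑.sum (λ i → length (filter (λ y → Q? (g i , y)) ys))
length-filter-product {n = zero} Q? g ys = refl
length-filter-product {n = suc n} Q? g ys = begin
  length (filter Q? (map (g zero ,_) ys ++ rest))                    ≡⟨ cong length (List.filter-++ Q? (map (g zero ,_) ys) rest) ⟩
  length (filter Q? (map (g zero ,_) ys) ++ filter Q? rest)          ≡⟨ List.length-++ (filter Q? (map (g zero ,_) ys)) ⟩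
  length (filter Q? (map (g zero ,_) ys)) ℕ.+ length (filter Q? rest) ≡⟨ cong₂ ℕ._+_ (row ys) (length-filter-product Q? (g ∘ suc) ys) ⟩
  length (filter (λ y → Q? (g zero , y)) ys) ℕ.+ ℕ∑.sum (λ i → length (filter (λ y → Q? (g (suc i) , y)) ys)) ∎
  where
  open ≡-Reasoning
  rest = cartesianProduct (List.tabulate (g ∘ suc)) ys
  row : ∀ zs → length (filter Q? (map (g zero ,_) zs)) ≡ length (filter (λ y → Q? (g zero , y)) zs)
  row [] = refl
  row (z ∷ zs) with does (Q? (g zero , z))
  ... | true  = cong suc (row zs)
  ... | false = row zs

module _ {n} {d : Point n → Point n} (M : IsMatching d) (planar : Planar d) where

  open TLMatching d M planar

  private
    ν : Point (n ℕ.+ n) → Point (n ℕ.+ n)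
    ν = νTL d
    inv = proj₁ M
    th : Fin (n ℕ.+ n) → Bool
    th k = isRight (ν (inj₁ k))

    th-jn : ∀ q → th (jn q) ≡ cross q
    th-jn q = trans (cong isRight (ν-left q)) (lemma (cross q))
      where
      lemma : ∀ b → isRight (put b (jn (d q))) ≡ b
      lemma true  = refl
      lemma false = refl

    ct cb : Fin n → Bool
    ct i = cross (inj₁ i)
    cb j = cross (inj₂ j)

    top : Fin n → Fin (n ℕ.+ n)
    top i = jn (inj₁ i)
    bottom : Fin n → Fin (n ℕ.+ n)
    bottom j = jn {n} (inj₂ j)

  -- Through points are fixed, so that this is an involution of all left points by which sums can be
  -- reindexed.
  partner : Fin n → Fin n
  partner i = [ id , const i ] (d (inj₁ i))

  partner-arc : ∀ {i} → ct i ≡ false → d (inj₁ i) ≡ inj₁ (partner i)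
  partner-arc {i} e with d (inj₁ i)
  ... | inj₁ _ = refl

  partner-through : ∀ {i} → ct i ≡ true → partner i ≡ i
  partner-through {i} e with d (inj₁ i)
  ... | inj₂ _ = refl

  partner-ct : ∀ {i} → ct i ≡ false → ct (partner i) ≡ false
  partner-ct {i} e = trans (cong cross (sym (partner-arc e))) (trans (cross-d (inj₁ i)) e)

  partner-involutive : ∀ i → partner (partner i) ≡ i
  partner-involutive i with ct i in e
  ... | true  = trans (cong partner (partner-through e)) (partner-through e)
  ... | false = inj₁-injective (trans (sym (partner-arc (partner-ct e))) (trans (cong d (sym (partner-arc e))) (inv (inj₁ i))))

  partner-≢ : ∀ {i} → ct i ≡ false → i ≢ partner i
  partner-≢ {i} e e′ = proj₂ M (inj₁ i) (trans (partner-arc e) (cong inj₁ (sym e′)))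

  opener closer : Fin n → Bool
  opener i = not (ct i) ∧ (i ⋖ partner i)
  closer i = not (ct i) ∧ (partner i ⋖ i)

  closer-partner : ∀ i → closer (partner i) ≡ opener i
  closer-partner i rewrite partner-involutive i with ct i in e
  ... | true rewrite partner-through e | e = refl
  ... | false rewrite partner-ct e = refl

  -- `h` is `true` at exactly one end of every arc, so the sum counts the arcs modulo 2.
  ⊕-arcs : (h : Fin n → Bool) → (∀ i → ct i ≡ false → h (partner i) ≡ not (h i)) →
           ⊕.sum (λ i → not (ct i) ∧ h i) ≡ ⊕.sum opener
  ⊕-arcs h alternating = begin
    ⊕.sum (λ i → not (ct i) ∧ h i)
      ≡⟨ ⊕.sum-cong-≗ split ⟩
    ⊕.sum (λ i → (opener i ∧ h i) xor (closer i ∧ h i))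
      ≡⟨ ⊕.∑-distrib-+ (λ i → opener i ∧ h i) (λ i → closer i ∧ h i) ⟩
    ⊕.sum (λ i → opener i ∧ h i) xor ⊕.sum (λ i → closer i ∧ h i)
      ≡⟨ cong (⊕.sum (λ i → opener i ∧ h i) xor_) (⊕-involution partner partner-involutive (λ i → closer i ∧ h i)) ⟩
    ⊕.sum (λ i → opener i ∧ h i) xor ⊕.sum (λ i → closer (partner i) ∧ h (partner i))
      ≡⟨ ⊕.∑-distrib-+ (λ i → opener i ∧ h i) (λ i → closer (partner i) ∧ h (partner i)) ⟨
    ⊕.sum (λ i → (opener i ∧ h i) xor (closer (partner i) ∧ h (partner i)))
      ≡⟨ ⊕.sum-cong-≗ join′ ⟩
    ⊕.sum opener ∎
    where
    open ≡-Reasoning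
    split : ∀ i → not (ct i) ∧ h i ≡ (opener i ∧ h i) xor (closer i ∧ h i)
    split i with ct i in e
    ... | true = refl
    ... | false rewrite ⋖-not {i = partner i} {i} (partner-≢ e ∘ sym) = lemma (i ⋖ partner i) (h i)
      where
      lemma : ∀ o x → x ≡ (o ∧ x) xor (not o ∧ x)
      lemma true  x = sym (xor-identityʳ x)
      lemma false x = refl
    join′ : ∀ i → (opener i ∧ h i) xor (closer (partner i) ∧ h (partner i)) ≡ opener i
    join′ i rewrite closer-partner i with ct i in e
    ... | true = refl
    ... | false rewrite alternating i e = lemma (i ⋖ partner i) (h i)
      where
      lemma : ∀ o x → (o ∧ x) xor (o ∧ not x) ≡ o
      lemma true  true  = refl
      lemma true  false = refl
      lemma false x     = refl

  order-openers : order d ≡ ℕ∑.sum (bit ∘ opener)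
  order-openers = trans (length-filter-product (λ (i , j) → leftEdge? d i j) id (allFin n))
    (ℕ∑.sum-cong-≗ λ i → trans (length-filter-tabulate (leftEdge? d i) id) (row i))
    where
    row : ∀ i → ℕ∑.sum (λ j → bit (does (leftEdge? d i j))) ≡ bit (opener i)
    row i with d (inj₁ i) in e
    ... | inj₂ k = ℕ∑-zero {n} λ j → cong bit (𝔹.∧-zeroʳ (does (i F.<? j)))
    ... | inj₁ k = trans (ℕ∑.sum-cong-≗ λ j → cell j) (ℕ∑-single k (bit (i ⋖ k)))
      where
      cell : ∀ j → bit (does (i F.<? j) ∧ does (k F.≟ j)) ≡ (if does (j F.≟ k) then bit (i ⋖ k) else 0)
      cell j with j F.≟ k
      ... | yes refl = cong bit (trans (cong₂ _∧_ (same (i F.<? j)) (dec-true (k F.≟ k) refl)) (𝔹.∧-identityʳ (i ⋖ j)))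
        where
        same : (x : Dec (i F.< j)) → does x ≡ (i ⋖ j)
        same (yes i<j) = sym (<⇒lt i<j)
        same (no i≮j)  = sym (≮⇒lt i≮j)
      ... | no j≢k = cong bit (trans (cong (does (i F.<? j) ∧_) (dec-false (k F.≟ j) (j≢k ∘ sym))) (𝔹.∧-zeroʳ (does (i F.<? j))))

  throughEdges : ℕ
  throughEdges = ℕ∑.sum (bit ∘ ct)

  through+arcs : n ≡ throughEdges ℕ.+ (order d ℕ.+ order d)
  through+arcs = begin
    n                                                                ≡⟨ trans (ℕ∑-const n 1) (ℕ.*-identityʳ n) ⟨
    ℕ∑.sum {n} (λ _ → 1)                                             ≡⟨ ℕ∑.sum-cong-≗ split ⟩
    ℕ∑.sum (λ i → bit (ct i) ℕ.+ (bit (opener i) ℕ.+ bit (closer i))) ≡⟨ ℕ∑.∑-distrib-+ (bit ∘ ct) (λ i → bit (opener i) ℕ.+ bit (closer i)) ⟩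
    throughEdges ℕ.+ ℕ∑.sum (λ i → bit (opener i) ℕ.+ bit (closer i)) ≡⟨ cong (throughEdges ℕ.+_) (ℕ∑.∑-distrib-+ (bit ∘ opener) (bit ∘ closer)) ⟩
    throughEdges ℕ.+ (ℕ∑.sum (bit ∘ opener) ℕ.+ ℕ∑.sum (bit ∘ closer))
      ≡⟨ cong₂ (λ x y → throughEdges ℕ.+ (x ℕ.+ y)) (sym order-openers)
           (trans (ℕ∑-involution partner partner-involutive (bit ∘ closer)) (trans (ℕ∑.sum-cong-≗ λ i → cong bit (closer-partner i)) (sym order-openers))) ⟩
    throughEdges ℕ.+ (order d ℕ.+ order d) ∎
    where
    open ≡-Reasoning
    split : ∀ i → 1 ≡ bit (ct i) ℕ.+ (bit (opener i) ℕ.+ bit (closer i))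
    split i with ct i in e
    ... | true = refl
    ... | false rewrite ⋖-not {i = partner i} {i} (partner-≢ e ∘ sym) with i ⋖ partner i
    ...   | true  = refl
    ...   | false = refl

  module _ {c ℓ} (𝕄 : CommutativeMonoid c ℓ) where

    open CommutativeMonoid 𝕄 using (Carrier; _≈_; _∙_; ε; setoid; identityˡ; identityʳ; ∙-cong; reflexive)
      renaming (sym to ≈-sym; trans to ≈-trans; refl to ≈-refl)
    open MonoidSum 𝕄 using (sum; sum-cong-≋; sum-replicate-zero)

    -- Extending `h` by the unit to the left points and reindexing all points by `d` moves the sum
    -- along the through edges to their left ends.
    sum-bottom : (h : Fin n → Carrier) (k : Fin n → Carrier) → (∀ j → cb j ≡ false → h j ≡ ε) →
                 (∀ i → ct i ≡ false → k i ≡ ε) → (∀ i j → d (inj₁ i) ≡ inj₂ j → h j ≡ k i) → sum h ≈ sum k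
    sum-bottom h k h-off k-off h-k = ≈-trans (≈-sym (identityˡ _)) (≈-trans (∙-cong (≈-sym (sum-replicate-zero n)) ≈-refl)
      (≈-trans (Split.sum-points 𝕄 d inv h⁺) (≈-trans (∙-cong (sum-cong-≋ λ i → reflexive (on-top i)) (≈-trans (sum-cong-≋ λ j → reflexive (on-bottom j)) (sum-replicate-zero n))) (identityʳ _))))
      where
      h⁺ : Point n → Carrier
      h⁺ = [ (λ _ → ε) , h ]
      on-top : ∀ i → h⁺ (d (inj₁ i)) ≡ k i
      on-top i with d (inj₁ i) in e
      ... | inj₁ _ = sym (k-off i (cong isRight e))
      ... | inj₂ j = h-k i j e
      on-bottom : ∀ j → h⁺ (d (inj₂ j)) ≡ ε
      on-bottom j with d (inj₂ j) in e
      ... | inj₁ _ = refl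
      ... | inj₂ k = h-off k (cong (not ∘ isRight) (trans (cong d (sym e)) (inv (inj₂ j))))

  through-bottom : ℕ∑.sum (bit ∘ cb) ≡ throughEdges
  through-bottom = sum-bottom ℕ.+-0-commutativeMonoid (bit ∘ cb) (bit ∘ ct) (λ j e → cong bit e) (λ i e → cong bit e)
    λ i j e → cong bit (trans (cong (not ∘ isRight) (trans (cong d (sym e)) (inv (inj₁ i)))) (sym (cong isRight e)))

  length-through : length (through ν) ≡ throughEdges ℕ.+ throughEdges
  length-through = trans (length-filterᵇ th id) (trans (ℕS.sum-split n (bit ∘ th))
    (cong₂ ℕ._+_ (ℕ∑.sum-cong-≗ λ i → cong bit (th-jn (inj₁ i)))
                 (trans (ℕ∑.sum-cong-≗ λ j → cong bit (th-jn (inj₂ j))) through-bottom)))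

  private
    pairs≡ : length (pairUp (through ν)) ≡ throughEdges
    pairs≡ = halves-double (through ν) throughEdges length-through

  tl-halves : halves (through ν)
  tl-halves = trans length-through (sym (cong₂ ℕ._+_ pairs≡ pairs≡))

  module V = DrawingVector ν core-TL tl-halves

  -- On the boundary the right point `j` has position `2 n - 1 - j`.
  par-pos-right : ∀ j → par (pos {n} (inj₂ j)) ≡ not (odd j)
  par-pos-right j = xor≡false _ _ (trans (sym (par-+ (pos {n} (inj₂ j)) (suc (toℕ j)))) (trans (cong par total) (trans (par-+ n n) (xor-same (par n)))))
    where
    total : pos {n} (inj₂ j) ℕ.+ suc (toℕ j) ≡ n ℕ.+ n
    total = trans (cong (ℕ._+ suc (toℕ j)) (trans (pos-right j) (cong (n ℕ.+_) (F.opposite-prop j))))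
      (trans (ℕ.+-assoc n _ _) (cong (n ℕ.+_) (ℕ.m∸n+n≡m (F.toℕ<n j))))

  arc-parity : ∀ i → ct i ≡ false → odd (partner i) ≡ not (odd i)
  arc-parity i e = trans (sym (trans (cong (par ∘ pos) (partner-arc e)) (cong par (pos-left (partner i)))))
    (trans (edge-parity M planar (inj₁ i)) (cong (not ∘ par) (pos-left i)))

  through-parity : ∀ {i j} → d (inj₁ i) ≡ inj₂ j → odd j ≡ odd i
  through-parity {i} {j} e = 𝔹.not-injective (trans (sym (par-pos-right j)) (trans (sym (cong (par ∘ pos) e))
    (trans (edge-parity M planar (inj₁ i)) (cong (not ∘ par) (pos-left i)))))

  module _ (G : SymmetricDrawing ν) where

    open SymmetricDrawing G using (paired; ends) renaming (whole to wholeG)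

    end : ∀ {q} → cross q ≡ true → endOf wholeG (jn q) ≡ jn (d q)
    end {q} e = ends (jn q) (jn (d q)) (trans (ν-left q) (cong (λ b → put b (jn (d q))) e))

    -- By planarity the through edges of `d` keep their vertical order. Hence in `νTL d` two wires
    -- that start in the same half do not cross, while a wire from the top half and one from the
    -- bottom half always do. With `k` through edges of `d` this gives `2 k k = 2 (2 p + k)`.
    tl-paired-count : length paired ≡ triangle throughEdges
    tl-paired-count = double-injective (ℕ.+-cancelʳ-≡ k _ _ (begin
      p ℕ.+ p ℕ.+ k                       ≡⟨ cong (λ x → p ℕ.+ x ℕ.+ k) (ℕ.+-identityʳ p) ⟨
      2 ℕ.* p ℕ.+ k                       ≡⟨ double-injective total ⟨
      k ℕ.* k                             ≡⟨ n*n≡n+2triangle k ⟩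
      k ℕ.+ (triangle k ℕ.+ triangle k)   ≡⟨ ℕ.+-comm k _ ⟩
      triangle k ℕ.+ triangle k ℕ.+ k     ∎))
      where
      open ≡-Reasoning
      p = length paired
      k = throughEdges
      I : Fin (n ℕ.+ n) → Fin (n ℕ.+ n) → ℕ
      I x y = bit (inverted th (endOf wholeG) x y)
      from-top : ∀ {i} → ct i ≡ true → ∃[ j ] d (inj₁ i) ≡ inj₂ j
      from-top {i} e with d (inj₁ i)
      ... | inj₂ j = j , refl
      from-bottom : ∀ {j} → cb j ≡ true → ∃[ i ] d (inj₂ j) ≡ inj₁ i
      from-bottom {j} e with d (inj₂ j)
      ... | inj₁ i = i , refl
      moved : ∀ {q r} → d q ≡ r → cross q ≡ true → cross r ≡ true
      moved {q} refl e = trans (cross-d q) e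
      ordered : ∀ {q r} → cross q ≡ true → cross r ≡ true → isRight q ≡ isRight r → (q ◃ r) ≡ (d q ◃ d r)
      ordered {q} {r} eq er side with q ≟ r
      ... | yes refl = trans (≮⇒lt (ℕ.<-irrefl {toℕ (jn q)} refl)) (sym (≮⇒lt (ℕ.<-irrefl {toℕ (jn (d q))} refl)))
      ... | no q≢r = go q r eq er side q≢r
        where
        r≢dq : ∀ q r → cross q ≡ true → isRight q ≡ isRight r → r ≢ d q
        r≢dq q r eq side refl = 𝔹.not-¬ {isRight q} refl (trans side (other-side eq))
        go : ∀ q r → cross q ≡ true → cross r ≡ true → isRight q ≡ isRight r → q ≢ r → (q ◃ r) ≡ (d q ◃ d r)
        go (inj₁ i) (inj₁ j) eq er side q≢r with from-top eq | from-top er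
        ... | i′ , di | j′ , dj = begin
          inj₁ i ◃ inj₁ j                             ≡⟨ top-⋖ i j ⟩
          (i ⋖ j)                                     ≡⟨ lt-left-left i j ⟨
          lt (inj₁ i) (inj₁ j)                        ≡⟨ xor-identityʳ _ ⟨
          lt (inj₁ i) (inj₁ j) xor false              ≡⟨ cong (lt (inj₁ i) (inj₁ j) xor_) (lt-right-left i′ j) ⟨
          lt (inj₁ i) (inj₁ j) xor lt (inj₂ i′) (inj₁ j)
            ≡⟨ cong (λ x → lt (inj₁ i) (inj₁ j) xor lt x (inj₁ j)) di ⟨
          lt (inj₁ i) (inj₁ j) xor lt (d (inj₁ i)) (inj₁ j)
            ≡⟨ planar (inj₁ i) (inj₁ j) (q≢r ∘ sym) (r≢dq (inj₁ i) (inj₁ j) eq refl) ⟩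
          lt (inj₁ i) (d (inj₁ j)) xor lt (d (inj₁ i)) (d (inj₁ j))
            ≡⟨ cong₂ (λ x y → lt (inj₁ i) y xor lt x y) di dj ⟩
          lt (inj₁ i) (inj₂ j′) xor lt (inj₂ i′) (inj₂ j′) ≡⟨ cong₂ _xor_ (lt-left-right i j′) (lt-right-right i′ j′) ⟩
          not (j′ ⋖ i′)                               ≡⟨ ⋖-not (λ e → q≢r (matching-injective M (trans di (trans (cong inj₂ e) (sym dj))))) ⟨
          (i′ ⋖ j′)                                   ≡⟨ bottom-⋖ i′ j′ ⟨
          inj₂ i′ ◃ inj₂ j′                           ≡⟨ cong₂ _◃_ di dj ⟨
          d (inj₁ i) ◃ d (inj₁ j)                     ∎
        go (inj₂ i) (inj₂ j) eq er side q≢r with from-bottom eq | from-bottom er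
        ... | i′ , di | j′ , dj = begin
          inj₂ i ◃ inj₂ j                             ≡⟨ cong₂ _◃_ (trans (cong d (sym di)) (inv (inj₂ i))) (trans (cong d (sym dj)) (inv (inj₂ j))) ⟨
          d (inj₁ i′) ◃ d (inj₁ j′)
            ≡⟨ go (inj₁ i′) (inj₁ j′) (moved di eq) (moved dj er) refl (λ e → q≢r (matching-injective M (trans di (trans e (sym dj))))) ⟨
          inj₁ i′ ◃ inj₁ j′                           ≡⟨ cong₂ _◃_ di dj ⟨
          d (inj₂ i) ◃ d (inj₂ j)                     ∎
      side-block : ∀ q r → isRight q ≡ isRight r → I (jn q) (jn r) ≡ 0
      side-block q r side = cong bit (go (th (jn q)) (th (jn r)) (th-jn q) (th-jn r))
        where
        go : ∀ a b → a ≡ cross q → b ≡ cross r → a ∧ (b ∧ ((q ◃ r) xor (endOf wholeG (jn q) ⋖ endOf wholeG (jn r)))) ≡ false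
        go false b _ _ = refl
        go true false _ _ = refl
        go true true eq er = trans (cong₂ _xor_ (ordered (sym eq) (sym er) side) (cong₂ _⋖_ (end (sym eq)) (end (sym er)))) (xor-same (d q ◃ d r))
      tb : ∀ i j → I (top i) (bottom j) ≡ bit (ct i) ℕ.* bit (cb j)
      tb i j = go (th (top i)) (th (bottom j)) (th-jn (inj₁ i)) (th-jn (inj₂ j))
        where
        facing : ∀ {q r} → isRight q ≡ true → isRight r ≡ false → (q ◃ r) ≡ false
        facing {inj₂ k} {inj₁ l} _ _ = bottom-top-⋖ k l
        go : ∀ a b → a ≡ ct i → b ≡ cb j → bit (a ∧ (b ∧ ((top i ⋖ bottom j) xor (endOf wholeG (top i) ⋖ endOf wholeG (bottom j))))) ≡ bit (ct i) ℕ.* bit (cb j)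
        go false b e _ = cong (λ x → bit x ℕ.* bit (cb j)) e
        go true false e e′ = sym (trans (cong (λ x → bit (ct i) ℕ.* bit x) (sym e′)) (ℕ.*-zeroʳ (bit (ct i))))
        go true true e e′ = trans (cong bit (cong₂ _xor_ (top-bottom-⋖ i j)
          (trans (cong₂ _⋖_ (end (sym e)) (end (sym e′))) (facing {d (inj₁ i)} {d (inj₂ j)} (other-side (sym e)) (other-side (sym e′))))))
          (cong₂ (λ x y → bit x ℕ.* bit y) e e′)
      bt : ∀ j i → I (bottom j) (top i) ≡ bit (cb j) ℕ.* bit (ct i)
      bt j i = go (th (bottom j)) (th (top i)) (th-jn (inj₂ j)) (th-jn (inj₁ i))
        where
        facing : ∀ {q r} → isRight q ≡ false → isRight r ≡ true → (q ◃ r) ≡ true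
        facing {inj₁ k} {inj₂ l} _ _ = top-bottom-⋖ k l
        go : ∀ b a → b ≡ cb j → a ≡ ct i → bit (b ∧ (a ∧ ((bottom j ⋖ top i) xor (endOf wholeG (bottom j) ⋖ endOf wholeG (top i))))) ≡ bit (cb j) ℕ.* bit (ct i)
        go false a e _ = cong (λ x → bit x ℕ.* bit (ct i)) e
        go true false e e′ = sym (trans (cong (λ x → bit (cb j) ℕ.* bit x) (sym e′)) (ℕ.*-zeroʳ (bit (cb j))))
        go true true e e′ = trans (cong bit (cong₂ _xor_ (bottom-top-⋖ j i)
          (trans (cong₂ _⋖_ (end (sym e)) (end (sym e′))) (facing {d (inj₂ j)} {d (inj₁ i)} (other-side (sym e)) (other-side (sym e′))))))
          (cong₂ (λ x y → bit x ℕ.* bit y) e e′)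
      zeros : (N : Fin n → Fin n → ℕ) → (∀ i j → N i j ≡ 0) → ∑∑ N ≡ 0
      zeros N e = ℕ∑-zero {n} λ i → ℕ∑-zero {n} (e i)
      TT TB BT BB : Fin n → Fin n → ℕ
      TT i j = I (top i) (top j)
      TB i j = I (top i) (bottom j)
      BT i j = I (bottom i) (top j)
      BB i j = I (bottom i) (bottom j)
      total : k ℕ.* k ℕ.+ k ℕ.* k ≡ 2 ℕ.* p ℕ.+ k ℕ.+ (2 ℕ.* p ℕ.+ k)
      total = begin
        k ℕ.* k ℕ.+ k ℕ.* k
          ≡⟨ cong (k ℕ.* k ℕ.+_) (ℕ.+-identityʳ _) ⟨
        (0 ℕ.+ k ℕ.* k) ℕ.+ (k ℕ.* k ℕ.+ 0)
          ≡⟨ cong₂ ℕ._+_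
               (cong₂ ℕ._+_ (zeros TT λ i j → side-block (inj₁ i) (inj₁ j) refl)
                 (trans (∑∑-cong {M = TB} tb) (trans (∑∑-* (bit ∘ ct) (bit ∘ cb)) (cong (k ℕ.*_) through-bottom))))
               (cong₂ ℕ._+_ (trans (∑∑-cong {M = BT} bt) (trans (∑∑-* (bit ∘ cb) (bit ∘ ct)) (cong (ℕ._* k) through-bottom)))
                 (zeros BB λ i j → side-block (inj₂ i) (inj₂ j) refl)) ⟨
        (∑∑ TT ℕ.+ ∑∑ TB) ℕ.+ (∑∑ BT ℕ.+ ∑∑ BB)
          ≡⟨ ∑∑-split {n} I ⟨
        ∑∑ I ≡⟨ nice-count ν core-TL G ⟩
        2 ℕ.* (2 ℕ.* p ℕ.+ length (pairUp (through ν))) ≡⟨ cong (λ k → 2 ℕ.* (2 ℕ.* p ℕ.+ k)) pairs≡ ⟩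
        2 ℕ.* (2 ℕ.* p ℕ.+ k) ≡⟨ cong (2 ℕ.* p ℕ.+ k ℕ.+_) (ℕ.+-identityʳ _) ⟩
        2 ℕ.* p ℕ.+ k ℕ.+ (2 ℕ.* p ℕ.+ k) ∎

xor-≡ : ∀ {x y} → x ≡ y → x xor y ≡ false
xor-≡ {x} refl = xor-same x

module _ {n} {d : Point n → Point n} (M : IsMatching d) (planar : Planar d)
         (G : SymmetricDrawing (νTL d)) (η : Fin (n ℕ.+ n) → Bool) where

  open TLMatching d M planar
  open V M planar

  private
    inv = proj₁ M
    ν = νTL d
    N = par n
    z = order d
    q₀ = throughEdges M planar
    ct : Fin n → Bool
    ct i = cross (inj₁ i)
    cb : Fin n → Bool
    cb j = cross (inj₂ j)
    ηᵗ : Fin n → Bool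
    ηᵗ i = η (jn (inj₁ i))
    ρ : Fin n → Bool
    ρ j = shade η (jn {n} (inj₂ j)) xor not N
    -- The same colouring by which the vector of ν(π) is expressed through the wiring, now read on
    -- the points of `d`.
    κ : Point n → Bool
    κ = [ shade ηᵗ , ρ ]
    open SymmetricDrawing G using (paired) renaming (whole to wholeG)

    κ-shade : ∀ q → κ q ≡ shade η (jn q) xor (isRight q ∧ not N)
    κ-shade (inj₁ i) = trans (cong (ηᵗ i xor_) (sym (odd-top i))) (sym (xor-identityʳ (shade η (jn (inj₁ i)))))
    κ-shade (inj₂ j) = refl

    slot-parity-left : ∀ i → ct i ≡ true → odd (jn (d (inj₁ i))) ≡ N xor odd (jn (inj₁ i))
    slot-parity-left i e with d (inj₁ i) in di
    ... | inj₂ j = trans (odd-bottom j) (cong (N xor_) (trans (through-parity M planar di) (sym (odd-top i))))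

    -- By `edge-parity` a through edge of `d` joins heights of equal parity, and the bottom half
    -- starts at slot `n`.
    slot-parity : ∀ q → cross q ≡ true → odd (jn (d q)) ≡ N xor odd (jn q)
    slot-parity (inj₁ i) e = slot-parity-left i e
    slot-parity (inj₂ j) e with d (inj₂ j) in dj
    ... | inj₁ i = sym (trans (cong (N xor_) (trans (cong (odd ∘ jn) (sym di)) (slot-parity-left i (cong isRight di))))
      (trans (sym (xor-assoc N N (odd (jn (inj₁ i))))) (cong (_xor odd (jn (inj₁ i))) (xor-same N))))
      where
      di : d (inj₁ i) ≡ inj₂ j
      di = trans (cong d (sym dj)) (inv (inj₂ j))

    κ-cross : ∀ q → cross q ≡ true → κ (d q) xor κ q ≡ not (η (jn (d q)) xor η (jn q))
    κ-cross q e = trans (cong₂ _xor_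
      (trans (κ-shade (d q)) (cong₂ (λ o s → (η (jn (d q)) xor o) xor (s ∧ not N)) (slot-parity q e) (other-side e))) (κ-shade q))
      (lemma (η (jn (d q))) (η (jn q)) N (odd (jn q)) (isRight q))
      where
      open xor-∧-Solver
      lemma : ∀ y x N o s → ((y xor (N xor o)) xor ((true xor s) ∧ (true xor N))) xor ((x xor o) xor (s ∧ (true xor N))) ≡ true xor (y xor x)
      lemma = solve 5 (λ y x N o s → ((y :+ (N :+ o)) :+ ((con true :+ s) :* (con true :+ N))) :+ ((x :+ o) :+ (s :* (con true :+ N))) := con true :+ (y :+ x)) refl

    κ-arc : ∀ q → cross q ≡ false → κ (d q) xor κ q ≡ shade η (jn (d q)) xor shade η (jn q)
    κ-arc q e = trans (cong₂ _xor_ (trans (κ-shade (d q)) (cong (λ s → shade η (jn (d q)) xor (s ∧ not N)) (same-side e))) (κ-shade q))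
      (lemma (shade η (jn (d q))) (shade η (jn q)) (isRight q ∧ not N))
      where
      open xor-∧-Solver
      lemma : ∀ y x c → (y xor c) xor (x xor c) ≡ y xor x
      lemma = solve 3 (λ y x c → (y :+ c) :+ (x :+ c) := y :+ x) refl

    th-jn : ∀ q → th (jn q) ≡ cross q
    th-jn q = trans (cong isRight (ν-left q)) (lemma (cross q))
      where
      lemma : ∀ b → isRight (put b (jn (d q))) ≡ b
      lemma true  = refl
      lemma false = refl

    mask-arc : ∀ q → cross q ≡ false → mask (shade η) (jn q) ≡ shade η (jn q)
    mask-arc q e rewrite trans (th-jn q) e = refl

    mask-cross : ∀ q → cross q ≡ true → mask (shade η) (jn q) ≡ false
    mask-cross q e rewrite trans (th-jn q) e = refl

    masked : Point (n ℕ.+ n) → Bool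
    masked = [ mask (shade η) , const false ]

    core-at : ∀ q b → cross q ≡ b → core ν (inj₁ (jn q)) ≡ (if b then inj₂ (jn q) else inj₁ (jn (d q)))
    core-at q b e = trans (core-left q) (cong (λ b → if b then inj₂ (jn q) else inj₁ (jn (d q))) e)

    core-at′ : ∀ q b → cross q ≡ b → core ν (inj₂ (jn q)) ≡ (if b then inj₁ (jn q) else inj₂ (jn (d q)))
    core-at′ q b e = trans (core-right q) (cong (λ b → if b then inj₁ (jn q) else inj₂ (jn (d q))) e)

    xor-not : ∀ {x y} → y ≡ not x → not (y xor x) ≡ false
    xor-not {false} refl = refl
    xor-not {true} refl = refl

    not-xor : ∀ x y → not (y xor x) ≡ false → y ≡ not x
    not-xor false true  _ = refl
    not-xor true  false _ = refl

    -- The ends of an arc lie in one half, where `κ` differs from the shade by a constant. Along a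
    -- through edge the parities of the slots and the shift in `ρ` combine to one negation, which
    -- turns opposition into equality.
    constant-split : arcsConstant (shade η) ∧ does (opposed? (endOf wholeG) η) ≡ constant d κ
    constant-split = trans (sym (does-true _)) (decide to from ((arcsConstant (shade η) ∧ does (opposed? (endOf wholeG) η)) 𝔹.≟ true) (constant? d κ))
      where
      undo : {A : Set} (a? : Dec A) → does a? ≡ true → A
      undo (yes a) _ = a
      split : ∀ {a b} → a ∧ b ≡ true → a ≡ true × b ≡ true
      split {true} {true} _ = refl , refl
      to : arcsConstant (shade η) ∧ does (opposed? (endOf wholeG) η) ≡ true → Constant d κ
      to e q = xor≡false (κ (d q)) (κ q) (by-cross (cross q) refl)
        where
        arcs : Constant (core ν) masked
        arcs = undo (constant? (core ν) masked) (proj₁ (split {arcsConstant (shade η)} e))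
        opp : Opposed (endOf wholeG) η
        opp = undo (opposed? (endOf wholeG) η) (proj₂ (split {arcsConstant (shade η)} e))
        by-cross : ∀ b → cross q ≡ b → κ (d q) xor κ q ≡ false
        by-cross true  e = trans (κ-cross q e) (xor-not (trans (cong η (sym (end M planar G e))) (opp (jn q) (trans (th-jn q) e))))
        by-cross false e = trans (κ-arc q e) (xor-≡ (trans (sym (mask-arc (d q) (trans (cross-d q) e)))
          (trans (trans (cong masked (sym (core-at q false e))) (arcs (inj₁ (jn q)))) (mask-arc q e))))
      from : Constant d κ → arcsConstant (shade η) ∧ does (opposed? (endOf wholeG) η) ≡ true
      from c = cong₂ _∧_ (dec-true (constant? (core ν) masked) arcs) (dec-true (opposed? (endOf wholeG) η) opp)
        where
        left : ∀ q b → cross q ≡ b → masked (core ν (inj₁ (jn q))) ≡ masked (inj₁ (jn q))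
        left q true  e = trans (cong masked (core-at q true e)) (sym (mask-cross q e))
        left q false e = trans (cong masked (core-at q false e)) (trans (mask-arc (d q) (trans (cross-d q) e))
          (trans (xor≡false (shade η (jn (d q))) (shade η (jn q)) (trans (sym (κ-arc q e)) (xor-≡ (c q)))) (sym (mask-arc q e))))
        right : ∀ q b → cross q ≡ b → masked (core ν (inj₂ (jn q))) ≡ false
        right q true  e = trans (cong masked (core-at′ q true e)) (mask-cross q e)
        right q false e = cong masked (core-at′ q false e)
        arcs : Constant (core ν) masked
        arcs (inj₁ k) with jn-split {n} k
        ... | q , refl = left q (cross q) refl
        arcs (inj₂ k) with jn-split {n} k
        ... | q , refl = right q (cross q) refl
        opp : Opposed (endOf wholeG) η
        opp k tk with jn-split {n} k
        ... | q , refl = trans (cong η (end M planar G cq)) (not-xor (η (jn q)) (η (jn (d q))) (trans (sym (κ-cross q cq)) (xor-≡ (c q))))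
          where
          cq : cross q ≡ true
          cq = trans (sym (th-jn q)) tk

    Zp = par z
    T₀ = par (triangle n)
    Σηᵗ = ⊕.sum ηᵗ

    par-openers : ⊕.sum (opener M planar) ≡ Zp
    par-openers = sym (trans (cong par (order-openers M planar)) (trans (par-∑ (bit ∘ opener M planar)) (⊕.sum-cong-≗ λ i → par-bit (opener M planar i))))

    par-through : par q₀ ≡ N
    par-through = sym (trans (cong par (through+arcs M planar)) (trans (par-+ q₀ (z ℕ.+ z)) (trans (cong (par q₀ xor_) (trans (par-+ z z) (xor-same Zp))) (xor-identityʳ (par q₀)))))

    -- Each of the `z` arcs on the left takes two points away from the through points, and by
    -- `par-triangle` that flips the parity once.
    par-triangle-through : par (triangle q₀) ≡ T₀ xor Zp
    par-triangle-through = sym (trans (cong (λ k → par (triangle k) xor Zp) (through+arcs M planar))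
      (trans (cong (_xor Zp) (par-triangle q₀ z)) (trans (xor-assoc (par (triangle q₀)) Zp Zp) (trans (cong (par (triangle q₀) xor_) (xor-same Zp)) (xor-identityʳ (par (triangle q₀)))))))

    -- On the left points of d, a sum over the through edges is the sum over
    -- all points minus one contribution of each arc.
    through-sum : (h : Fin n → Bool) → (∀ i → ct i ≡ false → h (partner M planar i) ≡ not (h i)) →
                  ⊕.sum (λ i → ct i ∧ h i) ≡ ⊕.sum h xor Zp
    through-sum h alternating = sym (begin
      ⊕.sum h xor Zp                                                        ≡⟨ cong (⊕.sum h xor_) (trans (sym par-openers) (sym (⊕-arcs M planar h alternating))) ⟩
      ⊕.sum h xor ⊕.sum (λ i → not (ct i) ∧ h i)                            ≡⟨ ⊕.∑-distrib-+ h (λ i → not (ct i) ∧ h i) ⟨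
      ⊕.sum (λ i → h i xor (not (ct i) ∧ h i))                              ≡⟨ ⊕.sum-cong-≗ (λ i → lemma (ct i) (h i)) ⟩
      ⊕.sum (λ i → ct i ∧ h i)                                              ∎)
      where
      open ≡-Reasoning
      lemma : ∀ c x → x xor (not c ∧ x) ≡ c ∧ x
      lemma true  x = xor-identityʳ x
      lemma false x = xor-same x

    module _ (c : Constant d κ) where

      ηᵗ-alternates : ∀ i → ct i ≡ false → ηᵗ (partner M planar i) ≡ not (ηᵗ i)
      ηᵗ-alternates i e = lemma (ηᵗ (partner M planar i)) (ηᵗ i) (odd i)
        (trans (cong (ηᵗ (partner M planar i) xor_) (sym (arc-parity M planar i e))) (trans (cong κ (sym (partner-arc M planar e))) (c (inj₁ i))))
        where
        lemma : ∀ y x o → y xor not o ≡ x xor o → y ≡ not x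
        lemma false true  false _ = refl
        lemma false true  true  _ = refl
        lemma true  false false _ = refl
        lemma true  false true  _ = refl

      shades : throughShades η ≡ ((T₀ xor Zp) xor N) xor (N ∧ (Σηᵗ xor Zp))
      shades = begin
        throughShades η
          ≡⟨ trans (⊕S.sum-split n (λ k → th k ∧ (η k ∧ odd k))) (cong₂ _xor_ (⊕.sum-cong-≗ at-top) at-bottom) ⟩
        ⊕.sum (λ i → ct i ∧ (ηᵗ i ∧ odd i)) xor ⊕.sum (λ i → ct i ∧ (not (ηᵗ i) ∧ (N xor odd i)))
          ≡⟨ ⊕.∑-distrib-+ (λ i → ct i ∧ (ηᵗ i ∧ odd i)) (λ i → ct i ∧ (not (ηᵗ i) ∧ (N xor odd i))) ⟨
        ⊕.sum (λ i → (ct i ∧ (ηᵗ i ∧ odd i)) xor (ct i ∧ (not (ηᵗ i) ∧ (N xor odd i))))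
          ≡⟨ ⊕.sum-cong-≗ (λ i → pair (ct i) (ηᵗ i) (odd i) N) ⟩
        ⊕.sum (λ i → ((ct i ∧ odd i) xor (N ∧ ct i)) xor (N ∧ (ct i ∧ ηᵗ i)))
          ≡⟨ trans (⊕.∑-distrib-+ (λ i → (ct i ∧ odd i) xor (N ∧ ct i)) (λ i → N ∧ (ct i ∧ ηᵗ i)))
               (cong₂ _xor_ (⊕.∑-distrib-+ (λ i → ct i ∧ odd i) (λ i → N ∧ ct i)) (⊕-∧ N (λ i → ct i ∧ ηᵗ i))) ⟩
        (⊕.sum (λ i → ct i ∧ odd i) xor ⊕.sum (λ i → N ∧ ct i)) xor (N ∧ ⊕.sum (λ i → ct i ∧ ηᵗ i))
          ≡⟨ cong₂ _xor_ (cong₂ _xor_ (trans (through-sum odd (arc-parity M planar)) (cong (_xor Zp) (⊕-odd n)))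
                 (trans (⊕-∧ N ct) (trans (cong (N ∧_) (trans (sym (trans (par-∑ (bit ∘ ct)) (⊕.sum-cong-≗ λ i → par-bit (ct i)))) par-through)) (𝔹.∧-idem N))))
               (cong (N ∧_) (through-sum ηᵗ ηᵗ-alternates)) ⟩
        ((T₀ xor Zp) xor N) xor (N ∧ (Σηᵗ xor Zp)) ∎
        where
        open ≡-Reasoning
        at-top : ∀ i → th (jn (inj₁ i)) ∧ (η (jn (inj₁ i)) ∧ odd (jn (inj₁ i))) ≡ ct i ∧ (ηᵗ i ∧ odd i)
        at-top i = cong₂ (λ t o → t ∧ (ηᵗ i ∧ o)) (th-jn (inj₁ i)) (odd-top i)
        at-bottom : ⊕.sum (λ j → th (jn {n} (inj₂ j)) ∧ (η (jn {n} (inj₂ j)) ∧ odd (jn {n} (inj₂ j)))) ≡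
                    ⊕.sum (λ i → ct i ∧ (not (ηᵗ i) ∧ (N xor odd i)))
        at-bottom = sum-bottom M planar (CommutativeRing.+-commutativeMonoid xor-∧-commutativeRing) _ _
          (λ j e → cong (_∧ (η (jn {n} (inj₂ j)) ∧ odd (jn {n} (inj₂ j)))) (trans (th-jn (inj₂ j)) e))
          (λ i e → cong (_∧ (not (ηᵗ i) ∧ (N xor odd i))) e)
          λ i j e → cong₂ _∧_ (trans (th-jn (inj₂ j)) (trans (cong cross (sym e)) (cross-d (inj₁ i))))
            (cong₂ _∧_ (trans (cong (η ∘ jn) (sym e)) (not-xor (ηᵗ i) (η (jn (d (inj₁ i)))) (trans (sym (κ-cross (inj₁ i) (cong isRight e))) (xor-≡ (c (inj₁ i))))))
                       (trans (odd-bottom j) (cong (N xor_) (through-parity M planar e))))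
        pair : ∀ c x o N → (c ∧ (x ∧ o)) xor (c ∧ (not x ∧ (N xor o))) ≡ ((c ∧ o) xor (N ∧ c)) xor (N ∧ (c ∧ x))
        pair = solve 4 (λ c x o N → (c :* (x :* o)) :+ (c :* ((con true :+ x) :* (N :+ o))) := ((c :* o) :+ (N :* c)) :+ (N :* (c :* x))) refl
          where open xor-∧-Solver

      -- The dependence of `shades` on the number of arcs cancels against that of the paired
      -- crossings, except for `N ∧ Zp`, which arises because `ηᵗ` is summed over the through points
      -- only. The factor of `g̃` with exponent `order d * n` removes this term.
      sign : (Zp ∧ N) xor (throughShades η xor (par (length paired) xor par pairs)) ≡ N ∧ Σηᵗ
      sign = trans (cong ((Zp ∧ N) xor_) (cong₂ _xor_ shades (cong₂ _xor_
          (trans (cong par (tl-paired-count M planar G)) par-triangle-through)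
          (trans (cong par (halves-double (through ν) q₀ (length-through M planar))) par-through))))
        (lemma Zp N T₀ Σηᵗ)
        where
        open xor-∧-Solver
        lemma : ∀ z N t s → (z ∧ N) xor ((((t xor z) xor N) xor (N ∧ (s xor z))) xor ((t xor z) xor N)) ≡ N ∧ s
        lemma = solve 4 (λ z N t s → (z :* N) :+ ((((t :+ z) :+ N) :+ (N :* (s :+ z))) :+ ((t :+ z) :+ N)) := N :* s) refl

  -- Sign and colouring are those of `matchingVector` and do not involve `d`, so in a sum over all
  -- `d` only the indicators `constant d` vary.
  tlVector : sg (par (order d ℕ.* n)) ℤ.* vector paired (shade η) ≡
             sg (par n ∧ ⊕.sum {n} (λ i → η (jn (inj₁ i)))) ℤ.*
             ⟦ constant d [ shade (λ i → η (jn (inj₁ i))) , (λ j → shade η (jn {n} (inj₂ j)) xor not (par n)) ] ⟧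
  tlVector = begin
    sg (par (z ℕ.* n)) ℤ.* vector paired (shade η)
      ≡⟨ cong₂ (λ x y → sg x ℤ.* y) (par-* z n) (vector-closed G η) ⟩
    sg (Zp ∧ N) ℤ.* (sg s ℤ.* (⟦ arcsConstant (shade η) ⟧ ℤ.* ⟦ does (opposed? (endOf wholeG) η) ⟧))
      ≡⟨ trans (sym (ℤ.*-assoc (sg (Zp ∧ N)) (sg s) _)) (cong₂ ℤ._*_ (sym (sg-xor (Zp ∧ N) s)) (sym (⟦⟧-∧ (arcsConstant (shade η)) _))) ⟩
    sg ((Zp ∧ N) xor s) ℤ.* ⟦ arcsConstant (shade η) ∧ does (opposed? (endOf wholeG) η) ⟧
      ≡⟨ cong (λ x → sg ((Zp ∧ N) xor s) ℤ.* ⟦ x ⟧) constant-split ⟩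
    sg ((Zp ∧ N) xor s) ℤ.* ⟦ constant d κ ⟧
      ≡⟨ agree (constant? d κ) ⟩
    sg (N ∧ Σηᵗ) ℤ.* ⟦ constant d κ ⟧ ∎
    where
    open ≡-Reasoning
    s = throughShades η xor (par (length paired) xor par pairs)
    agree : (c? : Dec (Constant d κ)) → sg ((Zp ∧ N) xor s) ℤ.* ⟦ does c? ⟧ ≡ sg (N ∧ Σηᵗ) ℤ.* ⟦ does c? ⟧
    agree (yes c) = cong (λ x → sg x ℤ.* 1ℤ) (sign c)
    agree (no _)  = trans (ℤ.*-zeroʳ (sg ((Zp ∧ N) xor s))) (sym (ℤ.*-zeroʳ (sg (N ∧ Σηᵗ))))

-- Independence of the state vectors of planar symmetric diagrams

-- The default is the colour of the right end of a horizontal edge: a slot that neither opens nor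
-- closes an arc belongs to such an edge and is read with an empty stack.
topOf : List Bool → Bool
topOf []      = false
topOf (y ∷ _) = y

-- A diagram is read from top to bottom as a word telling which slots open an
-- arc; the colours of the open arcs are kept on a stack.
matches : List Bool → Vec Bool m → Vec Bool m → Bool
matches s []          []      = true
matches s (true ∷ b)  (x ∷ ε) = matches (x ∷ s) b ε
matches s (false ∷ b) (x ∷ ε) = not (x xor topOf s) ∧ matches (drop 1 s) b ε

-- At each slot, opening an arc in the colour that the next closing slot does
-- not accept isolates the words with an opening letter.
alternating : ℕ → List Bool
alternating zero    = []
alternating (suc q) = not (topOf (alternating q)) ∷ alternating q

-- Independence is used in dual form: a linear functional that vanishes on the functions of words
-- given by all colourings is zero.
record Linear {A : Set} (F : (A → ℤ) → ℤ) : Set where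
  field
    F-cong : ∀ {φ ψ} → φ ≗ ψ → F φ ≡ F ψ
    F-+    : ∀ φ ψ → F (λ b → φ b ℤ.+ ψ b) ≡ F φ ℤ.+ F ψ
    F-*    : ∀ k φ → F (λ b → k ℤ.* φ b) ≡ k ℤ.* F φ

opening closing : (Vec Bool m → ℤ) → Vec Bool (suc m) → ℤ
opening φ (true ∷ b)  = φ b
opening φ (false ∷ b) = 0ℤ
closing φ (true ∷ b)  = 0ℤ
closing φ (false ∷ b) = φ b

opening-linear : {F : (Vec Bool (suc m) → ℤ) → ℤ} → Linear F → Linear (F ∘ opening)
opening-linear L = record
  { F-cong = λ e → L.F-cong λ { (true ∷ b) → e b ; (false ∷ b) → refl }
  ; F-+    = λ φ ψ → trans (L.F-cong λ { (true ∷ b) → refl ; (false ∷ b) → refl }) (L.F-+ (opening φ) (opening ψ))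
  ; F-*    = λ k φ → trans (L.F-cong λ { (true ∷ b) → refl ; (false ∷ b) → sym (ℤ.*-zeroʳ k) }) (L.F-* k (opening φ))
  }
  where module L = Linear L

closing-linear : {F : (Vec Bool (suc m) → ℤ) → ℤ} → Linear F → Linear (F ∘ closing)
closing-linear L = record
  { F-cong = λ e → L.F-cong λ { (true ∷ b) → refl ; (false ∷ b) → e b }
  ; F-+    = λ φ ψ → trans (L.F-cong λ { (true ∷ b) → refl ; (false ∷ b) → refl }) (L.F-+ (closing φ) (closing ψ))
  ; F-*    = λ k φ → trans (L.F-cong λ { (true ∷ b) → sym (ℤ.*-zeroʳ k) ; (false ∷ b) → refl }) (L.F-* k (closing φ))
  }
  where module L = Linear L

-- The induction covers all words, whether or not they come from diagrams, and all alternating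
-- stacks; the pushes and pops used keep the stack alternating. Functions supported on opening
-- letters are settled first, and this is then used for the closing letters.
matches-independent : ∀ m q {F : (Vec Bool m → ℤ) → ℤ} → Linear F →
                      (∀ ε → F (λ b → ⟦ matches (alternating q) b ε ⟧) ≡ 0ℤ) → ∀ φ → F φ ≡ 0ℤ
matches-independent zero q L vanish φ = trans (F-cong {φ} {λ _ → φ [] ℤ.* 1ℤ} λ { [] → sym (ℤ.*-identityʳ (φ [])) })
  (trans (F-* (φ []) (λ _ → 1ℤ)) (trans (cong (φ [] ℤ.*_) (trans (F-cong λ { [] → refl }) (vanish []))) (ℤ.*-zeroʳ (φ []))))
  where open Linear L
matches-independent (suc m) q {F} L vanish φ = trans (split φ) (cong₂ ℤ._+_ (openings (λ b → φ (true ∷ b))) (closings (λ b → φ (false ∷ b))))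
  where
  open Linear L
  t = topOf (alternating q)
  split : ∀ φ → F φ ≡ F (opening λ b → φ (true ∷ b)) ℤ.+ F (closing λ b → φ (false ∷ b))
  split φ = trans (F-cong λ { (true ∷ b) → sym (ℤ.+-identityʳ _) ; (false ∷ b) → sym (ℤ.+-identityˡ _) })
    (F-+ (opening λ b → φ (true ∷ b)) (closing λ b → φ (false ∷ b)))
  -- The colour `not t` at the next slot is refused by a closing letter, so `F` sees only words that
  -- begin with an opening, and `not t` is pushed on the stack.
  openings : ∀ φ → F (opening φ) ≡ 0ℤ
  openings = matches-independent m (suc q) (opening-linear L) λ ε →
    trans (F-cong λ { (true ∷ b) → refl
                    ; (false ∷ b) → cong (λ c → ⟦ c ∧ matches (drop 1 (alternating q)) b ε ⟧) (sym (cong not (isolate t))) })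
          (vanish (not t ∷ ε))
    where
    isolate : ∀ t → not t xor t ≡ true
    isolate false = refl
    isolate true  = refl
  drop-alternating : ∀ q → drop 1 (alternating q) ≡ alternating (ℕ.pred q)
  drop-alternating zero    = refl
  drop-alternating (suc q) = refl
  -- With the colour `t` both letters contribute, but the contribution of the openings is already
  -- known to vanish.
  closings : ∀ φ → F (closing φ) ≡ 0ℤ
  closings = matches-independent m (ℕ.pred q) (closing-linear L) λ ε → begin
    F (closing λ b → ⟦ matches (alternating (ℕ.pred q)) b ε ⟧)
      ≡⟨ F-cong (λ { (true ∷ b) → refl
                   ; (false ∷ b) → sym (cong₂ (λ c s → ⟦ c ∧ matches s b ε ⟧) (cong not (xor-same t)) (drop-alternating q)) }) ⟩
    F (closing λ b → ⟦ matches (alternating q) (false ∷ b) (t ∷ ε) ⟧)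
      ≡⟨ ℤ.+-identityˡ _ ⟨
    0ℤ ℤ.+ F (closing λ b → ⟦ matches (alternating q) (false ∷ b) (t ∷ ε) ⟧)
      ≡⟨ cong (ℤ._+ F (closing λ b → ⟦ matches (alternating q) (false ∷ b) (t ∷ ε) ⟧)) (openings λ b → ⟦ matches (alternating q) (true ∷ b) (t ∷ ε) ⟧) ⟨
    F (opening λ b → ⟦ matches (alternating q) (true ∷ b) (t ∷ ε) ⟧) ℤ.+ F (closing λ b → ⟦ matches (alternating q) (false ∷ b) (t ∷ ε) ⟧)
      ≡⟨ split (λ b → ⟦ matches (alternating q) b (t ∷ ε) ⟧) ⟨
    F (λ b → ⟦ matches (alternating q) b (t ∷ ε) ⟧)
      ≡⟨ vanish (t ∷ ε) ⟩
    0ℤ ∎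
    where open ≡-Reasoning

-- A horizontal edge gets the letter of a closing slot. As no arc passes over it, the empty stack
-- tells the two apart.
opens : (Point m → Point m) → Fin m → Bool
opens f i = [ (i ⋖_) , const false ] (f (inj₁ i))

word : (Point m → Point m) → Vec Bool m
word f = Vec.tabulate (opens f)

module _ {f : Point m → Point m} (F : SymmetricState f) (ε : Fin m → Bool) where

  open SymmetricState F

  private
    ε⁺ : Point m → Bool
    ε⁺ = [ ε , const false ]

    back : ∀ {p q} → f p ≡ q → f q ≡ p
    back {p} e = trans (cong f (sym e)) (involutive p)

    same : ∀ {i j k : Fin m} → f (inj₁ i) ≡ inj₁ j → f (inj₁ i) ≡ inj₁ k → j ≡ k
    same e e′ = inj₁-injective (trans (sym e) e′)

  -- Each edge is tested once: an arc at its closing slot, a horizontal edge at its left end. These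
  -- are the tests that `matches` makes while reading.
  Closes : Fin m → Set
  Closes z = (∀ {j} → f (inj₁ z) ≡ inj₁ j → j F.< z → ε j ≡ ε z) × (∀ {j} → f (inj₁ z) ≡ inj₂ j → ε z ≡ false)

  Open : ℕ → Fin m → Set
  Open k x = toℕ x ℕ.< k × ∃[ j ] f (inj₁ x) ≡ inj₁ j × k ℕ.≤ toℕ j

  -- Slots are stacked, and their colours are looked up afterwards. `descending` puts the arc opened
  -- last on top; planarity then makes it the one to be closed.
  record OpenStack (k : ℕ) (S : List (Fin m)) : Set where
    constructor stack
    field
      descending : AllPairs (λ x y → y F.< x) S
      sound      : ∀ {x} → x ∈ S → Open k x
      complete   : ∀ {x} → Open k x → x ∈ S

  open OpenStack

  Rest : ℕ → Set
  Rest k = ∀ z → k ℕ.≤ toℕ z → Closes z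

  module Step {k} (z : Fin m) (z≡k : toℕ z ≡ k) {S} (st : OpenStack k S) where

    Open-suc : ∀ {x} → Open k x → f (inj₁ x) ≢ inj₁ z → Open (suc k) x
    Open-suc (x<k , j , e , k≤j) ne = ℕ.m<n⇒m<1+n x<k , j , e , ℕ.≤∧≢⇒< k≤j λ k≡j → ne (trans e (cong inj₁ (F.toℕ-injective (trans (sym k≡j) (sym z≡k)))))

    Open-pred : ∀ {x} → Open (suc k) x → x ≢ z → Open k x
    Open-pred (s≤s x≤k , j , e , k<j) ne = ℕ.≤∧≢⇒< x≤k (λ x≡k → ne (F.toℕ-injective (trans x≡k (sym z≡k)))) , j , e , ℕ.<⇒≤ k<j

    Rest-suc : Rest k → Rest (suc k)
    Rest-suc r y k<y = r y (ℕ.<⇒≤ k<y)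

    Rest-pred : Closes z → Rest (suc k) → Rest k
    Rest-pred c r y k≤y with k ℕ.≟ toℕ y
    ... | yes k≡y = subst Closes (F.toℕ-injective (trans z≡k k≡y)) c
    ... | no k≢y = r y (ℕ.≤∧≢⇒< k≤y k≢y)

    module _ {j} (fz : f (inj₁ z) ≡ inj₁ j) (z<j : z F.< j) where

      push-stack : OpenStack (suc k) (z ∷ S)
      push-stack = stack
        (All.tabulate (λ x∈ → subst (_ ℕ.<_) (sym z≡k) (proj₁ (sound st x∈))) ∷ descending st)
        (λ { (here refl) → ℕ.≤-reflexive (cong suc z≡k) , j , fz , subst (ℕ._< toℕ j) z≡k z<j
           ; (there x∈) → Open-suc (sound st x∈) λ e → ℕ.<-asym z<j
               (subst (F._< z) (sym (same fz (back e))) (subst (_ ℕ.<_) (sym z≡k) (proj₁ (sound st x∈)))) })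
        λ {x} o → case x F.≟ z of λ { (yes refl) → here refl ; (no x≢z) → there (complete st (Open-pred o x≢z)) }

      push-closes : Closes z
      push-closes = (λ e l<z → contradiction (ℕ.<-trans z<j (subst (F._< z) (same e fz) l<z)) (ℕ.<-irrefl refl)) , λ e → contradiction (trans (sym fz) e) inj₁≢inj₂

    z<⇒ : ∀ {j : Fin m} → k ℕ.≤ toℕ j → j ≢ z → z F.< j
    z<⇒ k≤j j≢z = ℕ.≤∧≢⇒< (subst (ℕ._≤ _) (sym z≡k) k≤j) λ e → j≢z (sym (F.toℕ-injective e))

    <z⇒ : ∀ {x : Fin m} → toℕ x ℕ.< k → x F.< z
    <z⇒ {x} = subst (toℕ x ℕ.<_) (sym z≡k)

    module _ {j} (fz : f (inj₁ z) ≡ inj₁ j) (j<z : j F.< z) where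

      j-open : Open k j
      j-open = subst (toℕ j ℕ.<_) z≡k j<z , z , back fz , ℕ.≤-reflexive (sym z≡k)

      -- An arc opened after j and still open at z would cross the arc jz.
      top-unique : ∀ {y T} → S ≡ y ∷ T → y ≡ j
      top-unique {y} {T} refl with complete st j-open | descending st
      ... | here j≡y | _ = sym j≡y
      ... | there j∈ | y> ∷ _ = contradiction (sound st (here refl)) not-open
        where
        j<y : j F.< y
        j<y = All.lookup y> j∈
        not-open : ¬ Open k y
        not-open (y<k , l , fy , k≤l) = contradiction
          (trans (sym (cong₂ _xor_ (trans (lt-left-left j y) (<⇒lt j<y)) (trans (lt-left-left z y) (≮⇒lt (ℕ.<-asym (<z⇒ {y} y<k))))))
            (trans (subst₂′ (back fz) fy (planar (inj₁ j) (inj₁ y) y≢j (λ e → y≢z (trans e (back fz)))))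
              (cong₂ _xor_ (trans (lt-left-left j l) (<⇒lt (ℕ.<-trans j<z z<l))) (trans (lt-left-left z l) (<⇒lt z<l))))) λ ()
          where
          y≢j : _≢_ {A = Point m} (inj₁ y) (inj₁ j)
          y≢j e = ℕ.<-irrefl (cong toℕ (sym (inj₁-injective e))) j<y
          y≢z : _≢_ {A = Point m} (inj₁ y) (inj₁ z)
          y≢z e = ℕ.<-irrefl (cong toℕ (inj₁-injective e)) (<z⇒ {y} y<k)
          z<l : z F.< l
          z<l = z<⇒ k≤l λ { refl → y≢j (trans (sym (back fy)) fz) }
          subst₂′ : ∀ {x w} → f (inj₁ j) ≡ x → f (inj₁ y) ≡ w → Disjoint (inj₁ j) (f (inj₁ j)) (inj₁ y) (f (inj₁ y)) → Disjoint (inj₁ j) x (inj₁ y) w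
          subst₂′ refl refl D = D

      pop-stack : ∀ {T} → S ≡ j ∷ T → OpenStack (suc k) T
      pop-stack refl with descending st
      ... | j> ∷ desc = stack desc
        (λ x∈ → Open-suc (sound st (there x∈)) λ e → ℕ.<-irrefl (cong toℕ (same (back e) fz)) (All.lookup j> x∈))
        λ { {x} o@(_ , l , fx , k<l) → case complete st (Open-pred o (x≢z o)) of λ
              { (here refl) → contradiction (subst (suc k ℕ.≤_) (trans (cong toℕ (same fx (back fz))) z≡k) k<l) (ℕ.<-irrefl refl)
              ; (there x∈) → x∈ } }
        where
        x≢z : ∀ {x} → Open (suc k) x → x ≢ z
        x≢z (_ , l , fx , k<l) refl = ℕ.<-asym j<z (subst (z F.<_) (same fx fz) (subst (ℕ._< toℕ l) (sym z≡k) k<l))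

      pop-closes : ε j ≡ ε z → Closes z
      pop-closes e = (λ e′ _ → trans (cong ε (same e′ fz)) e) , λ e′ → contradiction (trans (sym fz) e′) inj₁≢inj₂

    module _ {j} (fz : f (inj₁ z) ≡ inj₂ j) where

      -- No arc passes over a horizontal edge.
      none-open : ∀ {y} → ¬ Open k y
      none-open {y} (y<k , l , fy , k≤l) = contradiction
        (trans (sym (cong₂ _xor_ (trans (lt-left-left y z) (<⇒lt (<z⇒ {y} y<k))) (trans (lt-left-left l z) (≮⇒lt (ℕ.<-asym z<l)))))
          (trans (subst₂′ fy fz (planar (inj₁ y) (inj₁ z) (λ e → ℕ.<-irrefl (cong toℕ (sym (inj₁-injective e))) (<z⇒ {y} y<k)) λ e → l≢z (sym (inj₁-injective (trans e fy)))))
            (cong₂ _xor_ (lt-left-right y j) (lt-left-right l j)))) λ ()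
        where
        l≢z : l ≢ z
        l≢z refl = inj₁≢inj₂ (trans (sym (back fy)) fz)
        z<l : z F.< l
        z<l = z<⇒ k≤l l≢z
        subst₂′ : ∀ {x w} → f (inj₁ y) ≡ x → f (inj₁ z) ≡ w → Disjoint (inj₁ y) (f (inj₁ y)) (inj₁ z) (f (inj₁ z)) → Disjoint (inj₁ y) x (inj₁ z) w
        subst₂′ refl refl D = D

      flat-stack : OpenStack (suc k) []
      flat-stack = stack [] (λ ()) λ { {x} o@(_ , l , fx , _) → contradiction (Open-pred o (λ { refl → inj₁≢inj₂ (trans (sym fx) fz) })) none-open }

  -- `e` lists the `r` slots from `k` on. The stack invariant is carried along as they are read, and
  -- each step accounts for the condition `Closes` at one slot.
  matches-rest : ∀ r k (e : Fin r → Fin m) → (∀ i → toℕ (e i) ≡ k ℕ.+ toℕ i) → k ℕ.+ r ≡ m → ∀ {S} → OpenStack k S →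
    (matches (map ε S) (Vec.tabulate (opens f ∘ e)) (Vec.tabulate (ε ∘ e)) ≡ true → Rest k) ×
    (Rest k → matches (map ε S) (Vec.tabulate (opens f ∘ e)) (Vec.tabulate (ε ∘ e)) ≡ true)
  matches-rest zero k e at k+0≡m _ =
    (λ _ z k≤z → contradiction (ℕ.≤-trans (ℕ.≤-reflexive (trans (sym k+0≡m) (ℕ.+-identityʳ k))) k≤z) (ℕ.<⇒≱ (F.toℕ<n z))) , λ _ → refl
  matches-rest (suc r) k e at k+r≡m {S} st with f (inj₁ (e zero)) in fz
  ... | inj₁ j with e zero ⋖ j in z⋖j
  ...   | true = (λ eq → Rest-pred (push-closes fz (lt⇒< z⋖j)) (proj₁ IH eq)) , λ rest → proj₂ IH (Rest-suc rest)
    where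
    open Step (e zero) (trans (at zero) (ℕ.+-identityʳ k)) st
    IH = matches-rest r (suc k) (e ∘ suc) (λ i → trans (at (suc i)) (ℕ.+-suc k (toℕ i))) (trans (sym (ℕ.+-suc k r)) k+r≡m) (push-stack fz (lt⇒< z⋖j))
  ...   | false = pop S refl
    where
    open Step (e zero) (trans (at zero) (ℕ.+-identityʳ k)) st
    j<z : j F.< e zero
    j<z = ℕ.≤∧≢⇒< (ℕ.≮⇒≥ (lt⇒≮ {toℕ (e zero)} z⋖j)) λ j≡z → noFix (inj₁ (e zero)) (trans fz (cong inj₁ (F.toℕ-injective j≡z)))
    pop : ∀ S′ → S ≡ S′ →
      (not (ε (e zero) xor topOf (map ε S′)) ∧ matches (drop 1 (map ε S′)) (Vec.tabulate (opens f ∘ e ∘ suc)) (Vec.tabulate (ε ∘ e ∘ suc)) ≡ true → Rest k) ×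
      (Rest k → not (ε (e zero) xor topOf (map ε S′)) ∧ matches (drop 1 (map ε S′)) (Vec.tabulate (opens f ∘ e ∘ suc)) (Vec.tabulate (ε ∘ e ∘ suc)) ≡ true)
    pop [] eq = contradiction (subst (j ∈_) eq (complete st (j-open fz j<z))) λ ()
    pop (y ∷ T) eq with top-unique fz j<z eq
    ... | refl = (λ t → Rest-pred (pop-closes fz j<z (equal (ε (e zero)) (ε j) (proj₁ (split t)))) (proj₁ IH (proj₂ (split t)))) ,
      λ rest → cong₂ _∧_ (trans (cong (λ x → not (ε (e zero) xor x)) (proj₁ (rest (e zero) (ℕ.≤-reflexive (sym (trans (at zero) (ℕ.+-identityʳ k))))) fz j<z)) (cong not (xor-same (ε (e zero)))))
                         (proj₂ IH (Rest-suc rest))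
      where
      IH = matches-rest r (suc k) (e ∘ suc) (λ i → trans (at (suc i)) (ℕ.+-suc k (toℕ i))) (trans (sym (ℕ.+-suc k r)) k+r≡m) (pop-stack fz j<z eq)
      split : ∀ {a b} → a ∧ b ≡ true → a ≡ true × b ≡ true
      split {true} {true} _ = refl , refl
      equal : ∀ x y → not (x xor y) ≡ true → y ≡ x
      equal false false _ = refl
      equal true  true  _ = refl
  matches-rest (suc r) k e at k+r≡m {S} st | inj₂ j = flat S refl
    where
    open Step (e zero) (trans (at zero) (ℕ.+-identityʳ k)) st
    flat : ∀ S′ → S ≡ S′ →
      (not (ε (e zero) xor topOf (map ε S′)) ∧ matches (drop 1 (map ε S′)) (Vec.tabulate (opens f ∘ e ∘ suc)) (Vec.tabulate (ε ∘ e ∘ suc)) ≡ true → Rest k) ×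
      (Rest k → not (ε (e zero) xor topOf (map ε S′)) ∧ matches (drop 1 (map ε S′)) (Vec.tabulate (opens f ∘ e ∘ suc)) (Vec.tabulate (ε ∘ e ∘ suc)) ≡ true)
    flat (y ∷ _) refl = contradiction (sound st (here refl)) (none-open fz)
    flat [] refl = (λ t → Rest-pred ((λ e′ _ → contradiction (trans (sym e′) fz) inj₁≢inj₂) , λ _ → black (ε (e zero)) (proj₁ (split t))) (proj₁ IH (proj₂ (split t)))) ,
      λ rest → cong₂ _∧_ (cong (λ x → not (x xor false)) (proj₂ (rest (e zero) (ℕ.≤-reflexive (sym (trans (at zero) (ℕ.+-identityʳ k))))) fz)) (proj₂ IH (Rest-suc rest))
      where
      IH = matches-rest r (suc k) (e ∘ suc) (λ i → trans (at (suc i)) (ℕ.+-suc k (toℕ i))) (trans (sym (ℕ.+-suc k r)) k+r≡m) (flat-stack fz)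
      split : ∀ {a b} → a ∧ b ≡ true → a ≡ true × b ≡ true
      split {true} {true} _ = refl , refl
      black : ∀ x → not (x xor false) ≡ true → x ≡ false
      black false _ = refl

  constant-matches : constant f ε⁺ ≡ matches [] (word f) (Vec.tabulate ε)
  constant-matches = trans (decide to from (constant? f ε⁺) (matches [] (word f) (Vec.tabulate ε) 𝔹.≟ true)) (does-true _)
    where
    M = matches-rest m 0 id (λ _ → refl) refl (stack [] (λ ()) λ { (() , _) })
    to : Constant f ε⁺ → matches [] (word f) (Vec.tabulate ε) ≡ true
    to c = proj₂ M λ z _ → (λ e _ → trans (cong ε⁺ (sym e)) (c (inj₁ z))) , λ e → trans (sym (c (inj₁ z))) (cong ε⁺ e)
    from : matches [] (word f) (Vec.tabulate ε) ≡ true → Constant f ε⁺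
    from eq = colours
      where
      rest = proj₁ M eq
      colours : Constant f ε⁺
      colours (inj₁ z) with f (inj₁ z) in fz
      ... | inj₂ j = sym (proj₂ (rest z z≤n) fz)
      ... | inj₁ j with ℕ.<-cmp (toℕ j) (toℕ z)
      ...   | tri< j<z _ _ = proj₁ (rest z z≤n) fz j<z
      ...   | tri≈ _ j≡z _ = cong ε (F.toℕ-injective j≡z)
      ...   | tri> _ _ z<j = sym (proj₁ (rest j z≤n) (back fz) z<j)
      colours (inj₂ z) with f (inj₂ z) in fz
      ... | inj₂ j = refl
      ... | inj₁ j = proj₂ (rest j z≤n) (back fz)

-- The word determines the colourings on which a diagram is constant, and these determine its arcs;
-- the remaining slots are horizontal in both diagrams.
word-injective : {f g : Point m → Point m} → SymmetricState f → SymmetricState g → word f ≡ word g → f ≗ g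
word-injective {m} {f} {g} Sf Sg e = λ { (inj₁ i) → left i
                                       ; (inj₂ i) → trans (SymmetricState.symmetric Sf (inj₁ i))
                                                    (trans (cong mirror (left i)) (sym (SymmetricState.symmetric Sg (inj₁ i)))) }
  where
  same-colours : ∀ {f g} → SymmetricState f → SymmetricState g → word f ≡ word g → ∀ ε → constant f [ ε , const false ] ≡ constant g [ ε , const false ]
  same-colours Sf Sg e ε = trans (constant-matches Sf ε) (trans (cong (λ b → matches [] b (Vec.tabulate ε)) e) (sym (constant-matches Sg ε)))
  -- If g had another edge at i, then the colouring that singles out the edge
  -- ij of f would not be constant on it.
  arc : ∀ {f g : Point m → Point m} → SymmetricState f → SymmetricState g → word f ≡ word g →
        ∀ {i j} → f (inj₁ i) ≡ inj₁ j → g (inj₁ i) ≡ inj₁ j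
  arc {f} {g} Sf Sg e {i} {j} fi = conclude (g (inj₁ i)) refl
    where
    open SymmetricState Sf
    ε : Fin m → Bool
    ε k = does (k F.≟ i) ∨ does (k F.≟ j)
    ε⁺ : Point m → Bool
    ε⁺ = [ ε , const false ]
    fj : f (inj₁ j) ≡ inj₁ i
    fj = trans (cong f (sym fi)) (involutive (inj₁ i))
    εi : ε i ≡ true
    εi = cong (_∨ does (i F.≟ j)) (dec-true (i F.≟ i) refl)
    εj : ε j ≡ true
    εj = trans (cong (does (j F.≟ i) ∨_) (dec-true (j F.≟ j) refl)) (𝔹.∨-zeroʳ (does (j F.≟ i)))
    off : ∀ p → p ≢ inj₁ i → p ≢ inj₁ j → ε⁺ p ≡ false
    off (inj₁ k) x y = cong₂ _∨_ (dec-false (k F.≟ i) (x ∘ cong inj₁)) (dec-false (k F.≟ j) (y ∘ cong inj₁))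
    off (inj₂ k) _ _ = refl
    constant-f : Constant f ε⁺
    constant-f p with p ≟ inj₁ i | p ≟ inj₁ j
    ... | yes refl | _ = trans (cong ε⁺ fi) (trans εj (sym εi))
    ... | no _ | yes refl = trans (cong ε⁺ fj) (trans εi (sym εj))
    ... | no x | no y = trans (off (f p) (λ e → y (trans (sym (involutive p)) (trans (cong f e) fi)))
                                         (λ e → x (trans (sym (involutive p)) (trans (cong f e) fj)))) (sym (off p x y))
    constant-g : Constant g ε⁺
    constant-g = undo (constant? g ε⁺) (trans (sym (same-colours Sf Sg e ε)) (dec-true (constant? f ε⁺) constant-f))
      where
      undo : {A : Set} (a? : Dec A) → does a? ≡ true → A
      undo (yes a) _ = a
    conclude : ∀ q → g (inj₁ i) ≡ q → q ≡ inj₁ j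
    conclude q gi with q ≟ inj₁ j
    ... | yes e = e
    ... | no ne = contradiction (trans (sym εi) (trans (sym (constant-g (inj₁ i))) (trans (cong ε⁺ gi) (off q (λ e → SymmetricState.noFix Sg (inj₁ i) (trans gi e)) ne)))) λ ()
  left : ∀ i → f (inj₁ i) ≡ g (inj₁ i)
  left i with f (inj₁ i) in fi | g (inj₁ i) in gi
  ... | inj₁ j | q = trans (sym (arc Sf Sg e fi)) gi
  ... | inj₂ j | inj₁ k = contradiction (trans (sym fi) (arc Sg Sf (sym e) gi)) inj₂≢inj₁
  ... | inj₂ j | inj₂ k = cong inj₂ (trans (sym (SymmetricState.level Sf fi)) (SymmetricState.level Sg gi))

-- Every object is enumerated exactly once

-- Maps are compared only pointwise, so unique occurrence is expressed by counting the entries that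
-- satisfy a decidable predicate. In this form a sum over the list collapses to one term.
Once : {A : Set} {Q : A → Set} → (∀ x → Dec (Q x)) → List A → Set
Once Q? xs = length (filter Q? xs) ≡ 1

filter-does : {A : Set} {Q Q′ : A → Set} (Q? : ∀ x → Dec (Q x)) (Q′? : ∀ x → Dec (Q′ x)) →
              (∀ x → does (Q? x) ≡ does (Q′? x)) → ∀ xs → length (filter Q? xs) ≡ length (filter Q′? xs)
filter-does Q? Q′? e [] = refl
filter-does Q? Q′? e (x ∷ xs) with does (Q? x) | does (Q′? x) | e x
... | true  | true  | _ = cong suc (filter-does Q? Q′? e xs)
... | false | false | _ = filter-does Q? Q′? e xs

filter-map : {A B : Set} {Q : B → Set} (Q? : ∀ x → Dec (Q x)) (h : A → B) (xs : List A) →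
             length (filter Q? (map h xs)) ≡ length (filter (Q? ∘ h) xs)
filter-map Q? h [] = refl
filter-map Q? h (x ∷ xs) with does (Q? (h x))
... | true  = cong suc (filter-map Q? h xs)
... | false = filter-map Q? h xs

filter-++ : {A : Set} {Q : A → Set} (Q? : ∀ x → Dec (Q x)) (xs ys : List A) →
            length (filter Q? (xs ++ ys)) ≡ length (filter Q? xs) ℕ.+ length (filter Q? ys)
filter-++ Q? xs ys = trans (cong length (List.filter-++ Q? xs ys)) (List.length-++ (filter Q? xs))

filter-none : {A : Set} {Q : A → Set} (Q? : ∀ x → Dec (Q x)) (xs : List A) → (∀ x → does (Q? x) ≡ false) → length (filter Q? xs) ≡ 0
filter-none Q? [] e = refl
filter-none Q? (x ∷ xs) e with does (Q? x) | e x
... | false | _ = filter-none Q? xs e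

-- Counting the accepted combinations row by row gives the product of the two counts.
once-product : {A B D : Set} {P : A → Set} {Q : B → Set} {R : D → Set}
  (P? : ∀ x → Dec (P x)) (Q? : ∀ y → Dec (Q y)) (R? : ∀ z → Dec (R z)) (h : A → B → D) →
  (∀ x y → does (R? (h x y)) ≡ does (P? x) ∧ does (Q? y)) →
  ∀ xs ys → Once P? xs → Once Q? ys → Once R? (cartesianProductWith h xs ys)
once-product P? Q? R? h e xs ys p q = trans (count xs) (cong₂ ℕ._*_ p q)
  where
  row : ∀ x → length (filter R? (map (h x) ys)) ≡ (if does (P? x) then length (filter Q? ys) else 0)
  row x with does (P? x) in Px
  ... | true  = trans (filter-map R? (h x) ys) (filter-does (R? ∘ h x) Q? (λ y → trans (e x y) (cong (_∧ does (Q? y)) Px)) ys)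
  ... | false = trans (filter-map R? (h x) ys) (filter-none (R? ∘ h x) ys (λ y → trans (e x y) (cong (_∧ does (Q? y)) Px)))
  count : ∀ xs → length (filter R? (cartesianProductWith h xs ys)) ≡ length (filter P? xs) ℕ.* length (filter Q? ys)
  count [] = refl
  count (x ∷ xs) = trans (filter-++ R? (map (h x) ys) _) (trans (cong₂ ℕ._+_ (row x) (count xs)) (lemma x))
    where
    lemma : ∀ x → (if does (P? x) then length (filter Q? ys) else 0) ℕ.+ length (filter P? xs) ℕ.* length (filter Q? ys) ≡
            length (filter P? (x ∷ xs)) ℕ.* length (filter Q? ys)
    lemma x with does (P? x)
    ... | true  = refl
    ... | false = refl

once-allFin : (i : Fin n) → Once (F._≟ i) (allFin n)
once-allFin i = trans (length-filter-tabulate (F._≟ i) id) (ℕ∑-single i 1)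

once-points : (p : Point n) → Once (_≟ p) (map inj₁ (allFin n) ++ map inj₂ (allFin n))
once-points {n} p = trans (filter-++ (_≟ p) (map inj₁ (allFin n)) _)
  (trans (cong₂ ℕ._+_ (filter-map (_≟ p) inj₁ (allFin n)) (filter-map (_≟ p) inj₂ (allFin n))) (by-side p))
  where
  by-side : ∀ p → length (filter (λ i → inj₁ i ≟ p) (allFin n)) ℕ.+ length (filter (λ i → inj₂ i ≟ p) (allFin n)) ≡ 1
  by-side (inj₁ i) = cong₂ ℕ._+_
    (trans (filter-does (λ j → inj₁ j ≟ inj₁ i) (F._≟ i) (λ j → refl) (allFin n)) (once-allFin i))
    (filter-none (λ j → inj₂ j ≟ inj₁ i) (allFin n) λ j → refl)
  by-side (inj₂ i) = cong₂ ℕ._+_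
    (filter-none (λ j → inj₁ j ≟ inj₂ i) (allFin n) λ j → refl)
    (trans (filter-does (λ j → inj₂ j ≟ inj₂ i) (F._≟ i) (λ j → refl) (allFin n)) (once-allFin i))

once-functions : {B : Set} (_≟ᴮ_ : ∀ (x y : B) → Dec (x ≡ y)) (bs : List B) → (∀ b → Once (_≟ᴮ b) bs) →
                 ∀ {k} (f : Fin k → B) → Once (λ g → F.all? λ i → g i ≟ᴮ f i) (functions bs k)
once-functions _≟ᴮ_ bs once {zero} f = refl
once-functions _≟ᴮ_ bs once {suc k} f =
  once-product (_≟ᴮ f zero) (λ g → F.all? λ i → g i ≟ᴮ f (suc i)) (λ g → F.all? λ i → g i ≟ᴮ f i) VF._∷_
    (λ b g → decide (λ e → e zero , e ∘ suc) (λ (e , es) → λ { zero → e ; (suc i) → es i })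
      (F.all? λ i → (b VF.∷ g) i ≟ᴮ f i) ((b ≟ᴮ f zero) ×-dec (F.all? λ i → g i ≟ᴮ f (suc i))))
    bs (functions bs k) (once (f zero)) (once-functions _≟ᴮ_ bs once (f ∘ suc))

once-pointMaps : (f : Point n → Point n) → Once (_≗? f) (pointMaps n)
once-pointMaps {n} f =
  once-product (λ (g : Fin n → Point n) → F.all? λ i → g i ≟ f (inj₁ i)) (λ (g : Fin n → Point n) → F.all? λ i → g i ≟ f (inj₂ i)) (_≗? f) [_,_]
    (λ g h → decide (λ e → (e ∘ inj₁) , (e ∘ inj₂)) (λ { (l , r) (inj₁ i) → l i ; (l , r) (inj₂ i) → r i })
      ([ g , h ] ≗? f) ((F.all? λ i → g i ≟ f (inj₁ i)) ×-dec (F.all? λ i → h i ≟ f (inj₂ i))))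
    (functions sides n) (functions sides n)
    (once-functions _≟_ sides once-points (f ∘ inj₁)) (once-functions _≟_ sides once-points (f ∘ inj₂))
  where
  sides : List (Point n)
  sides = map inj₁ (allFin n) ++ map inj₂ (allFin n)

once-collect : {A : Set} {P Q : A → Set} (P? : ∀ x → Dec (P x)) (Q? : ∀ x → Dec (Q x)) → (∀ x → P x → Q x) →
               ∀ xs → length (filter (P? ∘ proj₁) (collect Q? xs)) ≡ length (filter P? xs)
once-collect P? Q? P⇒Q [] = refl
once-collect P? Q? P⇒Q (x ∷ xs) with Q? x
... | yes q with does (P? x)
...   | true  = cong suc (once-collect P? Q? P⇒Q xs)
...   | false = once-collect P? Q? P⇒Q xs
once-collect P? Q? P⇒Q (x ∷ xs) | no ¬q with P? x
...   | yes p = contradiction (P⇒Q x p) ¬q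
...   | no _  = once-collect P? Q? P⇒Q xs

isTL-cong : {f g : Point n → Point n} → f ≗ g → IsTL g → IsTL f
isTL-cong {f = f} {g} e ((inv , nofix) , nc) =
  ((λ p → trans (trans (e (f p)) (cong g (e p))) (inv p)) , λ p → nofix p ∘ trans (sym (e p))) ,
  λ p q → subst₂ (λ x y → ¬ (position p F.< position q × position q F.< position x × position x F.< position y)) (sym (e p)) (sym (e q)) (nc p q)

once-allTL : {f : Point n → Point n} → IsTL f → Once (λ d → f ≗? proj₁ d) (allTL n)
once-allTL {n} {f} tl = trans (filter-does (λ d → f ≗? proj₁ d) (λ d → proj₁ d ≗? f)
    (λ d → decide (λ e p → sym (e p)) (λ e p → sym (e p)) (f ≗? proj₁ d) (proj₁ d ≗? f)) (allTL n))
  (trans (once-collect (_≗? f) isTL? (λ g e → isTL-cong e tl) (pointMaps n)) (once-pointMaps f))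

module OnceSums {c ℓ} (R : CommutativeRing c ℓ) where

  open CommutativeRing R renaming (refl to ≈-refl; sym to ≈-sym; trans to ≈-trans)
  open Pfaffinants R
  open Sums R

  ∑-once : {A : Set} {Q : A → Set} (Q? : ∀ x → Dec (Q x)) (xs : List A) → Once Q? xs → ∀ v →
           ∑ xs (λ x → if does (Q? x) then v else 0#) ≈ v
  ∑-once Q? xs once v = ≈-trans (≈-sym (∑-filter Q? xs)) (single (filter Q? xs) once)
    where
    single : ∀ {A : Set} (ys : List A) → length ys ≡ 1 → ∑ ys (λ _ → v) ≈ v
    single (y ∷ []) refl = +-identityʳ v

module ℤO = OnceSums ℤ.+-*-commutativeRing

-- The identity of coefficients over the integers

module ℤE = Exp (CommutativeRing.semiring ℤ.+-*-commutativeRing)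

sg-power : ∀ k → (ℤ.- 1ℤ) ℤE.^ k ≡ sg (par k)
sg-power k = trans (sym (ℤ.*-identityˡ _)) (trans (weightℤ 0 k) (ℤ.*-identityˡ _))

-- The sum over all uncrossings with the function of the resulting diagram left open: an indicator
-- of `D` gives a coefficient, a colour function gives the state vector.
functional : {ν : Point m → Point m} → SymmetricDrawing ν → ((Point m → Point m) → ℤ) → ℤ
functional {ν = ν} E φ = ℤP.∑ (uncrossings paired) λ x → ℤP.∑ (uncrossings unpaired) λ y →
  ℤP.weight (proj₂ (pictureSym ν (x , y))) (verticals y ℕ.+ horizontals x) ℤ.* φ (proj₁ (pictureSym ν (x , y)))
  where open SymmetricDrawing E

functional-linear : {ν : Point m → Point m} (E : SymmetricDrawing ν) → Linear (functional E)
functional-linear {ν = ν} E = record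
  { F-cong = λ e → ℤS.∑-cong (uncrossings paired) λ x → ℤS.∑-cong (uncrossings unpaired) λ y → cong (w x y ℤ.*_) (e (p x y))
  ; F-+ = λ φ ψ → trans (ℤS.∑-cong (uncrossings paired) λ x → trans (ℤS.∑-cong (uncrossings unpaired) λ y → ℤ.*-distribˡ-+ (w x y) (φ (p x y)) (ψ (p x y)))
                           (ℤS.∑-+ (uncrossings unpaired) {λ y → w x y ℤ.* φ (p x y)} {λ y → w x y ℤ.* ψ (p x y)}))
                        (ℤS.∑-+ (uncrossings paired) {λ x → ℤP.∑ (uncrossings unpaired) λ y → w x y ℤ.* φ (p x y)} {λ x → ℤP.∑ (uncrossings unpaired) λ y → w x y ℤ.* ψ (p x y)})
  ; F-* = λ k φ → trans (ℤS.∑-cong (uncrossings paired) λ x → trans (ℤS.∑-cong (uncrossings unpaired) λ y → exchange (w x y) k (φ (p x y)))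
                           (sym (ℤS.∑-*ˡ k (uncrossings unpaired) {λ y → w x y ℤ.* φ (p x y)})))
                        (sym (ℤS.∑-*ˡ k (uncrossings paired) {λ x → ℤP.∑ (uncrossings unpaired) λ y → w x y ℤ.* φ (p x y)}))
  }
  where
  open SymmetricDrawing E
  w : Uncrossed _ → Uncrossed _ → ℤ
  w x y = ℤP.weight (proj₂ (pictureSym ν (x , y))) (verticals y ℕ.+ horizontals x)
  p : Uncrossed _ → Uncrossed _ → Point _ → Point _
  p x y = proj₁ (pictureSym ν (x , y))
  exchange : ∀ w k z → w ℤ.* (k ℤ.* z) ≡ k ℤ.* (w ℤ.* z)
  exchange = solve-∀

if-⟦⟧ : ∀ b k → (if b then k else 0ℤ) ≡ k ℤ.* ⟦ b ⟧
if-⟦⟧ true  k = sym (ℤ.*-identityʳ k)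
if-⟦⟧ false k = sym (ℤ.*-zeroʳ k)

symmetricCoefficient-functional : {ν : Point m → Point m} (E : SymmetricDrawing ν) (D : Point m → Point m) →
  ℤP.symmetricCoefficient E D ≡ functional E (λ f → ⟦ does (f ≗? D) ⟧)
symmetricCoefficient-functional {ν = ν} E D = trans
  (ℤS.∑-filter (λ x → proj₁ (pictureSym ν x) ≗? D) (cartesianProduct (uncrossings paired) (uncrossings unpaired)) {w})
  (trans (ℤS.∑-cartesianProductWith _,_ (uncrossings paired) (uncrossings unpaired) {λ x → if does (proj₁ (pictureSym ν x) ≗? D) then w x else 0ℤ})
    (ℤS.∑-cong (uncrossings paired) λ x → ℤS.∑-cong (uncrossings unpaired) λ y → if-⟦⟧ (does (proj₁ (pictureSym ν (x , y)) ≗? D)) (w (x , y))))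
  where
  open SymmetricDrawing E
  w : Uncrossed _ × Uncrossed _ → ℤ
  w (x , y) = ℤP.weight (proj₂ (pictureSym ν (x , y))) (verticals y ℕ.+ horizontals x)

module _ {ν : Point m → Point m} (C : SymmetricState (core ν)) (half : halves (through ν)) (E : SymmetricDrawing ν) where

  open DrawingVector ν C half

  functional-states : ∀ {φ ψ} → (∀ {f} → SymmetricState f → φ f ≡ ψ f) → functional E φ ≡ functional E ψ
  functional-states {φ} {ψ} e = ℤS.∑-cong-All (All.map (λ {x} ex → ℤS.∑-cong-All (All.map (λ {y} ey →
      cong (ℤP.weight (proj₂ (pictureSym ν (x , y))) (verticals y ℕ.+ horizontals x) ℤ.*_)
        (e (State.symmetricState (pictureSym-state axis paired x y (All.map consecutive-neighbours adjacent) ex ey))))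
      (uncrossings-crossings unpaired))) (uncrossings-crossings paired))
    where open SymmetricDrawing E

  functional-vector : ∀ (ε : Vec Bool m) η → shade η ≗ Vec.lookup ε →
    functional E (λ f → scale f ℤ.* ⟦ matches [] (word f) ε ⟧) ≡ vector (SymmetricDrawing.paired E) (shade η)
  functional-vector ε η e = functional-states λ {f} S → cong (λ b → scale f ℤ.* ⟦ b ⟧)
    (trans (cong (matches [] (word f)) (trans (sym (Vec.tabulate∘lookup ε)) (Vec.tabulate-cong (sym ∘ e)))) (sym (constant-matches S (shade η))))

  -- All pictures that occur are planar and symmetric, so equal words mean equal diagrams, and the
  -- scale of the picture can be taken out as that of `D`.
  functional-indicator : ∀ {D} → SymmetricState D →
    functional E (λ f → scale f ℤ.* ⟦ does (Vec.≡-dec 𝔹._≟_ (word f) (word D)) ⟧) ≡ scale D ℤ.* ℤP.symmetricCoefficient E D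
  functional-indicator {D} SD = trans (functional-states same) (trans (Linear.F-* (functional-linear E) (scale D) (λ f → ⟦ does (f ≗? D) ⟧))
    (cong (scale D ℤ.*_) (sym (symmetricCoefficient-functional E D))))
    where
    same : ∀ {f} → SymmetricState f → scale f ℤ.* ⟦ does (Vec.≡-dec 𝔹._≟_ (word f) (word D)) ⟧ ≡ scale D ℤ.* ⟦ does (f ≗? D) ⟧
    same {f} Sf = go (f ≗? D)
      where
      go : (x : Dec (f ≗ D)) → scale f ℤ.* ⟦ does (Vec.≡-dec 𝔹._≟_ (word f) (word D)) ⟧ ≡ scale D ℤ.* ⟦ does x ⟧
      go (yes e) = cong₂ (λ s b → s ℤ.* ⟦ b ⟧) (scale-cong e) (dec-true (Vec.≡-dec 𝔹._≟_ (word f) (word D)) (Vec.tabulate-cong λ i → cong [ (i ⋖_) , const false ] (e (inj₁ i))))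
      go (no ne) = trans (cong (λ b → scale f ℤ.* ⟦ b ⟧) (dec-false (Vec.≡-dec 𝔹._≟_ (word f) (word D)) (ne ∘ word-injective Sf SD)))
                        (trans (ℤ.*-zeroʳ (scale f)) (sym (ℤ.*-zeroʳ (scale D))))

tl-planar : ((d , tl) : TL n) → Planar d
tl-planar (d , M , nc) = nonCrossing⇒planar M nc

-- Every picture of a wiring is planar and so agrees with exactly one listed diagram. Regrouping the
-- uncrossings by it replaces constancy on `d` by constancy on the picture.
immanant-sum : {w : Fin n → Fin n} (W : Wiring w) (κ : Point n → Bool) →
  ℤP.∑ (allTL n) (λ (d , _) → ⟦ constant d κ ⟧ ℤ.* ℤP.immanantCoefficient W d) ≡
  ℤP.∑ (uncrossings (Wiring.crossings W)) (λ x → ℤP.weight (proj₂ (pictureTL x)) (horizontals x) ℤ.* ⟦ constant (proj₁ (pictureTL x)) κ ⟧)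
immanant-sum {n} W κ = begin
  ℤP.∑ (allTL n) (λ (d , _) → ⟦ constant d κ ⟧ ℤ.* ℤP.immanantCoefficient W d)
    ≡⟨ ℤS.∑-cong (allTL n) (λ (d , _) → trans (cong (⟦ constant d κ ⟧ ℤ.*_) (ℤS.∑-filter (λ x → pic x ≗? d) us {w}))
         (trans (ℤS.∑-*ˡ ⟦ constant d κ ⟧ us {λ x → if does (pic x ≗? d) then w x else 0ℤ}) (ℤS.∑-cong us λ x → term x d))) ⟩
  ℤP.∑ (allTL n) (λ (d , _) → ℤP.∑ us λ x → if does (pic x ≗? d) then w x ℤ.* ⟦ constant (pic x) κ ⟧ else 0ℤ)
    ≡⟨ ℤS.∑-swap (allTL n) us {λ (d , _) x → if does (pic x ≗? d) then w x ℤ.* ⟦ constant (pic x) κ ⟧ else 0ℤ} ⟩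
  ℤP.∑ us (λ x → ℤP.∑ (allTL n) λ (d , _) → if does (pic x ≗? d) then w x ℤ.* ⟦ constant (pic x) κ ⟧ else 0ℤ)
    ≡⟨ ℤS.∑-cong-All (All.map (λ {x} e → ℤO.∑-once (λ d → pic x ≗? proj₁ d) (allTL n) (once-allTL (tl x e)) (w x ℤ.* ⟦ constant (pic x) κ ⟧))
         (uncrossings-crossings (Wiring.crossings W))) ⟩
  ℤP.∑ us (λ x → w x ℤ.* ⟦ constant (pic x) κ ⟧) ∎
  where
  open ≡-Reasoning
  us = uncrossings (Wiring.crossings W)
  pic : Uncrossed n → Point n → Point n
  pic x = proj₁ (pictureTL x)
  w : Uncrossed n → ℤ
  w x = ℤP.weight (proj₂ (pictureTL x)) (horizontals x)
  tl : ∀ x → map proj₁ x ≡ Wiring.crossings W → IsTL (pic x)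
  tl x e with pictureTL-planar x (Wiring.adjacent W) e
  ... | M , planar = M , planar⇒nonCrossing planar
  term : ∀ x d → ⟦ constant d κ ⟧ ℤ.* (if does (pic x ≗? d) then w x else 0ℤ) ≡ (if does (pic x ≗? d) then w x ℤ.* ⟦ constant (pic x) κ ⟧ else 0ℤ)
  term x d = go (pic x ≗? d)
    where
    go : (y : Dec (pic x ≗ d)) → ⟦ constant d κ ⟧ ℤ.* (if does y then w x else 0ℤ) ≡ (if does y then w x ℤ.* ⟦ constant (pic x) κ ⟧ else 0ℤ)
    go (yes e) = trans (ℤ.*-comm ⟦ constant d κ ⟧ (w x)) (cong (λ b → w x ℤ.* ⟦ b ⟧) (constant-cong {ε = κ} (sym ∘ e) (λ _ → refl)))
    go (no _)  = ℤ.*-zeroʳ ⟦ constant d κ ⟧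

module _ {n} (D : T n) {w w⁻¹ : Fin n → Fin n} (w-w⁻¹ : ∀ k → w (w⁻¹ k) ≡ k) (w⁻¹-w : ∀ k → w⁻¹ (w k) ≡ k)
         {π : Fin (n ℕ.+ n) → Fin (n ℕ.+ n)} (Mπ : IsMatching π) (π-top : ∀ i → π (jn (inj₁ i)) ≡ jn {n} (inj₂ (w i)))
         (E : SymmetricDrawing (νMatching π)) (W : Wiring w) (G : TLDrawings n) where

  private
    SD : SymmetricState (proj₁ D)
    SD = state (proj₁ (proj₁ (proj₂ D))) (nonCrossing⇒planar (proj₁ (proj₁ (proj₂ D))) (proj₂ (proj₁ (proj₂ D)))) (proj₂ (proj₂ D))

    imm : TL n → ℤ
    imm d = ℤP.immanantCoefficient W (proj₁ d)

    s : TL n → ℤ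
    s d = sg (par (order (proj₁ d) ℕ.* n))

    at : (Vec Bool (n ℕ.+ n) → ℤ) → (Point (n ℕ.+ n) → Point (n ℕ.+ n)) → ℤ
    at φ f = scale f ℤ.* φ (word f)

    diagrams : (Vec Bool (n ℕ.+ n) → ℤ) → ℤ
    diagrams φ = ℤP.∑ (allTL n) λ d → s d ℤ.* functional (G d) (at φ) ℤ.* imm d

    difference : (Vec Bool (n ℕ.+ n) → ℤ) → ℤ
    difference φ = functional E (at φ) ℤ.- diagrams φ

    at-linear : {A : Set} {Φ : ((Point (n ℕ.+ n) → Point (n ℕ.+ n)) → ℤ) → ℤ} → Linear Φ → Linear (Φ ∘ at)
    at-linear L = record
      { F-cong = λ e → L.F-cong λ f → cong (scale f ℤ.*_) (e (word f))
      ; F-+ = λ φ ψ → trans (L.F-cong λ f → ℤ.*-distribˡ-+ (scale f) (φ (word f)) (ψ (word f))) (L.F-+ (at φ) (at ψ))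
      ; F-* = λ k φ → trans (L.F-cong λ f → exchange (scale f) k (φ (word f))) (L.F-* k (at φ))
      }
      where
      module L = Linear L
      exchange : ∀ x k z → x ℤ.* (k ℤ.* z) ≡ k ℤ.* (x ℤ.* z)
      exchange = solve-∀

    difference-linear : Linear difference
    difference-linear = record
      { F-cong = λ e → cong₂ ℤ._-_ (LE.F-cong e) (ℤS.∑-cong (allTL n) λ d → cong (λ x → s d ℤ.* x ℤ.* imm d) (Linear.F-cong (LG d) e))
      ; F-+ = λ φ ψ → trans (cong₂ ℤ._-_ (LE.F-+ φ ψ)
          (trans (ℤS.∑-cong (allTL n) λ d → trans (cong (λ x → s d ℤ.* x ℤ.* imm d) (Linear.F-+ (LG d) φ ψ)) (distrib (s d) (imm d) (functional (G d) (at φ)) (functional (G d) (at ψ))))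
                 (ℤS.∑-+ (allTL n) {λ d → s d ℤ.* functional (G d) (at φ) ℤ.* imm d} {λ d → s d ℤ.* functional (G d) (at ψ) ℤ.* imm d})))
          (interchange (functional E (at φ)) (functional E (at ψ)) (diagrams φ) (diagrams ψ))
      ; F-* = λ k φ → trans (cong₂ ℤ._-_ (LE.F-* k φ)
          (trans (ℤS.∑-cong (allTL n) λ d → trans (cong (λ x → s d ℤ.* x ℤ.* imm d) (Linear.F-* (LG d) k φ)) (pull k (s d) (imm d) (functional (G d) (at φ))))
                 (sym (ℤS.∑-*ˡ k (allTL n) {λ d → s d ℤ.* functional (G d) (at φ) ℤ.* imm d}))))
          (minus k (functional E (at φ)) (diagrams φ))
      }
      where
      module LE = Linear (at-linear {ℤ} (functional-linear E))
      LG : ∀ d → Linear (functional (G d) ∘ at)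
      LG d = at-linear {ℤ} (functional-linear (G d))
      distrib : ∀ s i x y → s ℤ.* (x ℤ.+ y) ℤ.* i ≡ s ℤ.* x ℤ.* i ℤ.+ s ℤ.* y ℤ.* i
      distrib = solve-∀
      interchange : ∀ a b c d → a ℤ.+ b ℤ.- (c ℤ.+ d) ≡ a ℤ.- c ℤ.+ (b ℤ.- d)
      interchange = solve-∀
      pull : ∀ k s i x → s ℤ.* (k ℤ.* x) ℤ.* i ≡ k ℤ.* (s ℤ.* x ℤ.* i)
      pull = solve-∀
      minus : ∀ k a b → k ℤ.* a ℤ.- k ℤ.* b ≡ k ℤ.* (a ℤ.- b)
      minus = solve-∀

    module _ (ε : Vec Bool (n ℕ.+ n)) where

      η : Fin (n ℕ.+ n) → Bool
      -- `shade` is an involution, so the shade of this `η` is the colouring `ε`.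
      η = shade (Vec.lookup ε)

      shade-η : shade η ≗ Vec.lookup ε
      shade-η i = trans (xor-assoc (Vec.lookup ε i) (odd i) (odd i)) (trans (cong (Vec.lookup ε i xor_) (xor-same (odd i))) (xor-identityʳ _))

      ηᵗ : Fin n → Bool
      ηᵗ i = η (jn (inj₁ i))

      κ : Point n → Bool
      κ = [ shade ηᵗ , (λ j → shade η (jn {n} (inj₂ j)) xor not (par n)) ]

      A : ℤ
      A = sg (par n ∧ ⊕.sum ηᵗ)

      wires : ℤ
      wires = ℤP.∑ (uncrossings (Wiring.crossings W)) λ x → ℤP.weight (proj₂ (pictureTL x)) (horizontals x) ℤ.* ⟦ constant (proj₁ (pictureTL x)) κ ⟧

      left : functional E (at λ b → ⟦ matches [] b ε ⟧) ≡ A ℤ.* wires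
      left = trans (functional-vector (matching-core π) (matching-halves {n} π) E ε η shade-η) (matchingVector w-w⁻¹ w⁻¹-w Mπ π-top E W η)

      right : diagrams (λ b → ⟦ matches [] b ε ⟧) ≡ A ℤ.* wires
      right = trans (ℤS.∑-cong (allTL n) λ d → trans
          (cong (ℤ._* imm d) (trans (cong (s d ℤ.*_) (functional-vector (TLMatching.core-TL (proj₁ d) (proj₁ (proj₂ d)) (tl-planar d)) (tl-halves (proj₁ (proj₂ d)) (tl-planar d)) (G d) ε η shade-η))
                                    (tlVector (proj₁ (proj₂ d)) (tl-planar d) (G d) η)))
          (ℤ.*-assoc A ⟦ constant (proj₁ d) κ ⟧ (imm d)))
        (trans (sym (ℤS.∑-*ˡ A (allTL n) {λ d → ⟦ constant (proj₁ d) κ ⟧ ℤ.* imm d})) (cong (A ℤ.*_) (immanant-sum W κ)))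

  -- On every function `matches [] b ε` both terms of `difference` become the wire vector of the
  -- same colouring with the same sign. Independence makes `difference` zero everywhere, in
  -- particular at the indicator of the word of `D`, where it yields the identity multiplied by the
  -- nonzero `scale`.
  coefficientℤ : ℤP.symmetricCoefficient E (proj₁ D) ≡ ℤP.∑ (allTL n) (λ d → ℤP.g̃ {n} G D d ℤ.* ℤP.immanantCoefficient W (proj₁ d))
  coefficientℤ = ℤ.*-cancelˡ-≡ (scale (proj₁ D)) _ _ {{pow2-nonZero ⌊ horizontalEdges (proj₁ D) /2⌋}} (begin
    σ ℤ.* ℤP.symmetricCoefficient E (proj₁ D)
      ≡⟨ functional-indicator (matching-core π) (matching-halves {n} π) E SD ⟨
    functional E (at φ)
      ≡⟨ ℤ.i-j≡0⇒i≡j _ _ (matches-independent (n ℕ.+ n) 0 difference-linear (λ ε → trans (cong₂ ℤ._-_ (left ε) (right ε)) (ℤ.+-inverseʳ (A ε ℤ.* wires ε))) φ) ⟩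
    diagrams φ
      ≡⟨ ℤS.∑-cong (allTL n) (λ d → trans
           (cong (λ x → s d ℤ.* x ℤ.* imm d) (functional-indicator (TLMatching.core-TL (proj₁ d) (proj₁ (proj₂ d)) (tl-planar d)) (tl-halves (proj₁ (proj₂ d)) (tl-planar d)) (G d) SD))
           (trans (shuffle σ (s d) (imm d) (ℤP.symmetricCoefficient (G d) (proj₁ D)))
             (cong (λ x → σ ℤ.* (x ℤ.* ℤP.symmetricCoefficient (G d) (proj₁ D) ℤ.* imm d)) (sym (sg-power (order (proj₁ d) ℕ.* n)))))) ⟩
    ℤP.∑ (allTL n) (λ d → σ ℤ.* (ℤP.g̃ {n} G D d ℤ.* imm d))
      ≡⟨ ℤS.∑-*ˡ σ (allTL n) {λ d → ℤP.g̃ {n} G D d ℤ.* imm d} ⟨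
    σ ℤ.* ℤP.∑ (allTL n) (λ d → ℤP.g̃ {n} G D d ℤ.* imm d) ∎)
    where
    open ≡-Reasoning
    σ = scale (proj₁ D)
    φ : Vec Bool (n ℕ.+ n) → ℤ
    φ b = ⟦ does (Vec.≡-dec 𝔹._≟_ b (word (proj₁ D))) ⟧
    shuffle : ∀ σ s i c → s ℤ.* (σ ℤ.* c) ℤ.* i ≡ σ ℤ.* (s ℤ.* c ℤ.* i)
    shuffle = solve-∀

-- From the integers to a commutative ring

module FromℤTo {c ℓ} (R : CommutativeRing c ℓ) where

  open CommutativeRing R hiding (zero) renaming (refl to ≈-refl; sym to ≈-sym; trans to ≈-trans)
  open Sums R
  open import Algebra.Properties.Ring ring using (-‿+-comm; -‿involutive; -0#≈0#; -‿distribˡ-*)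
  open import Algebra.Properties.Semiring.Mult semiring using (×-homo-+) renaming (_×_ to _⋆_)
  open import Algebra.Properties.CommutativeSemigroup +-commutativeSemigroup using (interchange)
  open import Relation.Binary.Reasoning.Setoid setoid
  private
    module RE = Exp semiring
    module RP = Pfaffinants R

  -- The canonical ring homomorphism.
  ι : ℤ → Carrier
  ι (+ k)    = k ⋆ 1#
  ι -[1+ k ] = - (suc k ⋆ 1#)

  ι-neg : ∀ i → ι (ℤ.- i) ≈ - ι i
  ι-neg (+ zero)  = ≈-sym -0#≈0#
  ι-neg (+ suc k) = ≈-refl
  ι-neg -[1+ k ]  = ≈-sym (-‿involutive _)

  ι-⊖ : ∀ k l → ι (k ℤ.⊖ l) ≈ k ⋆ 1# - l ⋆ 1#
  ι-⊖ k       zero    = ≈-sym (≈-trans (+-congˡ -0#≈0#) (+-identityʳ _))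
  ι-⊖ zero    (suc l) = ≈-sym (+-identityˡ _)
  ι-⊖ (suc k) (suc l) = begin
    ι (suc k ℤ.⊖ suc l)                    ≡⟨ cong ι (ℤ.[1+m]⊖[1+n]≡m⊖n k l) ⟩
    ι (k ℤ.⊖ l)                            ≈⟨ ι-⊖ k l ⟩
    k ⋆ 1# - l ⋆ 1#                        ≈⟨ +-identityˡ _ ⟨
    0# + (k ⋆ 1# - l ⋆ 1#)                 ≈⟨ +-congʳ (-‿inverseʳ 1#) ⟨
    (1# - 1#) + (k ⋆ 1# - l ⋆ 1#)          ≈⟨ interchange 1# (- 1#) (k ⋆ 1#) (- (l ⋆ 1#)) ⟩
    (1# + k ⋆ 1#) + (- 1# - l ⋆ 1#)        ≈⟨ +-congˡ (-‿+-comm 1# (l ⋆ 1#)) ⟩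
    (1# + k ⋆ 1#) - (1# + l ⋆ 1#)          ∎

  ι-+ : ∀ i j → ι (i ℤ.+ j) ≈ ι i + ι j
  ι-+ (+ k)    (+ l)    = ×-homo-+ 1# k l
  ι-+ (+ k)    -[1+ l ] = ι-⊖ k (suc l)
  ι-+ -[1+ k ] (+ l)    = ≈-trans (ι-⊖ l (suc k)) (+-comm _ _)
  ι-+ -[1+ k ] -[1+ l ] = begin
    - (suc (suc (k ℕ.+ l)) ⋆ 1#)           ≡⟨ cong (λ j → - (suc j ⋆ 1#)) (sym (ℕ.+-suc k l)) ⟩
    - ((suc k ℕ.+ suc l) ⋆ 1#)             ≈⟨ -‿cong (×-homo-+ 1# (suc k) (suc l)) ⟩
    - (suc k ⋆ 1# + suc l ⋆ 1#)            ≈⟨ -‿+-comm _ _ ⟨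
    - (suc k ⋆ 1#) - suc l ⋆ 1#            ∎

  ι-1 : ι 1ℤ ≈ 1#
  ι-1 = +-identityʳ 1#

  ι-* : ∀ i j → ι (i ℤ.* j) ≈ ι i * ι j
  ι-* (+ k) j = positive k
    where
    positive : ∀ k → ι (+ k ℤ.* j) ≈ (k ⋆ 1#) * ι j
    positive zero    = ≈-sym (zeroˡ _)
    positive (suc k) = begin
      ι (+ suc k ℤ.* j)                    ≡⟨ cong ι (ℤ.suc-* (+ k) j) ⟩
      ι (j ℤ.+ + k ℤ.* j)                  ≈⟨ ι-+ j (+ k ℤ.* j) ⟩
      ι j + ι (+ k ℤ.* j)                  ≈⟨ +-cong (≈-sym (*-identityˡ _)) (positive k) ⟩
      1# * ι j + (k ⋆ 1#) * ι j            ≈⟨ distribʳ _ _ _ ⟨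
      (1# + k ⋆ 1#) * ι j                  ∎
  ι-* -[1+ k ] j = begin
    ι (-[1+ k ] ℤ.* j)                     ≡⟨ cong ι (sym (ℤ.neg-distribˡ-* (+ suc k) j)) ⟩
    ι (ℤ.- (+ suc k ℤ.* j))                ≈⟨ ι-neg (+ suc k ℤ.* j) ⟩
    - ι (+ suc k ℤ.* j)                    ≈⟨ -‿cong (ι-* (+ suc k) j) ⟩
    - ((suc k ⋆ 1#) * ι j)                 ≈⟨ -‿distribˡ-* _ _ ⟩
    (- (suc k ⋆ 1#)) * ι j                 ∎

  ι-^ : ∀ i k → ι (i ℤE.^ k) ≈ ι i RE.^ k
  ι-^ i zero    = ι-1
  ι-^ i (suc k) = ≈-trans (ι-* i (i ℤE.^ k)) (*-congˡ (ι-^ i k))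

  ι-minus : ∀ k → ι ((ℤ.- 1ℤ) ℤE.^ k) ≈ (- 1#) RE.^ k
  ι-minus k = ≈-trans (ι-^ (ℤ.- 1ℤ) k) (RE.^-congˡ k (-‿cong ι-1))

  ι-weight : ∀ l k → ι (ℤP.weight l k) ≈ RP.weight l k
  ι-weight l k = ≈-trans (ι-* ((1ℤ ℤ.+ 1ℤ) ℤE.^ l) ((ℤ.- 1ℤ) ℤE.^ k))
    (*-cong (≈-trans (ι-^ (1ℤ ℤ.+ 1ℤ) l) (RE.^-congˡ l (+-congˡ ι-1))) (ι-minus k))

  ι-∑ : {A : Set} (xs : List A) {f : A → ℤ} → ι (ℤP.∑ xs f) ≈ RP.∑ xs (ι ∘ f)
  ι-∑ []           = ≈-refl
  ι-∑ (x ∷ xs) {f} = ≈-trans (ι-+ (f x) _) (+-congˡ (ι-∑ xs {f}))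

  ι-symmetricCoefficient : {ν : Point m → Point m} (E : SymmetricDrawing ν) (D : Point m → Point m) →
                           ι (ℤP.symmetricCoefficient E D) ≈ RP.symmetricCoefficient E D
  ι-symmetricCoefficient {ν = ν} E D =
    ≈-trans (ι-∑ xs {λ (x , y) → ℤP.weight (proj₂ (pictureSym ν (x , y))) (verticals y ℕ.+ horizontals x)})
            (∑-cong xs λ (x , y) → ι-weight (proj₂ (pictureSym ν (x , y))) (verticals y ℕ.+ horizontals x))
    where
    open SymmetricDrawing E
    xs = filter (λ x → proj₁ (pictureSym ν x) ≗? D) (cartesianProduct (uncrossings paired) (uncrossings unpaired))

  ι-immanantCoefficient : {w : Fin n → Fin n} (W : Wiring w) (d : Point n → Point n) →
                          ι (ℤP.immanantCoefficient W d) ≈ RP.immanantCoefficient W d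
  ι-immanantCoefficient W d =
    ≈-trans (ι-∑ xs {λ x → ℤP.weight (proj₂ (pictureTL x)) (horizontals x)}) (∑-cong xs λ x → ι-weight (proj₂ (pictureTL x)) (horizontals x))
    where xs = filter (λ x → proj₁ (pictureTL x) ≗? d) (uncrossings (Wiring.crossings W))

  ι-g̃ : (G : TLDrawings n) (D : T n) (d : TL n) → ι (ℤP.g̃ {n} G D d) ≈ RP.g̃ {n} G D d
  ι-g̃ {n} G (D , _) d = ≈-trans (ι-* ((ℤ.- 1ℤ) ℤE.^ (order (proj₁ d) ℕ.* n)) (ℤP.symmetricCoefficient (G d) D)) (*-cong (ι-minus (order (proj₁ d) ℕ.* n)) (ι-symmetricCoefficient (G d) D))

-- Matchings with a nonzero monomial and the final sum

permutation-surjective : {w : Fin n → Fin n} → IsPermutation w → ∀ k → ∃[ i ] w i ≡ k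
permutation-surjective {suc n} {w} perm k with F.any? (λ i → w i F.≟ k)
... | yes e = e
-- If `k` were missed, punching it out would inject `suc n` points into `n`.
... | no ne = contradiction (F.injective⇒≤ {f = λ i → F.punchOut (k≢ i)} λ {i} {j} e → perm i j (F.punchOut-injective (k≢ i) (k≢ j) e)) (ℕ.<-irrefl refl)
  where
  k≢ : ∀ i → k ≢ w i
  k≢ i e = ne (i , sym e)

Joins : (Fin (n ℕ.+ n) → Fin (n ℕ.+ n)) → (Fin n → Fin n) → Set
Joins {n} π w = ∀ i → π (i ↑ˡ n) ≡ n ↑ʳ w i

joins? : (π : Fin (n ℕ.+ n) → Fin (n ℕ.+ n)) (w : Fin n → Fin n) → Dec (Joins {n} π w)
joins? {n} π w = F.all? λ i → π (i ↑ˡ n) F.≟ (n ↑ʳ w i)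

once-allPerms : ((w , _) : Perm n) → Once (λ v → F.all? λ i → proj₁ v i F.≟ w i) (allPerms n)
once-allPerms {n} (w , perm) = trans
  (once-collect (λ v → F.all? λ i → v i F.≟ w i) isPermutation? (λ v e i j e′ → perm i j (trans (sym (e i)) (trans e′ (e j)))) (endofunctions n))
  (once-functions F._≟_ (allFin n) once-allFin w)

-- The values on the top half fill the bottom half, and there an involution has no choice left; `π₀`
-- is the resulting matching.
once-joined : ((w , _) : Perm n) → Once (λ π → joins? {n} (proj₁ π) w) (allMatchings (n ℕ.+ n))
once-joined {n} (w , perm) = trans
  (filter-does (λ π → joins? {n} (proj₁ π) w) (λ π → F.all? λ k → proj₁ π k F.≟ π₀ k)
    (λ (π , M) → decide (unique π M) (λ e i → trans (e (i ↑ˡ n)) (π₀-top i)) (joins? {n} π w) (F.all? λ k → π k F.≟ π₀ k)) (allMatchings (n ℕ.+ n)))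
  (trans (once-collect (λ π → F.all? λ k → π k F.≟ π₀ k) isMatching? (λ π e → matching-≗ π e) (endofunctions (n ℕ.+ n)))
         (once-functions F._≟_ (allFin (n ℕ.+ n)) once-allFin π₀))
  where
  w⁻¹ : Fin n → Fin n
  w⁻¹ k = proj₁ (permutation-surjective perm k)
  w-w⁻¹ : ∀ k → w (w⁻¹ k) ≡ k
  w-w⁻¹ k = proj₂ (permutation-surjective perm k)
  w⁻¹-w : ∀ i → w⁻¹ (w i) ≡ i
  w⁻¹-w i = perm _ _ (w-w⁻¹ (w i))
  π₀ : Fin (n ℕ.+ n) → Fin (n ℕ.+ n)
  π₀ k = [ (λ i → n ↑ʳ w i) , (λ j → w⁻¹ j ↑ˡ n) ] (splitAt n k)
  π₀-top : ∀ i → π₀ (i ↑ˡ n) ≡ n ↑ʳ w i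
  π₀-top i = cong [ (λ i → n ↑ʳ w i) , (λ j → w⁻¹ j ↑ˡ n) ] (F.splitAt-↑ˡ n i n)
  π₀-bottom : ∀ j → π₀ (n ↑ʳ j) ≡ w⁻¹ j ↑ˡ n
  π₀-bottom j = cong [ (λ i → n ↑ʳ w i) , (λ j → w⁻¹ j ↑ˡ n) ] (F.splitAt-↑ʳ n n j)
  π₀-matching : IsMatching π₀
  π₀-matching = inv , noFix
    where
    inv : ∀ k → π₀ (π₀ k) ≡ k
    inv k with jn-split {n} k
    ... | inj₁ i , refl = trans (cong π₀ (π₀-top i)) (trans (π₀-bottom (w i)) (cong (_↑ˡ n) (w⁻¹-w i)))
    ... | inj₂ j , refl = trans (cong π₀ (π₀-bottom j)) (trans (π₀-top (w⁻¹ j)) (cong (n ↑ʳ_) (w-w⁻¹ j)))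
    noFix : ∀ k → π₀ k ≢ k
    noFix k e with jn-split {n} k
    ... | inj₁ i , refl = inj₂≢inj₁ (jn-injective {q = inj₂ (w i)} {inj₁ i} (trans (sym (π₀-top i)) e))
    ... | inj₂ j , refl = inj₁≢inj₂ (jn-injective {q = inj₁ (w⁻¹ j)} {inj₂ j} (trans (sym (π₀-bottom j)) e))
  matching-≗ : ∀ π → (∀ k → π k ≡ π₀ k) → IsMatching π
  matching-≗ π e = (λ k → trans (e (π k)) (trans (cong π₀ (e k)) (proj₁ π₀-matching k))) , λ k → proj₂ π₀-matching k ∘ trans (sym (e k))
  unique : ∀ π → IsMatching π → Joins {n} π w → ∀ k → π k ≡ π₀ k
  unique π (inv , _) top k with jn-split {n} k
  ... | inj₁ i , refl = trans (top i) (sym (π₀-top i))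
  ... | inj₂ j , refl = trans (cong π (trans (cong (n ↑ʳ_) (sym (w-w⁻¹ j))) (sym (top (w⁻¹ j))))) (trans (inv _) (sym (π₀-bottom j)))

module Products {c ℓ} (R : CommutativeRing c ℓ) where

  open CommutativeRing R hiding (zero) renaming (refl to ≈-refl; sym to ≈-sym; trans to ≈-trans)
  open Pfaffinants R

  ∏-zero : {A : Set} {xs : List A} {f : A → Carrier} {x : A} → x ∈ xs → f x ≈ 0# → ∏ xs f ≈ 0#
  ∏-zero (here refl) e = ≈-trans (*-congʳ e) (zeroˡ _)
  ∏-zero (there i)   e = ≈-trans (*-congˡ (∏-zero i e)) (zeroʳ _)

  ∏-tabulate : {A B : Set} {f : A → Carrier} {g : B → Carrier} (s : Fin n → A) (t : Fin n → B) → (∀ i → f (s i) ≈ g (t i)) →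
               ∏ (List.tabulate s) f ≈ ∏ (List.tabulate t) g
  ∏-tabulate {zero}  s t e = ≈-refl
  ∏-tabulate {suc n} s t e = *-cong (e zero) (∏-tabulate (s ∘ suc) (t ∘ suc) (e ∘ suc))

  ∏-none : {A : Set} {Q : A → Set} (Q? : ∀ x → Dec (Q x)) {f : A → Carrier} (s : Fin n → A) → (∀ i → ¬ Q (s i)) →
           ∏ (filter Q? (List.tabulate s)) f ≈ 1#
  ∏-none {zero}  Q? s e = ≈-refl
  ∏-none {suc n} Q? s e rewrite List.filter-reject Q? {xs = List.tabulate (s ∘ suc)} (e zero) = ∏-none Q? (s ∘ suc) (e ∘ suc)

  ∏-half : {A : Set} {Q : A → Set} (Q? : ∀ x → Dec (Q x)) {f : A → Carrier} (k : ℕ) {l : ℕ} (s : Fin (k ℕ.+ l) → A) →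
           (∀ i → Q (s (i ↑ˡ l))) → (∀ j → ¬ Q (s (k ↑ʳ j))) → ∏ (filter Q? (List.tabulate s)) f ≈ ∏ (List.tabulate (λ i → s (i ↑ˡ l))) f
  ∏-half Q? zero    s accept reject = ∏-none Q? s reject
  ∏-half Q? (suc k) s accept reject rewrite List.filter-accept Q? {xs = List.tabulate (s ∘ suc)} (accept zero) =
    *-congˡ (∏-half Q? k (s ∘ suc) (accept ∘ suc) reject)

theorem40 : ∀ {c ℓ} (R : CommutativeRing c ℓ) →
    let open CommutativeRing R
        open Pfaffinants R
    in (n : ℕ) → 1 ℕ.≤ n →
       (E : MatchingDrawings n) (W : PermWirings n) (G : TLDrawings n) →
       (a : Array (n ℕ.+ n)) →
       (∀ (i j : Fin n) → i < j → a (i ↑ˡ n) (j ↑ˡ n) ≈ 0#) →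
       (∀ (i j : Fin n) → i < j → a (n ↑ʳ i) (n ↑ʳ j) ≈ 0#) →
       (D : T n) → 2 ∣ order (proj₁ D) →
       Pfaf {n} E D a ≈
       ∑ (S {n} D) (λ D′ → ∑ (allTL n) (λ d →
         g̃ {n} G D′ d * Imm {n} W d (λ i j → a (i ↑ˡ n) (n ↑ʳ j))))
theorem40 R n _ E W G a a-top _ D _ = ∑-cong (S {n} D) diagram
  where
  open CommutativeRing R hiding (zero) renaming (refl to ≈-refl; sym to ≈-sym; trans to ≈-trans)
  open Pfaffinants R
  open Sums R
  open OnceSums R
  open Products R
  open FromℤTo R
  open import Relation.Binary.Reasoning.Setoid setoid

  b : Fin n → Fin n → Carrier
  b i j = a (i ↑ˡ n) (n ↑ʳ j)

  -- The smaller end of each edge is the one in the top half, so the filter in `monomial` keeps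
  -- exactly the first `n` slots.
  monomial-joined : ∀ ((π , M) : Matching (n ℕ.+ n)) w → Joins {n} π w → monomial a (π , M) ≈ ∏ (allFin n) (λ i → b i (w i))
  monomial-joined (π , inv , _) w joins = ≈-trans (∏-half (λ i → i F.<? π i) n id above below)
    (∏-tabulate (λ i → i ↑ˡ n) id λ i → reflexive (cong (a (i ↑ˡ n)) (joins i)))
    where
    above : ∀ i → (i ↑ˡ n) F.< π (i ↑ˡ n)
    above i = subst ((i ↑ˡ n) F.<_) (sym (joins i)) (top-bottom i (w i))
    w-injective : IsPermutation w
    w-injective i j e = inj₁-injective (jn-injective (trans (sym (inv (i ↑ˡ n))) (trans (cong π (trans (joins i) (trans (cong (n ↑ʳ_) e) (sym (joins j))))) (inv (j ↑ˡ n)))))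
    below : ∀ j → ¬ (n ↑ʳ j) F.< π (n ↑ʳ j)
    below j with permutation-surjective w-injective j
    ... | i , refl = λ lt → ℕ.<-asym (top-bottom i (w i)) (subst ((n ↑ʳ w i) F.<_) (trans (cong π (sym (joins i))) (inv (i ↑ˡ n))) lt)

  -- The edge lies inside the top half, and its entry of `a`, taken at the smaller end, is a factor
  -- 0.
  monomial-top : ∀ ((π , M) : Matching (n ℕ.+ n)) {i j} → π (i ↑ˡ n) ≡ j ↑ˡ n → monomial a (π , M) ≈ 0#
  monomial-top (π , inv , noFix) {i} {j} e with ℕ.<-cmp (toℕ i) (toℕ j)
  ... | tri< i<j _ _ = zero-factor e i<j
    where
    zero-factor : ∀ {i j} → π (i ↑ˡ n) ≡ j ↑ˡ n → i F.< j → monomial a (π , inv , noFix) ≈ 0#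
    zero-factor {i} {j} e i<j = ∏-zero (∈-filter⁺ (λ i → i F.<? π i) (∈-allFin (i ↑ˡ n))
        (subst ((i ↑ˡ n) F.<_) (sym e) (lt⇒< (trans (top-⋖ i j) (<⇒lt i<j)))))
      (≈-trans (reflexive (cong (a (i ↑ˡ n)) e)) (a-top i j i<j))
  ... | tri≈ _ i≡j _ = contradiction (trans e (cong (_↑ˡ n) (F.toℕ-injective (sym i≡j)))) (noFix (i ↑ˡ n))
  ... | tri> _ _ j<i = ∏-zero (∈-filter⁺ (λ i → i F.<? π i) (∈-allFin (j ↑ˡ n))
        (subst ((j ↑ˡ n) F.<_) (sym e′) (lt⇒< (trans (top-⋖ j i) (<⇒lt j<i)))))
      (≈-trans (reflexive (cong (a (j ↑ˡ n)) e′)) (a-top j i j<i))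
    where
    e′ : π (j ↑ˡ n) ≡ i ↑ˡ n
    e′ = trans (cong π (sym e)) (inv (i ↑ˡ n))

  module _ (D′ : T n) where

    combination : Perm n → Carrier
    combination w = ∑ (allTL n) λ d → g̃ {n} G D′ d * immanantCoefficient (W w) (proj₁ d)

    coefficient : ∀ π w → Joins {n} (proj₁ π) (proj₁ w) → symmetricCoefficient (E π) (proj₁ D′) ≈ combination w
    coefficient π (w , perm) joins = begin
      symmetricCoefficient (E π) (proj₁ D′)
        ≈⟨ ι-symmetricCoefficient (E π) (proj₁ D′) ⟨
      ι (ℤP.symmetricCoefficient (E π) (proj₁ D′))
        ≡⟨ cong ι (coefficientℤ D′ (λ k → proj₂ (permutation-surjective perm k)) (λ i → perm _ _ (proj₂ (permutation-surjective perm (w i))))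
                     (proj₂ π) joins (E π) (W (w , perm)) G) ⟩
      ι (ℤP.∑ (allTL n) λ d → ℤP.g̃ {n} G D′ d ℤ.* ℤP.immanantCoefficient (W (w , perm)) (proj₁ d))
        ≈⟨ ι-∑ (allTL n) {λ d → ℤP.g̃ {n} G D′ d ℤ.* ℤP.immanantCoefficient (W (w , perm)) (proj₁ d)} ⟩
      ∑ (allTL n) (λ d → ι (ℤP.g̃ {n} G D′ d ℤ.* ℤP.immanantCoefficient (W (w , perm)) (proj₁ d)))
        ≈⟨ ∑-cong (allTL n) (λ d → ≈-trans (ι-* (ℤP.g̃ {n} G D′ d) (ℤP.immanantCoefficient (W (w , perm)) (proj₁ d)))
             (*-cong (ι-g̃ {n} G D′ d) (ι-immanantCoefficient (W (w , perm)) (proj₁ d)))) ⟩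
      combination (w , perm) ∎

    summand : Perm n → Carrier
    summand w = combination w * ∏ (allFin n) (λ i → b i (proj₁ w i))

    -- Written as a sum over permutations, the term allows the two summations to be exchanged. A
    -- matching between the halves selects exactly one permutation; any other has an edge within the
    -- top half and gives 0 on both sides.
    matching : ∀ π → symmetricCoefficient (E π) (proj₁ D′) * monomial a π ≈
                     ∑ (allPerms n) (λ w → if does (joins? {n} (proj₁ π) (proj₁ w)) then summand w else 0#)
    matching (π , M) = cases (F.all? λ i → F.any? λ j → π (i ↑ˡ n) F.≟ (n ↑ʳ j))
      where
      value = symmetricCoefficient (E (π , M)) (proj₁ D′) * monomial a (π , M)
      cases : Dec (∀ i → ∃[ j ] π (i ↑ˡ n) ≡ n ↑ʳ j) → value ≈
              ∑ (allPerms n) (λ w → if does (joins? {n} π (proj₁ w)) then summand w else 0#)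
      cases (yes bottom) = ≈-sym (≈-trans (∑-cong (allPerms n) term) (∑-once same? (allPerms n) (once-allPerms w₀) value))
        where
        v : Fin n → Fin n
        v i = proj₁ (bottom i)
        joins-v : Joins {n} π v
        joins-v i = proj₂ (bottom i)
        w₀ : Perm n
        w₀ = v , λ i j e → inj₁-injective (jn-injective (matching-injective M (trans (joins-v i) (trans (cong (n ↑ʳ_) e) (sym (joins-v j))))))
        same? : (w : Perm n) → Dec (∀ i → proj₁ w i ≡ v i)
        same? w = F.all? λ i → proj₁ w i F.≟ v i
        term : ∀ w → (if does (joins? {n} π (proj₁ w)) then summand w else 0#) ≈ (if does (same? w) then value else 0#)
        term w = go (joins? {n} π (proj₁ w)) (same? w)
          where
          go : (x : Dec (Joins {n} π (proj₁ w))) (y : Dec (∀ i → proj₁ w i ≡ v i)) → (if does x then summand w else 0#) ≈ (if does y then value else 0#)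
          go (yes joins) (yes _) = ≈-sym (*-cong (coefficient (π , M) w joins) (monomial-joined (π , M) (proj₁ w) joins))
          go (no _)      (no _)  = ≈-refl
          go (yes joins) (no ne) = contradiction (λ i → inj₂-injective (jn-injective (trans (sym (joins i)) (joins-v i)))) ne
          go (no ne)     (yes e) = contradiction (λ i → trans (joins-v i) (cong (n ↑ʳ_) (sym (e i)))) ne
      cases (no ¬bottom) with F.¬∀⟶∃¬ n _ (λ i → F.any? λ j → π (i ↑ˡ n) F.≟ (n ↑ʳ j)) ¬bottom
      ... | i , up with jn-split {n} (π (i ↑ˡ n))
      ...   | inj₂ j , e = contradiction (j , e) up
      ...   | inj₁ j , e = ≈-trans (≈-trans (*-congˡ (monomial-top (π , M) e)) (zeroʳ _))
        (≈-sym (≈-trans (∑-cong (allPerms n) λ w → reflexive (cong (if_then summand w else 0#)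
          (dec-false (joins? {n} π (proj₁ w)) λ joins → up (proj₁ w i , joins i)))) (∑-zero (allPerms n))))

    diagram : Pfaf′ {n} E D′ a ≈ ∑ (allTL n) (λ d → g̃ {n} G D′ d * Imm {n} W d b)
    diagram = begin
      ∑ (allMatchings (n ℕ.+ n)) (λ π → symmetricCoefficient (E π) (proj₁ D′) * monomial a π)
        ≈⟨ ∑-cong (allMatchings (n ℕ.+ n)) matching ⟩
      ∑ (allMatchings (n ℕ.+ n)) (λ π → ∑ (allPerms n) λ w → if does (joins? {n} (proj₁ π) (proj₁ w)) then summand w else 0#)
        ≈⟨ ∑-swap (allMatchings (n ℕ.+ n)) (allPerms n) ⟩
      ∑ (allPerms n) (λ w → ∑ (allMatchings (n ℕ.+ n)) λ π → if does (joins? {n} (proj₁ π) (proj₁ w)) then summand w else 0#)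
        ≈⟨ ∑-cong (allPerms n) (λ w → ∑-once (λ π → joins? {n} (proj₁ π) (proj₁ w)) (allMatchings (n ℕ.+ n)) (once-joined w) (summand w)) ⟩
      ∑ (allPerms n) summand
        ≈⟨ ∑-cong (allPerms n) (λ w → ≈-trans (∑-*ʳ _ (allTL n)) (∑-cong (allTL n) λ d → *-assoc _ _ _)) ⟩
      ∑ (allPerms n) (λ w → ∑ (allTL n) λ d → g̃ {n} G D′ d * (immanantCoefficient (W w) (proj₁ d) * ∏ (allFin n) (λ i → b i (proj₁ w i))))
        ≈⟨ ∑-swap (allPerms n) (allTL n) ⟩
      ∑ (allTL n) (λ d → ∑ (allPerms n) λ w → g̃ {n} G D′ d * (immanantCoefficient (W w) (proj₁ d) * ∏ (allFin n) (λ i → b i (proj₁ w i))))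
        ≈⟨ ∑-cong (allTL n) (λ d → ∑-*ˡ (g̃ {n} G D′ d) (allPerms n)) ⟨
      ∑ (allTL n) (λ d → g̃ {n} G D′ d * Imm {n} W d b) ∎
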